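{- Let $(L_m)_{m\ge 1}$ be the lattices and $(\Gamma_m)_{m\ge1}$ the signed graphs defined in the context. Then for every $m\ge 1$ the signed graph $\Gamma_m$ is connected, has smallest eigenvalue $-3$, and is non-extendable; moreover, for $m\neq m'$ the signed graphs $\Gamma_m$ and $\Gamma_{m'}$ are switching-inequivalent (i.e. they lie in different switching classes up to vertex relabelling).
   Context: Codes. All codes are linear codes over $\mathbb{F}_3$, with standard inner product $\mathbf{x}\cdot\mathbf{y}$ in $\mathbb{F}_3$. The weight $\operatorname{wt}(\mathbf{c})$ is the number of nonzero coordinates. A code of length $n$, dimension $k$ and minimum nonzero weight $d$ is an $[n,k,d]$ code; a code $C$ is self-dual if $C=C^\perp$. Setup. Fix a ternary self-dual $[24,12,9]$ code $C$ containing the word $\mathbf{w}=\mathbf{1}_S$ (all-one on $S$, zero elsewhere) for some set $S$ of $9$ coordinates (any such code has this form after a monomial transformation), and fix a partition $S=P\sqcup Q$ with $|P|=4$, $|Q|=5$. Put $\mathbf{p}=-\mathbf{1}_P$, $\mathbf{q}=-\mathbf{1}_Q$ in $\mathbb{F}_3^{24}$ and $D=\{\mathbf{c}\in C:\mathbf{c}\cdot\mathbf{p}=0\}$. For $m\ge1$, split $24m$ coordinates into $m$ blocks of length $24$ indexed by $i\in\mathbb{Z}/m\mathbb{Z}$; for $\mathbf{v}\in\mathbb{F}_3^{24}$ let $\mathbf{v}^{(i)}\in\mathbb{F}_3^{24m}$ be the vector supported on block $i$ with value $\mathbf{v}$ there. Put $\mathbf{x}_i=\mathbf{p}^{(i)}+\mathbf{q}^{(i+1)}$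 for $i\in\mathbb{Z}/m\mathbb{Z}$, $X_m=\langle\mathbf{x}_i: i\in\mathbb{Z}/m\mathbb{Z}\rangle$, and $C_m=D^{\oplus m}+X_m\subseteq\mathbb{F}_3^{24m}$. Lattices. Define $L_m=\frac{1}{\sqrt3}\{\mathbf{z}\in\mathbb{Z}^{24m}:\mathbf{z}\bmod 3\in C_m\}$. The norm of a vector is its squared Euclidean length, and $\operatorname{Min}(L_m)$ is the set of vectors of smallest nonzero norm in $L_m$. Signed graphs. A signed graph is a finite simple graph $G$ with a map $\sigma:E(G)\to\{\pm1\}$; its signed adjacency matrix $A=A(G,\sigma)$ has entry $\sigma(\{x,y\})$ when $x,y$ are adjacent and $0$ otherwise. Its eigenvalues are those of $A$. Switching replaces $A$ by $TAT$ where $T$ is diagonal with entries in $\{\pm1\}$; switching classes are considered up to vertex relabelling. A connected signed graph with smallest eigenvalue $-3$ is non-extendable if it is not a proper induced signed subgraph of any connected signed graph with smallest eigenvalue at least $-3$. Definition of $\Gamma_m$. Choose one vector from each antipodal pair $\{\mathbf{v},-\mathbf{v}\}\subseteq\operatorname{Min}(L_m)$ and let $S_m$ be the resulting set. $\Gamma_m$ is the signed graph with vertex set $S_m$ in which distinct $\mathbf{u},\mathbf{v}\in S_m$ are joined exactly when $\mathbf{u}\cdot\mathbf{v}\neq0$, with this inner product (which lies in $\{0,\pm1\}$) as edge sign. -}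

module Defs where

open import Level using (0ℓ)
open import Data.Bool.Base using (if_then_else_)
open import Data.Fin.Base using (Fin; toℕ; fromℕ<)
open import Data.Fin.Patterns using (0F; 1F; 2F)
open import Data.Fin.Permutation using (Permutation; _⟨$⟩ʳ_)
open import Data.Fin.Properties using (_≟_)
open import Data.Fin.Subset using (Subset; _∪_; _∩_; ∣_∣; Empty)
open import Data.Integer.Base as ℤ using (ℤ; 0ℤ; _◃_)
open import Data.Integer.DivMod using (n%ℕd<d; _%ℕ_)
open import Data.Maybe.Base using (Maybe; just; nothing; maybe′)
open import Data.Nat.Base as ℕ using (ℕ; suc)
open import Data.Nat.DivMod using (_mod_)
import Data.Nat.Properties as ℕ
open import Data.Product.Base using (∃; ∃-syntax; _×_; _,_)
open import Data.Product using (∃!)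
open import Data.Rational.Base as ℚ using (ℚ; 0ℚ; 1ℚ; ½)
import Data.Rational.Properties as ℚ
open import Data.Rational.Solver using (module +-*-Solver)
open import Data.Sign.Base using (Sign)
open import Data.Sum.Base using (_⊎_)
open import Data.Vec.Base
  using (Vec; map; zipWith; replicate; foldr′; concat; count; tabulate; _[_]≔_)
open import Data.Vec.Relation.Unary.All using (All)
import Data.Vec.Functional as Vector
open import Function.Bundles using (_⇔_)
open import Function.Definitions using (Injective)
open import Relation.Binary.Construct.Closure.ReflexiveTransitive using (Star)
open import Relation.Binary.PropositionalEquality
  using (_≡_; _≢_; refl; sym; trans; cong; subst)
open import Relation.Nullary.Decidable using (¬?)
open import Relation.Nullary.Negation using (¬_)
open import Relation.Unary using (Pred; _∈_)

-- A real is a Cauchy sequence of rationals, with pointwise operations; equality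
-- is the setoid relation _≃ᵣ_ (the difference tends to 0), not _≡_.

IsCauchy : (ℕ → ℚ) → Set
IsCauchy x = ∀ ε → 0ℚ ℚ.< ε →
  ∃[ N ] (∀ i j → N ℕ.≤ i → N ℕ.≤ j → ℚ.∣ x i ℚ.- x j ∣ ℚ.< ε)

record ℝ : Set where
  constructor mkℝ
  field
    seq    : ℕ → ℚ
    cauchy : IsCauchy seq

open ℝ public

infix 4 _≃ᵣ_ _≤ᵣ_

_≃ᵣ_ : ℝ → ℝ → Set
x ≃ᵣ y = ∀ ε → 0ℚ ℚ.< ε →
  ∃[ N ] (∀ i → N ℕ.≤ i → ℚ.∣ seq x i ℚ.- seq y i ∣ ℚ.< ε)

_≤ᵣ_ : ℝ → ℝ → Set
x ≤ᵣ y = ∀ ε → 0ℚ ℚ.< ε →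
  ∃[ N ] (∀ i → N ℕ.≤ i → seq x i ℚ.< seq y i ℚ.+ ε)

fromℚ : ℚ → ℝ
fromℚ q = mkℝ (λ _ → q) λ ε 0<ε → 0 , λ _ _ _ _ →
  subst (ℚ._< ε) (sym (cong ℚ.∣_∣ (ℚ.+-inverseʳ q))) 0<ε

fromℤ : ℤ → ℝ
fromℤ z = fromℚ (z ℚ./ 1)

0ᵣ : ℝ
0ᵣ = fromℚ 0ℚ

private
  half-pos : ∀ {ε} → 0ℚ ℚ.< ε → 0ℚ ℚ.< ε ℚ.* ½
  half-pos {ε} 0<ε = subst (ℚ._< ε ℚ.* ½) (ℚ.*-zeroˡ ½) (ℚ.*-monoˡ-<-pos ½ 0<ε)

  halves : ∀ ε → ε ℚ.* ½ ℚ.+ ε ℚ.* ½ ≡ ε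
  halves ε = trans (sym (ℚ.*-distribˡ-+ ε ½ ½)) (ℚ.*-identityʳ ε)

  +-cauchy : ∀ x y → IsCauchy x → IsCauchy y → IsCauchy (λ n → x n ℚ.+ y n)
  +-cauchy x y cx cy ε 0<ε
    with cx (ε ℚ.* ½) (half-pos 0<ε) | cy (ε ℚ.* ½) (half-pos 0<ε)
  ... | M , hM | N , hN = M ℕ.⊔ N , λ i j M⊔N≤i M⊔N≤j → begin-strict
    ℚ.∣ (x i ℚ.+ y i) ℚ.- (x j ℚ.+ y j) ∣
      ≡⟨ cong ℚ.∣_∣ (solve 4 (λ a b c d → (a :+ b) :- (c :+ d) := (a :- c) :+ (b :- d))
                           refl (x i) (y i) (x j) (y j)) ⟩
    ℚ.∣ (x i ℚ.- x j) ℚ.+ (y i ℚ.- y j) ∣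
      ≤⟨ ℚ.∣p+q∣≤∣p∣+∣q∣ (x i ℚ.- x j) (y i ℚ.- y j) ⟩
    ℚ.∣ x i ℚ.- x j ∣ ℚ.+ ℚ.∣ y i ℚ.- y j ∣
      <⟨ ℚ.+-mono-< (hM i j (ℕ.m⊔n≤o⇒m≤o M N M⊔N≤i) (ℕ.m⊔n≤o⇒m≤o M N M⊔N≤j))
                    (hN i j (ℕ.m⊔n≤o⇒n≤o M N M⊔N≤i) (ℕ.m⊔n≤o⇒n≤o M N M⊔N≤j)) ⟩
    ε ℚ.* ½ ℚ.+ ε ℚ.* ½
      ≡⟨ halves ε ⟩
    ε ∎
    where
    open ℚ.≤-Reasoning
    open +-*-Solver

  bounded : ∀ x → IsCauchy x →
    ∃[ B ] 0ℚ ℚ.< B × ∃[ N ] (∀ i → N ℕ.≤ i → ℚ.∣ x i ∣ ℚ.≤ B)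
  bounded x cx with cx 1ℚ (ℚ.positive⁻¹ 1ℚ)
  ... | N , h = B , 0<B , N , λ i N≤i → begin
    ℚ.∣ x i ∣
      ≡⟨ cong ℚ.∣_∣ (solve 2 (λ a b → a := (a :- b) :+ b) refl (x i) (x N)) ⟩
    ℚ.∣ (x i ℚ.- x N) ℚ.+ x N ∣
      ≤⟨ ℚ.∣p+q∣≤∣p∣+∣q∣ (x i ℚ.- x N) (x N) ⟩
    ℚ.∣ x i ℚ.- x N ∣ ℚ.+ ℚ.∣ x N ∣
      ≤⟨ ℚ.+-monoˡ-≤ ℚ.∣ x N ∣ (ℚ.<⇒≤ (h i N N≤i ℕ.≤-refl)) ⟩
    B ∎
    where
    open ℚ.≤-Reasoning
    open +-*-Solver
    B   = 1ℚ ℚ.+ ℚ.∣ x N ∣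
    0<B : 0ℚ ℚ.< B
    0<B = ℚ.+-mono-<-≤ (ℚ.positive⁻¹ 1ℚ) (ℚ.0≤∣p∣ (x N))

  *-small : ∀ B ε → 0ℚ ℚ.< B → 0ℚ ℚ.< ε → ∃[ δ ] 0ℚ ℚ.< δ ×
    (∀ a b → ℚ.∣ a ∣ ℚ.≤ B → ℚ.∣ b ∣ ℚ.< δ → ℚ.∣ a ℚ.* b ∣ ℚ.< ε)
  *-small B ε 0<B 0<ε = ε ℚ.* ℚ.1/ B , 0<δ , λ a b a≤B b<δ → begin-strict
    ℚ.∣ a ℚ.* b ∣            ≡⟨ ℚ.∣p*q∣≡∣p∣*∣q∣ a b ⟩
    ℚ.∣ a ∣ ℚ.* ℚ.∣ b ∣      ≤⟨ ℚ.*-monoʳ-≤-nonNeg ℚ.∣ b ∣ {{ℚ.∣-∣-nonNeg b}} a≤B ⟩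
    B ℚ.* ℚ.∣ b ∣            <⟨ ℚ.*-monoʳ-<-pos B b<δ ⟩
    B ℚ.* (ε ℚ.* ℚ.1/ B)     ≡⟨ solve 3 (λ c e d → c :* (e :* d) := e :* (c :* d)) refl B ε (ℚ.1/ B) ⟩
    ε ℚ.* (B ℚ.* ℚ.1/ B)     ≡⟨ cong (ε ℚ.*_) (ℚ.*-inverseʳ B) ⟩
    ε ℚ.* 1ℚ                 ≡⟨ ℚ.*-identityʳ ε ⟩
    ε ∎
    where
    open ℚ.≤-Reasoning
    open +-*-Solver
    instance
      pB = ℚ.positive 0<B
      nB = ℚ.pos⇒nonZero B
    0<δ : 0ℚ ℚ.< ε ℚ.* ℚ.1/ B
    0<δ = subst (ℚ._< ε ℚ.* ℚ.1/ B) (ℚ.*-zeroˡ (ℚ.1/ B))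
      (ℚ.*-monoˡ-<-pos (ℚ.1/ B) {{ℚ.1/pos⇒pos B}} 0<ε)

  *-cauchy : ∀ x y → IsCauchy x → IsCauchy y → IsCauchy (λ n → x n ℚ.* y n)
  *-cauchy x y cx cy ε 0<ε =
    let A , 0<A , M₀ , hA = bounded x cx
        B , 0<B , N₀ , hB = bounded y cy
        γ , 0<γ , smallA  = *-small A (ε ℚ.* ½) 0<A (half-pos 0<ε)
        δ , 0<δ , smallB  = *-small B (ε ℚ.* ½) 0<B (half-pos 0<ε)
        M₁ , hx           = cx δ 0<δ
        N₁ , hy           = cy γ 0<γ
    in combine M₀ M₁ N₀ N₁
         (λ i j i≥M₀ i≥N₁ j≥N₁ → smallA (x i) (y i ℚ.- y j) (hA i i≥M₀) (hy i j i≥N₁ j≥N₁))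
         (λ i j j≥N₀ i≥M₁ j≥M₁ → smallB (y j) (x i ℚ.- x j) (hB j j≥N₀) (hx i j i≥M₁ j≥M₁))
    where
    open ℚ.≤-Reasoning
    open +-*-Solver
    combine : ∀ M₀ M₁ N₀ N₁ →
      (∀ i j → M₀ ℕ.≤ i → N₁ ℕ.≤ i → N₁ ℕ.≤ j →
        ℚ.∣ x i ℚ.* (y i ℚ.- y j) ∣ ℚ.< ε ℚ.* ½) →
      (∀ i j → N₀ ℕ.≤ j → M₁ ℕ.≤ i → M₁ ℕ.≤ j →
        ℚ.∣ y j ℚ.* (x i ℚ.- x j) ∣ ℚ.< ε ℚ.* ½) →
      ∃[ K ] (∀ i j → K ℕ.≤ i → K ℕ.≤ j →
        ℚ.∣ x i ℚ.* y i ℚ.- x j ℚ.* y j ∣ ℚ.< ε)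
    combine M₀ M₁ N₀ N₁ h k = M ℕ.⊔ N , λ i j M⊔N≤i M⊔N≤j →
      let M≤i = ℕ.m⊔n≤o⇒m≤o M N M⊔N≤i
          M≤j = ℕ.m⊔n≤o⇒m≤o M N M⊔N≤j
          N≤i = ℕ.m⊔n≤o⇒n≤o M N M⊔N≤i
          N≤j = ℕ.m⊔n≤o⇒n≤o M N M⊔N≤j
      in begin-strict
      ℚ.∣ x i ℚ.* y i ℚ.- x j ℚ.* y j ∣
        ≡⟨ cong ℚ.∣_∣ (solve 4 (λ a b c d →
             a :* b :- c :* d := a :* (b :- d) :+ d :* (a :- c)) refl (x i) (y i) (x j) (y j)) ⟩
      ℚ.∣ x i ℚ.* (y i ℚ.- y j) ℚ.+ y j ℚ.* (x i ℚ.- x j) ∣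
        ≤⟨ ℚ.∣p+q∣≤∣p∣+∣q∣ (x i ℚ.* (y i ℚ.- y j)) (y j ℚ.* (x i ℚ.- x j)) ⟩
      ℚ.∣ x i ℚ.* (y i ℚ.- y j) ∣ ℚ.+ ℚ.∣ y j ℚ.* (x i ℚ.- x j) ∣
        <⟨ ℚ.+-mono-<
             (h i j (ℕ.m⊔n≤o⇒m≤o M₀ M₁ M≤i) (ℕ.m⊔n≤o⇒n≤o N₀ N₁ N≤i) (ℕ.m⊔n≤o⇒n≤o N₀ N₁ N≤j))
             (k i j (ℕ.m⊔n≤o⇒m≤o N₀ N₁ N≤j) (ℕ.m⊔n≤o⇒n≤o M₀ M₁ M≤i) (ℕ.m⊔n≤o⇒n≤o M₀ M₁ M≤j)) ⟩
      ε ℚ.* ½ ℚ.+ ε ℚ.* ½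
        ≡⟨ halves ε ⟩
      ε ∎
      where
      M = M₀ ℕ.⊔ M₁
      N = N₀ ℕ.⊔ N₁

infixl 6 _+ᵣ_
infixl 7 _*ᵣ_

_+ᵣ_ : ℝ → ℝ → ℝ
x +ᵣ y = mkℝ (λ n → seq x n ℚ.+ seq y n) (+-cauchy (seq x) (seq y) (cauchy x) (cauchy y))

_*ᵣ_ : ℝ → ℝ → ℝ
x *ᵣ y = mkℝ (λ n → seq x n ℚ.* seq y n) (*-cauchy (seq x) (seq y) (cauchy x) (cauchy y))

∑ᵣ : ∀ {n} → (Fin n → ℝ) → ℝ
∑ᵣ = Vector.foldr _+ᵣ_ 0ᵣ

Matrix : ℕ → Set
Matrix n = Fin n → Fin n → ℤ

-- Only real eigenvalues are considered: the matrices used below are symmetric.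
IsEigenvalue : ∀ {n} → Matrix n → ℝ → Set
IsEigenvalue {n} A μ = ∃ λ (v : Fin n → ℝ) →
  (¬ (∀ x → v x ≃ᵣ 0ᵣ)) ×
  (∀ x → ∑ᵣ (λ y → fromℤ (A x y) *ᵣ v y) ≃ᵣ μ *ᵣ v x)

-- `edge x y` is `nothing` for non-adjacent x and y, and `just s` for
-- vertices joined by an edge of sign s.
record SignedGraph : Set where
  field
    order       : ℕ
    edge        : Fin order → Fin order → Maybe Sign
    edge-sym    : ∀ x y → edge x y ≡ edge y x
    edge-irrefl : ∀ x → edge x x ≡ nothing

  Vertex : Set
  Vertex = Fin order

  Adjacent : Vertex → Vertex → Set
  Adjacent x y = ∃[ s ] edge x y ≡ just s

  adjacency : Matrix order
  adjacency x y = maybe′ (_◃ 1) 0ℤ (edge x y)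

open SignedGraph public

Connected : SignedGraph → Set
Connected G = ∀ x y → Star (Adjacent G) x y

SmallestEigenvalueAtLeast : SignedGraph → ℝ → Set
SmallestEigenvalueAtLeast G μ = ∀ ν → IsEigenvalue (adjacency G) ν → μ ≤ᵣ ν

HasSmallestEigenvalue : SignedGraph → ℝ → Set
HasSmallestEigenvalue G μ = IsEigenvalue (adjacency G) μ × SmallestEigenvalueAtLeast G μ

ProperInducedSubgraph : SignedGraph → SignedGraph → Set
ProperInducedSubgraph G H = ∃ λ (f : Vertex G → Vertex H) →
  Injective _≡_ _≡_ f ×
  (∀ x y → edge H (f x) (f y) ≡ edge G x y) ×
  (∃[ z ] ∀ x → f x ≢ z)

-3ᵣ : ℝ
-3ᵣ = fromℤ (ℤ.- (ℤ.+ 3))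

NonExtendable : SignedGraph → Set
NonExtendable G = ∀ H → Connected H → SmallestEigenvalueAtLeast H -3ᵣ →
  ¬ ProperInducedSubgraph G H

-- Up to the relabelling π, the adjacency matrix of H is TAT, where A is the
-- adjacency matrix of G and T is the diagonal matrix of the signs t.
SwitchingEquivalent : SignedGraph → SignedGraph → Set
SwitchingEquivalent G H =
  ∃ λ (π : Permutation (order G) (order H)) →
  ∃ λ (t : Vertex G → Sign) →
  ∀ x y → adjacency H (π ⟨$⟩ʳ x) (π ⟨$⟩ʳ y)
        ≡ (t x ◃ 1) ℤ.* adjacency G x y ℤ.* (t y ◃ 1)

F₃ : Set
F₃ = Fin 3

infixl 6 _+₃_ _⊕_
infixl 7 _*₃_ _⊙_ _·_

_+₃_ _*₃_ : F₃ → F₃ → F₃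
a +₃ b = (toℕ a ℕ.+ toℕ b) mod 3
a *₃ b = (toℕ a ℕ.* toℕ b) mod 3

F₃^_ : ℕ → Set
F₃^ n = Vec F₃ n

𝟎 : ∀ {n} → F₃^ n
𝟎 = replicate _ 0F

_⊕_ : ∀ {n} → F₃^ n → F₃^ n → F₃^ n
_⊕_ = zipWith _+₃_

_⊙_ : ∀ {n} → F₃ → F₃^ n → F₃^ n
a ⊙ x = map (a *₃_) x

_·_ : ∀ {n} → F₃^ n → F₃^ n → F₃
x · y = foldr′ _+₃_ 0F (zipWith _*₃_ x y)

wt : ∀ {n} → F₃^ n → ℕ
wt = count (λ a → ¬? (a ≟ 0F))

linearCombination : ∀ {n k} → Vec F₃ k → Vec (F₃^ n) k → F₃^ n
linearCombination a vs = foldr′ _⊕_ 𝟎 (zipWith _⊙_ a vs)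

Code : ℕ → Set₁
Code n = Pred (F₃^ n) 0ℓ

span : ∀ {n k} → Vec (F₃^ n) k → Code n
span vs x = ∃[ a ] linearCombination a vs ≡ x

record IsLinear {n} (C : Code n) : Set where
  field
    𝟎∈       : 𝟎 ∈ C
    ⊕-closed : ∀ {x y} → x ∈ C → y ∈ C → x ⊕ y ∈ C
    ⊙-closed : ∀ a {x} → x ∈ C → a ⊙ x ∈ C

HasDimension : ∀ {n} → Code n → ℕ → Set
HasDimension {n} C k = ∃ λ (basis : Vec (F₃^ n) k) →
  (∀ x → x ∈ C ⇔ x ∈ span basis) ×
  (∀ a → linearCombination a basis ≡ 𝟎 → a ≡ 𝟎)

HasMinimumWeight : ∀ {n} → Code n → ℕ → Set
HasMinimumWeight C d =
  (∃[ c ] c ∈ C × c ≢ 𝟎 × wt c ≡ d) ×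
  (∀ c → c ∈ C → c ≢ 𝟎 → d ℕ.≤ wt c)

record IsCode[_,_,_] (n k d : ℕ) (C : Code n) : Set where
  field
    linear        : IsLinear C
    dimension     : HasDimension C k
    minimumWeight : HasMinimumWeight C d

_⊥ : ∀ {n} → Code n → Code n
(C ⊥) x = ∀ c → c ∈ C → x · c ≡ 0F

SelfDual : ∀ {n} → Code n → Set
SelfDual C = ∀ x → x ∈ C ⇔ x ∈ C ⊥

𝟏 : ∀ {n} → Subset n → F₃^ n
𝟏 = map (if_then 1F else 0F)

-1₃ : F₃
-1₃ = 2F

record Setup : Set₁ where
  field
    C        : Code 24
    isCode   : IsCode[ 24 , 12 , 9 ] C
    selfDual : SelfDual C
    S P Q    : Subset 24
    ∣S∣≡9    : ∣ S ∣ ≡ 9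
    𝟏S∈C     : 𝟏 S ∈ C
    S≡P∪Q    : S ≡ P ∪ Q
    disjoint : Empty (P ∩ Q)
    ∣P∣≡4    : ∣ P ∣ ≡ 4
    ∣Q∣≡5    : ∣ Q ∣ ≡ 5

-- Addition of 1 in ℤ/mℤ.
next : ∀ {m} → Fin m → Fin m
next {suc n} i = suc (toℕ i) mod suc n

-- The vector supported on the i-th of m blocks of length n, with value v there.
block : ∀ {m n} → Fin m → F₃^ n → F₃^ (m ℕ.* n)
block {m} i v = concat (replicate m 𝟎 [ i ]≔ v)

directPower : ∀ {n} → Code n → ∀ m → Code (m ℕ.* n)
directPower {n} D m z = ∃ λ (ds : Vec (F₃^ n) m) → All D ds × z ≡ concat ds

infixl 6 _⊞_

_⊞_ : ∀ {n} → Code n → Code n → Code n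
(U ⊞ V) z = ∃[ u ] ∃[ v ] u ∈ U × v ∈ V × z ≡ u ⊕ v

module Construction (setup : Setup) where
  open Setup setup

  p q : F₃^ 24
  p = -1₃ ⊙ 𝟏 P
  q = -1₃ ⊙ 𝟏 Q

  D : Code 24
  D c = c ∈ C × c · p ≡ 0F

  x[_] : ∀ {m} → Fin m → F₃^ (m ℕ.* 24)
  x[ i ] = block i p ⊕ block (next i) q

  X : ∀ m → Code (m ℕ.* 24)
  X m = span (tabulate {n = m} x[_])

  C[_] : ∀ m → Code (m ℕ.* 24)
  C[ m ] = directPower D m ⊞ X m

-- An integer vector z stands for the real vector z/√3, so that the inner
-- product of the vectors represented by z and z′ is (z · z′)/3.
⟪_,_⟫ : ∀ {n} → Vec ℤ n → Vec ℤ n → ℚ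
⟪ z , z′ ⟫ = foldr′ ℤ._+_ 0ℤ (zipWith ℤ._*_ z z′) ℚ./ 3

norm : ∀ {n} → Vec ℤ n → ℚ
norm z = ⟪ z , z ⟫

neg : ∀ {n} → Vec ℤ n → Vec ℤ n
neg = map (λ a → ℤ.- a)

mod3 : ℤ → F₃
mod3 z = fromℕ< (n%ℕd<d z 3)

Min : ∀ {n} → Pred (Vec ℤ n) 0ℓ → Pred (Vec ℤ n) 0ℓ
Min L z = z ∈ L × z ≢ replicate _ 0ℤ ×
  (∀ z′ → z′ ∈ L → z′ ≢ replicate _ 0ℤ → norm z ℚ.≤ norm z′)

module _ (setup : Setup) where
  open Construction setup

  L : ∀ m → Pred (Vec ℤ (m ℕ.* 24)) 0ℓ
  L m z = map mod3 z ∈ C[ m ]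

  -- G is the signed graph Γ_m for some choice of representatives of the
  -- antipodal pairs in Min (L m), its vertices being labelled bijectively by
  -- the chosen vectors.
  record IsΓ (m : ℕ) (G : SignedGraph) : Set where
    field
      vector      : Vertex G → Vec ℤ (m ℕ.* 24)
      vector-Min  : ∀ x → vector x ∈ Min (L m)
      transversal : ∀ z → z ∈ Min (L m) →
                    ∃! _≡_ λ x → vector x ≡ z ⊎ vector x ≡ neg z
      edge-sign   : ∀ x y → x ≢ y →
                    ⟪ vector x , vector y ⟫ ≡ adjacency G x y ℚ./ 1

-- Expanding the indicator of the self-dual code C in characters of F₃ shows that
-- powers of the adjacency operator of the Hamming graph, applied to it, are sums
-- over C of powers of a linear function of the weight. Polynomials with roots at the
-- weights 12, 15, … isolate the words of weight 9: those vanishing on four given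
-- coordinates span all codewords vanishing there, and words of weight 9 exist that
-- connect consecutive blocks. Hence C_m is self-dual of minimum weight 9 and L_m is
-- generated by its minimal vectors, among which are the frame vectors √3 e_j.
--
-- A + 3 is the Gram matrix of the chosen minimal vectors, so all eigenvalues are at
-- least −3, and a linear dependency gives −3. In an extension by one vertex with
-- eigenvalues at least −3, A + 3 stays positive semidefinite: otherwise the Lanczos
-- process and bisection would produce an actual eigenvalue below −3. So the new
-- vertex has a projection to the span of the lattice, of norm at most 3 and with
-- integral inner products with the minimal vectors; as L_m is unimodular, it is 0
-- or ± a minimal vector, and neither is compatible with a connected proper extension.
-- The dimension 24m, the greatest number of pairwise orthogonal minimal vectors,
-- is a switching invariant.

module Submission where

open import Defs
open import Algebra.Bundles using (CommutativeMonoid)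
import Algebra.Properties.CommutativeMonoid.Sum as CommutativeMonoidSum
import Algebra.Properties.Semiring.Sum as SemiringSum
open import Data.Bool.Base using (Bool; true; false; not; _∧_; if_then_else_)
import Data.Bool.Properties as Bool
open import Data.Empty using (⊥; ⊥-elim)
open import Data.Fin.Base as Fin using (Fin; zero; suc; toℕ; fromℕ; inject₁)
open import Data.Fin.Induction using (<-weakInduction; <-weakInduction-startingFrom)
open import Data.Fin.Patterns using (0F; 1F; 2F)
open import Data.Fin.Permutation using (_⟨$⟩ʳ_; _⟨$⟩ˡ_; inverseʳ; inverseˡ)
import Data.Fin.Properties as Fin
open import Data.Fin.Relation.Unary.Top as Top using (‵fromℕ; ‵inject₁)
open import Data.Fin.Subset using (Subset; _∈_; _∪_; _∩_; ∣_∣; Empty)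
open import Data.Fin.Subset.Properties using (∣p∣≤n; ∩-comm)
open import Data.Integer.Base as ℤ using (ℤ; +_; -[1+_]; 0ℤ; 1ℤ; -1ℤ; _◃_)
import Data.Integer.DivMod as ℤ
import Data.Integer.Properties as ℤ
import Data.Integer.Tactic.RingSolver as ℤ-Solver
open import Data.List.Base as List using (List; []; _∷_)
import Data.List.Membership.Propositional as List
import Data.List.Membership.Propositional.Properties as List
open import Data.List.Relation.Unary.Any using (here; there)
open import Data.Maybe.Base using (Maybe; just; nothing; maybe′)
open import Data.Nat.Base as ℕ using (ℕ; zero; suc; _≥_; z≤n; s≤s)
import Data.Nat.DivMod as ℕ
import Data.Nat.Properties as ℕ
open import Data.Product using (∃!)
open import Data.Product.Base using (∃; ∃-syntax; _×_; _,_; proj₁; proj₂)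
open import Data.Rational.Base as ℚ using (ℚ; 0ℚ; 1ℚ; ½)
import Data.Rational.Properties as ℚ
import Data.Rational.Unnormalised.Base as ℚᵘ
import Data.Rational.Unnormalised.Properties as ℚᵘ
open import Data.Sign.Base as Sign using (Sign)
open import Data.Sum.Base using (_⊎_; inj₁; inj₂)
open import Data.Vec.Base as Vec using (Vec; []; _∷_)
import Data.Vec.Properties as Vec
import Data.Vec.Relation.Unary.All as All
import Data.Vec.Relation.Unary.All.Properties as All
open import Function.Base using (_∘_; id; case_of_)
open import Function.Bundles using (Equivalence; _⇔_)
open import Level using (0ℓ)
open import Relation.Binary.Construct.Closure.ReflexiveTransitive
  using (Star; _◅_; _◅◅_) renaming (ε to Star-refl)
open import Relation.Binary.Definitions using (tri<; tri≈; tri>)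
open import Relation.Binary.PropositionalEquality as ≡
  using (_≡_; _≢_; refl; sym; trans; cong; cong₂; subst; subst₂; module ≡-Reasoning)
open import Relation.Nullary.Decidable
  using (Dec; yes; no; does; toWitness; map′; dec⇒maybe; ¬?; _×-dec_; _⊎-dec_; _→-dec_)
open import Relation.Nullary.Negation using (¬_; contradiction)
import Tactic.RingSolver as RingSolver
open import Tactic.RingSolver.Core.AlmostCommutativeRing using (AlmostCommutativeRing; fromCommutativeRing)

-- The code is known only through its parameters and one word, so the words of weight 9 that are
-- needed cannot be exhibited. Spanning is proved by comparing exact walk counts at a codeword with
-- upper bounds away from the code, existence by a nonzero value of a combination of characters.
-- Exactness is limited by distance 9: degree, weight and number of forgotten coordinates may add up
-- to 8 at most, which dictates the polynomials. The split 4 + 5 enters through self-products: p and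
-- q have products 1 and -1 with themselves, so cyclic sums telescope. A block of a word of C_m
-- outside C has weight at least 4, such blocks never occur alone, and divisibility by 3 raises 8 to
-- 9. On the analytic side, comparison of Cauchy reals is undecidable, so eigenvectors cannot be
-- found by elimination over the reals. All case distinctions are made on rationals: a rational
-- vector on which the form is negative starts an orthogonalisation over the rationals, and the
-- limit of the bisection is the only genuinely real number constructed. Its eigenvector is a
-- polynomial expression in that limit.

-- Arithmetic of F₃ and weights of ternary vectors

infix 4 _≟₃_
_≟₃_ : (a b : F₃) → Dec (a ≡ b)
_≟₃_ = Fin._≟_

+₃-comm : ∀ a b → a +₃ b ≡ b +₃ a
+₃-comm = toWitness {a? = Fin.all? λ a → Fin.all? λ b → a +₃ b ≟₃ b +₃ a} _

+₃-assoc : ∀ a b c → (a +₃ b) +₃ c ≡ a +₃ (b +₃ c)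
+₃-assoc = toWitness {a? = Fin.all? λ a → Fin.all? λ b → Fin.all? λ c →
  (a +₃ b) +₃ c ≟₃ a +₃ (b +₃ c)} _

+₃-identityˡ : ∀ a → 0F +₃ a ≡ a
+₃-identityˡ = toWitness {a? = Fin.all? λ a → 0F +₃ a ≟₃ a} _

+₃-identityʳ : ∀ a → a +₃ 0F ≡ a
+₃-identityʳ = toWitness {a? = Fin.all? λ a → a +₃ 0F ≟₃ a} _

*₃-comm : ∀ a b → a *₃ b ≡ b *₃ a
*₃-comm = toWitness {a? = Fin.all? λ a → Fin.all? λ b → a *₃ b ≟₃ b *₃ a} _

*₃-assoc : ∀ a b c → (a *₃ b) *₃ c ≡ a *₃ (b *₃ c)
*₃-assoc = toWitness {a? = Fin.all? λ a → Fin.all? λ b → Fin.all? λ c →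
  (a *₃ b) *₃ c ≟₃ a *₃ (b *₃ c)} _

*₃-distribˡ-+₃ : ∀ a b c → a *₃ (b +₃ c) ≡ a *₃ b +₃ a *₃ c
*₃-distribˡ-+₃ = toWitness {a? = Fin.all? λ a → Fin.all? λ b → Fin.all? λ c →
  a *₃ (b +₃ c) ≟₃ a *₃ b +₃ a *₃ c} _

*₃-distribʳ-+₃ : ∀ a b c → (b +₃ c) *₃ a ≡ b *₃ a +₃ c *₃ a
*₃-distribʳ-+₃ = toWitness {a? = Fin.all? λ a → Fin.all? λ b → Fin.all? λ c →
  (b +₃ c) *₃ a ≟₃ b *₃ a +₃ c *₃ a} _

*₃-zeroʳ : ∀ a → a *₃ 0F ≡ 0F
*₃-zeroʳ = toWitness {a? = Fin.all? λ a → a *₃ 0F ≟₃ 0F} _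

*₃-identityˡ : ∀ a → 1F *₃ a ≡ a
*₃-identityˡ = toWitness {a? = Fin.all? λ a → 1F *₃ a ≟₃ a} _

+₃-interchange : ∀ a b c d → (a +₃ b) +₃ (c +₃ d) ≡ (a +₃ c) +₃ (b +₃ d)
+₃-interchange = toWitness {a? = Fin.all? λ a → Fin.all? λ b → Fin.all? λ c → Fin.all? λ d →
  (a +₃ b) +₃ (c +₃ d) ≟₃ (a +₃ c) +₃ (b +₃ d)} _

+₃-swapʳ : ∀ a b c → (a +₃ b) +₃ c ≡ (a +₃ c) +₃ b
+₃-swapʳ = toWitness {a? = Fin.all? λ a → Fin.all? λ b → Fin.all? λ c →
  (a +₃ b) +₃ c ≟₃ (a +₃ c) +₃ b} _

+₃-cancel : ∀ a b → (a +₃ 2F *₃ b) +₃ b ≡ a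
+₃-cancel = toWitness {a? = Fin.all? λ a → Fin.all? λ b → (a +₃ 2F *₃ b) +₃ b ≟₃ a} _

+₃-inverse : ∀ a → a +₃ 2F *₃ a ≡ 0F
+₃-inverse = toWitness {a? = Fin.all? λ a → a +₃ 2F *₃ a ≟₃ 0F} _

infix 4 _≟ᵥ_
_≟ᵥ_ : ∀ {n} (x y : F₃^ n) → Dec (x ≡ y)
_≟ᵥ_ = Vec.≡-dec _≟₃_

⊕-assoc : ∀ {n} (x y z : F₃^ n) → (x ⊕ y) ⊕ z ≡ x ⊕ (y ⊕ z)
⊕-assoc = Vec.zipWith-assoc +₃-assoc

⊕-identityˡ : ∀ {n} (x : F₃^ n) → 𝟎 ⊕ x ≡ x
⊕-identityˡ = Vec.zipWith-identityˡ +₃-identityˡ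

⊕-identityʳ : ∀ {n} (x : F₃^ n) → x ⊕ 𝟎 ≡ x
⊕-identityʳ = Vec.zipWith-identityʳ +₃-identityʳ

infixl 6 _⊖_
_⊖_ : ∀ {n} → F₃^ n → F₃^ n → F₃^ n
x ⊖ y = x ⊕ 2F ⊙ y

⊖-⊕-cancel : ∀ {n} (x y : F₃^ n) → (x ⊖ y) ⊕ y ≡ x
⊖-⊕-cancel []       []       = refl
⊖-⊕-cancel (a ∷ x) (b ∷ y) = cong₂ _∷_ (+₃-cancel a b) (⊖-⊕-cancel x y)

⊖-self : ∀ {n} (x : F₃^ n) → x ⊖ x ≡ 𝟎
⊖-self []      = refl
⊖-self (a ∷ x) = cong₂ _∷_ (+₃-inverse a) (⊖-self x)

⊖-triangle : ∀ {n} (x y z : F₃^ n) → x ⊖ z ≡ (x ⊖ y) ⊕ (y ⊖ z)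
⊖-triangle x y z = begin
  x ⊕ 2F ⊙ z                  ≡⟨ cong (_⊕ 2F ⊙ z) (⊖-⊕-cancel x y) ⟨
  ((x ⊖ y) ⊕ y) ⊕ 2F ⊙ z      ≡⟨ ⊕-assoc _ _ _ ⟩
  (x ⊖ y) ⊕ (y ⊖ z)           ∎
  where open ≡-Reasoning

·-comm : ∀ {n} (x y : F₃^ n) → x · y ≡ y · x
·-comm []      []      = refl
·-comm (a ∷ x) (b ∷ y) = cong₂ _+₃_ (*₃-comm a b) (·-comm x y)

·-⊕ˡ : ∀ {n} (x y z : F₃^ n) → (x ⊕ y) · z ≡ x · z +₃ y · z
·-⊕ˡ []      []      []      = refl
·-⊕ˡ (a ∷ x) (b ∷ y) (c ∷ z) = begin
  (a +₃ b) *₃ c +₃ (x ⊕ y) · z              ≡⟨ cong₂ _+₃_ (*₃-distribʳ-+₃ c a b) (·-⊕ˡ x y z) ⟩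
  (a *₃ c +₃ b *₃ c) +₃ (x · z +₃ y · z)    ≡⟨ +₃-interchange (a *₃ c) _ _ _ ⟩
  (a *₃ c +₃ x · z) +₃ (b *₃ c +₃ y · z)    ∎
  where open ≡-Reasoning

·-⊙ˡ : ∀ {n} a (x z : F₃^ n) → (a ⊙ x) · z ≡ a *₃ (x · z)
·-⊙ˡ a []      []      = sym (*₃-zeroʳ a)
·-⊙ˡ a (b ∷ x) (c ∷ z) = begin
  (a *₃ b) *₃ c +₃ (a ⊙ x) · z      ≡⟨ cong₂ _+₃_ (*₃-assoc a b c) (·-⊙ˡ a x z) ⟩
  a *₃ (b *₃ c) +₃ a *₃ (x · z)     ≡⟨ *₃-distribˡ-+₃ a _ _ ⟨
  a *₃ (b *₃ c +₃ x · z)            ∎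
  where open ≡-Reasoning

·-zeroˡ : ∀ {n} (z : F₃^ n) → 𝟎 · z ≡ 0F
·-zeroˡ []      = refl
·-zeroˡ (c ∷ z) = trans (cong (0F *₃ c +₃_) (·-zeroˡ z)) refl

·-⊕ʳ : ∀ {n} (z x y : F₃^ n) → z · (x ⊕ y) ≡ z · x +₃ z · y
·-⊕ʳ z x y = trans (·-comm z _) (trans (·-⊕ˡ x y z) (cong₂ _+₃_ (·-comm x z) (·-comm y z)))

·-⊙ʳ : ∀ {n} a (z x : F₃^ n) → z · (a ⊙ x) ≡ a *₃ (z · x)
·-⊙ʳ a z x = trans (·-comm z _) (trans (·-⊙ˡ a x z) (cong (a *₃_) (·-comm x z)))

·-zeroʳ : ∀ {n} (z : F₃^ n) → z · 𝟎 ≡ 0F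
·-zeroʳ z = trans (·-comm z 𝟎) (·-zeroˡ z)

⊙-zeroˡ : ∀ {n} (x : F₃^ n) → 0F ⊙ x ≡ 𝟎
⊙-zeroˡ []      = refl
⊙-zeroˡ (a ∷ x) = cong (0F ∷_) (⊙-zeroˡ x)

⊙-identity : ∀ {n} (x : F₃^ n) → 1F ⊙ x ≡ x
⊙-identity []      = refl
⊙-identity (a ∷ x) = cong₂ _∷_ (*₃-identityˡ a) (⊙-identity x)

⊙-⊙ : ∀ {n} a b (x : F₃^ n) → a ⊙ (b ⊙ x) ≡ (a *₃ b) ⊙ x
⊙-⊙ a b []      = refl
⊙-⊙ a b (c ∷ x) = cong₂ _∷_ (sym (*₃-assoc a b c)) (⊙-⊙ a b x)

⊙-⊕ : ∀ {n} a (x y : F₃^ n) → a ⊙ (x ⊕ y) ≡ a ⊙ x ⊕ a ⊙ y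
⊙-⊕ a []      []      = refl
⊙-⊕ a (b ∷ x) (c ∷ y) = cong₂ _∷_ (*₃-distribˡ-+₃ a b c) (⊙-⊕ a x y)

⊙-zeroʳ : ∀ {n} a → a ⊙ 𝟎 {n} ≡ 𝟎
⊙-zeroʳ {zero}  a = refl
⊙-zeroʳ {suc n} a = cong₂ _∷_ (*₃-zeroʳ a) (⊙-zeroʳ a)

⊖≡𝟎⇒≡ : ∀ {n} (x y : F₃^ n) → x ⊖ y ≡ 𝟎 → x ≡ y
⊖≡𝟎⇒≡ x y x⊖y≡𝟎 = trans (sym (⊖-⊕-cancel x y)) (trans (cong (_⊕ y) x⊖y≡𝟎) (⊕-identityˡ y))

wt≡0⇒𝟎 : ∀ {n} (x : F₃^ n) → wt x ≡ 0 → x ≡ 𝟎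
wt≡0⇒𝟎 []           _ = refl
wt≡0⇒𝟎 (0F ∷ x)    e = cong (0F ∷_) (wt≡0⇒𝟎 x e)
wt≡0⇒𝟎 (suc _ ∷ x) ()

wt-𝟎 : ∀ n → wt (𝟎 {n}) ≡ 0
wt-𝟎 zero    = refl
wt-𝟎 (suc n) = wt-𝟎 n

wt-⊕ : ∀ {n} (x y : F₃^ n) → wt (x ⊕ y) ℕ.≤ wt x ℕ.+ wt y
wt-⊕ []      []      = z≤n
wt-⊕ (a ∷ x) (b ∷ y) = step a b (wt-⊕ x y)
  where
  step : ∀ a b → wt (x ⊕ y) ℕ.≤ wt x ℕ.+ wt y →
         wt ((a ∷ x) ⊕ (b ∷ y)) ℕ.≤ wt (a ∷ x) ℕ.+ wt (b ∷ y)
  step 0F 0F h = h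
  step 0F 1F h = subst (suc (wt (x ⊕ y)) ℕ.≤_) (sym (ℕ.+-suc (wt x) (wt y))) (s≤s h)
  step 0F 2F h = subst (suc (wt (x ⊕ y)) ℕ.≤_) (sym (ℕ.+-suc (wt x) (wt y))) (s≤s h)
  step 1F 0F h = s≤s h
  step 1F 1F h = s≤s (ℕ.≤-trans h (ℕ.+-monoʳ-≤ (wt x) (ℕ.n≤1+n _)))
  step 1F 2F h = ℕ.≤-trans h (ℕ.m≤n⇒m≤1+n (ℕ.+-monoʳ-≤ (wt x) (ℕ.n≤1+n _)))
  step 2F 0F h = s≤s h
  step 2F 1F h = ℕ.≤-trans h (ℕ.m≤n⇒m≤1+n (ℕ.+-monoʳ-≤ (wt x) (ℕ.n≤1+n _)))
  step 2F 2F h = s≤s (ℕ.≤-trans h (ℕ.+-monoʳ-≤ (wt x) (ℕ.n≤1+n _)))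

wt-⊙ : ∀ {n} a (x : F₃^ n) → wt (a ⊙ x) ℕ.≤ wt x
wt-⊙ a []      = z≤n
wt-⊙ a (b ∷ x) = step a b (wt-⊙ a x)
  where
  step : ∀ a b → wt (a ⊙ x) ℕ.≤ wt x → wt (a ⊙ (b ∷ x)) ℕ.≤ wt (b ∷ x)
  step 0F 0F h = h
  step 0F 1F h = ℕ.m≤n⇒m≤1+n h
  step 0F 2F h = ℕ.m≤n⇒m≤1+n h
  step 1F 0F h = h
  step 1F 1F h = s≤s h
  step 1F 2F h = s≤s h
  step 2F 0F h = h
  step 2F 1F h = s≤s h
  step 2F 2F h = s≤s h

wt-⊖ : ∀ {n} (x y : F₃^ n) → wt (x ⊖ y) ℕ.≤ wt x ℕ.+ wt y
wt-⊖ x y = ℕ.≤-trans (wt-⊕ x (2F ⊙ y)) (ℕ.+-monoʳ-≤ (wt x) (wt-⊙ 2F y))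

-- Nonzero elements of F₃ have square 1, so weight and self-product agree modulo 3. This restricts
-- the weights of a self-orthogonal code to multiples of 3, which is what lets a polynomial of low
-- degree remove all weights above 9.
wt-self : ∀ {n} (x : F₃^ n) → ∃[ q ] wt x ≡ toℕ (x · x) ℕ.+ q ℕ.* 3
wt-self []      = 0 , refl
wt-self (a ∷ x) = step a (x · x) (wt-self x)
  where
  step : ∀ a s → ∃[ q ] wt x ≡ toℕ s ℕ.+ q ℕ.* 3 →
         ∃[ q ] wt (a ∷ x) ≡ toℕ (a *₃ a +₃ s) ℕ.+ q ℕ.* 3
  step 0F 0F h       = h
  step 0F 1F h       = h
  step 0F 2F h       = h
  step 1F 0F (q , e) = q , cong suc e
  step 1F 1F (q , e) = q , cong suc e
  step 1F 2F (q , e) = suc q , cong suc e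
  step 2F 0F (q , e) = q , cong suc e
  step 2F 1F (q , e) = q , cong suc e
  step 2F 2F (q , e) = suc q , cong suc e

wt-self-orthogonal : ∀ {n} (x : F₃^ n) → x · x ≡ 0F → ∃[ q ] wt x ≡ q ℕ.* 3
wt-self-orthogonal x x·x≡0 with wt-self x
... | q , e = q , trans e (cong (λ s → toℕ s ℕ.+ q ℕ.* 3) x·x≡0)

-- Hamming graph operators relative to a set of coordinates

-- The subscript stands for outside: both count in the word punctured at `T`.
wtₒ zerosₒ : ∀ {n} → Subset n → F₃^ n → ℕ
wtₒ []          []           = 0
wtₒ (true  ∷ T) (_ ∷ y)      = wtₒ T y
wtₒ (false ∷ T) (zero ∷ y)   = wtₒ T y
wtₒ (false ∷ T) (suc _ ∷ y)  = suc (wtₒ T y)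
zerosₒ []          []          = 0
zerosₒ (true  ∷ T) (_ ∷ y)     = zerosₒ T y
zerosₒ (false ∷ T) (zero ∷ y)  = suc (zerosₒ T y)
zerosₒ (false ∷ T) (suc _ ∷ y) = zerosₒ T y

wtₒ+zerosₒ+∣T∣≡n : ∀ {n} (T : Subset n) y → (wtₒ T y ℕ.+ zerosₒ T y) ℕ.+ ∣ T ∣ ≡ n
wtₒ+zerosₒ+∣T∣≡n []          []          = refl
wtₒ+zerosₒ+∣T∣≡n (true  ∷ T) (_ ∷ y)     =
  trans (ℕ.+-suc _ _) (cong suc (wtₒ+zerosₒ+∣T∣≡n T y))
wtₒ+zerosₒ+∣T∣≡n (false ∷ T) (zero ∷ y)  =
  trans (cong (ℕ._+ ∣ T ∣) (ℕ.+-suc (wtₒ T y) _)) (cong suc (wtₒ+zerosₒ+∣T∣≡n T y))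
wtₒ+zerosₒ+∣T∣≡n (false ∷ T) (suc _ ∷ y) = cong suc (wtₒ+zerosₒ+∣T∣≡n T y)

wtₒ-𝟎 : ∀ {n} (T : Subset n) → wtₒ T 𝟎 ≡ 0
wtₒ-𝟎 []          = refl
wtₒ-𝟎 (true  ∷ T) = wtₒ-𝟎 T
wtₒ-𝟎 (false ∷ T) = wtₒ-𝟎 T

wtₒ-⊕ : ∀ {n} (T : Subset n) (x y : F₃^ n) → wtₒ T (x ⊕ y) ℕ.≤ wtₒ T x ℕ.+ wtₒ T y
wtₒ-⊕ []          []      []      = z≤n
wtₒ-⊕ (true  ∷ T) (_ ∷ x) (_ ∷ y) = wtₒ-⊕ T x y
wtₒ-⊕ (false ∷ T) (a ∷ x) (b ∷ y) = step a b (wtₒ-⊕ T x y)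
  where
  step : ∀ a b → wtₒ T (x ⊕ y) ℕ.≤ wtₒ T x ℕ.+ wtₒ T y →
         wtₒ (false ∷ T) ((a ∷ x) ⊕ (b ∷ y)) ℕ.≤ wtₒ (false ∷ T) (a ∷ x) ℕ.+ wtₒ (false ∷ T) (b ∷ y)
  step 0F 0F h = h
  step 0F 1F h = subst (suc (wtₒ T (x ⊕ y)) ℕ.≤_) (sym (ℕ.+-suc (wtₒ T x) (wtₒ T y))) (s≤s h)
  step 0F 2F h = subst (suc (wtₒ T (x ⊕ y)) ℕ.≤_) (sym (ℕ.+-suc (wtₒ T x) (wtₒ T y))) (s≤s h)
  step 1F 0F h = s≤s h
  step 1F 1F h = s≤s (ℕ.≤-trans h (ℕ.+-monoʳ-≤ (wtₒ T x) (ℕ.n≤1+n _)))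
  step 1F 2F h = ℕ.≤-trans h (ℕ.m≤n⇒m≤1+n (ℕ.+-monoʳ-≤ (wtₒ T x) (ℕ.n≤1+n _)))
  step 2F 0F h = s≤s h
  step 2F 1F h = ℕ.≤-trans h (ℕ.m≤n⇒m≤1+n (ℕ.+-monoʳ-≤ (wtₒ T x) (ℕ.n≤1+n _)))
  step 2F 2F h = s≤s (ℕ.≤-trans h (ℕ.+-monoʳ-≤ (wtₒ T x) (ℕ.n≤1+n _)))

F₃-sum : (F₃ → ℤ) → ℤ
F₃-sum h = h 0F ℤ.+ h 1F ℤ.+ h 2F

-- A is the adjacency operator of the Hamming graph on the coordinates outside
-- T, and J sums over all values of the coordinates in T.
A J : ∀ {n} → Subset n → (F₃^ n → ℤ) → F₃^ n → ℤ
A []          Ψ []      = 0ℤ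
A (true  ∷ T) Ψ (a ∷ y) = A T (Ψ ∘ (a ∷_)) y
A (false ∷ T) Ψ (a ∷ y) =
  (Ψ ((a +₃ 1F) ∷ y) ℤ.+ Ψ ((a +₃ 2F) ∷ y)) ℤ.+ A T (Ψ ∘ (a ∷_)) y
J []          Ψ []      = Ψ []
J (true  ∷ T) Ψ (_ ∷ y) = F₃-sum λ v → J T (Ψ ∘ (v ∷_)) y
J (false ∷ T) Ψ (a ∷ y) = J T (Ψ ∘ (a ∷_)) y

A-cong : ∀ {n} (T : Subset n) {Ψ Φ : F₃^ n → ℤ} → (∀ y → Ψ y ≡ Φ y) → ∀ y → A T Ψ y ≡ A T Φ y
A-cong []          h []      = refl
A-cong (true  ∷ T) h (a ∷ y) = A-cong T (h ∘ (a ∷_)) y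
A-cong (false ∷ T) h (a ∷ y) = cong₂ ℤ._+_ (cong₂ ℤ._+_ (h _) (h _)) (A-cong T (h ∘ (a ∷_)) y)

J-cong : ∀ {n} (T : Subset n) {Ψ Φ : F₃^ n → ℤ} → (∀ y → Ψ y ≡ Φ y) → ∀ y → J T Ψ y ≡ J T Φ y
J-cong []          h []      = h []
J-cong (true  ∷ T) h (_ ∷ y) = cong₂ ℤ._+_ (cong₂ ℤ._+_
  (J-cong T (h ∘ (0F ∷_)) y) (J-cong T (h ∘ (1F ∷_)) y)) (J-cong T (h ∘ (2F ∷_)) y)
J-cong (false ∷ T) h (a ∷ y) = J-cong T (h ∘ (a ∷_)) y

A-+ : ∀ {n} (T : Subset n) (Ψ Φ : F₃^ n → ℤ) y →
      A T (λ y → Ψ y ℤ.+ Φ y) y ≡ A T Ψ y ℤ.+ A T Φ y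
A-+ []          Ψ Φ []      = refl
A-+ (true  ∷ T) Ψ Φ (a ∷ y) = A-+ T _ _ y
A-+ (false ∷ T) Ψ Φ (a ∷ y) = trans
  (cong (λ r → (Ψ _ ℤ.+ Φ _) ℤ.+ (Ψ _ ℤ.+ Φ _) ℤ.+ r) (A-+ T (Ψ ∘ (a ∷_)) (Φ ∘ (a ∷_)) y))
  (lemma (Ψ _) (Φ _) (Ψ _) (Φ _) _ _)
  where
  lemma : ∀ a b c d e f → (a ℤ.+ b) ℤ.+ (c ℤ.+ d) ℤ.+ (e ℤ.+ f) ≡ (a ℤ.+ c ℤ.+ e) ℤ.+ (b ℤ.+ d ℤ.+ f)
  lemma = ℤ-Solver.solve-∀

J-+ : ∀ {n} (T : Subset n) (Ψ Φ : F₃^ n → ℤ) y →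
      J T (λ y → Ψ y ℤ.+ Φ y) y ≡ J T Ψ y ℤ.+ J T Φ y
J-+ []          Ψ Φ []      = refl
J-+ (true  ∷ T) Ψ Φ (_ ∷ y) = trans
  (cong₂ ℤ._+_ (cong₂ ℤ._+_ (J-+ T _ _ y) (J-+ T _ _ y)) (J-+ T _ _ y))
  (lemma (J T (Ψ ∘ (0F ∷_)) y) (J T (Φ ∘ (0F ∷_)) y) (J T (Ψ ∘ (1F ∷_)) y) _ _ _)
  where
  lemma : ∀ a b c d e f → (a ℤ.+ b) ℤ.+ (c ℤ.+ d) ℤ.+ (e ℤ.+ f) ≡ (a ℤ.+ c ℤ.+ e) ℤ.+ (b ℤ.+ d ℤ.+ f)
  lemma = ℤ-Solver.solve-∀
J-+ (false ∷ T) Ψ Φ (a ∷ y) = J-+ T _ _ y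

A-* : ∀ {n} (T : Subset n) k (Ψ : F₃^ n → ℤ) y → A T (λ y → k ℤ.* Ψ y) y ≡ k ℤ.* A T Ψ y
A-* []          k Ψ []      = sym (ℤ.*-zeroʳ k)
A-* (true  ∷ T) k Ψ (a ∷ y) = A-* T k _ y
A-* (false ∷ T) k Ψ (a ∷ y) = trans
  (cong (λ r → k ℤ.* Ψ _ ℤ.+ k ℤ.* Ψ _ ℤ.+ r) (A-* T k (Ψ ∘ (a ∷_)) y))
  (lemma k (Ψ _) (Ψ _) _)
  where
  lemma : ∀ k a b c → k ℤ.* a ℤ.+ k ℤ.* b ℤ.+ k ℤ.* c ≡ k ℤ.* (a ℤ.+ b ℤ.+ c)
  lemma = ℤ-Solver.solve-∀

J-* : ∀ {n} (T : Subset n) k (Ψ : F₃^ n → ℤ) y → J T (λ y → k ℤ.* Ψ y) y ≡ k ℤ.* J T Ψ y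
J-* []          k Ψ []      = refl
J-* (true  ∷ T) k Ψ (_ ∷ y) = trans
  (cong₂ ℤ._+_ (cong₂ ℤ._+_ (J-* T k _ y) (J-* T k _ y)) (J-* T k _ y))
  (lemma k (J T (Ψ ∘ (0F ∷_)) y) _ _)
  where
  lemma : ∀ k a b c → k ℤ.* a ℤ.+ k ℤ.* b ℤ.+ k ℤ.* c ≡ k ℤ.* (a ℤ.+ b ℤ.+ c)
  lemma = ℤ-Solver.solve-∀
J-* (false ∷ T) k Ψ (a ∷ y) = J-* T k _ y

A-translate : ∀ {n} (T : Subset n) (Ψ : F₃^ n → ℤ) d y →
              A T (λ y → Ψ (y ⊕ d)) y ≡ A T Ψ (y ⊕ d)
A-translate []          Ψ []      []      = refl
A-translate (true  ∷ T) Ψ (b ∷ d) (a ∷ y) = A-translate T _ d y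
A-translate (false ∷ T) Ψ (b ∷ d) (a ∷ y) = cong₂ ℤ._+_
  (cong₂ ℤ._+_ (cong (λ v → Ψ (v ∷ (y ⊕ d))) (+₃-swapʳ a 1F b))
               (cong (λ v → Ψ (v ∷ (y ⊕ d))) (+₃-swapʳ a 2F b)))
  (A-translate T (Ψ ∘ ((a +₃ b) ∷_)) d y)

F₃-sum-translate : ∀ (h : F₃ → ℤ) b → F₃-sum (λ v → h (v +₃ b)) ≡ F₃-sum h
F₃-sum-translate h 0F = refl
F₃-sum-translate h 1F = lemma (h 0F) (h 1F) (h 2F)
  where
  lemma : ∀ a b c → b ℤ.+ c ℤ.+ a ≡ a ℤ.+ b ℤ.+ c
  lemma = ℤ-Solver.solve-∀
F₃-sum-translate h 2F = lemma (h 0F) (h 1F) (h 2F)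
  where
  lemma : ∀ a b c → c ℤ.+ a ℤ.+ b ≡ a ℤ.+ b ℤ.+ c
  lemma = ℤ-Solver.solve-∀

J-translate : ∀ {n} (T : Subset n) (Ψ : F₃^ n → ℤ) d y →
              J T (λ y → Ψ (y ⊕ d)) y ≡ J T Ψ (y ⊕ d)
J-translate []          Ψ []      []      = refl
J-translate (true  ∷ T) Ψ (b ∷ d) (a ∷ y) = trans
  (cong₂ ℤ._+_ (cong₂ ℤ._+_ (J-translate T (Ψ ∘ ((0F +₃ b) ∷_)) d y)
    (J-translate T (Ψ ∘ ((1F +₃ b) ∷_)) d y)) (J-translate T (Ψ ∘ ((2F +₃ b) ∷_)) d y))
  (F₃-sum-translate (λ v → J T (Ψ ∘ (v ∷_)) (y ⊕ d)) b)
J-translate (false ∷ T) Ψ (b ∷ d) (a ∷ y) = J-translate T _ d y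

A-mono : ∀ {n} (T : Subset n) {Ψ Φ : F₃^ n → ℤ} → (∀ y → Ψ y ℤ.≤ Φ y) → ∀ y → A T Ψ y ℤ.≤ A T Φ y
A-mono []          h []      = ℤ.≤-refl
A-mono (true  ∷ T) h (a ∷ y) = A-mono T (h ∘ (a ∷_)) y
A-mono (false ∷ T) h (a ∷ y) = ℤ.+-mono-≤ (ℤ.+-mono-≤ (h _) (h _)) (A-mono T (h ∘ (a ∷_)) y)

J-mono : ∀ {n} (T : Subset n) {Ψ Φ : F₃^ n → ℤ} → (∀ y → Ψ y ℤ.≤ Φ y) → ∀ y → J T Ψ y ℤ.≤ J T Φ y
J-mono []          h []      = h []
J-mono (true  ∷ T) h (_ ∷ y) = ℤ.+-mono-≤ (ℤ.+-mono-≤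
  (J-mono T (h ∘ (0F ∷_)) y) (J-mono T (h ∘ (1F ∷_)) y)) (J-mono T (h ∘ (2F ∷_)) y)
J-mono (false ∷ T) h (a ∷ y) = J-mono T (h ∘ (a ∷_)) y

wtₒ-change-head : ∀ {n} (T : Subset n) a b y → wtₒ (false ∷ T) ((a ∷ y) ⊖ (b ∷ y)) ℕ.≤ 1
wtₒ-change-head T a b y with a +₃ 2F *₃ b
... | zero  = ℕ.≤-trans (ℕ.≤-reflexive (trans (cong (wtₒ T) (⊖-self y)) (wtₒ-𝟎 T))) z≤n
... | suc _ = s≤s (ℕ.≤-reflexive (trans (cong (wtₒ T) (⊖-self y)) (wtₒ-𝟎 T)))

-- A nonzero sum has a nonzero term, and deciding the terms over ℤ produces it. One application of
-- `A` changes a single coordinate outside `T`.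
A-support : ∀ {n} (T : Subset n) (Ψ : F₃^ n → ℤ) y → A T Ψ y ≢ 0ℤ →
            ∃[ y′ ] Ψ y′ ≢ 0ℤ × wtₒ T (y ⊖ y′) ℕ.≤ 1
A-support []          Ψ []      A≢0 = contradiction refl A≢0
A-support (true  ∷ T) Ψ (a ∷ y) A≢0 with A-support T (Ψ ∘ (a ∷_)) y A≢0
... | y′ , Ψ≢0 , close = a ∷ y′ , Ψ≢0 , close
A-support (false ∷ T) Ψ (a ∷ y) A≢0
  with Ψ ((a +₃ 1F) ∷ y) ℤ.≟ 0ℤ | Ψ ((a +₃ 2F) ∷ y) ℤ.≟ 0ℤ | A T (Ψ ∘ (a ∷_)) y ℤ.≟ 0ℤ
... | no Ψ≢0 | _ | _ = (a +₃ 1F) ∷ y , Ψ≢0 , wtₒ-change-head T a (a +₃ 1F) y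
... | yes _ | no Ψ≢0 | _ = (a +₃ 2F) ∷ y , Ψ≢0 , wtₒ-change-head T a (a +₃ 2F) y
... | yes e₁ | yes e₂ | yes e₃ = contradiction (cong₂ ℤ._+_ (cong₂ ℤ._+_ e₁ e₂) e₃) A≢0
... | yes _ | yes _ | no A′≢0 with A-support T (Ψ ∘ (a ∷_)) y A′≢0
...   | y′ , Ψ≢0 , close = a ∷ y′ , Ψ≢0 ,
  subst (λ v → wtₒ (false ∷ T) (v ∷ (y ⊖ y′)) ℕ.≤ 1) (sym (+₃-inverse a)) close

J-support : ∀ {n} (T : Subset n) (Ψ : F₃^ n → ℤ) y → J T Ψ y ≢ 0ℤ →
            ∃[ y′ ] Ψ y′ ≢ 0ℤ × wtₒ T (y ⊖ y′) ≡ 0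
J-support []          Ψ []      J≢0 = [] , J≢0 , refl
J-support (true  ∷ T) Ψ (a ∷ y) J≢0
  with J T (Ψ ∘ (0F ∷_)) y ℤ.≟ 0ℤ | J T (Ψ ∘ (1F ∷_)) y ℤ.≟ 0ℤ | J T (Ψ ∘ (2F ∷_)) y ℤ.≟ 0ℤ
... | yes e₁ | yes e₂ | yes e₃ = contradiction (cong₂ ℤ._+_ (cong₂ ℤ._+_ e₁ e₂) e₃) J≢0
... | no J′≢0 | _ | _ with J-support T _ y J′≢0
...   | y′ , Ψ≢0 , close = 0F ∷ y′ , Ψ≢0 , close
J-support (true  ∷ T) Ψ (a ∷ y) J≢0 | yes _ | no J′≢0 | _ with J-support T _ y J′≢0
...   | y′ , Ψ≢0 , close = 1F ∷ y′ , Ψ≢0 , close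
J-support (true  ∷ T) Ψ (a ∷ y) J≢0 | yes _ | yes _ | no J′≢0 with J-support T _ y J′≢0
...   | y′ , Ψ≢0 , close = 2F ∷ y′ , Ψ≢0 , close
J-support (false ∷ T) Ψ (a ∷ y) J≢0 with J-support T (Ψ ∘ (a ∷_)) y J≢0
... | y′ , Ψ≢0 , close = a ∷ y′ , Ψ≢0 ,
  subst (λ v → wtₒ (false ∷ T) (v ∷ (y ⊖ y′)) ≡ 0) (sym (+₃-inverse a)) close

-- g a is the trace ωᵃ + ω⁻ᵃ of the additive character of F₃.
g : F₃ → ℤ
g zero    = + 2
g (suc _) = -1ℤ

-- The eigenvalue of `J` on the character of `c`: a coordinate of `T` contributes the sum of a
-- character of F₃, which is 3 if the character is trivial and 0 otherwise.
vanishₒ : ∀ {n} → Subset n → F₃^ n → ℤ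
vanishₒ []          []          = 1ℤ
vanishₒ (true  ∷ T) (zero ∷ c)  = + 3 ℤ.* vanishₒ T c
vanishₒ (true  ∷ T) (suc _ ∷ c) = 0ℤ
vanishₒ (false ∷ T) (_ ∷ c)     = vanishₒ T c

-- The eigenvalue of `A` on the character of `c`: a zero coordinate contributes 1 + 1, a nonzero one
-- ω + ω⁻¹ = -1.
eigenvalueₒ : ∀ {n} → Subset n → F₃^ n → ℤ
eigenvalueₒ T c = + 2 ℤ.* + zerosₒ T c ℤ.- + wtₒ T c

g-neighbours-0 : ∀ r a s → g (r +₃ (0F *₃ (a +₃ 1F) +₃ s)) ℤ.+ g (r +₃ (0F *₃ (a +₃ 2F) +₃ s))
                           ≡ + 2 ℤ.* g ((r +₃ 0F *₃ a) +₃ s)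
g-neighbours-0 = toWitness {a? = Fin.all? λ r → Fin.all? λ a → Fin.all? λ s → _ ℤ.≟ _} _

g-neighbours-suc : ∀ c r a s →
  g (r +₃ (suc c *₃ (a +₃ 1F) +₃ s)) ℤ.+ g (r +₃ (suc c *₃ (a +₃ 2F) +₃ s))
  ≡ -1ℤ ℤ.* g ((r +₃ suc c *₃ a) +₃ s)
g-neighbours-suc = toWitness {a? = Fin.all? λ c → Fin.all? λ r → Fin.all? λ a → Fin.all? λ s → _ ℤ.≟ _} _

g-sum-0 : ∀ r a s → F₃-sum (λ v → g ((r +₃ 0F *₃ v) +₃ s)) ≡ + 3 ℤ.* g (r +₃ (0F *₃ a +₃ s))
g-sum-0 = toWitness {a? = Fin.all? λ r → Fin.all? λ a → Fin.all? λ s → _ ℤ.≟ _} _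

g-sum-suc : ∀ c r s → F₃-sum (λ v → g ((r +₃ suc c *₃ v) +₃ s)) ≡ 0ℤ
g-sum-suc = toWitness {a? = Fin.all? λ c → Fin.all? λ r → Fin.all? λ s → _ ℤ.≟ _} _

-- The offset `r` carries the part of the inner product that the induction on coordinates has
-- already passed; `g` alone is not multiplicative, so the identity must be proved for all offsets.
A-character : ∀ {n} (T : Subset n) c r y →
  A T (λ y → g (r +₃ c · y)) y ≡ eigenvalueₒ T c ℤ.* g (r +₃ c · y)
A-character []          []        r []      = refl
A-character (true  ∷ T) (b ∷ c) r (a ∷ y) = begin
  A T (λ y → g (r +₃ (b *₃ a +₃ c · y))) y
    ≡⟨ A-cong T (λ y → cong g (+₃-assoc r (b *₃ a) (c · y))) y ⟨
  A T (λ y → g ((r +₃ b *₃ a) +₃ c · y)) y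
    ≡⟨ A-character T c (r +₃ b *₃ a) y ⟩
  eigenvalueₒ T c ℤ.* g ((r +₃ b *₃ a) +₃ c · y)
    ≡⟨ cong (λ s → eigenvalueₒ T c ℤ.* g s) (+₃-assoc r (b *₃ a) (c · y)) ⟩
  eigenvalueₒ T c ℤ.* g (r +₃ (b *₃ a +₃ c · y)) ∎
  where open ≡-Reasoning
A-character (false ∷ T) (b ∷ c) r (a ∷ y) = begin
  g (r +₃ (b *₃ (a +₃ 1F) +₃ c · y)) ℤ.+ g (r +₃ (b *₃ (a +₃ 2F) +₃ c · y))
    ℤ.+ A T (λ y → g (r +₃ (b *₃ a +₃ c · y))) y
    ≡⟨ cong (λ e → g (r +₃ (b *₃ (a +₃ 1F) +₃ c · y)) ℤ.+ g (r +₃ (b *₃ (a +₃ 2F) +₃ c · y)) ℤ.+ e)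
         (trans (A-cong T (λ y → cong g (sym (+₃-assoc r (b *₃ a) (c · y)))) y)
                (A-character T c (r +₃ b *₃ a) y)) ⟩
  g (r +₃ (b *₃ (a +₃ 1F) +₃ c · y)) ℤ.+ g (r +₃ (b *₃ (a +₃ 2F) +₃ c · y))
    ℤ.+ eigenvalueₒ T c ℤ.* g ((r +₃ b *₃ a) +₃ c · y)
    ≡⟨ split b ⟩
  eigenvalueₒ (false ∷ T) (b ∷ c) ℤ.* g ((r +₃ b *₃ a) +₃ c · y)
    ≡⟨ cong (λ s → eigenvalueₒ (false ∷ T) (b ∷ c) ℤ.* g s) (+₃-assoc r (b *₃ a) (c · y)) ⟩
  eigenvalueₒ (false ∷ T) (b ∷ c) ℤ.* g (r +₃ (b *₃ a +₃ c · y)) ∎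
  where
  open ≡-Reasoning
  add-zero : ∀ z w x → + 2 ℤ.* x ℤ.+ (+ 2 ℤ.* z ℤ.- w) ℤ.* x ≡ (+ 2 ℤ.* (1ℤ ℤ.+ z) ℤ.- w) ℤ.* x
  add-zero = ℤ-Solver.solve-∀
  add-nonzero : ∀ z w x → -1ℤ ℤ.* x ℤ.+ (+ 2 ℤ.* z ℤ.- w) ℤ.* x ≡ (+ 2 ℤ.* z ℤ.- (1ℤ ℤ.+ w)) ℤ.* x
  add-nonzero = ℤ-Solver.solve-∀
  split : ∀ b → g (r +₃ (b *₃ (a +₃ 1F) +₃ c · y)) ℤ.+ g (r +₃ (b *₃ (a +₃ 2F) +₃ c · y))
    ℤ.+ eigenvalueₒ T c ℤ.* g ((r +₃ b *₃ a) +₃ c · y)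
    ≡ eigenvalueₒ (false ∷ T) (b ∷ c) ℤ.* g ((r +₃ b *₃ a) +₃ c · y)
  split zero    = trans
    (cong (ℤ._+ eigenvalueₒ T c ℤ.* g ((r +₃ 0F *₃ a) +₃ c · y)) (g-neighbours-0 r a (c · y)))
    (add-zero (+ zerosₒ T c) (+ wtₒ T c) (g ((r +₃ 0F *₃ a) +₃ c · y)))
  split (suc b) = trans
    (cong (ℤ._+ eigenvalueₒ T c ℤ.* g ((r +₃ suc b *₃ a) +₃ c · y)) (g-neighbours-suc b r a (c · y)))
    (add-nonzero (+ zerosₒ T c) (+ wtₒ T c) (g ((r +₃ suc b *₃ a) +₃ c · y)))

J-character : ∀ {n} (T : Subset n) c r y →
  J T (λ y → g (r +₃ c · y)) y ≡ vanishₒ T c ℤ.* g (r +₃ c · y)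
J-character []          []      r []      = sym (ℤ.*-identityˡ _)
J-character (true  ∷ T) (b ∷ c) r (a ∷ y) = begin
  F₃-sum (λ v → J T (λ y → g (r +₃ (b *₃ v +₃ c · y))) y)
    ≡⟨ cong₂ ℤ._+_ (cong₂ ℤ._+_ (each 0F) (each 1F)) (each 2F) ⟩
  F₃-sum (λ v → vanishₒ T c ℤ.* g ((r +₃ b *₃ v) +₃ c · y))
    ≡⟨ distrib (vanishₒ T c) (g ((r +₃ b *₃ 0F) +₃ c · y)) (g ((r +₃ b *₃ 1F) +₃ c · y)) _ ⟩
  vanishₒ T c ℤ.* F₃-sum (λ v → g ((r +₃ b *₃ v) +₃ c · y))
    ≡⟨ split b ⟩
  vanishₒ (true ∷ T) (b ∷ c) ℤ.* g (r +₃ (b *₃ a +₃ c · y)) ∎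
  where
  open ≡-Reasoning
  each : ∀ v → J T (λ y → g (r +₃ (b *₃ v +₃ c · y))) y
             ≡ vanishₒ T c ℤ.* g ((r +₃ b *₃ v) +₃ c · y)
  each v = trans (J-cong T (λ y → cong g (sym (+₃-assoc r (b *₃ v) (c · y)))) y)
                 (J-character T c (r +₃ b *₃ v) y)
  distrib : ∀ k x y z → k ℤ.* x ℤ.+ k ℤ.* y ℤ.+ k ℤ.* z ≡ k ℤ.* (x ℤ.+ y ℤ.+ z)
  distrib = ℤ-Solver.solve-∀
  swap : ∀ k x → k ℤ.* (+ 3 ℤ.* x) ≡ + 3 ℤ.* k ℤ.* x
  swap = ℤ-Solver.solve-∀
  split : ∀ b → vanishₒ T c ℤ.* F₃-sum (λ v → g ((r +₃ b *₃ v) +₃ c · y))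
              ≡ vanishₒ (true ∷ T) (b ∷ c) ℤ.* g (r +₃ (b *₃ a +₃ c · y))
  split zero    = trans (cong (vanishₒ T c ℤ.*_) (g-sum-0 r a (c · y))) (swap (vanishₒ T c) (g (r +₃ (0F *₃ a +₃ c · y))))
  split (suc b) = trans (cong (vanishₒ T c ℤ.*_) (g-sum-suc b r (c · y))) (ℤ.*-zeroʳ (vanishₒ T c))
J-character (false ∷ T) (b ∷ c) r (a ∷ y) = begin
  J T (λ y → g (r +₃ (b *₃ a +₃ c · y))) y
    ≡⟨ J-cong T (λ y → cong g (+₃-assoc r (b *₃ a) (c · y))) y ⟨
  J T (λ y → g ((r +₃ b *₃ a) +₃ c · y)) y
    ≡⟨ J-character T c (r +₃ b *₃ a) y ⟩
  vanishₒ T c ℤ.* g ((r +₃ b *₃ a) +₃ c · y)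
    ≡⟨ cong (λ s → vanishₒ T c ℤ.* g s) (+₃-assoc r (b *₃ a) (c · y)) ⟩
  vanishₒ T c ℤ.* g (r +₃ (b *₃ a +₃ c · y)) ∎
  where open ≡-Reasoning

vanishₒ≢0⇒wt≡wtₒ : ∀ {n} (T : Subset n) c → vanishₒ T c ≢ 0ℤ → wt c ≡ wtₒ T c
vanishₒ≢0⇒wt≡wtₒ []          []          _   = refl
vanishₒ≢0⇒wt≡wtₒ (true  ∷ T) (zero ∷ c)  v≢0 =
  vanishₒ≢0⇒wt≡wtₒ T c (λ v≡0 → v≢0 (cong (+ 3 ℤ.*_) v≡0))
vanishₒ≢0⇒wt≡wtₒ (true  ∷ T) (suc _ ∷ c) v≢0 = contradiction refl v≢0
vanishₒ≢0⇒wt≡wtₒ (false ∷ T) (zero ∷ c)  v≢0 = vanishₒ≢0⇒wt≡wtₒ T c v≢0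
vanishₒ≢0⇒wt≡wtₒ (false ∷ T) (suc _ ∷ c) v≢0 = cong suc (vanishₒ≢0⇒wt≡wtₒ T c v≢0)

-- A nonzero coordinate has one change that lowers the weight and one that keeps it; a zero
-- coordinate has two that raise it. `Ψ` need only be radial up to one more than the weight of `y`,
-- so the identity works inside a ball around 0.
shell-step : ∀ {n} (T : Subset n) (Ψ : F₃^ n → ℤ) (α : ℕ → ℤ) y →
  (∀ y′ → wtₒ T y′ ℕ.≤ suc (wtₒ T y) → Ψ y′ ≡ α (wtₒ T y′)) →
  A T Ψ y ≡ + wtₒ T y ℤ.* (α (ℕ.pred (wtₒ T y)) ℤ.+ α (wtₒ T y))
            ℤ.+ + 2 ℤ.* + zerosₒ T y ℤ.* α (suc (wtₒ T y))
shell-step []          Ψ α []         h = refl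
shell-step (true  ∷ T) Ψ α (a ∷ y)    h = shell-step T (Ψ ∘ (a ∷_)) α y (λ y′ → h (a ∷ y′))
shell-step (false ∷ T) Ψ α (zero ∷ y) h = begin
  Ψ (1F ∷ y) ℤ.+ Ψ (2F ∷ y) ℤ.+ A T (Ψ ∘ (0F ∷_)) y
    ≡⟨ cong₂ ℤ._+_ (cong₂ ℤ._+_ (h (1F ∷ y) ℕ.≤-refl) (h (2F ∷ y) ℕ.≤-refl))
         (shell-step T (Ψ ∘ (0F ∷_)) α y (λ y′ → h (0F ∷ y′))) ⟩
  α (suc w) ℤ.+ α (suc w) ℤ.+ (+ w ℤ.* (α (ℕ.pred w) ℤ.+ α w) ℤ.+ + 2 ℤ.* z ℤ.* α (suc w))
    ≡⟨ lemma (α (suc w)) (+ w ℤ.* (α (ℕ.pred w) ℤ.+ α w)) z ⟩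
  + w ℤ.* (α (ℕ.pred w) ℤ.+ α w) ℤ.+ + 2 ℤ.* (1ℤ ℤ.+ z) ℤ.* α (suc w) ∎
  where
  open ≡-Reasoning
  w = wtₒ T y
  z = + zerosₒ T y
  lemma : ∀ x r z → x ℤ.+ x ℤ.+ (r ℤ.+ + 2 ℤ.* z ℤ.* x) ≡ r ℤ.+ + 2 ℤ.* (1ℤ ℤ.+ z) ℤ.* x
  lemma = ℤ-Solver.solve-∀
shell-step (false ∷ T) Ψ α (suc b ∷ y) h = begin
  Ψ ((suc b +₃ 1F) ∷ y) ℤ.+ Ψ ((suc b +₃ 2F) ∷ y) ℤ.+ A T (Ψ ∘ (suc b ∷_)) y
    ≡⟨ cong₂ ℤ._+_ (neighbours b)
         (shell-step T (Ψ ∘ (suc b ∷_)) (α ∘ suc) y (λ y′ le → h (suc b ∷ y′) (s≤s le))) ⟩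
  (α w ℤ.+ α (suc w)) ℤ.+ (+ w ℤ.* (α (suc (ℕ.pred w)) ℤ.+ α (suc w)) ℤ.+ + 2 ℤ.* z ℤ.* α (suc (suc w)))
    -- `suc (ℕ.pred w)` differs from `w` only at `w = 0`, where the factor `+ w` removes the term.
    ≡⟨ cong (λ r → (α w ℤ.+ α (suc w)) ℤ.+ (r ℤ.+ + 2 ℤ.* z ℤ.* α (suc (suc w)))) (fix w) ⟩
  (α w ℤ.+ α (suc w)) ℤ.+ (+ w ℤ.* (α w ℤ.+ α (suc w)) ℤ.+ + 2 ℤ.* z ℤ.* α (suc (suc w)))
    ≡⟨ lemma (α w ℤ.+ α (suc w)) (+ w) (+ 2 ℤ.* z ℤ.* α (suc (suc w))) ⟩
  (1ℤ ℤ.+ + w) ℤ.* (α w ℤ.+ α (suc w)) ℤ.+ + 2 ℤ.* z ℤ.* α (suc (suc w)) ∎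
  where
  open ≡-Reasoning
  w = wtₒ T y
  z = + zerosₒ T y
  lemma : ∀ x w r → x ℤ.+ (w ℤ.* x ℤ.+ r) ≡ (1ℤ ℤ.+ w) ℤ.* x ℤ.+ r
  lemma = ℤ-Solver.solve-∀
  fix : ∀ w → + w ℤ.* (α (suc (ℕ.pred w)) ℤ.+ α (suc w)) ≡ + w ℤ.* (α w ℤ.+ α (suc w))
  fix zero    = refl
  fix (suc w) = refl
  h₀ : Ψ (0F ∷ y) ≡ α w
  h₀ = h (0F ∷ y) (ℕ.m≤n⇒m≤1+n (ℕ.n≤1+n w))
  neighbours : ∀ b → Ψ ((suc b +₃ 1F) ∷ y) ℤ.+ Ψ ((suc b +₃ 2F) ∷ y) ≡ α w ℤ.+ α (suc w)
  neighbours 0F = trans (ℤ.+-comm (Ψ (2F ∷ y)) (Ψ (0F ∷ y))) (cong₂ ℤ._+_ h₀ (h (2F ∷ y) (ℕ.n≤1+n _)))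
  neighbours 1F = cong₂ ℤ._+_ h₀ (h (1F ∷ y) (ℕ.n≤1+n _))

isZero : ℕ → ℤ
isZero zero    = 1ℤ
isZero (suc _) = 0ℤ

-- `r` is the weight accumulated so far. A nonzero value in a coordinate of `T` raises it and
-- contributes 0, so only the filling of `T` by zeros survives; the weight bound in the hypothesis
-- covers every filling.
J-punctured : ∀ {n} (T : Subset n) (Ψ : F₃^ n → ℤ) r y →
  (∀ y′ → wt y′ ℕ.≤ wtₒ T y ℕ.+ ∣ T ∣ → Ψ y′ ≡ isZero (r ℕ.+ wt y′)) →
  J T Ψ y ≡ isZero (r ℕ.+ wtₒ T y)
J-punctured []          Ψ r []         h = h [] z≤n
J-punctured (true  ∷ T) Ψ r (_ ∷ y) h = begin
  J T (Ψ ∘ (0F ∷_)) y ℤ.+ J T (Ψ ∘ (1F ∷_)) y ℤ.+ J T (Ψ ∘ (2F ∷_)) y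
    ≡⟨ cong₂ ℤ._+_ (cong₂ ℤ._+_
         (J-punctured T _ r y λ y′ le → h (0F ∷ y′) (ℕ.≤-trans le (ℕ.+-monoʳ-≤ (wtₒ T y) (ℕ.n≤1+n _))))
         (shifted 0F)) (shifted 1F) ⟩
  isZero (r ℕ.+ wtₒ T y) ℤ.+ 0ℤ ℤ.+ 0ℤ
    ≡⟨ trans (ℤ.+-identityʳ _) (ℤ.+-identityʳ _) ⟩
  isZero (r ℕ.+ wtₒ T y) ∎
  where
  open ≡-Reasoning
  shifted : ∀ b → J T (Ψ ∘ (suc b ∷_)) y ≡ 0ℤ
  shifted b = J-punctured T (Ψ ∘ (suc b ∷_)) (suc r) y λ y′ le →
    trans (h (suc b ∷ y′) (subst (suc (wt y′) ℕ.≤_) (sym (ℕ.+-suc _ _)) (s≤s le)))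
          (cong isZero (ℕ.+-suc r (wt y′)))
J-punctured (false ∷ T) Ψ r (zero ∷ y)  h = J-punctured T (Ψ ∘ (0F ∷_)) r y (λ y′ → h (0F ∷ y′))
J-punctured (false ∷ T) Ψ r (suc b ∷ y) h = trans
  (J-punctured T (Ψ ∘ (suc b ∷_)) (suc r) y λ y′ le →
    trans (h (suc b ∷ y′) (s≤s le)) (cong isZero (ℕ.+-suc r (wt y′))))
  (cong isZero (sym (ℕ.+-suc r (wtₒ T y))))

-- Character sums over coefficient vectors

Vec-sum : ∀ k → (Vec F₃ k → ℤ) → ℤ
Vec-sum zero    h = h []
Vec-sum (suc k) h = F₃-sum λ v → Vec-sum k (h ∘ (v ∷_))

F₃-sum-cong : ∀ {h h′ : F₃ → ℤ} → (∀ v → h v ≡ h′ v) → F₃-sum h ≡ F₃-sum h′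
F₃-sum-cong e = cong₂ ℤ._+_ (cong₂ ℤ._+_ (e 0F) (e 1F)) (e 2F)

Vec-sum-cong : ∀ k {h h′ : Vec F₃ k → ℤ} → (∀ a → h a ≡ h′ a) → Vec-sum k h ≡ Vec-sum k h′
Vec-sum-cong zero    e = e []
Vec-sum-cong (suc k) e = F₃-sum-cong λ v → Vec-sum-cong k (e ∘ (v ∷_))

Vec-sum-+ : ∀ k (h h′ : Vec F₃ k → ℤ) →
  Vec-sum k (λ a → h a ℤ.+ h′ a) ≡ Vec-sum k h ℤ.+ Vec-sum k h′
Vec-sum-+ zero    h h′ = refl
Vec-sum-+ (suc k) h h′ = trans
  (F₃-sum-cong λ v → Vec-sum-+ k (h ∘ (v ∷_)) (h′ ∘ (v ∷_)))
  (lemma (Vec-sum k (h ∘ (0F ∷_))) (Vec-sum k (h′ ∘ (0F ∷_))) (Vec-sum k (h ∘ (1F ∷_)))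
         (Vec-sum k (h′ ∘ (1F ∷_))) (Vec-sum k (h ∘ (2F ∷_))) (Vec-sum k (h′ ∘ (2F ∷_))))
  where
  lemma : ∀ a b c d e f → (a ℤ.+ b) ℤ.+ (c ℤ.+ d) ℤ.+ (e ℤ.+ f) ≡ (a ℤ.+ c ℤ.+ e) ℤ.+ (b ℤ.+ d ℤ.+ f)
  lemma = ℤ-Solver.solve-∀

Vec-sum-* : ∀ k m (h : Vec F₃ k → ℤ) → Vec-sum k (λ a → m ℤ.* h a) ≡ m ℤ.* Vec-sum k h
Vec-sum-* zero    m h = refl
Vec-sum-* (suc k) m h = trans
  (F₃-sum-cong λ v → Vec-sum-* k m (h ∘ (v ∷_)))
  (lemma m (Vec-sum k (h ∘ (0F ∷_))) (Vec-sum k (h ∘ (1F ∷_))) (Vec-sum k (h ∘ (2F ∷_))))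
  where
  lemma : ∀ k a b c → k ℤ.* a ℤ.+ k ℤ.* b ℤ.+ k ℤ.* c ≡ k ℤ.* (a ℤ.+ b ℤ.+ c)
  lemma = ℤ-Solver.solve-∀

Vec-sum-0 : ∀ k → Vec-sum k (λ _ → 0ℤ) ≡ 0ℤ
Vec-sum-0 zero    = refl
Vec-sum-0 (suc k) = F₃-sum-cong λ _ → Vec-sum-0 k

A-Vec-sum : ∀ {n} (T : Subset n) k (Ψ : Vec F₃ k → F₃^ n → ℤ) y →
  A T (λ y → Vec-sum k (λ a → Ψ a y)) y ≡ Vec-sum k (λ a → A T (Ψ a) y)
A-Vec-sum T zero    Ψ y = refl
A-Vec-sum T (suc k) Ψ y = trans
  (trans (A-+ T _ _ y) (cong (ℤ._+ A T (λ y → Vec-sum k (λ a → Ψ (2F ∷ a) y)) y) (A-+ T _ _ y)))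
  (F₃-sum-cong λ v → A-Vec-sum T k (Ψ ∘ (v ∷_)) y)

J-Vec-sum : ∀ {n} (T : Subset n) k (Ψ : Vec F₃ k → F₃^ n → ℤ) y →
  J T (λ y → Vec-sum k (λ a → Ψ a y)) y ≡ Vec-sum k (λ a → J T (Ψ a) y)
J-Vec-sum T zero    Ψ y = refl
J-Vec-sum T (suc k) Ψ y = trans
  (trans (J-+ T _ _ y) (cong (ℤ._+ J T (λ y → Vec-sum k (λ a → Ψ (2F ∷ a) y)) y) (J-+ T _ _ y)))
  (F₃-sum-cong λ v → J-Vec-sum T k (Ψ ∘ (v ∷_)) y)

3^_ : ℕ → ℤ
3^ zero  = 1ℤ
3^ suc k = + 3 ℤ.* 3^ k

3^-positive : ∀ k → 0ℤ ℤ.< 3^ k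
3^-positive zero    = ℤ.+<+ (s≤s z≤n)
3^-positive (suc k) = ℤ.*-monoˡ-<-pos (+ 3) (3^-positive k)

character-sum-trivial : ∀ k r → Vec-sum k (λ a → g (r +₃ a · 𝟎)) ≡ 3^ k ℤ.* g r
character-sum-trivial zero    r = trans (cong g (+₃-identityʳ r)) (sym (ℤ.*-identityˡ _))
character-sum-trivial (suc k) r = trans
  (F₃-sum-cong λ v → trans
    (Vec-sum-cong k λ a → cong (λ t → g (r +₃ (t +₃ a · 𝟎))) (*₃-zeroʳ v))
    (trans (Vec-sum-cong k λ a → cong (λ t → g (r +₃ t)) (+₃-identityˡ (a · 𝟎)))
           (character-sum-trivial k r)))
  (lemma (3^ k) (g r))
  where
  lemma : ∀ m x → m ℤ.* x ℤ.+ m ℤ.* x ℤ.+ m ℤ.* x ≡ + 3 ℤ.* m ℤ.* x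
  lemma = ℤ-Solver.solve-∀

g-sum-nonzero : ∀ b r → F₃-sum (λ v → g (r +₃ v *₃ suc b)) ≡ 0ℤ
g-sum-nonzero = toWitness {a? = Fin.all? λ b → Fin.all? λ r → _ ℤ.≟ _} _

-- If the tail of `v` is nonzero, the inner sums vanish by induction. Otherwise the head is nonzero,
-- the inner sums are constant multiples of `g`, and summing over the first coefficient gives 2 - 1
-- - 1 = 0.
character-sum-nontrivial : ∀ k v r → v ≢ 𝟎 → Vec-sum k (λ a → g (r +₃ a · v)) ≡ 0ℤ
character-sum-nontrivial zero    []      r v≢𝟎 = contradiction refl v≢𝟎
character-sum-nontrivial (suc k) (b ∷ v) r v≢𝟎 = trans
  (F₃-sum-cong λ x → Vec-sum-cong k λ a → cong g (sym (+₃-assoc r (x *₃ b) (a · v))))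
  (split b (v ≟ᵥ 𝟎) v≢𝟎)
  where
  split : ∀ b → Dec (v ≡ 𝟎) → b ∷ v ≢ 𝟎 →
          F₃-sum (λ x → Vec-sum k (λ a → g ((r +₃ x *₃ b) +₃ a · v))) ≡ 0ℤ
  split b       (no v≢𝟎)   _ = F₃-sum-cong {h′ = λ _ → 0ℤ} λ x →
    character-sum-nontrivial k v (r +₃ x *₃ b) v≢𝟎
  split zero    (yes refl) ≢ = contradiction refl ≢
  split (suc b) (yes refl) _ = trans
    (F₃-sum-cong λ x → character-sum-trivial k (r +₃ x *₃ suc b))
    (trans (lemma (3^ k) (g (r +₃ 0F *₃ suc b)) (g (r +₃ 1F *₃ suc b)) (g (r +₃ 2F *₃ suc b)))
           (trans (cong (3^ k ℤ.*_) (g-sum-nonzero b r)) (ℤ.*-zeroʳ (3^ k))))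
    where
    lemma : ∀ k a b c → k ℤ.* a ℤ.+ k ℤ.* b ℤ.+ k ℤ.* c ≡ k ℤ.* (a ℤ.+ b ℤ.+ c)
    lemma = ℤ-Solver.solve-∀

linearCombination-· : ∀ {n k} (a : Vec F₃ k) (vs : Vec (F₃^ n) k) y →
  linearCombination a vs · y ≡ a · Vec.map (_· y) vs
linearCombination-· []      []       y = ·-zeroˡ y
linearCombination-· (b ∷ a) (v ∷ vs) y = trans (·-⊕ˡ (b ⊙ v) _ y)
  (cong₂ _+₃_ (·-⊙ˡ b v y) (linearCombination-· a vs y))

·-nondegenerate : ∀ {k} (v : F₃^ k) → (∀ a → a · v ≡ 0F) → v ≡ 𝟎
·-nondegenerate []      h = refl
·-nondegenerate (b ∷ v) h = cong₂ _∷_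
  (trans (sym (trans (cong (1F *₃ b +₃_) (·-zeroˡ v)) (trans (+₃-identityʳ _) (*₃-identityˡ b)))) (h (1F ∷ 𝟎)))
  (·-nondegenerate v λ a → trans (sym (+₃-identityˡ (a · v)))
    (trans (cong (_+₃ a · v) (sym (*₃-zeroˡ b))) (h (0F ∷ a))))
  where
  *₃-zeroˡ : ∀ b → 0F *₃ b ≡ 0F
  *₃-zeroˡ b = trans (*₃-comm 0F b) (*₃-zeroʳ b)

AJ : ∀ {n} → Subset n → ℕ → (F₃^ n → ℤ) → F₃^ n → ℤ
AJ T zero    Ψ = J T Ψ
AJ T (suc j) Ψ = A T (AJ T j Ψ)

AJ-cong : ∀ {n} (T : Subset n) j {Ψ Φ : F₃^ n → ℤ} → (∀ y → Ψ y ≡ Φ y) → ∀ y → AJ T j Ψ y ≡ AJ T j Φ y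
AJ-cong T zero    e = J-cong T e
AJ-cong T (suc j) e = A-cong T (AJ-cong T j e)

AJ-* : ∀ {n} (T : Subset n) j m (Ψ : F₃^ n → ℤ) y → AJ T j (λ y → m ℤ.* Ψ y) y ≡ m ℤ.* AJ T j Ψ y
AJ-* T zero    m Ψ y = J-* T m Ψ y
AJ-* T (suc j) m Ψ y = trans (A-cong T (AJ-* T j m Ψ) y) (A-* T m (AJ T j Ψ) y)

AJ-Vec-sum : ∀ {n} (T : Subset n) j k (Ψ : Vec F₃ k → F₃^ n → ℤ) y →
  AJ T j (λ y → Vec-sum k (λ a → Ψ a y)) y ≡ Vec-sum k (λ a → AJ T j (Ψ a) y)
AJ-Vec-sum T zero    k Ψ y = J-Vec-sum T k Ψ y
AJ-Vec-sum T (suc j) k Ψ y = trans (A-cong T (AJ-Vec-sum T j k Ψ) y) (A-Vec-sum T k (λ a → AJ T j (Ψ a)) y)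

AJ-translate : ∀ {n} (T : Subset n) j (Ψ : F₃^ n → ℤ) d y →
  AJ T j (λ y → Ψ (y ⊕ d)) y ≡ AJ T j Ψ (y ⊕ d)
AJ-translate T zero    Ψ d y = J-translate T Ψ d y
AJ-translate T (suc j) Ψ d y = trans (A-cong T (AJ-translate T j Ψ d) y) (A-translate T (AJ T j Ψ) d y)

AJ-nonneg : ∀ {n} (T : Subset n) j {Ψ : F₃^ n → ℤ} → (∀ y → 0ℤ ℤ.≤ Ψ y) → ∀ y → 0ℤ ℤ.≤ AJ T j Ψ y
AJ-nonneg T zero    {Ψ} h y = subst (ℤ._≤ J T Ψ y) (J-* T 0ℤ (λ _ → 0ℤ) y) (J-mono T h y)
AJ-nonneg T (suc j) {Ψ} h y = subst (ℤ._≤ A T (AJ T j Ψ) y) (A-* T 0ℤ (λ _ → 0ℤ) y)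
  (A-mono T (AJ-nonneg T j h) y)

AJ-support : ∀ {n} (T : Subset n) j (Ψ : F₃^ n → ℤ) y → AJ T j Ψ y ≢ 0ℤ →
             ∃[ y′ ] Ψ y′ ≢ 0ℤ × wtₒ T (y ⊖ y′) ℕ.≤ j
AJ-support T zero    Ψ y ≢0 with J-support T Ψ y ≢0
... | y′ , Ψ≢0 , close = y′ , Ψ≢0 , ℕ.≤-reflexive close
AJ-support T (suc j) Ψ y ≢0 with A-support T (AJ T j Ψ) y ≢0
... | y₁ , ≢0′ , close₁ with AJ-support T j Ψ y₁ ≢0′
...   | y₂ , Ψ≢0 , close₂ = y₂ , Ψ≢0 ,
  ℕ.≤-trans (ℕ.≤-reflexive (cong (wtₒ T) (⊖-triangle y y₁ y₂)))
    (ℕ.≤-trans (wtₒ-⊕ T (y ⊖ y₁) (y₁ ⊖ y₂)) (ℕ.+-mono-≤ close₁ close₂))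

AJ-character : ∀ {n} (T : Subset n) j c y →
  AJ T j (λ y → g (c · y)) y ≡ eigenvalueₒ T c ℤ.^ j ℤ.* vanishₒ T c ℤ.* g (c · y)
AJ-character T zero    c y = begin
  J T (λ y → g (c · y)) y               ≡⟨ J-cong T (λ y → cong g (+₃-identityˡ (c · y))) y ⟨
  J T (λ y → g (0F +₃ c · y)) y         ≡⟨ J-character T c 0F y ⟩
  vanishₒ T c ℤ.* g (0F +₃ c · y)       ≡⟨ cong₂ (λ v t → v ℤ.* g t) (sym (ℤ.*-identityˡ (vanishₒ T c))) (+₃-identityˡ (c · y)) ⟩
  1ℤ ℤ.* vanishₒ T c ℤ.* g (c · y)      ∎
  where open ≡-Reasoning
AJ-character T (suc j) c y = begin
  A T (AJ T j (λ y → g (c · y))) y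
    ≡⟨ A-cong T (λ y → trans (AJ-character T j c y) (cong (λ t → m ℤ.* g t) (sym (+₃-identityˡ (c · y))))) y ⟩
  A T (λ y → m ℤ.* g (0F +₃ c · y)) y
    ≡⟨ A-* T m _ y ⟩
  m ℤ.* A T (λ y → g (0F +₃ c · y)) y
    ≡⟨ cong (m ℤ.*_) (trans (A-character T c 0F y) (cong (λ t → e ℤ.* g t) (+₃-identityˡ (c · y)))) ⟩
  m ℤ.* (e ℤ.* g (c · y))
    ≡⟨ lemma (e ℤ.^ j) (vanishₒ T c) e (g (c · y)) ⟩
  e ℤ.* e ℤ.^ j ℤ.* vanishₒ T c ℤ.* g (c · y) ∎
  where
  open ≡-Reasoning
  e = eigenvalueₒ T c
  m = e ℤ.^ j ℤ.* vanishₒ T c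
  lemma : ∀ p v e x → p ℤ.* v ℤ.* (e ℤ.* x) ≡ e ℤ.* p ℤ.* v ℤ.* x
  lemma = ℤ-Solver.solve-∀

-- The values of Aʲ applied to the indicator of 0, as a function of the weight.
shell : ℕ → ℕ → ℕ → ℤ
shell n zero    w = isZero w
shell n (suc j) w = + w ℤ.* (shell n j (ℕ.pred w) ℤ.+ shell n j w)
                    ℤ.+ + 2 ℤ.* + (n ℕ.∸ w) ℤ.* shell n j (suc w)

-- Walk counts and words of weight 9 in an extremal self-dual code

module ExtremalCode
  {n k} (C : Code n) (isLinear : IsLinear C) (selfDual : SelfDual C)
  (basis : Vec (F₃^ n) k) (spanning : ∀ x → C x ⇔ span basis x)
  (distance : ∀ c → C c → c ≢ 𝟎 → 9 ℕ.≤ wt c) (n≡24 : n ≡ 24) where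

  open IsLinear isLinear

  orthogonal : ∀ {x y} → C x → C y → x · y ≡ 0F
  orthogonal {x} {y} x∈C y∈C = Equivalence.to (selfDual x) x∈C y y∈C

  ⊖-closed : ∀ {x y} → C x → C y → C (x ⊖ y)
  ⊖-closed x∈C y∈C = ⊕-closed x∈C (⊙-closed 2F y∈C)

  codeword : Vec F₃ k → F₃^ n
  codeword a = linearCombination a basis

  codeword∈C : ∀ a → C (codeword a)
  codeword∈C a = Equivalence.from (spanning (codeword a)) (a , refl)

  -- By self-duality a basis is also a parity check. This makes membership decidable although the
  -- code is given only as a predicate.
  syndrome : F₃^ n → F₃^ k
  syndrome y = Vec.map (_· y) basis

  syndrome≡𝟎 : ∀ {y} → C y → syndrome y ≡ 𝟎
  syndrome≡𝟎 {y} y∈C = ·-nondegenerate (syndrome y) λ a →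
    trans (sym (linearCombination-· a basis y)) (orthogonal (codeword∈C a) y∈C)

  syndrome≡𝟎⇒∈C : ∀ {y} → syndrome y ≡ 𝟎 → C y
  syndrome≡𝟎⇒∈C {y} s≡𝟎 = Equivalence.from (selfDual y) λ c c∈C →
    case Equivalence.to (spanning c) c∈C of λ where
      (a , refl) → begin
        y · codeword a      ≡⟨ ·-comm y (codeword a) ⟩
        codeword a · y      ≡⟨ linearCombination-· a basis y ⟩
        a · syndrome y      ≡⟨ cong (a ·_) s≡𝟎 ⟩
        a · 𝟎               ≡⟨ ·-zeroʳ a ⟩
        0F                  ∎
    where open ≡-Reasoning

  C? : ∀ y → Dec (C y)
  C? y = map′ syndrome≡𝟎⇒∈C syndrome≡𝟎 (syndrome y ≟ᵥ 𝟎)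

  indicator : F₃^ n → ℤ
  indicator y with C? y
  ... | yes _ = 1ℤ
  ... | no  _ = 0ℤ

  indicator-∈ : ∀ {y} → C y → indicator y ≡ 1ℤ
  indicator-∈ {y} y∈C with C? y
  ... | yes _  = refl
  ... | no y∉C = contradiction y∈C y∉C

  indicator-∉ : ∀ {y} → ¬ C y → indicator y ≡ 0ℤ
  indicator-∉ {y} y∉C with C? y
  ... | yes y∈C = contradiction y∈C y∉C
  ... | no _    = refl

  indicator≢0 : ∀ {y} → indicator y ≢ 0ℤ → C y
  indicator≢0 {y} ≢0 with C? y
  ... | yes y∈C = y∈C
  ... | no _    = contradiction refl ≢0

  indicator-nonneg : ∀ y → 0ℤ ℤ.≤ indicator y
  indicator-nonneg y with C? y
  ... | yes _ = ℤ.+≤+ z≤n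
  ... | no _  = ℤ.+≤+ z≤n

  indicator-translate : ∀ {c} → C c → ∀ y → indicator (y ⊕ 2F ⊙ c) ≡ indicator y
  indicator-translate {c} c∈C y with C? y
  ... | yes y∈C = indicator-∈ (⊖-closed y∈C c∈C)
  ... | no y∉C  = indicator-∉ λ y⊖c∈C →
    y∉C (subst C (⊖-⊕-cancel y c) (⊕-closed y⊖c∈C c∈C))

  -- Twice the number of coefficient vectors; the 2 is `g 0F`, because `g` adds a character and its
  -- conjugate.
  M : ℤ
  M = 3^ k ℤ.* + 2

  M-cancel : ∀ x y → M ℤ.* x ≡ M ℤ.* y → x ≡ y
  M-cancel x y = ℤ.*-cancelˡ-≡ M x y {{ℤ.>-nonZero M>0}}
    where
    M>0 : 0ℤ ℤ.< M
    M>0 = ℤ.*-monoʳ-<-pos (+ 2) (3^-positive k)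

  orthogonality-of-characters : ∀ y → M ℤ.* indicator y ≡ Vec-sum k λ a → g (codeword a · y)
  orthogonality-of-characters y with C? y
  ... | yes y∈C = trans (ℤ.*-identityʳ M) (sym (begin
    Vec-sum k (λ a → g (codeword a · y))     ≡⟨ Vec-sum-cong k (λ a → cong g (orthogonal (codeword∈C a) y∈C)) ⟩
    Vec-sum k (λ a → g 0F)                   ≡⟨ Vec-sum-cong k (λ a → cong g (trans (+₃-identityˡ _) (·-zeroʳ a))) ⟨
    Vec-sum k (λ a → g (0F +₃ a · 𝟎))        ≡⟨ character-sum-trivial k 0F ⟩
    M                                        ∎))
    where open ≡-Reasoning
  ... | no y∉C = trans (ℤ.*-zeroʳ M) (sym (begin
    Vec-sum k (λ a → g (codeword a · y))
      ≡⟨ Vec-sum-cong k (λ a → cong g (trans (linearCombination-· a basis y) (sym (+₃-identityˡ _)))) ⟩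
    Vec-sum k (λ a → g (0F +₃ a · syndrome y))
      ≡⟨ character-sum-nontrivial k (syndrome y) 0F (y∉C ∘ syndrome≡𝟎⇒∈C) ⟩
    0ℤ ∎))
    where open ≡-Reasoning

  β : Subset n → ℕ → F₃^ n → ℤ
  β T j = AJ T j indicator

  spectral-term : Subset n → ℕ → F₃^ n → F₃^ n → ℤ
  spectral-term T j y c = eigenvalueₒ T c ℤ.^ j ℤ.* vanishₒ T c ℤ.* g (c · y)

  -- Every character is a common eigenfunction of `A` and `J`, so the operators act termwise on the
  -- expansion of the indicator.
  trace : ∀ T j y → M ℤ.* β T j y ≡ Vec-sum k (spectral-term T j y ∘ codeword)
  trace T j y = begin
    M ℤ.* β T j y                                        ≡⟨ AJ-* T j M indicator y ⟨
    AJ T j (λ y → M ℤ.* indicator y) y                   ≡⟨ AJ-cong T j orthogonality-of-characters y ⟩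
    AJ T j (λ y → Vec-sum k λ a → g (codeword a · y)) y  ≡⟨ AJ-Vec-sum T j k (λ a y → g (codeword a · y)) y ⟩
    Vec-sum k (λ a → AJ T j (λ y → g (codeword a · y)) y) ≡⟨ Vec-sum-cong k (λ a → AJ-character T j (codeword a) y) ⟩
    Vec-sum k (spectral-term T j y ∘ codeword)           ∎
    where open ≡-Reasoning

  β-translate : ∀ T j {c} → C c → ∀ y → β T j (y ⊖ c) ≡ β T j y
  β-translate T j {c} c∈C y = trans (sym (AJ-translate T j indicator (2F ⊙ c) y))
    (AJ-cong T j (indicator-translate c∈C) y)

  β-nonneg : ∀ T j y → 0ℤ ℤ.≤ β T j y
  β-nonneg T j = AJ-nonneg T j indicator-nonneg

  -- Walking `j` steps from `y` and refilling `T` reaches only words of weight at most 8. The sole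
  -- codeword among them is 0, so the count is the same as for the zero code.
  β-shell : ∀ (T : Subset n) n′ → n′ ℕ.+ ∣ T ∣ ≡ n → ∀ j y → j ℕ.+ wtₒ T y ℕ.+ ∣ T ∣ ℕ.≤ 8 →
            β T j y ≡ shell n′ j (wtₒ T y)
  β-shell T n′ n′+∣T∣≡n zero y near = J-punctured T indicator 0 y λ y′ le → small y′ (ℕ.≤-trans le near)
    where
    small : ∀ y′ → wt y′ ℕ.≤ 8 → indicator y′ ≡ isZero (wt y′)
    small y′ wt≤8 with C? y′
    ... | yes y′∈C with y′ ≟ᵥ 𝟎
    ...   | yes refl = sym (cong isZero (wt-𝟎 n))
    ...   | no y′≢𝟎 = contradiction (ℕ.≤-trans (distance y′ y′∈C y′≢𝟎) wt≤8) (ℕ.<⇒≱ (ℕ.n<1+n 8))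
    small y′ wt≤8 | no y′∉C with wt y′ in eq
    ... | zero  = contradiction (subst C (sym (wt≡0⇒𝟎 y′ eq)) 𝟎∈) y′∉C
    ... | suc _ = refl
  β-shell T n′ n′+∣T∣≡n (suc j) y near = trans
    (shell-step T (β T j) (shell n′ j) y λ y′ le → β-shell T n′ n′+∣T∣≡n j y′
      (ℕ.≤-trans (ℕ.+-monoˡ-≤ ∣ T ∣ (ℕ.≤-trans (ℕ.+-monoʳ-≤ j le) (ℕ.≤-reflexive (ℕ.+-suc j _)))) near))
    (cong (λ z → + wtₒ T y ℤ.* (shell n′ j (ℕ.pred (wtₒ T y)) ℤ.+ shell n′ j (wtₒ T y))
                 ℤ.+ + 2 ℤ.* + z ℤ.* shell n′ j (suc (wtₒ T y))) zeros≡)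
    where
    zeros≡ : zerosₒ T y ≡ n′ ℕ.∸ wtₒ T y
    zeros≡ = trans (sym (ℕ.m+n∸m≡n (wtₒ T y) (zerosₒ T y)))
      (cong (ℕ._∸ wtₒ T y) (ℕ.+-cancelʳ-≡ ∣ T ∣ _ _ (trans (wtₒ+zerosₒ+∣T∣≡n T y) (sym n′+∣T∣≡n))))

  β-support : ∀ T j y → β T j y ≢ 0ℤ → ∃[ c ] C c × wtₒ T (y ⊖ c) ℕ.≤ j
  β-support T j y ≢0 with AJ-support T j indicator y ≢0
  ... | c , ≢0′ , close = c , indicator≢0 ≢0′ , close

  complement : ∀ (T : Subset n) m n′ → ∣ T ∣ ≡ m → n′ ℕ.+ m ≡ 24 → n′ ℕ.+ ∣ T ∣ ≡ n
  complement T m n′ ∣T∣≡m n′+m≡24 = trans (cong (n′ ℕ.+_) ∣T∣≡m) (trans n′+m≡24 (sym n≡24))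

  -- A polynomial in the eigenvalue that kills the weights 12, 15, … turns a
  -- sum over all codewords vanishing on T into one over the weights 0 and 9.
  weights : ∀ (T : Subset n) m n′ → ∣ T ∣ ≡ m → n′ ℕ.+ m ≡ 24 → (f : ℤ → ℤ) →
    (∀ q z → 4 ℕ.≤ q → q ℕ.* 3 ℕ.+ z ≡ n′ → f (+ 2 ℤ.* + z ℤ.- + (q ℕ.* 3)) ≡ 0ℤ) →
    ∀ c → C c → f (eigenvalueₒ T c) ℤ.* vanishₒ T c ≡ 0ℤ ⊎
      c ≡ 𝟎 ⊎ (wt c ≡ 9 × vanishₒ T c ≢ 0ℤ)
  weights T m n′ ∣T∣≡m n′+m≡24 f kills c c∈C with vanishₒ T c ℤ.≟ 0ℤ
  ... | yes v≡0 = inj₁ (trans (cong (f (eigenvalueₒ T c) ℤ.*_) v≡0) (ℤ.*-zeroʳ (f (eigenvalueₒ T c))))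
  ... | no v≢0 with c ≟ᵥ 𝟎 | wt-self-orthogonal c (orthogonal c∈C c∈C)
  ...   | yes c≡𝟎 | _ = inj₂ (inj₁ c≡𝟎)
  ...   | no c≢𝟎 | q , wt≡ = split q wt≡
    where
    weight : wt c ≡ wtₒ T c
    weight = vanishₒ≢0⇒wt≡wtₒ T c v≢0
    total : wtₒ T c ℕ.+ zerosₒ T c ≡ n′
    total = ℕ.+-cancelʳ-≡ ∣ T ∣ _ _
      (trans (wtₒ+zerosₒ+∣T∣≡n T c) (sym (complement T m n′ ∣T∣≡m n′+m≡24)))
    large : ∀ {r} → wt c ≡ r ℕ.* 3 → ¬ 9 ℕ.≤ r ℕ.* 3 → ⊥
    large e not = not (subst (9 ℕ.≤_) e (distance c c∈C c≢𝟎))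
    split : ∀ q → wt c ≡ q ℕ.* 3 → f (eigenvalueₒ T c) ℤ.* vanishₒ T c ≡ 0ℤ ⊎
            c ≡ 𝟎 ⊎ (wt c ≡ 9 × vanishₒ T c ≢ 0ℤ)
    split 0 e = inj₂ (inj₁ (wt≡0⇒𝟎 c e))
    split 1 e = ⊥-elim (large {1} e λ where (s≤s (s≤s (s≤s ()))))
    split 2 e = ⊥-elim (large {2} e λ where (s≤s (s≤s (s≤s (s≤s (s≤s (s≤s ())))))))
    split 3 e = inj₂ (inj₂ (e , v≢0))
    split q@(suc (suc (suc (suc _)))) e = inj₁ (trans
      (cong (ℤ._* vanishₒ T c) (trans
        (cong (λ w → f (+ 2 ℤ.* + zerosₒ T c ℤ.- + w)) (trans (sym weight) e))
        (kills q (zerosₒ T c) (s≤s (s≤s (s≤s (s≤s z≤n))))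
          (trans (cong (ℕ._+ zerosₒ T c) (trans (sym e) weight)) total))))
      (ℤ.*-zeroˡ (vanishₒ T c)))

  β-poly : Subset n → ℕ → List ℤ → F₃^ n → ℤ
  β-poly T j []       y = 0ℤ
  β-poly T j (p ∷ ps) y = p ℤ.* β T j y ℤ.+ β-poly T (suc j) ps y

  poly : ℕ → List ℤ → ℤ → ℤ
  poly j []       e = 0ℤ
  poly j (p ∷ ps) e = p ℤ.* e ℤ.^ j ℤ.+ poly (suc j) ps e

  poly-term : Subset n → ℕ → List ℤ → F₃^ n → F₃^ n → ℤ
  poly-term T j ps y c = poly j ps (eigenvalueₒ T c) ℤ.* vanishₒ T c ℤ.* g (c · y)

  poly-trace : ∀ T j ps y → M ℤ.* β-poly T j ps y ≡ Vec-sum k (poly-term T j ps y ∘ codeword)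
  poly-trace T j [] y = trans (ℤ.*-zeroʳ M) (sym (Vec-sum-0 k))
  poly-trace T j (p ∷ ps) y = begin
    M ℤ.* (p ℤ.* β T j y ℤ.+ β-poly T (suc j) ps y)
      ≡⟨ expand M p (β T j y) (β-poly T (suc j) ps y) ⟩
    p ℤ.* (M ℤ.* β T j y) ℤ.+ M ℤ.* β-poly T (suc j) ps y
      ≡⟨ cong₂ (λ a b → p ℤ.* a ℤ.+ b) (trace T j y) (poly-trace T (suc j) ps y) ⟩
    p ℤ.* Vec-sum k (spectral-term T j y ∘ codeword) ℤ.+ Vec-sum k (poly-term T (suc j) ps y ∘ codeword)
      ≡⟨ cong (ℤ._+ Vec-sum k (poly-term T (suc j) ps y ∘ codeword)) (Vec-sum-* k p (spectral-term T j y ∘ codeword)) ⟨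
    Vec-sum k (λ a → p ℤ.* spectral-term T j y (codeword a)) ℤ.+ Vec-sum k (poly-term T (suc j) ps y ∘ codeword)
      ≡⟨ Vec-sum-+ k (λ a → p ℤ.* spectral-term T j y (codeword a)) (poly-term T (suc j) ps y ∘ codeword) ⟨
    Vec-sum k (λ a → p ℤ.* spectral-term T j y (codeword a) ℤ.+ poly-term T (suc j) ps y (codeword a))
      ≡⟨ Vec-sum-cong k (λ a → collect p (eigenvalueₒ T (codeword a) ℤ.^ j) (vanishₒ T (codeword a))
           (g (codeword a · y)) (poly (suc j) ps (eigenvalueₒ T (codeword a)))) ⟩
    Vec-sum k (poly-term T j (p ∷ ps) y ∘ codeword) ∎
    where
    open ≡-Reasoning
    expand : ∀ m p b r → m ℤ.* (p ℤ.* b ℤ.+ r) ≡ p ℤ.* (m ℤ.* b) ℤ.+ m ℤ.* r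
    expand = ℤ-Solver.solve-∀
    collect : ∀ p e v x r → p ℤ.* (e ℤ.* v ℤ.* x) ℤ.+ r ℤ.* v ℤ.* x ≡ (p ℤ.* e ℤ.+ r) ℤ.* v ℤ.* x
    collect = ℤ-Solver.solve-∀

  module _ (T : Subset n) (∣T∣≡4 : ∣ T ∣ ≡ 4) where

    private
      -- (e − 4)(e + 5)(e + 14); the roots are the eigenvalues of the weights
      -- 12, 15 and 18.
      ps : List ℤ
      ps = -[1+ 279 ] ∷ -[1+ 5 ] ∷ + 15 ∷ 1ℤ ∷ []

      kills : ∀ q z → 4 ℕ.≤ q → q ℕ.* 3 ℕ.+ z ≡ 20 → poly 0 ps (+ 2 ℤ.* + z ℤ.- + (q ℕ.* 3)) ≡ 0ℤ
      kills 4 z _ e with refl ← ℕ.+-cancelˡ-≡ 12 z 8 e = refl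
      kills 5 z _ e with refl ← ℕ.+-cancelˡ-≡ 15 z 5 e = refl
      kills 6 z _ e with refl ← ℕ.+-cancelˡ-≡ 18 z 2 e = refl
      kills (suc (suc (suc (suc (suc (suc (suc q))))))) z _ ()
      kills 1 z (s≤s ())
      kills 2 z (s≤s (s≤s ()))
      kills 3 z (s≤s (s≤s (s≤s ())))

      shell-value : ∀ j y → j ℕ.+ wtₒ T y ℕ.≤ 4 → β T j y ≡ shell 20 j (wtₒ T y)
      shell-value j y le = β-shell T 20 (complement T 4 20 ∣T∣≡4 refl) j y
        (subst (λ t → j ℕ.+ wtₒ T y ℕ.+ t ℕ.≤ 8) (sym ∣T∣≡4) (ℕ.+-monoˡ-≤ 4 le))

      -- On 20 coordinates there are 1, 0, 40, 40 closed walks of lengths 0 to 3, and -280 + 15 · 40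
      -- + 40 = 360.
      at-𝟎 : β-poly T 0 ps 𝟎 ≡ + 360
      at-𝟎 = cong₂ (λ a b → -[1+ 279 ] ℤ.* a ℤ.+ b) (value 0 z≤n)
        (cong₂ (λ a b → -[1+ 5 ] ℤ.* a ℤ.+ b) (value 1 (s≤s z≤n))
        (cong₂ (λ a b → + 15 ℤ.* a ℤ.+ (1ℤ ℤ.* b ℤ.+ 0ℤ)) (value 2 (s≤s (s≤s z≤n)))
          (value 3 (s≤s (s≤s (s≤s z≤n))))))
        where
        value : ∀ j → j ℕ.≤ 4 → β T j 𝟎 ≡ shell 20 j 0
        value j j≤4 = trans
          (shell-value j 𝟎 (subst (λ w → j ℕ.+ w ℕ.≤ 4) (sym (wtₒ-𝟎 T)) (subst (ℕ._≤ 4) (sym (ℕ.+-identityʳ j)) j≤4)))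
          (cong (shell 20 j) (wtₒ-𝟎 T))

      near : ∀ j z → j ℕ.≤ 2 → ∀ {c} → C c → wtₒ T (z ⊖ c) ℕ.≤ 2 → β T j z ≡ shell 20 j (wtₒ T (z ⊖ c))
      near j z j≤2 {c} c∈C le = trans (sym (β-translate T j c∈C z)) (shell-value j (z ⊖ c) (ℕ.+-mono-≤ j≤2 le))

      -- A nonzero count provides a codeword within distance 1 outside `T`. Translating it to 0
      -- makes the exact values 0 and 1 available.
      β₁≤1 : ∀ z → β T 1 z ℤ.≤ 1ℤ
      β₁≤1 z with β T 1 z ℤ.≟ 0ℤ
      ... | yes e = ℤ.≤-trans (ℤ.≤-reflexive e) (ℤ.+≤+ z≤n)
      ... | no ≢0 with β-support T 1 z ≢0
      ...   | c , c∈C , le = ℤ.≤-trans (ℤ.≤-reflexive (near 1 z (s≤s z≤n) c∈C (ℕ.m≤n⇒m≤1+n le))) (bound _ le)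
        where
        bound : ∀ w → w ℕ.≤ 1 → shell 20 1 w ℤ.≤ 1ℤ
        bound 0 _ = ℤ.+≤+ z≤n
        bound 1 _ = ℤ.≤-refl
        bound (suc (suc _)) (s≤s ())

      -- The counts at distances 0, 1, 2 from the punctured code are 40, 1, 2. Only distance 0
      -- exceeds 2, by 38, and there `β T 0` is 1.
      β₂≤ : ∀ z → β T 2 z ℤ.≤ + 2 ℤ.+ + 38 ℤ.* β T 0 z
      β₂≤ z with β T 2 z ℤ.≟ 0ℤ
      ... | yes e = ℤ.≤-trans (ℤ.≤-reflexive e)
        (ℤ.+-mono-≤ (ℤ.+≤+ {n = 2} z≤n) (ℤ.*-monoˡ-≤-nonNeg (+ 38) (β-nonneg T 0 z)))
      ... | no ≢0 with β-support T 2 z ≢0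
      ...   | c , c∈C , le = subst (ℤ._≤ + 2 ℤ.+ + 38 ℤ.* β T 0 z) (sym (near 2 z ℕ.≤-refl c∈C le))
        (subst (λ b → shell 20 2 w ℤ.≤ + 2 ℤ.+ + 38 ℤ.* b) (sym (near 0 z z≤n c∈C le)) (bound w le))
        where
        w = wtₒ T (z ⊖ c)
        bound : ∀ w → w ℕ.≤ 2 → shell 20 2 w ℤ.≤ + 2 ℤ.+ + 38 ℤ.* shell 20 0 w
        bound 0 _ = ℤ.≤-refl
        bound 1 _ = ℤ.+≤+ (s≤s z≤n)
        bound 2 _ = ℤ.≤-refl
        bound (suc (suc (suc _))) (s≤s (s≤s ()))

      -- The graph on the 20 coordinates outside `T` is regular of degree 2 · 20.
      A-const : ∀ x s → A T (λ _ → x) s ≡ + 40 ℤ.* x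
      A-const x s = trans (shell-step T (λ _ → x) (λ _ → x) s (λ _ _ → refl))
        (trans (lemma (+ wtₒ T s) (+ zerosₒ T s) x) (cong (λ t → + 2 ℤ.* + t ℤ.* x)
          (ℕ.+-cancelʳ-≡ ∣ T ∣ _ _ (trans (wtₒ+zerosₒ+∣T∣≡n T s) (sym (complement T 4 20 ∣T∣≡4 refl))))))
        where
        lemma : ∀ w z x → w ℤ.* (x ℤ.+ x) ℤ.+ + 2 ℤ.* z ℤ.* x ≡ + 2 ℤ.* (w ℤ.+ z) ℤ.* x
        lemma = ℤ-Solver.solve-∀

      β₃≤ : ∀ s → β T 3 s ℤ.≤ + 80 ℤ.+ + 38 ℤ.* β T 1 s
      β₃≤ s = ℤ.≤-trans (A-mono T β₂≤ s) (ℤ.≤-reflexive (trans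
        (A-+ T (λ _ → + 2) (λ z → + 38 ℤ.* β T 0 z) s)
        (cong₂ ℤ._+_ (A-const (+ 2) s) (A-* T (+ 38) (β T 0) s))))

      -- If no codeword agrees with `s` outside `T`, the bounds give at most 15 · 2 + 80 + (38 - 6)
      -- · 1 = 142, far below the value 360 at a codeword.
      far : ∀ s → β T 0 s ≡ 0ℤ → β-poly T 0 ps s ≢ + 360
      far s β₀≡0 e = ℤ.<⇒≱ (ℤ.+<+ (ℕ.≤ᵇ⇒≤ 143 360 _)) (begin
        + 360
          ≡⟨ e ⟨
        β-poly T 0 ps s
          ≡⟨ cong (λ b → -[1+ 279 ] ℤ.* b ℤ.+ (-[1+ 5 ] ℤ.* b₁ ℤ.+ (+ 15 ℤ.* b₂ ℤ.+ (1ℤ ℤ.* β T 3 s ℤ.+ 0ℤ)))) β₀≡0 ⟩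
        -[1+ 279 ] ℤ.* 0ℤ ℤ.+ (-[1+ 5 ] ℤ.* b₁ ℤ.+ (+ 15 ℤ.* b₂ ℤ.+ (1ℤ ℤ.* β T 3 s ℤ.+ 0ℤ)))
          ≡⟨ regroup b₁ b₂ (β T 3 s) ⟩
        + 15 ℤ.* b₂ ℤ.+ β T 3 s ℤ.+ -[1+ 5 ] ℤ.* b₁
          ≤⟨ ℤ.+-monoˡ-≤ (-[1+ 5 ] ℤ.* b₁) (ℤ.+-mono-≤ (ℤ.*-monoˡ-≤-nonNeg (+ 15) b₂≤2) (β₃≤ s)) ⟩
        + 30 ℤ.+ (+ 80 ℤ.+ + 38 ℤ.* b₁) ℤ.+ -[1+ 5 ] ℤ.* b₁
          ≡⟨ collect b₁ ⟩
        + 110 ℤ.+ + 32 ℤ.* b₁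
          ≤⟨ ℤ.+-monoʳ-≤ (+ 110) (ℤ.*-monoˡ-≤-nonNeg (+ 32) (β₁≤1 s)) ⟩
        + 142 ∎)
        where
        open ℤ.≤-Reasoning
        b₁ = β T 1 s
        b₂ = β T 2 s
        b₂≤2 : b₂ ℤ.≤ + 2
        b₂≤2 = subst (λ b → b₂ ℤ.≤ + 2 ℤ.+ + 38 ℤ.* b) β₀≡0 (β₂≤ s)
        regroup : ∀ b₁ b₂ b₃ → -[1+ 279 ] ℤ.* 0ℤ ℤ.+ (-[1+ 5 ] ℤ.* b₁ ℤ.+ (+ 15 ℤ.* b₂ ℤ.+ (1ℤ ℤ.* b₃ ℤ.+ 0ℤ)))
                  ≡ + 15 ℤ.* b₂ ℤ.+ b₃ ℤ.+ -[1+ 5 ] ℤ.* b₁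
        regroup = ℤ-Solver.solve-∀
        collect : ∀ b → + 30 ℤ.+ (+ 80 ℤ.+ + 38 ℤ.* b) ℤ.+ -[1+ 5 ] ℤ.* b ≡ + 110 ℤ.+ + 32 ℤ.* b
        collect = ℤ-Solver.solve-∀

    -- Only weights 0 and 9 survive in the spectral sum, and by hypothesis their characters do not
    -- distinguish `s` from 0. The polynomial in the walk counts thus takes its value 360 at `s` as
    -- well, which forces `s` onto the punctured code.
    minimum-words-span : ∀ s → (∀ c → C c → wt c ≡ 9 → vanishₒ T c ≢ 0ℤ → c · s ≡ 0F) →
                         ∃[ c ] C c × wtₒ T (s ⊖ c) ≡ 0
    minimum-words-span s orth with β T 0 s ℤ.≟ 0ℤ
    ... | no ≢0 with β-support T 0 s ≢0
    ...   | c , c∈C , le = c , c∈C , ℕ.n≤0⇒n≡0 le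
    minimum-words-span s orth | yes β₀≡0 = contradiction
      (M-cancel _ _ (begin
        M ℤ.* β-poly T 0 ps s                          ≡⟨ poly-trace T 0 ps s ⟩
        Vec-sum k (poly-term T 0 ps s ∘ codeword)      ≡⟨ Vec-sum-cong k (λ a → same (codeword a) (codeword∈C a)) ⟩
        Vec-sum k (poly-term T 0 ps 𝟎 ∘ codeword)      ≡⟨ poly-trace T 0 ps 𝟎 ⟨
        M ℤ.* β-poly T 0 ps 𝟎                          ≡⟨ cong (M ℤ.*_) at-𝟎 ⟩
        M ℤ.* + 360                                    ∎))
      (far s β₀≡0)
      where
      open ≡-Reasoning
      same : ∀ c → C c → poly-term T 0 ps s c ≡ poly-term T 0 ps 𝟎 c
      same c c∈C with weights T 4 20 ∣T∣≡4 refl (poly 0 ps) kills c c∈C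
      ... | inj₁ v≡0 = trans (cong (ℤ._* g (c · s)) v≡0) (sym (cong (ℤ._* g (c · 𝟎)) v≡0))
      ... | inj₂ (inj₁ refl) = cong (λ t → poly 0 ps (eigenvalueₒ T c) ℤ.* vanishₒ T c ℤ.* g t)
        (trans (·-zeroˡ s) (sym (·-zeroʳ c)))
      ... | inj₂ (inj₂ (wt≡9 , v≢0)) = cong (λ t → poly 0 ps (eigenvalueₒ T c) ℤ.* vanishₒ T c ℤ.* g t)
        (trans (orth c c∈C wt≡9 v≢0) (sym (·-zeroʳ c)))

  module _ (T : Subset n) (∣T∣≡2 : ∣ T ∣ ≡ 2) where

    private
      -- (e − 8)(e + 1)(e + 10)(e + 19); the roots are the eigenvalues of the
      -- weights 12, 15, 18 and 21.
      ps : List ℤ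
      ps = -[1+ 1519 ] ∷ -[1+ 1561 ] ∷ -[1+ 20 ] ∷ + 22 ∷ 1ℤ ∷ []

      kills : ∀ q z → 4 ℕ.≤ q → q ℕ.* 3 ℕ.+ z ≡ 22 → poly 0 ps (+ 2 ℤ.* + z ℤ.- + (q ℕ.* 3)) ≡ 0ℤ
      kills 4 z _ e with refl ← ℕ.+-cancelˡ-≡ 12 z 10 e = refl
      kills 5 z _ e with refl ← ℕ.+-cancelˡ-≡ 15 z 7 e = refl
      kills 6 z _ e with refl ← ℕ.+-cancelˡ-≡ 18 z 4 e = refl
      kills 7 z _ e with refl ← ℕ.+-cancelˡ-≡ 21 z 1 e = refl
      kills (suc (suc (suc (suc (suc (suc (suc (suc q)))))))) z _ ()
      kills 1 z (s≤s ())
      kills 2 z (s≤s (s≤s ()))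
      kills 3 z (s≤s (s≤s (s≤s ())))

      value : ∀ y w → wtₒ T y ≡ w → w ℕ.≤ 2 → β-poly T 0 ps y ≡
        -[1+ 1519 ] ℤ.* shell 22 0 w ℤ.+ (-[1+ 1561 ] ℤ.* shell 22 1 w ℤ.+ (-[1+ 20 ] ℤ.* shell 22 2 w
          ℤ.+ (+ 22 ℤ.* shell 22 3 w ℤ.+ (1ℤ ℤ.* shell 22 4 w ℤ.+ 0ℤ))))
      value y w refl w≤2 =
        cong₂ (λ a b → -[1+ 1519 ] ℤ.* a ℤ.+ b) (at 0 z≤n)
        (cong₂ (λ a b → -[1+ 1561 ] ℤ.* a ℤ.+ b) (at 1 (s≤s z≤n))
        (cong₂ (λ a b → -[1+ 20 ] ℤ.* a ℤ.+ b) (at 2 (s≤s (s≤s z≤n)))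
        (cong₂ (λ a b → + 22 ℤ.* a ℤ.+ (1ℤ ℤ.* b ℤ.+ 0ℤ)) (at 3 (s≤s (s≤s (s≤s z≤n))))
          (at 4 ℕ.≤-refl))))
        where
        at : ∀ j → j ℕ.≤ 4 → β T j y ≡ shell 22 j (wtₒ T y)
        -- The budget allowed by distance 9 is used up: degree 4, weight 2 and the 2 coordinates of
        -- `T` add up to 8.
        at j j≤4 = β-shell T 22 (complement T 2 22 ∣T∣≡2 refl) j y
          (subst (λ t → j ℕ.+ wtₒ T y ℕ.+ t ℕ.≤ 8) (sym ∣T∣≡2) (ℕ.+-monoˡ-≤ 2 (ℕ.+-mono-≤ j≤4 w≤2)))

    -- The combination b(0) + 2b(h) - b(e) - b(e+h) - b(e-h) weighs the character of `c` by 9 if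
    -- `c · h` is 0 and `c · e` is not, and by 0 otherwise. The values of b at weights 0, 1, 2 are
    -- 4200, 1680, 600, so the weights prescribed for the arguments give 4200 + 600 - 2 · 1680 =
    -- 1440. As this is not 0, some word of weight 9 must contribute.
    minimum-word-exists : ∀ h e → wtₒ T h ≡ 2 → wtₒ T e ≡ 1 → wtₒ T (e ⊕ h) ≡ 2 → wtₒ T (e ⊖ h) ≡ 1 →
      ¬ (∀ c → C c → wt c ≡ 9 → vanishₒ T c ≢ 0ℤ → c · h ≡ 0F → c · e ≡ 0F)
    minimum-word-exists h e wt-h wt-e wt-e⊕h wt-e⊖h none = contradiction
      (M-cancel (+ 1440) 0ℤ (begin
        M ℤ.* + 1440
          ≡⟨ cong (M ℤ.*_) values ⟨
        M ℤ.* (b 𝟎 ℤ.+ + 2 ℤ.* b h ℤ.- b e ℤ.- b (e ⊕ h) ℤ.- b (e ⊖ h))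
          ≡⟨ expand M (b 𝟎) (b h) (b e) (b (e ⊕ h)) (b (e ⊖ h)) ⟩
        M ℤ.* b 𝟎 ℤ.+ (+ 2 ℤ.* (M ℤ.* b h) ℤ.+ (-1ℤ ℤ.* (M ℤ.* b e) ℤ.+
          (-1ℤ ℤ.* (M ℤ.* b (e ⊕ h)) ℤ.+ -1ℤ ℤ.* (M ℤ.* b (e ⊖ h)))))
          ≡⟨ cong₂ ℤ._+_ (poly-trace T 0 ps 𝟎) (cong₂ ℤ._+_ (scaled (+ 2) h) (cong₂ ℤ._+_ (scaled -1ℤ e)
               (cong₂ ℤ._+_ (scaled -1ℤ (e ⊕ h)) (scaled -1ℤ (e ⊖ h))))) ⟩
        Vec-sum k (t 𝟎) ℤ.+ (Vec-sum k (λ a → + 2 ℤ.* t h a) ℤ.+ (Vec-sum k (λ a → -1ℤ ℤ.* t e a) ℤ.+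
          (Vec-sum k (λ a → -1ℤ ℤ.* t (e ⊕ h) a) ℤ.+ Vec-sum k (λ a → -1ℤ ℤ.* t (e ⊖ h) a))))
          ≡⟨ merge (t 𝟎) (λ a → + 2 ℤ.* t h a) (λ a → -1ℤ ℤ.* t e a) (λ a → -1ℤ ℤ.* t (e ⊕ h) a) (λ a → -1ℤ ℤ.* t (e ⊖ h) a) ⟨
        Vec-sum k (λ a → t 𝟎 a ℤ.+ (+ 2 ℤ.* t h a ℤ.+ (-1ℤ ℤ.* t e a ℤ.+
          (-1ℤ ℤ.* t (e ⊕ h) a ℤ.+ -1ℤ ℤ.* t (e ⊖ h) a))))
          ≡⟨ Vec-sum-cong k (λ a → vanishing (codeword a) (codeword∈C a)) ⟩
        Vec-sum k (λ _ → 0ℤ)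
          ≡⟨ Vec-sum-0 k ⟩
        0ℤ
          ≡⟨ ℤ.*-zeroʳ M ⟨
        M ℤ.* 0ℤ ∎)) λ ()
      where
      open ≡-Reasoning
      b : F₃^ n → ℤ
      b = β-poly T 0 ps
      t : F₃^ n → Vec F₃ k → ℤ
      t y = poly-term T 0 ps y ∘ codeword
      values : b 𝟎 ℤ.+ + 2 ℤ.* b h ℤ.- b e ℤ.- b (e ⊕ h) ℤ.- b (e ⊖ h) ≡ + 1440
      values = cong₂ ℤ._-_ (cong₂ ℤ._-_ (cong₂ ℤ._-_ (cong₂ (λ x y → x ℤ.+ + 2 ℤ.* y)
        (value 𝟎 0 (wtₒ-𝟎 T) z≤n) (value h 2 wt-h ℕ.≤-refl)) (value e 1 wt-e (s≤s z≤n)))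
        (value (e ⊕ h) 2 wt-e⊕h ℕ.≤-refl)) (value (e ⊖ h) 1 wt-e⊖h (s≤s z≤n))
      expand : ∀ m a b c d e → m ℤ.* (a ℤ.+ + 2 ℤ.* b ℤ.- c ℤ.- d ℤ.- e) ≡
        m ℤ.* a ℤ.+ (+ 2 ℤ.* (m ℤ.* b) ℤ.+ (-1ℤ ℤ.* (m ℤ.* c) ℤ.+ (-1ℤ ℤ.* (m ℤ.* d) ℤ.+ -1ℤ ℤ.* (m ℤ.* e))))
      expand = ℤ-Solver.solve-∀
      scaled : ∀ x y → x ℤ.* (M ℤ.* b y) ≡ Vec-sum k (λ a → x ℤ.* t y a)
      scaled x y = trans (cong (x ℤ.*_) (poly-trace T 0 ps y)) (sym (Vec-sum-* k x (t y)))
      merge : ∀ f₁ f₂ f₃ f₄ f₅ → Vec-sum k (λ a → f₁ a ℤ.+ (f₂ a ℤ.+ (f₃ a ℤ.+ (f₄ a ℤ.+ f₅ a)))) ≡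
        Vec-sum k f₁ ℤ.+ (Vec-sum k f₂ ℤ.+ (Vec-sum k f₃ ℤ.+ (Vec-sum k f₄ ℤ.+ Vec-sum k f₅)))
      merge f₁ f₂ f₃ f₄ f₅ = trans (Vec-sum-+ k f₁ _) (cong (λ r → Vec-sum k f₁ ℤ.+ r)
        (trans (Vec-sum-+ k f₂ _) (cong (λ r → Vec-sum k f₂ ℤ.+ r)
        (trans (Vec-sum-+ k f₃ _) (cong (λ r → Vec-sum k f₃ ℤ.+ r) (Vec-sum-+ k f₄ f₅))))))

      test : F₃ → F₃ → ℤ
      test u v = g 0F ℤ.+ (+ 2 ℤ.* g u ℤ.+ (-1ℤ ℤ.* g v ℤ.+ (-1ℤ ℤ.* g (v +₃ u) ℤ.+ -1ℤ ℤ.* g (v +₃ 2F *₃ u))))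
      test-suc : ∀ u v → test (suc u) v ≡ 0ℤ
      test-suc = toWitness {a? = Fin.all? λ u → Fin.all? λ v → _ ℤ.≟ _} _
      test≡0 : ∀ u v → (u ≡ 0F → v ≡ 0F) → test u v ≡ 0ℤ
      test≡0 zero    v imp with refl ← imp refl = refl
      test≡0 (suc u) v imp = test-suc u v

      factor : ∀ c → poly-term T 0 ps 𝟎 c ℤ.+ (+ 2 ℤ.* poly-term T 0 ps h c ℤ.+ (-1ℤ ℤ.* poly-term T 0 ps e c ℤ.+
          (-1ℤ ℤ.* poly-term T 0 ps (e ⊕ h) c ℤ.+ -1ℤ ℤ.* poly-term T 0 ps (e ⊖ h) c)))
        ≡ poly 0 ps (eigenvalueₒ T c) ℤ.* vanishₒ T c ℤ.* test (c · h) (c · e)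
      factor c = trans
        (lemma (poly 0 ps (eigenvalueₒ T c) ℤ.* vanishₒ T c) (g (c · 𝟎)) (g (c · h)) (g (c · e)) (g (c · (e ⊕ h))) (g (c · (e ⊖ h))))
        (cong (poly 0 ps (eigenvalueₒ T c) ℤ.* vanishₒ T c ℤ.*_)
          (cong₂ ℤ._+_ (cong g (·-zeroʳ c)) (cong (λ r → + 2 ℤ.* g (c · h) ℤ.+ (-1ℤ ℤ.* g (c · e) ℤ.+ r))
            (cong₂ (λ x y → -1ℤ ℤ.* g x ℤ.+ -1ℤ ℤ.* g y) (·-⊕ʳ c e h)
              (trans (·-⊕ʳ c e (2F ⊙ h)) (cong (c · e +₃_) (·-⊙ʳ 2F c h)))))))
        where
        lemma : ∀ w a b c d e → w ℤ.* a ℤ.+ (+ 2 ℤ.* (w ℤ.* b) ℤ.+ (-1ℤ ℤ.* (w ℤ.* c) ℤ.+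
            (-1ℤ ℤ.* (w ℤ.* d) ℤ.+ -1ℤ ℤ.* (w ℤ.* e))))
          ≡ w ℤ.* (a ℤ.+ (+ 2 ℤ.* b ℤ.+ (-1ℤ ℤ.* c ℤ.+ (-1ℤ ℤ.* d ℤ.+ -1ℤ ℤ.* e))))
        lemma = ℤ-Solver.solve-∀

      vanishing : ∀ c → C c → poly-term T 0 ps 𝟎 c ℤ.+ (+ 2 ℤ.* poly-term T 0 ps h c ℤ.+ (-1ℤ ℤ.* poly-term T 0 ps e c ℤ.+
          (-1ℤ ℤ.* poly-term T 0 ps (e ⊕ h) c ℤ.+ -1ℤ ℤ.* poly-term T 0 ps (e ⊖ h) c))) ≡ 0ℤ
      vanishing c c∈C = trans (factor c) (split (weights T 2 22 ∣T∣≡2 refl (poly 0 ps) kills c c∈C))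
        where
        w = poly 0 ps (eigenvalueₒ T c) ℤ.* vanishₒ T c
        split : w ≡ 0ℤ ⊎ c ≡ 𝟎 ⊎ (wt c ≡ 9 × vanishₒ T c ≢ 0ℤ) → w ℤ.* test (c · h) (c · e) ≡ 0ℤ
        split (inj₁ w≡0) = cong (ℤ._* test (c · h) (c · e)) w≡0
        split (inj₂ (inj₁ refl)) = trans (cong (w ℤ.*_) (test≡0 (c · h) (c · e) λ _ → ·-zeroˡ e)) (ℤ.*-zeroʳ w)
        split (inj₂ (inj₂ (wt≡9 , v≢0))) =
          trans (cong (w ℤ.*_) (test≡0 (c · h) (c · e) (none c c∈C wt≡9 v≢0))) (ℤ.*-zeroʳ w)

-- Coordinates, supports and vectors on two coordinates

F₃^-ext : ∀ {n} {x y : F₃^ n} → (∀ i → Vec.lookup x i ≡ Vec.lookup y i) → x ≡ y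
F₃^-ext {x = []}    {[]}    h = refl
F₃^-ext {x = a ∷ x} {b ∷ y} h = cong₂ _∷_ (h zero) (F₃^-ext (h ∘ suc))

lookup-⊕ : ∀ {n} (x y : F₃^ n) i → Vec.lookup (x ⊕ y) i ≡ Vec.lookup x i +₃ Vec.lookup y i
lookup-⊕ x y i = Vec.lookup-zipWith _+₃_ i x y

lookup-⊙ : ∀ {n} a (x : F₃^ n) i → Vec.lookup (a ⊙ x) i ≡ a *₃ Vec.lookup x i
lookup-⊙ a x i = Vec.lookup-map i (a *₃_) x

lookup-𝟎 : ∀ {n} (i : Fin n) → Vec.lookup 𝟎 i ≡ 0F
lookup-𝟎 i = Vec.lookup-replicate i 0F

infixl 6 _[_]≔_
_[_]≔_ : ∀ {A : Set} {n} → Vec A n → Fin n → A → Vec A n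
_[_]≔_ = Vec._[_]≔_

⊕-[]≔ : ∀ {n} (x y : F₃^ n) i a b → (x [ i ]≔ a) ⊕ (y [ i ]≔ b) ≡ (x ⊕ y) [ i ]≔ (a +₃ b)
⊕-[]≔ (_ ∷ x) (_ ∷ y) zero    a b = refl
⊕-[]≔ (c ∷ x) (d ∷ y) (suc i) a b = cong (c +₃ d ∷_) (⊕-[]≔ x y i a b)

·-[]≔ : ∀ {n} (c x : F₃^ n) i a → Vec.lookup x i ≡ 0F → c · (x [ i ]≔ a) ≡ c · x +₃ Vec.lookup c i *₃ a
·-[]≔ (b ∷ c) (0F ∷ x) zero    a refl = trans (+₃-comm (b *₃ a) (c · x))
  (cong (_+₃ b *₃ a) (sym (trans (cong (_+₃ c · x) (*₃-zeroʳ b)) (+₃-identityˡ (c · x)))))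
·-[]≔ (b ∷ c) (d ∷ x)  (suc i) a e    =
  trans (cong (b *₃ d +₃_) (·-[]≔ c x i a e)) (sym (+₃-assoc (b *₃ d) (c · x) _))

·-pointwise : ∀ {n} (c d x y : F₃^ n) →
  (∀ i → Vec.lookup c i *₃ Vec.lookup x i ≡ Vec.lookup d i *₃ Vec.lookup y i) → c · x ≡ d · y
·-pointwise []      []      []      []      h = refl
·-pointwise (_ ∷ c) (_ ∷ d) (_ ∷ x) (_ ∷ y) h = cong₂ _+₃_ (h zero) (·-pointwise c d x y (h ∘ suc))

nonzero : F₃ → ℕ
nonzero zero    = 0
nonzero (suc _) = 1

wtₒ-[]≔ : ∀ {n} (T : Subset n) x i a → Vec.lookup T i ≡ false → Vec.lookup x i ≡ 0F →
          wtₒ T (x [ i ]≔ a) ≡ nonzero a ℕ.+ wtₒ T x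
wtₒ-[]≔ (false ∷ T) (0F ∷ x)    zero    zero    refl refl = refl
wtₒ-[]≔ (false ∷ T) (0F ∷ x)    zero    (suc a) refl refl = refl
wtₒ-[]≔ (true  ∷ T) (_ ∷ x)     (suc i) a       e e′      = wtₒ-[]≔ T x i a e e′
wtₒ-[]≔ (false ∷ T) (zero ∷ x)  (suc i) a       e e′      = wtₒ-[]≔ T x i a e e′
wtₒ-[]≔ (false ∷ T) (suc _ ∷ x) (suc i) a       e e′      =
  trans (cong suc (wtₒ-[]≔ T x i a e e′)) (sym (ℕ.+-suc (nonzero a) _))

vanishₒ-lookup : ∀ {n} (T : Subset n) c → vanishₒ T c ≢ 0ℤ → ∀ i → Vec.lookup T i ≡ true → Vec.lookup c i ≡ 0F
vanishₒ-lookup (true  ∷ T) (zero ∷ c)  v≢0 zero    _ = refl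
vanishₒ-lookup (true  ∷ T) (suc _ ∷ c) v≢0 i       _ = contradiction refl v≢0
vanishₒ-lookup (true  ∷ T) (zero ∷ c)  v≢0 (suc i) e = vanishₒ-lookup T c (λ v≡0 → v≢0 (cong (+ 3 ℤ.*_) v≡0)) i e
vanishₒ-lookup (false ∷ T) (_ ∷ c)     v≢0 (suc i) e = vanishₒ-lookup T c v≢0 i e

wtₒ≡0-lookup : ∀ {n} (T : Subset n) y → wtₒ T y ≡ 0 → ∀ i → Vec.lookup T i ≡ false → Vec.lookup y i ≡ 0F
wtₒ≡0-lookup (false ∷ T) (zero ∷ y) e zero    _  = refl
wtₒ≡0-lookup (true  ∷ T) (_ ∷ y)    e (suc i) e′ = wtₒ≡0-lookup T y e i e′
wtₒ≡0-lookup (false ∷ T) (zero ∷ y) e (suc i) e′ = wtₒ≡0-lookup T y e i e′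

remove-∣∣ : ∀ {n} (P : Subset n) i → Vec.lookup P i ≡ true → suc ∣ P [ i ]≔ false ∣ ≡ ∣ P ∣
remove-∣∣ (true  ∷ P) zero    refl = refl
remove-∣∣ (true  ∷ P) (suc i) e    = cong suc (remove-∣∣ P i e)
remove-∣∣ (false ∷ P) (suc i) e    = remove-∣∣ P i e

remove-∣∣-≤ : ∀ {n} (P : Subset n) i → ∣ P ∣ ℕ.≤ suc ∣ P [ i ]≔ false ∣
remove-∣∣-≤ (true  ∷ P) zero    = ℕ.≤-refl
remove-∣∣-≤ (false ∷ P) zero    = ℕ.n≤1+n _
remove-∣∣-≤ (true  ∷ P) (suc i) = s≤s (remove-∣∣-≤ P i)
remove-∣∣-≤ (false ∷ P) (suc i) = remove-∣∣-≤ P i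

shrink : ∀ {n} (P : Subset n) m → m ℕ.≤ ∣ P ∣ →
         ∃[ T ] ∣ T ∣ ≡ m × (∀ i → Vec.lookup T i ≡ true → Vec.lookup P i ≡ true)
shrink {n} P zero _ = Vec.replicate n false , empty n , λ i e →
  contradiction (trans (sym (Vec.lookup-replicate i false)) e) λ ()
  where
  empty : ∀ n → ∣ Vec.replicate n false ∣ ≡ 0
  empty zero    = refl
  empty (suc n) = empty n
shrink (true ∷ P) (suc m) (s≤s m≤) with shrink P m m≤
... | T , e , sub = true ∷ T , cong suc e , λ where
  zero    _ → refl
  (suc i) h → sub i h
shrink (false ∷ P) (suc m) m≤ with shrink P (suc m) m≤
... | T , e , sub = false ∷ T , e , λ where (suc i) h → sub i h

∣∣-member : ∀ {n} (T : Subset n) {m} → ∣ T ∣ ≡ suc m → ∃[ i ] Vec.lookup T i ≡ true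
∣∣-member (true  ∷ T) _ = zero , refl
∣∣-member (false ∷ T) e with ∣∣-member T e
... | i , h = suc i , h

𝟏-∪ : ∀ {n} (P Q : Subset n) → Empty (P ∩ Q) → 𝟏 (P ∪ Q) ≡ 𝟏 P ⊕ 𝟏 Q
𝟏-∪ []          []          _ = refl
𝟏-∪ (true  ∷ P) (true  ∷ Q) h = contradiction (zero , Vec.here) h
𝟏-∪ (true  ∷ P) (false ∷ Q) h = cong (1F ∷_) (𝟏-∪ P Q λ (i , m) → h (suc i , Vec.there m))
𝟏-∪ (false ∷ P) (true  ∷ Q) h = cong (1F ∷_) (𝟏-∪ P Q λ (i , m) → h (suc i , Vec.there m))
𝟏-∪ (false ∷ P) (false ∷ Q) h = cong (0F ∷_) (𝟏-∪ P Q λ (i , m) → h (suc i , Vec.there m))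

𝟏-disjoint : ∀ {n} (P Q : Subset n) → Empty (P ∩ Q) → 𝟏 P · 𝟏 Q ≡ 0F
𝟏-disjoint []          []          _ = refl
𝟏-disjoint (true  ∷ P) (true  ∷ Q) h = contradiction (zero , Vec.here) h
𝟏-disjoint (true  ∷ P) (false ∷ Q) h = trans (+₃-identityˡ _) (𝟏-disjoint P Q λ (i , m) → h (suc i , Vec.there m))
𝟏-disjoint (false ∷ P) (true  ∷ Q) h = trans (+₃-identityˡ _) (𝟏-disjoint P Q λ (i , m) → h (suc i , Vec.there m))
𝟏-disjoint (false ∷ P) (false ∷ Q) h = trans (+₃-identityˡ _) (𝟏-disjoint P Q λ (i , m) → h (suc i , Vec.there m))

count₃ : ℕ → F₃
count₃ zero    = 0F
count₃ (suc n) = 1F +₃ count₃ n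

𝟏-self : ∀ {n} (P : Subset n) → 𝟏 P · 𝟏 P ≡ count₃ ∣ P ∣
𝟏-self []          = refl
𝟏-self (true  ∷ P) = cong (1F +₃_) (𝟏-self P)
𝟏-self (false ∷ P) = trans (+₃-identityˡ _) (𝟏-self P)

wt-𝟏 : ∀ {n} a (P : Subset n) → wt (suc a ⊙ 𝟏 P) ≡ ∣ P ∣
wt-𝟏 a  []          = refl
wt-𝟏 0F (true  ∷ P) = cong suc (wt-𝟏 0F P)
wt-𝟏 1F (true  ∷ P) = cong suc (wt-𝟏 1F P)
wt-𝟏 0F (false ∷ P) = wt-𝟏 0F P
wt-𝟏 1F (false ∷ P) = wt-𝟏 1F P

lookup-𝟏 : ∀ {n} (P : Subset n) i → Vec.lookup (𝟏 P) i ≡ (if Vec.lookup P i then 1F else 0F)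
lookup-𝟏 P i = Vec.lookup-map i (if_then 1F else 0F) P

restrict : ∀ {n} → Subset n → F₃^ n → F₃^ n
restrict = Vec.zipWith (λ b a → if b then a else 0F)

complementₛ : ∀ {n} → Subset n → Subset n
complementₛ = Vec.map not

wt-restrict : ∀ {n} (K : Subset n) y → wt (restrict K y) ℕ.+ wt (restrict (complementₛ K) y) ≡ wt y
wt-restrict []          []          = refl
wt-restrict (true  ∷ K) (zero ∷ y)  = wt-restrict K y
wt-restrict (true  ∷ K) (suc _ ∷ y) = cong suc (wt-restrict K y)
wt-restrict (false ∷ K) (zero ∷ y)  = wt-restrict K y
wt-restrict (false ∷ K) (suc _ ∷ y) = trans (ℕ.+-suc _ _) (cong suc (wt-restrict K y))

lookup-restrict : ∀ {n} (K : Subset n) y i → Vec.lookup (restrict K y) i ≡ (if Vec.lookup K i then Vec.lookup y i else 0F)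
lookup-restrict K y i = Vec.lookup-zipWith _ i K y

module _ {n} (i j : Fin n) where

  pair : F₃ → F₃ → F₃^ n
  pair a b = 𝟎 [ i ]≔ a [ j ]≔ b

  ⊕-pair : ∀ a b a′ b′ → pair a b ⊕ pair a′ b′ ≡ pair (a +₃ a′) (b +₃ b′)
  ⊕-pair a b a′ b′ = trans (⊕-[]≔ (𝟎 [ i ]≔ a) (𝟎 [ i ]≔ a′) j b b′)
    (cong (_[ j ]≔ (b +₃ b′)) (trans (⊕-[]≔ 𝟎 𝟎 i a a′) (cong (_[ i ]≔ (a +₃ a′)) (⊕-identityˡ 𝟎))))

  ⊙-pair : ∀ m a b → m ⊙ pair a b ≡ pair (m *₃ a) (m *₃ b)
  ⊙-pair m a b = trans (Vec.map-[]≔ (m *₃_) (𝟎 [ i ]≔ a) j)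
    (cong (_[ j ]≔ (m *₃ b)) (trans (Vec.map-[]≔ (m *₃_) 𝟎 i) (cong (_[ i ]≔ (m *₃ a)) (⊙-zeroʳ m))))

  module _ (i≢j : i ≢ j) where

    lookup-half-pair : ∀ a → Vec.lookup (𝟎 [ i ]≔ a) j ≡ 0F
    lookup-half-pair a = trans (Vec.lookup∘update′ (i≢j ∘ sym) 𝟎 a) (lookup-𝟎 j)

    ·-pair : ∀ c a b → c · pair a b ≡ Vec.lookup c i *₃ a +₃ Vec.lookup c j *₃ b
    ·-pair c a b = trans (·-[]≔ c (𝟎 [ i ]≔ a) j b (lookup-half-pair a))
      (cong (_+₃ Vec.lookup c j *₃ b) (trans (·-[]≔ c 𝟎 i a (lookup-𝟎 i))
        (trans (cong (_+₃ Vec.lookup c i *₃ a) (·-zeroʳ c)) (+₃-identityˡ (Vec.lookup c i *₃ a)))))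

    wtₒ-pair : ∀ T → Vec.lookup T i ≡ false → Vec.lookup T j ≡ false → ∀ a b →
               wtₒ T (pair a b) ≡ nonzero b ℕ.+ (nonzero a ℕ.+ 0)
    wtₒ-pair T i∉T j∉T a b = trans (wtₒ-[]≔ T (𝟎 [ i ]≔ a) j b j∉T (lookup-half-pair a))
      (cong (nonzero b ℕ.+_) (trans (wtₒ-[]≔ T 𝟎 i a i∉T (lookup-𝟎 i)) (cong (nonzero a ℕ.+_) (wtₒ-𝟎 T))))

    ·-on-pair : ∀ (P : Subset n) c x →
      (∀ l → l ≢ i → l ≢ j → Vec.lookup P l ≡ true → Vec.lookup c l ≡ 0F) →
      (∀ l → Vec.lookup P l ≡ false → Vec.lookup x l ≡ 0F) →
      c · x ≡ c · pair (Vec.lookup x i) (Vec.lookup x j)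
    ·-on-pair P c x c≡0 x≡0 = ·-pointwise c c x (pair (Vec.lookup x i) (Vec.lookup x j)) at
      where
      y = pair (Vec.lookup x i) (Vec.lookup x j)
      at : ∀ l → Vec.lookup c l *₃ Vec.lookup x l ≡ Vec.lookup c l *₃ Vec.lookup y l
      at l with l Fin.≟ j
      ... | yes refl = cong (Vec.lookup c l *₃_) (sym (Vec.lookup∘update l (𝟎 [ i ]≔ Vec.lookup x i) (Vec.lookup x l)))
      ... | no l≢j with l Fin.≟ i
      ...   | yes refl = cong (Vec.lookup c l *₃_) (sym (trans
        (Vec.lookup∘update′ l≢j (𝟎 [ l ]≔ Vec.lookup x l) (Vec.lookup x j)) (Vec.lookup∘update l 𝟎 (Vec.lookup x l))))
      ...   | no l≢i with Vec.lookup P l in e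
      ...     | true  = trans (cong (_*₃ Vec.lookup x l) (c≡0 l l≢i l≢j e))
        (sym (cong (_*₃ Vec.lookup y l) (c≡0 l l≢i l≢j e)))
      ...     | false = cong (Vec.lookup c l *₃_) (trans (x≡0 l e) (sym (trans
        (Vec.lookup∘update′ l≢j (𝟎 [ i ]≔ Vec.lookup x i) (Vec.lookup x j))
        (trans (Vec.lookup∘update′ l≢i 𝟎 (Vec.lookup x i)) (lookup-𝟎 l)))))

-- The fixed code, its subcode D and the supports of its words of weight 9

module SetupCode (setup : Setup) where
  open Setup setup public
  open Construction setup public
  open IsCode[_,_,_] isCode public
  open ExtremalCode C linear selfDual (proj₁ dimension) (proj₁ (proj₂ dimension))
    (proj₂ minimumWeight) refl public
  open IsLinear linear public

  distance : ∀ c → C c → c ≢ 𝟎 → 9 ℕ.≤ wt c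
  distance = proj₂ minimumWeight

  p·q≡0 : p · q ≡ 0F
  p·q≡0 = trans (·-⊙ˡ 2F (𝟏 P) q) (cong (2F *₃_)
    (trans (·-⊙ʳ 2F (𝟏 P) (𝟏 Q)) (cong (2F *₃_) (𝟏-disjoint P Q disjoint))))

  p·p≡1 : p · p ≡ 1F
  p·p≡1 = trans (·-⊙ˡ 2F (𝟏 P) p) (cong (2F *₃_)
    (trans (·-⊙ʳ 2F (𝟏 P) (𝟏 P)) (cong (2F *₃_) (trans (𝟏-self P) (cong count₃ ∣P∣≡4)))))

  q·q≡2 : q · q ≡ 2F
  q·q≡2 = trans (·-⊙ˡ 2F (𝟏 Q) q) (cong (2F *₃_)
    (trans (·-⊙ʳ 2F (𝟏 Q) (𝟏 Q)) (cong (2F *₃_) (trans (𝟏-self Q) (cong count₃ ∣Q∣≡5)))))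

  p⊕q∈C : C (p ⊕ q)
  p⊕q∈C = subst C (trans (cong (2F ⊙_) (trans (cong 𝟏 S≡P∪Q) (𝟏-∪ P Q disjoint))) (⊙-⊕ 2F (𝟏 P) (𝟏 Q)))
    (⊙-closed 2F 𝟏S∈C)

  wt-p : ∀ a → wt (suc a ⊙ p) ≡ 4
  wt-p 0F = trans (cong wt (⊙-⊙ 1F 2F (𝟏 P))) (trans (wt-𝟏 1F P) ∣P∣≡4)
  wt-p 1F = trans (cong wt (⊙-⊙ 2F 2F (𝟏 P))) (trans (wt-𝟏 0F P) ∣P∣≡4)

  wt-q : wt q ≡ 5
  wt-q = trans (wt-𝟏 1F Q) ∣Q∣≡5

  private
    scaled-lookup : ∀ (T : Subset 24) i → Vec.lookup (-1₃ ⊙ 𝟏 T) i ≡ (if Vec.lookup T i then 2F else 0F)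
    scaled-lookup T i = trans (lookup-⊙ 2F (𝟏 T) i) (trans (cong (2F *₃_) (lookup-𝟏 T i)) (push (Vec.lookup T i)))
      where
      push : ∀ b → 2F *₃ (if b then 1F else 0F) ≡ (if b then 2F else 0F)
      push true  = refl
      push false = refl

    scaled-in : ∀ (T : Subset 24) i → Vec.lookup T i ≡ true → Vec.lookup (-1₃ ⊙ 𝟏 T) i ≡ 2F
    scaled-in T i e = trans (scaled-lookup T i) (cong (if_then 2F else 0F) e)

    scaled-out : ∀ (T U : Subset 24) i → Empty (U ∩ T) → Vec.lookup U i ≡ true → Vec.lookup (-1₃ ⊙ 𝟏 T) i ≡ 0F
    scaled-out T U i empty i∈U = trans (scaled-lookup T i) (cong (if_then 2F else 0F) (out (Vec.lookup T i) refl))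
      where
      out : ∀ t → Vec.lookup T i ≡ t → Vec.lookup T i ≡ false
      out false e = e
      out true  e = contradiction (i , Vec.lookup⇒[]= i (U ∩ T) (trans (Vec.lookup-zipWith _∧_ i U T) (cong₂ _∧_ i∈U e))) empty

  lookup-p : ∀ i → Vec.lookup p i ≡ (if Vec.lookup P i then 2F else 0F)
  lookup-p = scaled-lookup P

  p-on-P : ∀ i → Vec.lookup P i ≡ true → Vec.lookup p i ≡ 2F
  p-on-P = scaled-in P

  q-on-Q : ∀ i → Vec.lookup Q i ≡ true → Vec.lookup q i ≡ 2F
  q-on-Q = scaled-in Q

  q-on-P : ∀ i → Vec.lookup P i ≡ true → Vec.lookup q i ≡ 0F
  q-on-P i = scaled-out Q P i disjoint

  p-on-Q : ∀ i → Vec.lookup Q i ≡ true → Vec.lookup p i ≡ 0F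
  p-on-Q i = scaled-out P Q i (λ (l , h) → disjoint (l , ∩-swap l h))
    where
    ∩-swap : ∀ l → l ∈ (Q ∩ P) → l ∈ (P ∩ Q)
    ∩-swap l h = subst (l ∈_) (∩-comm Q P) h

  -- The two test vectors are (1,1) and (1,0) on the pair. The sum of the second with the first is
  -- (2,1) and the difference is (0,2), of weights 2 and 1 as `minimum-word-exists` requires.
  minimum-word-on-pair : ∀ T → ∣ T ∣ ≡ 2 → ∀ i j → i ≢ j → Vec.lookup T i ≡ false → Vec.lookup T j ≡ false →
    ¬ (∀ c → C c → wt c ≡ 9 → vanishₒ T c ≢ 0ℤ → Vec.lookup c i +₃ Vec.lookup c j ≡ 0F → Vec.lookup c i ≡ 0F)
  minimum-word-on-pair T ∣T∣≡2 i j i≢j i∉T j∉T none =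
    minimum-word-exists T ∣T∣≡2 (pair i j 1F 1F) (pair i j 1F 0F)
      (wt-pair 1F 1F) (wt-pair 1F 0F)
      (trans (cong (wtₒ T) (⊕-pair i j 1F 0F 1F 1F)) (wt-pair 2F 1F))
      (trans (cong (wtₒ T) (trans (cong (pair i j 1F 0F ⊕_) (⊙-pair i j 2F 1F 1F)) (⊕-pair i j 1F 0F 2F 2F))) (wt-pair 0F 2F))
      λ c c∈C wt≡9 v≢0 c·h≡0 → trans (·-pair i j i≢j c 1F 0F)
        (trans (simplify-e (Vec.lookup c i) (Vec.lookup c j))
          (none c c∈C wt≡9 v≢0 (trans (sym (simplify-h (Vec.lookup c i) (Vec.lookup c j)))
            (trans (sym (·-pair i j i≢j c 1F 1F)) c·h≡0))))
    where
    simplify-e : ∀ a b → a *₃ 1F +₃ b *₃ 0F ≡ a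
    simplify-e = toWitness {a? = Fin.all? λ a → Fin.all? λ b → _ ≟₃ _} _
    simplify-h : ∀ a b → a *₃ 1F +₃ b *₃ 1F ≡ a +₃ b
    simplify-h = toWitness {a? = Fin.all? λ a → Fin.all? λ b → _ ≟₃ _} _
    wt-pair = wtₒ-pair i j i≢j T i∉T j∉T

  vanishing-on-P : ∀ c → vanishₒ P c ≢ 0ℤ → c · p ≡ 0F
  vanishing-on-P c v≢0 = trans (·-pointwise c 𝟎 p p λ i → at i (Vec.lookup P i) refl) (·-zeroˡ p)
    where
    at : ∀ i b → Vec.lookup P i ≡ b → Vec.lookup c i *₃ Vec.lookup p i ≡ Vec.lookup 𝟎 i *₃ Vec.lookup p i
    at i true  e = cong (_*₃ Vec.lookup p i) (trans (vanishₒ-lookup P c v≢0 i e) (sym (lookup-𝟎 i)))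
    at i false e = trans (cong (Vec.lookup c i *₃_) p≡0) (trans (*₃-zeroʳ (Vec.lookup c i))
      (sym (trans (cong (Vec.lookup 𝟎 i *₃_) p≡0) (*₃-zeroʳ (Vec.lookup 𝟎 i)))))
      where
      p≡0 : Vec.lookup p i ≡ 0F
      p≡0 = trans (lookup-p i) (cong (if_then 2F else 0F) e)

  -- Words vanishing on `P` lie in `D` and yield a codeword agreeing with `s` off `P`. For `i`, `j`
  -- in `P`, a word of weight 9 with opposite nonzero entries there and zeros at the other two
  -- points of `P` also lies in `D`; orthogonality to it makes the remaining difference equal at `i`
  -- and `j`. A vector constant on `P` and zero elsewhere is a multiple of `p`.
  D-minimum-words-span : ∀ s → (∀ c → C c → wt c ≡ 9 → c · p ≡ 0F → c · s ≡ 0F) → ∃[ b ] C (s ⊖ b ⊙ p)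
  D-minimum-words-span s orth
    with minimum-words-span P ∣P∣≡4 s (λ c c∈C wt≡9 v≢0 → orth c c∈C wt≡9 (vanishing-on-P c v≢0))
       | ∣∣-member P ∣P∣≡4
  ... | c₀ , c₀∈C , wtₒ≡0 | i₀ , i₀∈P = b , subst C (sym s⊖bp≡c₀) c₀∈C
    where
    π = s ⊖ c₀
    -- `p` equals 2 on `P`, and 2 is its own inverse.
    b = 2F *₃ Vec.lookup π i₀

    constant : ∀ i j → Vec.lookup P i ≡ true → Vec.lookup P j ≡ true → Vec.lookup π i ≡ Vec.lookup π j
    constant i j i∈P j∈P with i Fin.≟ j | Vec.lookup π i ≟₃ Vec.lookup π j
    ... | yes refl | _ = refl
    ... | no _   | yes e = e
    ... | no i≢j | no π≢ = ⊥-elim (minimum-word-on-pair T ∣T∣≡2 i j i≢j i∉T j∉T λ c c∈C wt≡9 v≢0 cᵢ+cⱼ≡0 →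
      solve _ _ _ _ cᵢ+cⱼ≡0 π≢ (begin
        Vec.lookup c i *₃ Vec.lookup π i +₃ Vec.lookup c j *₃ Vec.lookup π j
          ≡⟨ ·-pair i j i≢j c _ _ ⟨
        c · pair i j (Vec.lookup π i) (Vec.lookup π j)
          ≡⟨ on-pair c v≢0 π (wtₒ≡0-lookup P π wtₒ≡0) ⟨
        c · π
          ≡⟨ +₃-identityʳ (c · π) ⟨
        c · π +₃ 0F
          ≡⟨ cong (c · π +₃_) (orthogonal c∈C c₀∈C) ⟨
        c · π +₃ c · c₀
          ≡⟨ ·-⊕ʳ c π c₀ ⟨
        c · (π ⊕ c₀)
          ≡⟨ cong (c ·_) (⊖-⊕-cancel s c₀) ⟩
        c · s
          ≡⟨ orth c c∈C wt≡9 (trans (on-pair c v≢0 p (λ l e → trans (lookup-p l) (cong (if_then 2F else 0F) e)))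
               (trans (·-pair i j i≢j c _ _) (trans (cong₂ (λ x y → Vec.lookup c i *₃ x +₃ Vec.lookup c j *₃ y)
                 (p≡2 i i∈P) (p≡2 j j∈P)) (trans (sym (*₃-distribʳ-+₃ 2F (Vec.lookup c i) (Vec.lookup c j))) (cong (_*₃ 2F) cᵢ+cⱼ≡0))))) ⟩
        0F ∎))
      where
      open ≡-Reasoning
      solve : ∀ a b x y → a +₃ b ≡ 0F → x ≢ y → a *₃ x +₃ b *₃ y ≡ 0F → a ≡ 0F
      solve = toWitness {a? = Fin.all? λ a → Fin.all? λ b → Fin.all? λ x → Fin.all? λ y →
        (a +₃ b ≟₃ 0F) →-dec (¬? (x ≟₃ y) →-dec ((a *₃ x +₃ b *₃ y ≟₃ 0F) →-dec (a ≟₃ 0F)))} _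
      p≡2 : ∀ l → Vec.lookup P l ≡ true → Vec.lookup p l ≡ 2F
      p≡2 l e = trans (lookup-p l) (cong (if_then 2F else 0F) e)
      T = P [ i ]≔ false [ j ]≔ false
      i∉T : Vec.lookup T i ≡ false
      i∉T = trans (Vec.lookup∘update′ i≢j (P [ i ]≔ false) false) (Vec.lookup∘update i P false)
      j∉T : Vec.lookup T j ≡ false
      j∉T = Vec.lookup∘update j (P [ i ]≔ false) false
      ∣T∣≡2 : ∣ T ∣ ≡ 2
      ∣T∣≡2 = ℕ.suc-injective (trans (remove-∣∣ (P [ i ]≔ false) j
        (trans (Vec.lookup∘update′ (i≢j ∘ sym) P false) j∈P)) (ℕ.suc-injective (trans (remove-∣∣ P i i∈P) ∣P∣≡4)))
      on-pair : ∀ c → vanishₒ T c ≢ 0ℤ → ∀ x → (∀ l → Vec.lookup P l ≡ false → Vec.lookup x l ≡ 0F) →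
                c · x ≡ c · pair i j (Vec.lookup x i) (Vec.lookup x j)
      on-pair c v≢0 x = ·-on-pair i j i≢j P c x λ l l≢i l≢j e → vanishₒ-lookup T c v≢0 l
        (trans (Vec.lookup∘update′ l≢j (P [ i ]≔ false) false) (trans (Vec.lookup∘update′ l≢i P false) e))

    π≡bp : π ≡ b ⊙ p
    π≡bp = F₃^-ext λ i → sym (trans (lookup-⊙ b p i) (trans (cong (b *₃_) (lookup-p i)) (at i (Vec.lookup P i) refl)))
      where
      undo : ∀ a → 2F *₃ a *₃ 2F ≡ a
      undo = toWitness {a? = Fin.all? λ a → _ ≟₃ _} _
      at : ∀ i t → Vec.lookup P i ≡ t → b *₃ (if t then 2F else 0F) ≡ Vec.lookup π i
      at i true  e = trans (undo (Vec.lookup π i₀)) (constant i₀ i i₀∈P e)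
      at i false e = trans (*₃-zeroʳ b) (sym (wtₒ≡0-lookup P π wtₒ≡0 i e))

    s⊖bp≡c₀ : s ⊖ b ⊙ p ≡ c₀
    s⊖bp≡c₀ = F₃^-ext λ i → trans (lookup-⊕ s (2F ⊙ (b ⊙ p)) i)
      (trans (cong (Vec.lookup s i +₃_) (trans (lookup-⊙ 2F (b ⊙ p) i) (cong (λ v → 2F *₃ Vec.lookup v i) (sym π≡bp))))
      (trans (cong (λ t → Vec.lookup s i +₃ 2F *₃ t) (trans (lookup-⊕ s (2F ⊙ c₀) i) (cong (Vec.lookup s i +₃_) (lookup-⊙ 2F c₀ i))))
        (double (Vec.lookup s i) (Vec.lookup c₀ i))))
      where
      double : ∀ a b → a +₃ 2F *₃ (a +₃ 2F *₃ b) ≡ b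
      double = toWitness {a? = Fin.all? λ a → Fin.all? λ b → _ ≟₃ _} _

  -- At least two points of `P` differ from `j` and `k`, and the word can be required to vanish
  -- there. Such a zero on `P` later shows that a restriction of the word is not a nonzero multiple
  -- of `p`.
  minimum-word-through : ∀ j k → j ≢ k →
    ¬ (∀ c → C c → wt c ≡ 9 → ∀ x → Vec.lookup P x ≡ true → Vec.lookup c x ≡ 0F →
       Vec.lookup c j ≢ 0F → Vec.lookup c k ≢ 0F → ⊥)
  minimum-word-through j k j≢k none
    with shrink (P [ j ]≔ false [ k ]≔ false) 2 (ℕ.≤-pred (ℕ.≤-pred (ℕ.≤-trans (ℕ.≤-reflexive (sym ∣P∣≡4))
      (ℕ.≤-trans (remove-∣∣-≤ P j) (s≤s (remove-∣∣-≤ (P [ j ]≔ false) k))))))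
  ... | T , ∣T∣≡2 , T⊆ with ∣∣-member T ∣T∣≡2
  ...   | x , x∈T = minimum-word-on-pair T ∣T∣≡2 j k j≢k (not-in j j∉P′) (not-in k k∉P′) λ c c∈C wt≡9 v≢0 cⱼ+cₖ≡0 →
    case Vec.lookup c j ≟₃ 0F of λ where
      (yes cⱼ≡0) → cⱼ≡0
      (no cⱼ≢0)  → ⊥-elim (none c c∈C wt≡9 x x∈P (vanishₒ-lookup T c v≢0 x x∈T) cⱼ≢0
        (λ cₖ≡0 → cⱼ≢0 (trans (sym (+₃-identityʳ _)) (trans (cong (Vec.lookup c j +₃_) (sym cₖ≡0)) cⱼ+cₖ≡0))))
    where
    P′ = P [ j ]≔ false [ k ]≔ false
    k∉P′ : Vec.lookup P′ k ≡ false
    k∉P′ = Vec.lookup∘update k (P [ j ]≔ false) false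
    j∉P′ : Vec.lookup P′ j ≡ false
    j∉P′ = trans (Vec.lookup∘update′ j≢k (P [ j ]≔ false) false) (Vec.lookup∘update j P false)
    not-in : ∀ i → Vec.lookup P′ i ≡ false → Vec.lookup T i ≡ false
    not-in i i∉P′ with Vec.lookup T i in e
    ... | false = refl
    ... | true  = contradiction (trans (sym (T⊆ i e)) i∉P′) λ ()
    x∈P : Vec.lookup P x ≡ true
    x∈P with x Fin.≟ k | x Fin.≟ j
    ... | yes refl | _        = contradiction (trans (sym (T⊆ x x∈T)) k∉P′) λ ()
    ... | no _     | yes refl = contradiction (trans (sym (T⊆ x x∈T)) j∉P′) λ ()
    ... | no x≢k   | no x≢j   = trans (sym (trans (Vec.lookup∘update′ x≢k (P [ j ]≔ false) false)
                                  (Vec.lookup∘update′ x≢j P false))) (T⊆ x x∈T)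

  Splits : Subset 24 → Set
  Splits K = ∀ c → C c → wt c ≡ 9 → c · p ≡ 0F →
    (∀ l → Vec.lookup c l ≢ 0F → Vec.lookup K l ≡ true) ⊎ (∀ l → Vec.lookup c l ≢ 0F → Vec.lookup K l ≡ false)

  splits-complement : ∀ K → Splits K → Splits (complementₛ K)
  splits-complement K split c c∈C wt≡9 c·p≡0 with split c c∈C wt≡9 c·p≡0
  ... | inj₁ sub = inj₂ λ l c≢0 → trans (Vec.lookup-map l not K) (cong not (sub l c≢0))
  ... | inj₂ sub = inj₁ λ l c≢0 → trans (Vec.lookup-map l not K) (cong not (sub l c≢0))

  -- A test word inside `K` cannot tell the restriction from `y`, and one outside is orthogonal to
  -- it, so the restriction lies in a coset of `C` by a multiple of `p`. If that multiple is
  -- nonzero, the zero at `x` keeps the corresponding codeword from being 0, and `p` accounts for at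
  -- most 4 of its weight, which is at least 9.
  restrict-heavy : ∀ K → Splits K → ∀ y → C y → ∀ x → Vec.lookup P x ≡ true → Vec.lookup y x ≡ 0F →
    restrict K y ≢ 𝟎 → 5 ℕ.≤ wt (restrict K y)
  restrict-heavy K split y y∈C x x∈P yₓ≡0 r≢𝟎
    with D-minimum-words-span (restrict K y) orth
    where
    side : ∀ c t → (∀ l → Vec.lookup c l ≢ 0F → Vec.lookup K l ≡ t) → ∀ l →
           Vec.lookup c l *₃ Vec.lookup (restrict K y) l ≡ Vec.lookup c l *₃ (if t then Vec.lookup y l else 0F)
    side c t sub l with Vec.lookup c l ≟₃ 0F
    ... | yes e = trans (cong (_*₃ Vec.lookup (restrict K y) l) e) (trans (*₃-comm 0F (Vec.lookup (restrict K y) l))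
      (trans (*₃-zeroʳ (Vec.lookup (restrict K y) l)) (sym (trans (cong (_*₃ (if t then Vec.lookup y l else 0F)) e)
        (trans (*₃-comm 0F (if t then Vec.lookup y l else 0F)) (*₃-zeroʳ (if t then Vec.lookup y l else 0F)))))))
    ... | no c≢0 = cong (Vec.lookup c l *₃_) (trans (lookup-restrict K y l)
      (cong (if_then Vec.lookup y l else 0F) (sub l c≢0)))
    orth : ∀ c → C c → wt c ≡ 9 → c · p ≡ 0F → c · restrict K y ≡ 0F
    orth c c∈C wt≡9 c·p≡0 with split c c∈C wt≡9 c·p≡0
    ... | inj₁ sub = trans (·-pointwise c c (restrict K y) y (side c true sub)) (orthogonal c∈C y∈C)
    ... | inj₂ sub = trans (·-pointwise c c (restrict K y) 𝟎 (λ l → trans (side c false sub l)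
      (cong (Vec.lookup c l *₃_) (sym (lookup-𝟎 l))))) (·-zeroʳ c)
  ... | zero , r∈C = ℕ.≤-trans (ℕ.m≤n+m 5 4) (distance (restrict K y) (subst C
          (trans (cong (λ t → restrict K y ⊕ 2F ⊙ t) (⊙-zeroˡ p))
            (trans (cong (restrict K y ⊕_) (⊙-zeroʳ 2F)) (⊕-identityʳ (restrict K y)))) r∈C) r≢𝟎)
  ... | suc b , r∈C = ℕ.+-cancelʳ-≤ 4 5 (wt (restrict K y)) (ℕ.≤-trans (distance _ r∈C r⊖bp≢𝟎)
          (ℕ.≤-trans (wt-⊖ (restrict K y) (suc b ⊙ p)) (ℕ.+-monoʳ-≤ (wt (restrict K y)) (ℕ.≤-reflexive (wt-p b)))))
    where
    r⊖bp≢𝟎 : restrict K y ⊖ suc b ⊙ p ≢ 𝟎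
    r⊖bp≢𝟎 e = contradiction (begin
      0F                                        ≡⟨ if-zero (Vec.lookup K x) ⟨
      (if Vec.lookup K x then 0F else 0F)       ≡⟨ cong (if Vec.lookup K x then_else 0F) yₓ≡0 ⟨
      (if Vec.lookup K x then Vec.lookup y x else 0F) ≡⟨ lookup-restrict K y x ⟨
      Vec.lookup (restrict K y) x               ≡⟨ cong (λ v → Vec.lookup v x) (⊖≡𝟎⇒≡ _ _ e) ⟩
      Vec.lookup (suc b ⊙ p) x                  ≡⟨ lookup-⊙ (suc b) p x ⟩
      suc b *₃ Vec.lookup p x                   ≡⟨ cong (suc b *₃_) (trans (lookup-p x) (cong (if_then 2F else 0F) x∈P)) ⟩
      suc b *₃ 2F                               ∎) (nonzero-product b)
      where
      open ≡-Reasoning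
      if-zero : ∀ t → (if t then 0F else 0F) ≡ zero {2}
      if-zero true  = refl
      if-zero false = refl
      nonzero-product : ∀ b → 0F ≢ suc b *₃ 2F
      nonzero-product 0F ()
      nonzero-product 1F ()

  -- A word of weight 9 through two points on different sides would be cut into parts of weight at
  -- least 5 each.
  D-support-connected : ∀ K → Splits K → ∀ j k → Vec.lookup K j ≡ true → Vec.lookup K k ≡ true
  D-support-connected K split j k j∈K with Vec.lookup K k in k∈K
  ... | true  = refl
  ... | false = ⊥-elim (minimum-word-through j k j≢k λ y y∈C wt≡9 x x∈P yₓ≡0 yⱼ≢0 yₖ≢0 →
    ℕ.<⇒≱ (ℕ.n<1+n 9) (ℕ.≤-trans
      (ℕ.+-mono-≤
        (restrict-heavy K split y y∈C x x∈P yₓ≡0 (nontrivial y K j yⱼ≢0 j∈K))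
        (restrict-heavy (complementₛ K) (splits-complement K split) y y∈C x x∈P yₓ≡0
          (nontrivial y (complementₛ K) k yₖ≢0 (trans (Vec.lookup-map k not K) (cong not k∈K)))))
      (ℕ.≤-reflexive (trans (wt-restrict K y) wt≡9))))
    where
    j≢k : j ≢ k
    j≢k refl = contradiction (trans (sym j∈K) k∈K) λ ()
    nontrivial : ∀ y K l → Vec.lookup y l ≢ 0F → Vec.lookup K l ≡ true → restrict K y ≢ 𝟎
    nontrivial y K l y≢0 l∈K e = y≢0 (begin
      Vec.lookup y l                                  ≡⟨ cong (if_then Vec.lookup y l else 0F) l∈K ⟨
      (if Vec.lookup K l then Vec.lookup y l else 0F) ≡⟨ lookup-restrict K y l ⟨
      Vec.lookup (restrict K y) l                     ≡⟨ cong (λ v → Vec.lookup v l) e ⟩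
      Vec.lookup 𝟎 l                                  ≡⟨ lookup-𝟎 l ⟩
      0F                                              ∎)
      where open ≡-Reasoning

-- Cyclic indices, finite sums and blocks

next-inject₁ : ∀ {n} (i : Fin n) → next (inject₁ i) ≡ suc i
next-inject₁ {n} i = Fin.toℕ-injective (begin
  toℕ (next (inject₁ i))            ≡⟨ Fin.toℕ-fromℕ< (ℕ.m%n<n (suc (toℕ (inject₁ i))) (suc n)) ⟩
  suc (toℕ (inject₁ i)) ℕ.% suc n   ≡⟨ cong (λ t → suc t ℕ.% suc n) (Fin.toℕ-inject₁ i) ⟩
  suc (toℕ i) ℕ.% suc n             ≡⟨ ℕ.m<n⇒m%n≡m (s≤s (Fin.toℕ<n i)) ⟩
  suc (toℕ i)                       ∎)
  where open ≡-Reasoning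

next-fromℕ : ∀ n → next (fromℕ n) ≡ zero
next-fromℕ n = Fin.toℕ-injective (begin
  toℕ (next (fromℕ n))              ≡⟨ Fin.toℕ-fromℕ< (ℕ.m%n<n (suc (toℕ (fromℕ n))) (suc n)) ⟩
  suc (toℕ (fromℕ n)) ℕ.% suc n     ≡⟨ cong (λ t → suc t ℕ.% suc n) (Fin.toℕ-fromℕ n) ⟩
  suc n ℕ.% suc n                   ≡⟨ ℕ.n%n≡0 (suc n) ⟩
  0                                 ∎)
  where open ≡-Reasoning

next-surjective : ∀ {m} (k : Fin m) → ∃[ i ] next i ≡ k
next-surjective {suc n} zero    = fromℕ n , next-fromℕ n
next-surjective {suc n} (suc i) = inject₁ i , next-inject₁ i

next-injective : ∀ {m} {i j : Fin m} → next i ≡ next j → i ≡ j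
next-injective {suc n} {i} {j} e with Top.view i | Top.view j
... | ‵fromℕ     | ‵fromℕ     = refl
... | ‵fromℕ     | ‵inject₁ l = contradiction (trans (sym (next-fromℕ n)) (trans e (next-inject₁ l))) λ ()
... | ‵inject₁ l | ‵fromℕ     = contradiction (trans (sym (next-inject₁ l)) (trans e (next-fromℕ n))) λ ()
... | ‵inject₁ l | ‵inject₁ r = cong inject₁ (Fin.suc-injective (trans (sym (next-inject₁ l)) (trans e (next-inject₁ r))))

module Sums (M : CommutativeMonoid 0ℓ 0ℓ)
  (≈⇒≡ : ∀ {x y} → CommutativeMonoid._≈_ M x y → x ≡ y) where

  open CommutativeMonoid M using (Carrier; _∙_; ε) renaming (refl to ≈-refl; reflexive to ≈-reflexive)
  open CommutativeMonoidSum M public using (sum; sum-cong-≗)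

  identityˡ : ∀ x → ε ∙ x ≡ x
  identityˡ x = ≈⇒≡ (CommutativeMonoid.identityˡ M x)

  identityʳ : ∀ x → x ∙ ε ≡ x
  identityʳ x = ≈⇒≡ (CommutativeMonoid.identityʳ M x)

  sum-distrib : ∀ {n} (f h : Fin n → Carrier) → sum (λ i → f i ∙ h i) ≡ sum f ∙ sum h
  sum-distrib f h = ≈⇒≡ (CommutativeMonoidSum.∑-distrib-+ M f h)

  sum-swap : ∀ {m n} (f : Fin m → Fin n → Carrier) →
             sum (λ i → sum (λ j → f i j)) ≡ sum (λ j → sum (λ i → f i j))
  sum-swap f = ≈⇒≡ (CommutativeMonoidSum.∑-comm M f)

  sum-ε : ∀ {n} {f : Fin n → Carrier} → (∀ i → f i ≡ ε) → sum f ≡ ε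
  sum-ε {n} f≡ε = trans (sum-cong-≗ f≡ε) (≈⇒≡ (CommutativeMonoidSum.sum-replicate-zero M n))

  sum-single : ∀ {n} k (f : Fin n → Carrier) → (∀ i → i ≢ k → f i ≡ ε) → sum f ≡ f k
  sum-single zero    f h = trans (cong (f zero ∙_) (sum-ε λ i → h (suc i) λ ())) (identityʳ (f zero))
  sum-single (suc k) f h = trans (cong (_∙ sum (f ∘ suc)) (h zero λ ()))
    (trans (identityˡ (sum (f ∘ suc))) (sum-single k (f ∘ suc) λ i i≢k → h (suc i) (i≢k ∘ Fin.suc-injective)))

  sum-next : ∀ {m} (f : Fin m → Carrier) → sum (f ∘ next) ≡ sum f
  sum-next {zero}  f = refl
  sum-next {suc n} f = begin
    sum (f ∘ next)
      ≡⟨ ≈⇒≡ (CommutativeMonoidSum.sum-init-last M (f ∘ next)) ⟩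
    sum (f ∘ next ∘ inject₁) ∙ f (next (fromℕ n))
      ≡⟨ cong₂ _∙_ (sum-cong-≗ (cong f ∘ next-inject₁)) (cong f (next-fromℕ n)) ⟩
    sum (f ∘ suc) ∙ f zero
      ≡⟨ ≈⇒≡ (CommutativeMonoid.comm M (sum (f ∘ suc)) (f zero)) ⟩
    f zero ∙ sum (f ∘ suc) ∎
    where open ≡-Reasoning

  sum-↑ : ∀ n {k} (f : Fin (n ℕ.+ k) → Carrier) →
          sum f ≡ sum (f ∘ (Fin._↑ˡ k)) ∙ sum (f ∘ (n Fin.↑ʳ_))
  sum-↑ zero    f = sym (identityˡ (sum f))
  sum-↑ (suc n) f = trans (cong (f zero ∙_) (sum-↑ n (f ∘ suc)))
    (sym (≈⇒≡ (CommutativeMonoid.assoc M (f zero) _ _)))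

  sum-combine : ∀ m n (f : Fin (m ℕ.* n) → Carrier) → sum f ≡ sum (λ i → sum (λ j → f (Fin.combine {m} i j)))
  sum-combine zero    n f = refl
  sum-combine (suc m) n f = trans (sum-↑ n f)
    (cong (sum (f ∘ (Fin._↑ˡ (m ℕ.* n))) ∙_) (sum-combine m n (f ∘ (n Fin.↑ʳ_))))

+₃-commutativeMonoid : CommutativeMonoid 0ℓ 0ℓ
+₃-commutativeMonoid = record
  { Carrier = F₃ ; _≈_ = _≡_ ; _∙_ = _+₃_ ; ε = 0F
  ; isCommutativeMonoid = record
    { isMonoid = record
      { isSemigroup = record
        { isMagma = record { isEquivalence = ≡.isEquivalence ; ∙-cong = cong₂ _+₃_ }
        ; assoc = +₃-assoc }
      ; identity = +₃-identityˡ , +₃-identityʳ }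
    ; comm = +₃-comm } }

module Σ₃ = Sums +₃-commutativeMonoid id
module Σℕ = Sums ℕ.+-0-commutativeMonoid id
module Σℤ = Sums ℤ.+-0-commutativeMonoid id

·-sum : ∀ {n} (x y : F₃^ n) → x · y ≡ Σ₃.sum (λ i → Vec.lookup x i *₃ Vec.lookup y i)
·-sum []      []      = refl
·-sum (a ∷ x) (b ∷ y) = cong (a *₃ b +₃_) (·-sum x y)

wt-sum : ∀ {n} (x : F₃^ n) → wt x ≡ Σℕ.sum (λ i → nonzero (Vec.lookup x i))
wt-sum []          = refl
wt-sum (zero ∷ x)  = wt-sum x
wt-sum (suc _ ∷ x) = cong suc (wt-sum x)

sum-≥ : ∀ {n} (f : Fin n → ℕ) k → f k ℕ.≤ Σℕ.sum f
sum-≥ f zero    = ℕ.m≤m+n (f zero) _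
sum-≥ f (suc k) = ℕ.≤-trans (sum-≥ (f ∘ suc) k) (ℕ.m≤n+m _ (f zero))

sum-≥₂ : ∀ {n} (f : Fin n → ℕ) k l → k ≢ l → f k ℕ.+ f l ℕ.≤ Σℕ.sum f
sum-≥₂ f zero    zero    k≢l = contradiction refl k≢l
sum-≥₂ f zero    (suc l) k≢l = ℕ.+-monoʳ-≤ (f zero) (sum-≥ (f ∘ suc) l)
sum-≥₂ f (suc k) zero    k≢l = ℕ.≤-trans (ℕ.≤-reflexive (ℕ.+-comm (f (suc k)) (f zero)))
  (ℕ.+-monoʳ-≤ (f zero) (sum-≥ (f ∘ suc) k))
sum-≥₂ f (suc k) (suc l) k≢l = ℕ.≤-trans (sum-≥₂ (f ∘ suc) k l (k≢l ∘ cong suc)) (ℕ.m≤n+m _ (f zero))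

Vec-ext : ∀ {A : Set} {n} {x y : Vec A n} → (∀ i → Vec.lookup x i ≡ Vec.lookup y i) → x ≡ y
Vec-ext {x = x} {y} h = trans (sym (Vec.tabulate∘lookup x)) (trans (Vec.tabulate-cong h) (Vec.tabulate∘lookup y))

module Blocks (m n : ℕ) where

  blockOf : ∀ {A : Set} → Vec A (m ℕ.* n) → Fin m → Vec A n
  blockOf z i = Vec.tabulate λ j → Vec.lookup z (Fin.combine i j)

  lookup-blockOf : ∀ {A : Set} (z : Vec A (m ℕ.* n)) i j → Vec.lookup (blockOf z i) j ≡ Vec.lookup z (Fin.combine i j)
  lookup-blockOf z i j = Vec.lookup∘tabulate _ j

  blockOf-ext : ∀ {A : Set} {y z : Vec A (m ℕ.* n)} → (∀ i → blockOf y i ≡ blockOf z i) → y ≡ z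
  blockOf-ext {y = y} {z} h = Vec-ext λ l → case Fin.combine-surjective {m} {n} l of λ where
    (i , j , refl) → trans (sym (lookup-blockOf y i j)) (trans (cong (λ v → Vec.lookup v j) (h i)) (lookup-blockOf z i j))

  blockOf-concat : ∀ {A : Set} (zs : Vec (Vec A n) m) i → blockOf (Vec.concat zs) i ≡ Vec.lookup zs i
  blockOf-concat zs i = Vec-ext λ j → trans (lookup-blockOf (Vec.concat zs) i j) (Vec.lookup-concat zs i j)

  blockOf-⊕ : ∀ (y z : F₃^ (m ℕ.* n)) i → blockOf (y ⊕ z) i ≡ blockOf y i ⊕ blockOf z i
  blockOf-⊕ y z i = Vec-ext λ j → begin
    Vec.lookup (blockOf (y ⊕ z) i) j                                 ≡⟨ lookup-blockOf (y ⊕ z) i j ⟩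
    Vec.lookup (y ⊕ z) (Fin.combine i j)                             ≡⟨ lookup-⊕ y z _ ⟩
    Vec.lookup y (Fin.combine i j) +₃ Vec.lookup z (Fin.combine i j) ≡⟨ cong₂ _+₃_ (lookup-blockOf y i j) (lookup-blockOf z i j) ⟨
    Vec.lookup (blockOf y i) j +₃ Vec.lookup (blockOf z i) j         ≡⟨ lookup-⊕ (blockOf y i) (blockOf z i) j ⟨
    Vec.lookup (blockOf y i ⊕ blockOf z i) j                         ∎
    where open ≡-Reasoning

  blockOf-⊙ : ∀ a (z : F₃^ (m ℕ.* n)) i → blockOf (a ⊙ z) i ≡ a ⊙ blockOf z i
  blockOf-⊙ a z i = Vec-ext λ j → begin
    Vec.lookup (blockOf (a ⊙ z) i) j          ≡⟨ lookup-blockOf (a ⊙ z) i j ⟩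
    Vec.lookup (a ⊙ z) (Fin.combine i j)      ≡⟨ lookup-⊙ a z _ ⟩
    a *₃ Vec.lookup z (Fin.combine i j)       ≡⟨ cong (a *₃_) (lookup-blockOf z i j) ⟨
    a *₃ Vec.lookup (blockOf z i) j           ≡⟨ lookup-⊙ a (blockOf z i) j ⟨
    Vec.lookup (a ⊙ blockOf z i) j            ∎
    where open ≡-Reasoning

  blockOf-𝟎 : ∀ (i : Fin m) → blockOf (𝟎 {m ℕ.* n}) i ≡ 𝟎
  blockOf-𝟎 i = Vec-ext λ j → trans (lookup-blockOf 𝟎 i j) (trans (lookup-𝟎 (Fin.combine i j)) (sym (lookup-𝟎 j)))

  ·-blocks : ∀ (y z : F₃^ (m ℕ.* n)) → y · z ≡ Σ₃.sum (λ i → blockOf y i · blockOf z i)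
  ·-blocks y z = begin
    y · z
      ≡⟨ ·-sum y z ⟩
    Σ₃.sum (λ l → Vec.lookup y l *₃ Vec.lookup z l)
      ≡⟨ Σ₃.sum-combine m n (λ l → Vec.lookup y l *₃ Vec.lookup z l) ⟩
    Σ₃.sum (λ (i : Fin m) → Σ₃.sum (λ (j : Fin n) → Vec.lookup y (Fin.combine i j) *₃ Vec.lookup z (Fin.combine i j)))
      ≡⟨ Σ₃.sum-cong-≗ (λ i → trans (·-sum (blockOf y i) (blockOf z i))
           (Σ₃.sum-cong-≗ λ j → cong₂ _*₃_ (lookup-blockOf y i j) (lookup-blockOf z i j))) ⟨
    Σ₃.sum (λ i → blockOf y i · blockOf z i) ∎
    where open ≡-Reasoning

  wt-blocks : ∀ (z : F₃^ (m ℕ.* n)) → wt z ≡ Σℕ.sum (λ i → wt (blockOf z i))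
  wt-blocks z = begin
    wt z
      ≡⟨ wt-sum z ⟩
    Σℕ.sum (λ l → nonzero (Vec.lookup z l))
      ≡⟨ Σℕ.sum-combine m n (λ l → nonzero (Vec.lookup z l)) ⟩
    Σℕ.sum (λ (i : Fin m) → Σℕ.sum (λ (j : Fin n) → nonzero (Vec.lookup z (Fin.combine i j))))
      ≡⟨ Σℕ.sum-cong-≗ (λ i → trans (wt-sum (blockOf z i))
           (Σℕ.sum-cong-≗ λ j → cong nonzero (lookup-blockOf z i j))) ⟨
    Σℕ.sum (λ i → wt (blockOf z i)) ∎
    where open ≡-Reasoning

  at : Fin m → F₃^ n → Fin m → F₃^ n
  at i v k = if does (i Fin.≟ k) then v else 𝟎

  blockOf-block : ∀ i (v : F₃^ n) k → blockOf (block {m} i v) k ≡ at i v k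
  blockOf-block i v k = trans (blockOf-concat (Vec.replicate m 𝟎 [ i ]≔ v) k) split
    where
    split : Vec.lookup (Vec.replicate m 𝟎 [ i ]≔ v) k ≡ at i v k
    split with i Fin.≟ k
    ... | yes refl = Vec.lookup∘update i (Vec.replicate m 𝟎) v
    ... | no i≢k   = trans (Vec.lookup∘update′ (i≢k ∘ sym) (Vec.replicate m 𝟎) v) (Vec.lookup-replicate k 𝟎)

  at-same : ∀ i v → at i v i ≡ v
  at-same i v with i Fin.≟ i
  ... | yes _  = refl
  ... | no i≢i = contradiction refl i≢i

  at-other : ∀ i v k → i ≢ k → at i v k ≡ 𝟎
  at-other i v k i≢k with i Fin.≟ k
  ... | yes i≡k = contradiction i≡k i≢k
  ... | no _    = refl

  block-· : ∀ i (v : F₃^ n) z → block {m} i v · z ≡ v · blockOf z i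
  block-· i v z = begin
    block i v · z                                       ≡⟨ ·-blocks (block i v) z ⟩
    Σ₃.sum (λ k → blockOf (block i v) k · blockOf z k)  ≡⟨ Σ₃.sum-single i _ (λ k k≢i →
      trans (cong (_· blockOf z k) (trans (blockOf-block i v k) (at-other i v k (k≢i ∘ sym)))) (·-zeroˡ (blockOf z k))) ⟩
    blockOf (block i v) i · blockOf z i                 ≡⟨ cong (_· blockOf z i) (trans (blockOf-block i v i) (at-same i v)) ⟩
    v · blockOf z i                                     ∎
    where open ≡-Reasoning

  wt-block : ∀ i (v : F₃^ n) → wt (block {m} i v) ≡ wt v
  wt-block i v = begin
    wt (block i v)                                      ≡⟨ wt-blocks (block i v) ⟩
    Σℕ.sum (λ k → wt (blockOf (block i v) k))           ≡⟨ Σℕ.sum-single i _ (λ k k≢i →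
      trans (cong wt (trans (blockOf-block i v k) (at-other i v k (k≢i ∘ sym)))) (wt-𝟎 n)) ⟩
    wt (blockOf (block i v) i)                          ≡⟨ cong wt (trans (blockOf-block i v i) (at-same i v)) ⟩
    wt v                                                ∎
    where open ≡-Reasoning

  blockOf-linearCombination : ∀ {r} (a : Vec F₃ r) (f : Fin r → F₃^ (m ℕ.* n)) k →
    blockOf (linearCombination a (Vec.tabulate f)) k ≡ linearCombination a (Vec.tabulate λ i → blockOf (f i) k)
  blockOf-linearCombination []      f k = blockOf-𝟎 k
  blockOf-linearCombination (b ∷ a) f k = trans
    (blockOf-⊕ (b ⊙ f zero) (linearCombination a (Vec.tabulate (f ∘ suc))) k)
    (cong₂ _⊕_ (blockOf-⊙ b (f zero) k) (blockOf-linearCombination a (f ∘ suc) k))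

linearCombination-⊕ : ∀ {n r} (a : Vec F₃ r) (f h : Fin r → F₃^ n) →
  linearCombination a (Vec.tabulate λ i → f i ⊕ h i) ≡
  linearCombination a (Vec.tabulate f) ⊕ linearCombination a (Vec.tabulate h)
linearCombination-⊕ []      f h = sym (⊕-identityˡ 𝟎)
linearCombination-⊕ (b ∷ a) f h = trans
  (cong₂ _⊕_ (⊙-⊕ b (f zero) (h zero)) (linearCombination-⊕ a (f ∘ suc) (h ∘ suc)))
  (⊕-interchange (b ⊙ f zero) (b ⊙ h zero) _ _)
  where
  ⊕-interchange : ∀ {n} (w x y z : F₃^ n) → (w ⊕ x) ⊕ (y ⊕ z) ≡ (w ⊕ y) ⊕ (x ⊕ z)
  ⊕-interchange []      []      []      []      = refl
  ⊕-interchange (a ∷ w) (b ∷ x) (c ∷ y) (d ∷ z) = cong₂ _∷_ (+₃-interchange a b c d) (⊕-interchange w x y z)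

linearCombination-single : ∀ {n r} (a : Vec F₃ r) (f : Fin r → F₃^ n) k →
  (∀ i → i ≢ k → f i ≡ 𝟎) → linearCombination a (Vec.tabulate f) ≡ Vec.lookup a k ⊙ f k
linearCombination-single (b ∷ a) f zero    h = trans (cong (b ⊙ f zero ⊕_) (zeros a (f ∘ suc) λ i → h (suc i) λ ()))
  (⊕-identityʳ _)
  where
  zeros : ∀ {n r} (a : Vec F₃ r) (f : Fin r → F₃^ n) → (∀ i → f i ≡ 𝟎) → linearCombination a (Vec.tabulate f) ≡ 𝟎
  zeros []      f h = refl
  zeros (b ∷ a) f h = trans (cong₂ _⊕_ (trans (cong (b ⊙_) (h zero)) (⊙-zeroʳ b)) (zeros a (f ∘ suc) (h ∘ suc)))
    (⊕-identityˡ 𝟎)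
linearCombination-single (b ∷ a) f (suc k) h = trans
  (cong₂ _⊕_ (trans (cong (b ⊙_) (h zero λ ())) (⊙-zeroʳ b))
    (linearCombination-single a (f ∘ suc) k λ i i≢k → h (suc i) (i≢k ∘ Fin.suc-injective)))
  (⊕-identityˡ _)

linearCombination-unit : ∀ {n r} (f : Fin r → F₃^ n) i →
  linearCombination (𝟎 [ i ]≔ 1F) (Vec.tabulate f) ≡ f i
linearCombination-unit f zero    = trans (cong₂ _⊕_ (⊙-identity (f zero)) (zero-coefficients (f ∘ suc))) (⊕-identityʳ (f zero))
  where
  zero-coefficients : ∀ {n r} (f : Fin r → F₃^ n) → linearCombination 𝟎 (Vec.tabulate f) ≡ 𝟎
  zero-coefficients {r = zero}  f = refl
  zero-coefficients {r = suc r} f = trans (cong₂ _⊕_ (⊙-zeroˡ (f zero)) (zero-coefficients (f ∘ suc))) (⊕-identityˡ 𝟎)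
linearCombination-unit f (suc i) = trans (cong₂ _⊕_ (⊙-zeroˡ (f zero)) (linearCombination-unit (f ∘ suc) i)) (⊕-identityˡ (f (suc i)))

⊕-⊖-cancel : ∀ {n} (x y : F₃^ n) → (x ⊕ y) ⊖ y ≡ x
⊕-⊖-cancel []      []      = refl
⊕-⊖-cancel (a ∷ x) (b ∷ y) = cong₂ _∷_ (cancel a b) (⊕-⊖-cancel x y)
  where
  cancel : ∀ a b → (a +₃ b) +₃ 2F *₃ b ≡ a
  cancel = toWitness {a? = Fin.all? λ a → Fin.all? λ b → _ ≟₃ _} _

Vec-any? : ∀ {k} {P : Vec F₃ k → Set} → (∀ a → Dec (P a)) → Dec (∃ P)
Vec-any? {zero}  P? = map′ (λ h → [] , h) (λ where ([] , h) → h) (P? [])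
Vec-any? {suc k} P? = map′ (λ (b , a , h) → b ∷ a , h) (λ where (b ∷ a , h) → b , a , h)
  (Fin.any? λ b → Vec-any? (P? ∘ (b ∷_)))

-- The code C_m: self-orthogonality, minimum weight and duality

module LongCode (setup : Setup) (m : ℕ) where
  open SetupCode setup
  open Blocks m 24

  combo : F₃ → F₃ → F₃^ 24
  combo a b = a ⊙ p ⊕ b ⊙ q

  record InCoset (a b : F₃) (u : F₃^ 24) : Set where
    constructor mkCoset
    field difference∈D : D (u ⊖ combo a b)

  ·-q : ∀ {d} → D d → d · q ≡ 0F
  ·-q {d} (d∈C , d·p≡0) = begin
    d · q               ≡⟨ +₃-identityˡ (d · q) ⟨
    0F +₃ d · q         ≡⟨ cong (_+₃ d · q) d·p≡0 ⟨
    d · p +₃ d · q      ≡⟨ ·-⊕ʳ d p q ⟨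
    d · (p ⊕ q)         ≡⟨ orthogonal d∈C p⊕q∈C ⟩
    0F                  ∎
    where open ≡-Reasoning

  ·-combo : ∀ x a b → x · combo a b ≡ a *₃ (x · p) +₃ b *₃ (x · q)
  ·-combo x a b = trans (·-⊕ʳ x (a ⊙ p) (b ⊙ q)) (cong₂ _+₃_ (·-⊙ʳ a x p) (·-⊙ʳ b x q))

  D-·-combo : ∀ {d} → D d → ∀ a b → d · combo a b ≡ 0F
  D-·-combo {d} d∈D a b = trans (·-combo d a b)
    (cong₂ _+₃_ (trans (cong (a *₃_) (proj₂ d∈D)) (*₃-zeroʳ a)) (trans (cong (b *₃_) (·-q d∈D)) (*₃-zeroʳ b)))

  combo-·-combo : ∀ a b a′ b′ → combo a b · combo a′ b′ ≡ a *₃ a′ +₃ 2F *₃ (b *₃ b′)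
  combo-·-combo a b a′ b′ = begin
    combo a b · combo a′ b′
      ≡⟨ ·-combo (combo a b) a′ b′ ⟩
    a′ *₃ (combo a b · p) +₃ b′ *₃ (combo a b · q)
      ≡⟨ cong₂ (λ x y → a′ *₃ x +₃ b′ *₃ y)
           (trans (·-comm (combo a b) p) (trans (·-combo p a b) (cong₂ (λ x y → a *₃ x +₃ b *₃ y) p·p≡1 p·q≡0)))
           (trans (·-comm (combo a b) q) (trans (·-combo q a b) (cong₂ (λ x y → a *₃ x +₃ b *₃ y)
             (trans (·-comm q p) p·q≡0) q·q≡2))) ⟩
    a′ *₃ (a *₃ 1F +₃ b *₃ 0F) +₃ b′ *₃ (a *₃ 0F +₃ b *₃ 2F)
      ≡⟨ lemma a b a′ b′ ⟩
    a *₃ a′ +₃ 2F *₃ (b *₃ b′) ∎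
    where
    open ≡-Reasoning
    lemma : ∀ a b a′ b′ → a′ *₃ (a *₃ 1F +₃ b *₃ 0F) +₃ b′ *₃ (a *₃ 0F +₃ b *₃ 2F) ≡ a *₃ a′ +₃ 2F *₃ (b *₃ b′)
    lemma = toWitness {a? = Fin.all? λ a → Fin.all? λ b → Fin.all? λ a′ → Fin.all? λ b′ → _ ≟₃ _} _

  coset-product : ∀ {a b a′ b′ u u′} → InCoset a b u → InCoset a′ b′ u′ →
                  u · u′ ≡ a *₃ a′ +₃ 2F *₃ (b *₃ b′)
  coset-product {a} {b} {a′} {b′} {u} {u′} (mkCoset h) (mkCoset h′) = begin
    u · u′
      ≡⟨ cong₂ _·_ (⊖-⊕-cancel u (combo a b)) (⊖-⊕-cancel u′ (combo a′ b′)) ⟨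
    (d ⊕ combo a b) · (d′ ⊕ combo a′ b′)
      ≡⟨ ·-⊕ˡ d (combo a b) (d′ ⊕ combo a′ b′) ⟩
    d · (d′ ⊕ combo a′ b′) +₃ combo a b · (d′ ⊕ combo a′ b′)
      ≡⟨ cong₂ _+₃_ (trans (·-⊕ʳ d d′ (combo a′ b′)) (cong₂ _+₃_ (orthogonal (proj₁ h) (proj₁ h′)) (D-·-combo h a′ b′)))
           (trans (·-⊕ʳ (combo a b) d′ (combo a′ b′))
             (cong₂ _+₃_ (trans (·-comm (combo a b) d′) (D-·-combo h′ a b)) (combo-·-combo a b a′ b′))) ⟩
    0F +₃ (0F +₃ (a *₃ a′ +₃ 2F *₃ (b *₃ b′)))
      ≡⟨ trans (+₃-identityˡ _) (+₃-identityˡ _) ⟩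
    a *₃ a′ +₃ 2F *₃ (b *₃ b′) ∎
    where
    open ≡-Reasoning
    d  = u ⊖ combo a b
    d′ = u′ ⊖ combo a′ b′

  -- `a p + b q = (a - b) p + b (p + q)`, and `p + q` lies in `C`. Modulo `C` a block therefore
  -- depends only on the difference of the two coefficients.
  coset-C : ∀ {a b u} → InCoset a b u → C (u ⊖ (a +₃ 2F *₃ b) ⊙ p)
  coset-C {a} {b} {u} (mkCoset (h , _)) = subst C (Vec-ext λ i → begin
    Vec.lookup ((u ⊖ combo a b) ⊕ b ⊙ (p ⊕ q)) i
      ≡⟨ lookup-⊕ (u ⊖ combo a b) (b ⊙ (p ⊕ q)) i ⟩
    Vec.lookup (u ⊖ combo a b) i +₃ Vec.lookup (b ⊙ (p ⊕ q)) i
      ≡⟨ cong₂ _+₃_ (trans (lookup-⊕ u (2F ⊙ combo a b) i) (cong (Vec.lookup u i +₃_) (trans (lookup-⊙ 2F (combo a b) i)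
           (cong (2F *₃_) (trans (lookup-⊕ (a ⊙ p) (b ⊙ q) i) (cong₂ _+₃_ (lookup-⊙ a p i) (lookup-⊙ b q i)))))))
           (trans (lookup-⊙ b (p ⊕ q) i) (cong (b *₃_) (lookup-⊕ p q i))) ⟩
    (Vec.lookup u i +₃ 2F *₃ (a *₃ Vec.lookup p i +₃ b *₃ Vec.lookup q i)) +₃ b *₃ (Vec.lookup p i +₃ Vec.lookup q i)
      ≡⟨ lemma (Vec.lookup u i) a b (Vec.lookup p i) (Vec.lookup q i) ⟩
    Vec.lookup u i +₃ 2F *₃ ((a +₃ 2F *₃ b) *₃ Vec.lookup p i)
      ≡⟨ trans (lookup-⊕ u (2F ⊙ ((a +₃ 2F *₃ b) ⊙ p)) i) (cong (Vec.lookup u i +₃_)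
           (trans (lookup-⊙ 2F ((a +₃ 2F *₃ b) ⊙ p) i) (cong (2F *₃_) (lookup-⊙ (a +₃ 2F *₃ b) p i)))) ⟨
    Vec.lookup (u ⊖ (a +₃ 2F *₃ b) ⊙ p) i ∎)
    (⊕-closed h (⊙-closed b p⊕q∈C))
    where
    open ≡-Reasoning
    rest : ∀ a b x y → 2F *₃ (a *₃ x +₃ b *₃ y) +₃ b *₃ (x +₃ y) ≡ 2F *₃ ((a +₃ 2F *₃ b) *₃ x)
    rest = toWitness {a? = Fin.all? λ a → Fin.all? λ b → Fin.all? λ x → Fin.all? λ y → _ ≟₃ _} _
    lemma : ∀ u a b x y → (u +₃ 2F *₃ (a *₃ x +₃ b *₃ y)) +₃ b *₃ (x +₃ y) ≡ u +₃ 2F *₃ ((a +₃ 2F *₃ b) *₃ x)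
    lemma u a b x y = trans (+₃-assoc u (2F *₃ (a *₃ x +₃ b *₃ y)) (b *₃ (x +₃ y))) (cong (u +₃_) (rest a b x y))

  coset-same : ∀ {a u} → InCoset a a u → C u
  coset-same {a} {u} h = subst C (trans (cong (λ t → u ⊕ 2F ⊙ (t ⊙ p)) (+₃-inverse a))
    (trans (cong (λ v → u ⊕ 2F ⊙ v) (⊙-zeroˡ p)) (trans (cong (u ⊕_) (⊙-zeroʳ 2F)) (⊕-identityʳ u)))) (coset-C h)

  -- Either the codeword is 0 and `u` is a nonzero multiple of `p`, of weight 4, or the codeword has
  -- weight at least 9, of which `p` accounts for at most 4.
  coset-weight : ∀ e {u} → C (u ⊖ suc e ⊙ p) → 4 ℕ.≤ wt u
  coset-weight e {u} c∈C = split (u ⊖ suc e ⊙ p ≟ᵥ 𝟎)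
    where
    split : Dec (u ⊖ suc e ⊙ p ≡ 𝟎) → 4 ℕ.≤ wt u
    split (yes c≡𝟎) = ℕ.≤-reflexive (sym (trans (cong wt (⊖≡𝟎⇒≡ u (suc e ⊙ p) c≡𝟎)) (wt-p e)))
    split (no c≢𝟎)  = ℕ.+-cancelʳ-≤ 4 4 (wt u) (ℕ.≤-trans (ℕ.≤-trans (ℕ.n≤1+n 8) (distance _ c∈C c≢𝟎))
      (ℕ.≤-trans (wt-⊖ u (suc e ⊙ p)) (ℕ.+-monoʳ-≤ (wt u) (ℕ.≤-reflexive (wt-p e)))))

  coset-different : ∀ {a b u} → a ≢ b → InCoset a b u → 4 ℕ.≤ wt u
  coset-different {a} {b} {u} a≢b h = split (a +₃ 2F *₃ b) refl (coset-C h)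
    where
    difference : ∀ a b → a +₃ 2F *₃ b ≡ 0F → a ≡ b
    difference = toWitness {a? = Fin.all? λ a → Fin.all? λ b → (a +₃ 2F *₃ b ≟₃ 0F) →-dec (a ≟₃ b)} _
    split : ∀ e → a +₃ 2F *₃ b ≡ e → C (u ⊖ e ⊙ p) → 4 ℕ.≤ wt u
    split zero    e≡ _   = contradiction (difference a b e≡) a≢b
    split (suc e) _  c∈C = coset-weight e c∈C

  -- Block `next k` receives `p` from `x[ next k ]` and `q` from `x[ k ]`. Indexing blocks by
  -- `next k` avoids a predecessor function.
  Coordinates : F₃^ (m ℕ.* 24) → Vec F₃ m → Set
  Coordinates z a = ∀ k → InCoset (Vec.lookup a (next k)) (Vec.lookup a k) (blockOf z (next k))

  blockOf-X : ∀ a k → blockOf (linearCombination a (Vec.tabulate x[_])) (next k) ≡ combo (Vec.lookup a (next k)) (Vec.lookup a k)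
  blockOf-X a k = begin
    blockOf (linearCombination a (Vec.tabulate x[_])) (next k)
      ≡⟨ blockOf-linearCombination a x[_] (next k) ⟩
    linearCombination a (Vec.tabulate λ i → blockOf x[ i ] (next k))
      ≡⟨ cong (linearCombination a) (Vec.tabulate-cong λ i → trans (blockOf-⊕ (block i p) (block (next i) q) (next k))
           (cong₂ _⊕_ (blockOf-block i p (next k)) (blockOf-block (next i) q (next k)))) ⟩
    linearCombination a (Vec.tabulate λ i → at i p (next k) ⊕ at (next i) q (next k))
      ≡⟨ linearCombination-⊕ a (λ i → at i p (next k)) (λ i → at (next i) q (next k)) ⟩
    linearCombination a (Vec.tabulate λ i → at i p (next k)) ⊕ linearCombination a (Vec.tabulate λ i → at (next i) q (next k))
      ≡⟨ cong₂ _⊕_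
           (trans (linearCombination-single a _ (next k) λ i i≢ → at-other i p (next k) i≢) (cong (Vec.lookup a (next k) ⊙_) (at-same (next k) p)))
           (trans (linearCombination-single a _ k λ i i≢k → at-other (next i) q (next k) (i≢k ∘ next-injective))
             (cong (Vec.lookup a k ⊙_) (at-same (next k) q))) ⟩
    combo (Vec.lookup a (next k)) (Vec.lookup a k) ∎
    where open ≡-Reasoning

  to-coordinates : ∀ {z} → C[ m ] z → ∃ (Coordinates z)
  to-coordinates (_ , _ , (ds , ds∈D , refl) , (a , refl) , refl) = a , λ k →
    mkCoset (subst D (sym (begin
      blockOf (Vec.concat ds ⊕ linearCombination a (Vec.tabulate x[_])) (next k) ⊖ combo (Vec.lookup a (next k)) (Vec.lookup a k)
        ≡⟨ cong (_⊖ combo (Vec.lookup a (next k)) (Vec.lookup a k))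
             (trans (blockOf-⊕ (Vec.concat ds) (linearCombination a (Vec.tabulate x[_])) (next k))
               (cong₂ _⊕_ (blockOf-concat ds (next k)) (blockOf-X a k))) ⟩
      (Vec.lookup ds (next k) ⊕ combo (Vec.lookup a (next k)) (Vec.lookup a k)) ⊖ combo (Vec.lookup a (next k)) (Vec.lookup a k)
        ≡⟨ ⊕-⊖-cancel (Vec.lookup ds (next k)) (combo (Vec.lookup a (next k)) (Vec.lookup a k)) ⟩
      Vec.lookup ds (next k) ∎)) (All.lookup⁺ ds∈D (next k)))
    where open ≡-Reasoning

  from-coordinates : ∀ {z} → ∃ (Coordinates z) → C[ m ] z
  from-coordinates {z} (a , h) = Vec.concat ds , v , (ds , All.lookup⁻ ds∈D , refl) , (a , refl) ,
    trans (sym (⊖-⊕-cancel z v)) (cong (_⊕ v) (sym (blockOf-ext λ i → trans (blockOf-concat ds i) (Vec.lookup∘tabulate _ i))))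
    where
    v = linearCombination a (Vec.tabulate x[_])
    ds = Vec.tabulate (blockOf (z ⊖ v))
    block≡ : ∀ k → blockOf (z ⊖ v) (next k) ≡ blockOf z (next k) ⊖ combo (Vec.lookup a (next k)) (Vec.lookup a k)
    block≡ k = trans (blockOf-⊕ z (2F ⊙ v) (next k)) (cong (blockOf z (next k) ⊕_)
      (trans (blockOf-⊙ 2F v (next k)) (cong (2F ⊙_) (blockOf-X a k))))
    ds∈D : ∀ i → D (Vec.lookup ds i)
    ds∈D i with next-surjective i
    ... | k , refl = subst D (sym (trans (Vec.lookup∘tabulate (blockOf (z ⊖ v)) (next k)) (block≡ k))) (InCoset.difference∈D (h k))

  C[m]? : ∀ z → Dec (C[ m ] z)
  C[m]? z = map′ from-coordinates to-coordinates (Vec-any? λ a → Fin.all? λ k →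
    map′ mkCoset InCoset.difference∈D (C? _ ×-dec (_ ≟₃ 0F)))

  -- With `h k` the product of the two coefficients at `k`, block `next k` contributes
  -- `h (next k) - h k`. Around the cycle this telescopes; with -1 written as 2 it appears as three
  -- times the sum of `h`.
  C[m]-orthogonal : ∀ {y z} → C[ m ] y → C[ m ] z → y · z ≡ 0F
  C[m]-orthogonal {y} {z} y∈ z∈ with to-coordinates y∈ | to-coordinates z∈
  ... | a , ha | b , hb = begin
    y · z
      ≡⟨ ·-blocks y z ⟩
    Σ₃.sum (λ i → blockOf y i · blockOf z i)
      ≡⟨ Σ₃.sum-next (λ i → blockOf y i · blockOf z i) ⟨
    Σ₃.sum (λ k → blockOf y (next k) · blockOf z (next k))
      ≡⟨ Σ₃.sum-cong-≗ (λ k → trans (coset-product (ha k) (hb k)) (double (h (next k)) (h k))) ⟩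
    Σ₃.sum (λ k → h (next k) +₃ (h k +₃ h k))
      ≡⟨ trans (Σ₃.sum-distrib (h ∘ next) (λ k → h k +₃ h k)) (cong₂ _+₃_ (Σ₃.sum-next h) (Σ₃.sum-distrib h h)) ⟩
    Σ₃.sum h +₃ (Σ₃.sum h +₃ Σ₃.sum h)
      ≡⟨ triple (Σ₃.sum h) ⟩
    0F ∎
    where
    open ≡-Reasoning
    h : Fin m → F₃
    h k = Vec.lookup a k *₃ Vec.lookup b k
    double : ∀ x y → x +₃ 2F *₃ y ≡ x +₃ (y +₃ y)
    double = toWitness {a? = Fin.all? λ x → Fin.all? λ y → _ ≟₃ _} _
    triple : ∀ x → x +₃ (x +₃ x) ≡ 0F
    triple = toWitness {a? = Fin.all? λ x → _ ≟₃ 0F} _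

  -- A nonzero block where the coefficient does not jump is a word of `C`. If there is none, a jump
  -- occurs somewhere, and a second one as well because the jumps sum to 0 around the cycle. Two
  -- such blocks give weight 8, which divisibility by 3 raises to 9.
  C[m]-distance : ∀ {z} → C[ m ] z → z ≢ 𝟎 → 9 ℕ.≤ wt z
  C[m]-distance {z} z∈ z≢𝟎 with to-coordinates z∈
  ... | a , h with Fin.any? (λ k → (Vec.lookup a (next k) ≟₃ Vec.lookup a k) ×-dec ¬? (blockOf z (next k) ≟ᵥ 𝟎))
  ...   | yes (k , same , ≢𝟎) = ℕ.≤-trans
    (distance _ (coset-same (subst (λ t → InCoset t (Vec.lookup a k) (blockOf z (next k))) same (h k))) ≢𝟎)
    (subst (wt (blockOf z (next k)) ℕ.≤_) (sym (wt-blocks z)) (sum-≥ (wt ∘ blockOf z) (next k)))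
  ...   | no none with Fin.all? (λ k → Vec.lookup a (next k) ≟₃ Vec.lookup a k)
  ...     | yes all-same = contradiction (blockOf-ext zero-block) z≢𝟎
    where
    zero-block : ∀ i → blockOf z i ≡ blockOf 𝟎 i
    zero-block i with next-surjective i
    ... | k , refl with blockOf z (next k) ≟ᵥ 𝟎
    ...   | yes e  = trans e (sym (blockOf-𝟎 (next k)))
    ...   | no ≢𝟎 = contradiction (k , all-same k , ≢𝟎) none
  ...     | no ¬all-same with Fin.¬∀⟶∃¬ m _ (λ k → Vec.lookup a (next k) ≟₃ Vec.lookup a k) ¬all-same
  ...       | k , k-jump with Fin.any? (λ l → ¬? (l Fin.≟ k) ×-dec ¬? (Vec.lookup a (next l) ≟₃ Vec.lookup a l))
  ...         | no single = contradiction (cancel (Vec.lookup a (next k)) (Vec.lookup a k) (trans (sym (Σ₃.sum-single k jump others)) total)) k-jump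
    where
    jump : Fin m → F₃
    jump i = Vec.lookup a (next i) +₃ 2F *₃ Vec.lookup a i
    cancel : ∀ x y → x +₃ 2F *₃ y ≡ 0F → x ≡ y
    cancel = toWitness {a? = Fin.all? λ a → Fin.all? λ b → (a +₃ 2F *₃ b ≟₃ 0F) →-dec (a ≟₃ b)} _
    others : ∀ i → i ≢ k → jump i ≡ 0F
    others i i≢k with Vec.lookup a (next i) ≟₃ Vec.lookup a i
    ... | yes e  = trans (cong (_+₃ 2F *₃ Vec.lookup a i) e) (+₃-inverse (Vec.lookup a i))
    ... | no i-jump = contradiction (i , i≢k , i-jump) single
    double : ∀ x y → x +₃ 2F *₃ y ≡ x +₃ (y +₃ y)
    double = toWitness {a? = Fin.all? λ x → Fin.all? λ y → _ ≟₃ _} _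
    triple : ∀ x → x +₃ (x +₃ x) ≡ 0F
    triple = toWitness {a? = Fin.all? λ x → _ ≟₃ 0F} _
    total : Σ₃.sum jump ≡ 0F
    total = trans (Σ₃.sum-cong-≗ λ i → double (Vec.lookup a (next i)) (Vec.lookup a i))
      (trans (Σ₃.sum-distrib (Vec.lookup a ∘ next) (λ i → Vec.lookup a i +₃ Vec.lookup a i))
      (trans (cong₂ _+₃_ (Σ₃.sum-next (Vec.lookup a)) (Σ₃.sum-distrib (Vec.lookup a) (Vec.lookup a))) (triple (Σ₃.sum (Vec.lookup a)))))
  ...         | yes (l , l≢k , l-jump) = divisible (wt-self-orthogonal z (C[m]-orthogonal z∈ z∈))
    where
    eight : 8 ℕ.≤ wt z
    eight = ℕ.≤-trans (ℕ.+-mono-≤ (coset-different k-jump (h k)) (coset-different l-jump (h l)))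
      (subst (wt (blockOf z (next k)) ℕ.+ wt (blockOf z (next l)) ℕ.≤_) (sym (wt-blocks z))
        (sum-≥₂ (wt ∘ blockOf z) (next k) (next l) (λ e → l≢k (sym (next-injective e)))))
    divisible : ∃[ r ] wt z ≡ r ℕ.* 3 → 9 ℕ.≤ wt z
    divisible (0 , e) = contradiction (subst (8 ℕ.≤_) e eight) λ ()
    divisible (1 , e) = contradiction (subst (8 ℕ.≤_) e eight) λ where (s≤s (s≤s (s≤s ())))
    divisible (2 , e) = contradiction (subst (8 ℕ.≤_) e eight) λ where (s≤s (s≤s (s≤s (s≤s (s≤s (s≤s ()))))))
    divisible (suc (suc (suc r)) , e) = subst (9 ℕ.≤_) (sym e) (ℕ.m≤m+n 9 (r ℕ.* 3))

  -- With c i · p = γ i, orthogonality to x[ i ] gives the recursion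
  -- γ (next i) = γ i + b i, so γ ∘ next supplies the coordinates of z.
  C[m]-dual : ∀ z → (∀ i → ∃[ b ] C (blockOf z i ⊖ b ⊙ p)) → (∀ i → x[ i ] · z ≡ 0F) → C[ m ] z
  C[m]-dual z decomposition orth = from-coordinates (a , λ k → coset k)
    where
    open ≡-Reasoning
    b : Fin m → F₃
    b i = proj₁ (decomposition i)
    c : Fin m → F₃^ 24
    c i = blockOf z i ⊖ b i ⊙ p
    c∈C : ∀ i → C (c i)
    c∈C i = proj₂ (decomposition i)
    γ : Fin m → F₃
    γ i = c i · p
    a : Vec F₃ m
    a = Vec.tabulate (γ ∘ next)

    p-part : ∀ i → p · blockOf z i ≡ γ i +₃ b i
    p-part i = begin
      p · blockOf z i                 ≡⟨ ·-comm p (blockOf z i) ⟩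
      blockOf z i · p                 ≡⟨ cong (_· p) (⊖-⊕-cancel (blockOf z i) (b i ⊙ p)) ⟨
      (c i ⊕ b i ⊙ p) · p             ≡⟨ ·-⊕ˡ (c i) (b i ⊙ p) p ⟩
      γ i +₃ (b i ⊙ p) · p            ≡⟨ cong (γ i +₃_) (trans (·-⊙ˡ (b i) p p) (trans (cong (b i *₃_) p·p≡1) (*-identity (b i)))) ⟩
      γ i +₃ b i                      ∎
      where
      *-identity : ∀ b → b *₃ 1F ≡ b
      *-identity b = trans (*₃-comm b 1F) (*₃-identityˡ b)

    q-part : ∀ i → q · blockOf z i ≡ 2F *₃ γ i
    q-part i = begin
      q · blockOf z i                 ≡⟨ ·-comm q (blockOf z i) ⟩
      blockOf z i · q                 ≡⟨ cong (_· q) (⊖-⊕-cancel (blockOf z i) (b i ⊙ p)) ⟨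
      (c i ⊕ b i ⊙ p) · q             ≡⟨ ·-⊕ˡ (c i) (b i ⊙ p) q ⟩
      c i · q +₃ (b i ⊙ p) · q        ≡⟨ cong (c i · q +₃_) (trans (·-⊙ˡ (b i) p q) (trans (cong (b i *₃_) p·q≡0) (*₃-zeroʳ (b i)))) ⟩
      c i · q +₃ 0F                   ≡⟨ opposite (c i · p) (c i · q) (trans (sym (·-⊕ʳ (c i) p q)) (orthogonal (c∈C i) p⊕q∈C)) ⟩
      2F *₃ γ i                       ∎
      where
      opposite : ∀ x y → x +₃ y ≡ 0F → y +₃ 0F ≡ 2F *₃ x
      opposite = toWitness {a? = Fin.all? λ x → Fin.all? λ y → (x +₃ y ≟₃ 0F) →-dec (y +₃ 0F ≟₃ 2F *₃ x)} _

    step : ∀ i → γ (next i) ≡ γ i +₃ b i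
    step i = solve (γ i) (b i) (γ (next i)) (begin
      (γ i +₃ b i) +₃ 2F *₃ γ (next i)                 ≡⟨ cong₂ _+₃_ (p-part i) (q-part (next i)) ⟨
      p · blockOf z i +₃ q · blockOf z (next i)        ≡⟨ cong₂ _+₃_ (block-· i p z) (block-· (next i) q z) ⟨
      block i p · z +₃ block (next i) q · z            ≡⟨ ·-⊕ˡ (block i p) (block (next i) q) z ⟨
      x[ i ] · z                                       ≡⟨ orth i ⟩
      0F                                               ∎)
      where
      solve : ∀ x y w → (x +₃ y) +₃ 2F *₃ w ≡ 0F → w ≡ x +₃ y
      solve = toWitness {a? = Fin.all? λ x → Fin.all? λ y → Fin.all? λ w →
        ((x +₃ y) +₃ 2F *₃ w ≟₃ 0F) →-dec (w ≟₃ x +₃ y)} _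

    coset : ∀ k → InCoset (Vec.lookup a (next k)) (Vec.lookup a k) (blockOf z (next k))
    coset k = subst (λ t → InCoset (proj₁ t) (proj₂ t) (blockOf z i))
      (cong₂ _,_ (sym (trans (Vec.lookup∘tabulate (γ ∘ next) (next k)) (step i))) (sym (Vec.lookup∘tabulate (γ ∘ next) k)))
      (mkCoset (subst C d≡ (⊕-closed (c∈C i) (⊙-closed (2F *₃ γ i) p⊕q∈C)) , (begin
        (blockOf z i ⊖ combo (γ i +₃ b i) (γ i)) · p
          ≡⟨ ·-⊕ˡ (blockOf z i) (2F ⊙ combo (γ i +₃ b i) (γ i)) p ⟩
        blockOf z i · p +₃ (2F ⊙ combo (γ i +₃ b i) (γ i)) · p
          ≡⟨ cong₂ _+₃_ (trans (·-comm (blockOf z i) p) (p-part i))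
               (trans (·-⊙ˡ 2F (combo (γ i +₃ b i) (γ i)) p) (cong (2F *₃_) (trans (·-comm (combo (γ i +₃ b i) (γ i)) p)
                 (trans (·-combo p (γ i +₃ b i) (γ i)) (cong₂ (λ x y → (γ i +₃ b i) *₃ x +₃ γ i *₃ y) p·p≡1 p·q≡0))))) ⟩
        (γ i +₃ b i) +₃ 2F *₃ ((γ i +₃ b i) *₃ 1F +₃ γ i *₃ 0F)
          ≡⟨ vanish (γ i) (b i) ⟩
        0F ∎)))
      where
      i = next k
      vanish : ∀ x y → (x +₃ y) +₃ 2F *₃ ((x +₃ y) *₃ 1F +₃ x *₃ 0F) ≡ 0F
      vanish = toWitness {a? = Fin.all? λ x → Fin.all? λ y → _ ≟₃ _} _
      pointwise : ∀ u b g x y → (u +₃ 2F *₃ (b *₃ x)) +₃ (2F *₃ g) *₃ (x +₃ y) ≡ u +₃ 2F *₃ ((g +₃ b) *₃ x +₃ g *₃ y)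
      pointwise u b g x y = trans (+₃-assoc u (2F *₃ (b *₃ x)) ((2F *₃ g) *₃ (x +₃ y))) (cong (u +₃_) (rest b g x y))
        where
        rest : ∀ b g x y → 2F *₃ (b *₃ x) +₃ (2F *₃ g) *₃ (x +₃ y) ≡ 2F *₃ ((g +₃ b) *₃ x +₃ g *₃ y)
        rest = toWitness {a? = Fin.all? λ b → Fin.all? λ g → Fin.all? λ x → Fin.all? λ y → _ ≟₃ _} _
      d≡ : c i ⊕ (2F *₃ γ i) ⊙ (p ⊕ q) ≡ blockOf z i ⊖ combo (γ i +₃ b i) (γ i)
      d≡ = Vec-ext λ j → begin
        Vec.lookup (c i ⊕ (2F *₃ γ i) ⊙ (p ⊕ q)) j
          ≡⟨ trans (lookup-⊕ (c i) ((2F *₃ γ i) ⊙ (p ⊕ q)) j) (cong₂ _+₃_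
               (trans (lookup-⊕ (blockOf z i) (2F ⊙ (b i ⊙ p)) j) (cong (Vec.lookup (blockOf z i) j +₃_)
                 (trans (lookup-⊙ 2F (b i ⊙ p) j) (cong (2F *₃_) (lookup-⊙ (b i) p j)))))
               (trans (lookup-⊙ (2F *₃ γ i) (p ⊕ q) j) (cong ((2F *₃ γ i) *₃_) (lookup-⊕ p q j)))) ⟩
        (Vec.lookup (blockOf z i) j +₃ 2F *₃ (b i *₃ Vec.lookup p j)) +₃ (2F *₃ γ i) *₃ (Vec.lookup p j +₃ Vec.lookup q j)
          ≡⟨ pointwise (Vec.lookup (blockOf z i) j) (b i) (γ i) (Vec.lookup p j) (Vec.lookup q j) ⟩
        Vec.lookup (blockOf z i) j +₃ 2F *₃ ((γ i +₃ b i) *₃ Vec.lookup p j +₃ γ i *₃ Vec.lookup q j)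
          ≡⟨ trans (lookup-⊕ (blockOf z i) (2F ⊙ combo (γ i +₃ b i) (γ i)) j) (cong (Vec.lookup (blockOf z i) j +₃_)
               (trans (lookup-⊙ 2F (combo (γ i +₃ b i) (γ i)) j) (cong (2F *₃_)
                 (trans (lookup-⊕ ((γ i +₃ b i) ⊙ p) (γ i ⊙ q) j) (cong₂ _+₃_ (lookup-⊙ (γ i +₃ b i) p j) (lookup-⊙ (γ i) q j)))))) ⟨
        Vec.lookup (blockOf z i ⊖ combo (γ i +₃ b i) (γ i)) j ∎

  block∈C[m] : ∀ i {d} → D d → C[ m ] (block i d)
  block∈C[m] i {d} d∈D = from-coordinates (𝟎 , λ k →
    subst₂ (λ s t → InCoset s t (blockOf (block i d) (next k))) (sym (lookup-𝟎 (next k))) (sym (lookup-𝟎 k))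
      (mkCoset (subst D (sym (trans (cong (λ v → blockOf (block i d) (next k) ⊕ 2F ⊙ v) combo-0)
        (trans (cong (blockOf (block i d) (next k) ⊕_) (⊙-zeroʳ 2F))
          (trans (⊕-identityʳ _) (blockOf-block i d (next k)))))) (in-D (next k)))))
    where
    combo-0 : combo 0F 0F ≡ 𝟎
    combo-0 = trans (cong₂ _⊕_ (⊙-zeroˡ p) (⊙-zeroˡ q)) (⊕-identityˡ 𝟎)
    in-D : ∀ k → D (at i d k)
    in-D k with i Fin.≟ k
    ... | yes _ = d∈D
    ... | no _  = 𝟎∈ , ·-zeroˡ p

  x∈C[m] : ∀ i → C[ m ] x[ i ]
  x∈C[m] i = 𝟎 , x[ i ] , (Vec.replicate m 𝟎 , All.lookup⁻ zero∈D , blockOf-ext zero-blocks) ,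
    (𝟎 [ i ]≔ 1F , linearCombination-unit x[_] i) , sym (⊕-identityˡ x[ i ])
    where
    zero∈D : ∀ k → D (Vec.lookup (Vec.replicate m 𝟎) k)
    zero∈D k = subst D (sym (Vec.lookup-replicate k 𝟎)) (𝟎∈ , ·-zeroˡ p)
    zero-blocks : ∀ k → blockOf 𝟎 k ≡ blockOf (Vec.concat (Vec.replicate m 𝟎)) k
    zero-blocks k = trans (blockOf-𝟎 k) (sym (trans (blockOf-concat (Vec.replicate m 𝟎) k) (Vec.lookup-replicate k 𝟎)))

  -- For `m = 1` the blocks `i` and `next i` coincide, so the weights of the two parts are not added
  -- blockwise. The bound 4 + 5 from above and the minimum weight from below treat all `m` alike;
  -- the product 1 with the block of `p` shows that the word is not 0.
  wt-x : ∀ i → wt x[ i ] ≡ 9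
  wt-x i = ℕ.≤-antisym
    (ℕ.≤-trans (wt-⊕ (block i p) (block (next i) q)) (ℕ.≤-reflexive (cong₂ ℕ._+_
      (trans (wt-block i p) (trans (cong wt (sym (⊙-identity p))) (wt-p 0F))) (trans (wt-block (next i) q) wt-q))))
    (C[m]-distance (x∈C[m] i) λ x≡𝟎 → contradiction
      (trans (sym (product i)) (trans (cong (_· block i p) x≡𝟎) (·-zeroˡ (block i p)))) λ ())
    where
    open ≡-Reasoning
    product : ∀ i → x[ i ] · block i p ≡ 1F
    product i = begin
      x[ i ] · block i p
        ≡⟨ ·-⊕ˡ (block i p) (block (next i) q) (block i p) ⟩
      block i p · block i p +₃ block (next i) q · block i p
        ≡⟨ cong₂ _+₃_ (trans (block-· i p (block i p)) (trans (cong (p ·_) (trans (blockOf-block i p i) (at-same i p))) p·p≡1))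
             (trans (block-· (next i) q (block i p)) (trans (cong (q ·_) (blockOf-block i p (next i))) (q-at (next i)))) ⟩
      1F ∎
      where
      q-at : ∀ k → q · at i p k ≡ 0F
      q-at k with i Fin.≟ k
      ... | yes _ = trans (·-comm q p) p·q≡0
      ... | no _  = ·-zeroʳ q

  lookup-x : ∀ i k l → Vec.lookup x[ i ] (Fin.combine k l) ≡ Vec.lookup (at i p k) l +₃ Vec.lookup (at (next i) q k) l
  lookup-x i k l = begin
    Vec.lookup x[ i ] (Fin.combine k l)                       ≡⟨ lookup-blockOf x[ i ] k l ⟨
    Vec.lookup (blockOf x[ i ] k) l                           ≡⟨ cong (λ v → Vec.lookup v l) (trans (blockOf-⊕ (block i p) (block (next i) q) k)
                                                                   (cong₂ _⊕_ (blockOf-block i p k) (blockOf-block (next i) q k))) ⟩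
    Vec.lookup (at i p k ⊕ at (next i) q k) l                 ≡⟨ lookup-⊕ (at i p k) (at (next i) q k) l ⟩
    Vec.lookup (at i p k) l +₃ Vec.lookup (at (next i) q k) l ∎
    where open ≡-Reasoning

  lookup-at-zero : ∀ i v k l → Vec.lookup v l ≡ 0F → Vec.lookup (at i v k) l ≡ 0F
  lookup-at-zero i v k l e = split (i Fin.≟ k)
    where
    split : (d : Dec (i ≡ k)) → Vec.lookup (if does d then v else 𝟎) l ≡ 0F
    split (yes _) = e
    split (no _)  = lookup-𝟎 l

  x-on-P : ∀ i a → Vec.lookup P a ≡ true → Vec.lookup x[ i ] (Fin.combine i a) ≡ 2F
  x-on-P i a a∈P = trans (lookup-x i i a) (cong₂ _+₃_
    (trans (cong (λ v → Vec.lookup v a) (at-same i p)) (p-on-P a a∈P)) (lookup-at-zero (next i) q i a (q-on-P a a∈P)))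

  x-on-Q : ∀ i b → Vec.lookup Q b ≡ true → Vec.lookup x[ i ] (Fin.combine (next i) b) ≡ 2F
  x-on-Q i b b∈Q = trans (lookup-x i (next i) b) (cong₂ _+₃_
    (lookup-at-zero i p (next i) b (p-on-Q b b∈Q)) (trans (cong (λ v → Vec.lookup v b) (at-same (next i) q)) (q-on-Q b b∈Q)))

  -- Two kinds of test words suffice: words of weight 9 of `D` in a single block, and the `x[ i ]`,
  -- which also have weight 9.
  minimum-words-generate : ∀ z → (∀ y → C[ m ] y → wt y ≡ 9 → y · z ≡ 0F) → C[ m ] z
  minimum-words-generate z orth = C[m]-dual z
    (λ i → D-minimum-words-span (blockOf z i) λ c c∈C wt≡9 c·p≡0 →
      trans (sym (block-· i c z)) (orth (block i c) (block∈C[m] i (c∈C , c·p≡0)) (trans (wt-block i c) wt≡9)))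
    (λ i → orth x[ i ] (x∈C[m] i) (wt-x i))

  -- Orthogonality to the words of weight 9 is a linear condition that suffices for membership, so
  -- closure of C_m follows without rearranging representations by blocks and generators.
  C[m]-⊕ : ∀ {y z} → C[ m ] y → C[ m ] z → C[ m ] (y ⊕ z)
  C[m]-⊕ {y} {z} y∈ z∈ = minimum-words-generate (y ⊕ z) λ w w∈ _ →
    trans (·-⊕ʳ w y z) (cong₂ _+₃_ (C[m]-orthogonal w∈ y∈) (C[m]-orthogonal w∈ z∈))

  C[m]-⊙ : ∀ a {z} → C[ m ] z → C[ m ] (a ⊙ z)
  C[m]-⊙ a {z} z∈ = minimum-words-generate (a ⊙ z) λ w w∈ _ →
    trans (·-⊙ʳ a w z) (trans (cong (a *₃_) (C[m]-orthogonal w∈ z∈)) (*₃-zeroʳ a))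

  C[m]-𝟎 : C[ m ] 𝟎
  C[m]-𝟎 = minimum-words-generate 𝟎 λ w _ _ → ·-zeroʳ w

-- Reduction modulo 3 and integer vectors

mod3-division : ∀ z → ∃[ r ] z ≡ + toℕ (mod3 z) ℤ.+ r ℤ.* + 3
mod3-division z = z ℤ./ℕ 3 , trans (ℤ.a≡a%ℕn+[a/ℕn]*n z 3)
  (cong (λ t → + t ℤ.+ (z ℤ./ℕ 3) ℤ.* + 3) (sym (Fin.toℕ-fromℕ< (ℤ.n%ℕd<d z 3))))

residue-unique : ∀ (a b : F₃) q r → + toℕ a ℤ.+ q ℤ.* + 3 ≡ + toℕ b ℤ.+ r ℤ.* + 3 → a ≡ b
residue-unique a b q r e = small a b (r ℤ.- q) (begin
  + toℕ a ℤ.- + toℕ b                                          ≡⟨ expand (+ toℕ a) (+ toℕ b) q ⟩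
  (+ toℕ a ℤ.+ q ℤ.* + 3) ℤ.- (+ toℕ b ℤ.+ q ℤ.* + 3)          ≡⟨ cong (ℤ._- (+ toℕ b ℤ.+ q ℤ.* + 3)) e ⟩
  (+ toℕ b ℤ.+ r ℤ.* + 3) ℤ.- (+ toℕ b ℤ.+ q ℤ.* + 3)          ≡⟨ collect (+ toℕ b) q r ⟩
  (r ℤ.- q) ℤ.* + 3                                            ∎)
  where
  open ≡-Reasoning
  expand : ∀ a b q → a ℤ.- b ≡ (a ℤ.+ q ℤ.* + 3) ℤ.- (b ℤ.+ q ℤ.* + 3)
  expand = ℤ-Solver.solve-∀
  collect : ∀ b q r → (b ℤ.+ r ℤ.* + 3) ℤ.- (b ℤ.+ q ℤ.* + 3) ≡ (r ℤ.- q) ℤ.* + 3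
  collect = ℤ-Solver.solve-∀
  small : ∀ (a b : F₃) s → + toℕ a ℤ.- + toℕ b ≡ s ℤ.* + 3 → a ≡ b
  small 0F 0F s _ = refl
  small 1F 1F s _ = refl
  small 2F 2F s _ = refl
  small 0F 1F (+ 0) ()
  small 0F 1F (+ suc _) ()
  small 0F 1F -[1+ _ ] ()
  small 0F 2F (+ 0) ()
  small 0F 2F (+ suc _) ()
  small 0F 2F -[1+ _ ] ()
  small 1F 0F (+ 0) ()
  small 1F 0F (+ suc _) ()
  small 1F 0F -[1+ _ ] ()
  small 1F 2F (+ 0) ()
  small 1F 2F (+ suc _) ()
  small 1F 2F -[1+ _ ] ()
  small 2F 0F (+ 0) ()
  small 2F 0F (+ suc _) ()
  small 2F 0F -[1+ _ ] ()
  small 2F 1F (+ 0) ()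
  small 2F 1F (+ suc _) ()
  small 2F 1F -[1+ _ ] ()

mod3-unique : ∀ z a r → z ≡ + toℕ a ℤ.+ r ℤ.* + 3 → mod3 z ≡ a
mod3-unique z a r e with mod3-division z
... | q , e′ = residue-unique (mod3 z) a q r (trans (sym e′) e)

+₃-residue : ∀ a b → ∃[ r ] + (toℕ a ℕ.+ toℕ b) ≡ + toℕ (a +₃ b) ℤ.+ r ℤ.* + 3
+₃-residue a b = mod3-division (+ (toℕ a ℕ.+ toℕ b))

*₃-residue : ∀ a b → ∃[ r ] + (toℕ a ℕ.* toℕ b) ≡ + toℕ (a *₃ b) ℤ.+ r ℤ.* + 3
*₃-residue a b = mod3-division (+ (toℕ a ℕ.* toℕ b))

mod3-+ : ∀ x y → mod3 (x ℤ.+ y) ≡ mod3 x +₃ mod3 y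
mod3-+ x y with mod3-division x | mod3-division y | +₃-residue (mod3 x) (mod3 y)
... | q , ex | r , ey | s , es = mod3-unique (x ℤ.+ y) (mod3 x +₃ mod3 y) (s ℤ.+ q ℤ.+ r) (begin
  x ℤ.+ y                                                           ≡⟨ cong₂ ℤ._+_ ex ey ⟩
  (a ℤ.+ q ℤ.* + 3) ℤ.+ (b ℤ.+ r ℤ.* + 3)                           ≡⟨ regroup a b q r ⟩
  (a ℤ.+ b) ℤ.+ (q ℤ.+ r) ℤ.* + 3                                   ≡⟨ cong (ℤ._+ (q ℤ.+ r) ℤ.* + 3) es ⟩
  (+ toℕ (mod3 x +₃ mod3 y) ℤ.+ s ℤ.* + 3) ℤ.+ (q ℤ.+ r) ℤ.* + 3    ≡⟨ collect (+ toℕ (mod3 x +₃ mod3 y)) s q r ⟩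
  + toℕ (mod3 x +₃ mod3 y) ℤ.+ (s ℤ.+ q ℤ.+ r) ℤ.* + 3              ∎)
  where
  open ≡-Reasoning
  a = + toℕ (mod3 x)
  b = + toℕ (mod3 y)
  regroup : ∀ a b q r → (a ℤ.+ q ℤ.* + 3) ℤ.+ (b ℤ.+ r ℤ.* + 3) ≡ (a ℤ.+ b) ℤ.+ (q ℤ.+ r) ℤ.* + 3
  regroup = ℤ-Solver.solve-∀
  collect : ∀ t s q r → (t ℤ.+ s ℤ.* + 3) ℤ.+ (q ℤ.+ r) ℤ.* + 3 ≡ t ℤ.+ (s ℤ.+ q ℤ.+ r) ℤ.* + 3
  collect = ℤ-Solver.solve-∀

mod3-* : ∀ x y → mod3 (x ℤ.* y) ≡ mod3 x *₃ mod3 y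
mod3-* x y with mod3-division x | mod3-division y | *₃-residue (mod3 x) (mod3 y)
... | q , ex | r , ey | s , es = mod3-unique (x ℤ.* y) (mod3 x *₃ mod3 y)
  (s ℤ.+ (q ℤ.* b ℤ.+ a ℤ.* r ℤ.+ q ℤ.* r ℤ.* + 3)) (begin
  x ℤ.* y                                                           ≡⟨ cong₂ ℤ._*_ ex ey ⟩
  (a ℤ.+ q ℤ.* + 3) ℤ.* (b ℤ.+ r ℤ.* + 3)                           ≡⟨ regroup a b q r ⟩
  a ℤ.* b ℤ.+ (q ℤ.* b ℤ.+ a ℤ.* r ℤ.+ q ℤ.* r ℤ.* + 3) ℤ.* + 3     ≡⟨ cong (ℤ._+ (q ℤ.* b ℤ.+ a ℤ.* r ℤ.+ q ℤ.* r ℤ.* + 3) ℤ.* + 3)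
    (trans (sym (ℤ.pos-* (toℕ (mod3 x)) (toℕ (mod3 y)))) es) ⟩
  (c ℤ.+ s ℤ.* + 3) ℤ.+ (q ℤ.* b ℤ.+ a ℤ.* r ℤ.+ q ℤ.* r ℤ.* + 3) ℤ.* + 3 ≡⟨ collect c s (q ℤ.* b ℤ.+ a ℤ.* r ℤ.+ q ℤ.* r ℤ.* + 3) ⟩
  c ℤ.+ (s ℤ.+ (q ℤ.* b ℤ.+ a ℤ.* r ℤ.+ q ℤ.* r ℤ.* + 3)) ℤ.* + 3   ∎)
  where
  open ≡-Reasoning
  a = + toℕ (mod3 x)
  b = + toℕ (mod3 y)
  c = + toℕ (mod3 x *₃ mod3 y)
  regroup : ∀ a b q r → (a ℤ.+ q ℤ.* + 3) ℤ.* (b ℤ.+ r ℤ.* + 3) ≡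
    a ℤ.* b ℤ.+ (q ℤ.* b ℤ.+ a ℤ.* r ℤ.+ q ℤ.* r ℤ.* + 3) ℤ.* + 3
  regroup = ℤ-Solver.solve-∀
  collect : ∀ t s u → (t ℤ.+ s ℤ.* + 3) ℤ.+ u ℤ.* + 3 ≡ t ℤ.+ (s ℤ.+ u) ℤ.* + 3
  collect = ℤ-Solver.solve-∀

mod3≡0 : ∀ z → mod3 z ≡ 0F → ∃[ r ] z ≡ r ℤ.* + 3
mod3≡0 z e with mod3-division z
... | r , e′ = r , trans e′ (trans (cong (λ a → + toℕ a ℤ.+ r ℤ.* + 3) e) (ℤ.+-identityˡ (r ℤ.* + 3)))

ip : ∀ {n} → Vec ℤ n → Vec ℤ n → ℤ
ip z z′ = Vec.foldr′ ℤ._+_ 0ℤ (Vec.zipWith ℤ._*_ z z′)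

infixl 6 _+ᵥ_
_+ᵥ_ : ∀ {n} → Vec ℤ n → Vec ℤ n → Vec ℤ n
_+ᵥ_ = Vec.zipWith ℤ._+_

0ᵥ : ∀ {n} → Vec ℤ n
0ᵥ = Vec.replicate _ 0ℤ

ip-sum : ∀ {n} (x y : Vec ℤ n) → ip x y ≡ Σℤ.sum (λ i → Vec.lookup x i ℤ.* Vec.lookup y i)
ip-sum []      []      = refl
ip-sum (a ∷ x) (b ∷ y) = cong (λ r → a ℤ.* b ℤ.+ r) (ip-sum x y)

ip-comm : ∀ {n} (x y : Vec ℤ n) → ip x y ≡ ip y x
ip-comm []      []      = refl
ip-comm (a ∷ x) (b ∷ y) = cong₂ ℤ._+_ (ℤ.*-comm a b) (ip-comm x y)

ip-mod3 : ∀ {n} (x y : Vec ℤ n) → mod3 (ip x y) ≡ Vec.map mod3 x · Vec.map mod3 y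
ip-mod3 []      []      = refl
ip-mod3 (a ∷ x) (b ∷ y) = trans (mod3-+ (a ℤ.* b) (ip x y)) (cong₂ _+₃_ (mod3-* a b) (ip-mod3 x y))

map-mod3-+ : ∀ {n} (x y : Vec ℤ n) → Vec.map mod3 (x +ᵥ y) ≡ Vec.map mod3 x ⊕ Vec.map mod3 y
map-mod3-+ []      []      = refl
map-mod3-+ (a ∷ x) (b ∷ y) = cong₂ _∷_ (mod3-+ a b) (map-mod3-+ x y)

negᵥ : ∀ {n} → Vec ℤ n → Vec ℤ n
negᵥ = Vec.map (λ a → ℤ.- a)

map-mod3-neg : ∀ {n} (x : Vec ℤ n) → Vec.map mod3 (negᵥ x) ≡ 2F ⊙ Vec.map mod3 x
map-mod3-neg []      = refl
map-mod3-neg (a ∷ x) = cong₂ _∷_ (trans (cong mod3 (sym (ℤ.-1*i≡-i a))) (mod3-* -1ℤ a)) (map-mod3-neg x)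

ip-neg : ∀ {n} (x y : Vec ℤ n) → ip (negᵥ x) y ≡ ℤ.- ip x y
ip-neg []      []      = refl
ip-neg (a ∷ x) (b ∷ y) = trans (cong₂ ℤ._+_ (sym (ℤ.neg-distribˡ-* a b)) (ip-neg x y))
  (sym (ℤ.neg-distrib-+ (a ℤ.* b) (ip x y)))

ip-square : ∀ {n} (x y : Vec ℤ n) → ip (x +ᵥ y) (x +ᵥ y) ≡ ip x x ℤ.+ ip y y ℤ.+ + 2 ℤ.* ip x y
ip-square []      []      = refl
ip-square (a ∷ x) (b ∷ y) = trans (cong (λ r → (a ℤ.+ b) ℤ.* (a ℤ.+ b) ℤ.+ r) (ip-square x y))
  (lemma a b (ip x x) (ip y y) (ip x y))
  where
  lemma : ∀ a b u v w → (a ℤ.+ b) ℤ.* (a ℤ.+ b) ℤ.+ (u ℤ.+ v ℤ.+ + 2 ℤ.* w) ≡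
    (a ℤ.* a ℤ.+ u) ℤ.+ (b ℤ.* b ℤ.+ v) ℤ.+ + 2 ℤ.* (a ℤ.* b ℤ.+ w)
  lemma = ℤ-Solver.solve-∀

square-nonneg : ∀ a → 0ℤ ℤ.≤ a ℤ.* a
square-nonneg (+ n)    = subst (0ℤ ℤ.≤_) (ℤ.pos-* n n) (ℤ.+≤+ z≤n)
square-nonneg -[1+ n ] = ℤ.+≤+ z≤n

square-positive : ∀ a → a ≢ 0ℤ → 1ℤ ℤ.≤ a ℤ.* a
square-positive (+ zero)  a≢0 = contradiction refl a≢0
square-positive (+ suc n) _   = ℤ.+≤+ (s≤s z≤n)
square-positive -[1+ n ]  _   = ℤ.+≤+ (s≤s z≤n)

ip-nonneg : ∀ {n} (x : Vec ℤ n) → 0ℤ ℤ.≤ ip x x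
ip-nonneg []      = ℤ.≤-refl
ip-nonneg (a ∷ x) = ℤ.+-mono-≤ (square-nonneg a) (ip-nonneg x)

ip-≥-square : ∀ {n} (x : Vec ℤ n) i → Vec.lookup x i ℤ.* Vec.lookup x i ℤ.≤ ip x x
ip-≥-square (a ∷ x) zero    = subst (ℤ._≤ ip (a ∷ x) (a ∷ x)) (ℤ.+-identityʳ (a ℤ.* a)) (ℤ.+-monoʳ-≤ (a ℤ.* a) (ip-nonneg x))
ip-≥-square (a ∷ x) (suc i) = ℤ.≤-trans (ip-≥-square x i)
  (subst (ℤ._≤ ip (a ∷ x) (a ∷ x)) (ℤ.+-identityˡ (ip x x)) (ℤ.+-monoˡ-≤ (ip x x) (square-nonneg a)))

wt-≤-ip : ∀ {n} (x : Vec ℤ n) → + wt (Vec.map mod3 x) ℤ.≤ ip x x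
wt-≤-ip []      = ℤ.≤-refl
wt-≤-ip (a ∷ x) = split (mod3 a) refl
  where
  split : ∀ r → mod3 a ≡ r → + wt (mod3 a ∷ Vec.map mod3 x) ℤ.≤ ip (a ∷ x) (a ∷ x)
  split zero    e = subst (λ t → + wt (t ∷ Vec.map mod3 x) ℤ.≤ ip (a ∷ x) (a ∷ x)) (sym e)
    (subst (ℤ._≤ ip (a ∷ x) (a ∷ x)) (ℤ.+-identityˡ (+ wt (Vec.map mod3 x))) (ℤ.+-mono-≤ (square-nonneg a) (wt-≤-ip x)))
  split (suc r) e = subst (λ t → + wt (t ∷ Vec.map mod3 x) ℤ.≤ ip (a ∷ x) (a ∷ x)) (sym e)
    (ℤ.+-mono-≤ (square-positive a a≢0) (wt-≤-ip x))
    where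
    a≢0 : a ≢ 0ℤ
    a≢0 refl = contradiction e λ ()

lift : F₃ → ℤ
lift 0F = 0ℤ
lift 1F = 1ℤ
lift 2F = -1ℤ

map-mod3-lift : ∀ {n} (x : F₃^ n) → Vec.map mod3 (Vec.map lift x) ≡ x
map-mod3-lift []       = refl
map-mod3-lift (0F ∷ x) = cong (0F ∷_) (map-mod3-lift x)
map-mod3-lift (1F ∷ x) = cong (1F ∷_) (map-mod3-lift x)
map-mod3-lift (2F ∷ x) = cong (2F ∷_) (map-mod3-lift x)

ip-lift : ∀ {n} (x : F₃^ n) → ip (Vec.map lift x) (Vec.map lift x) ≡ + wt x
ip-lift []       = refl
ip-lift (0F ∷ x) = trans (ℤ.+-identityˡ _) (ip-lift x)
ip-lift (1F ∷ x) = cong (λ r → 1ℤ ℤ.+ r) (ip-lift x)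
ip-lift (2F ∷ x) = cong (λ r → 1ℤ ℤ.+ r) (ip-lift x)

frame : ∀ {n} → Fin n → Vec ℤ n
frame j = 0ᵥ [ j ]≔ + 3

ip-0ᵥ : ∀ {n} (z : Vec ℤ n) → ip z 0ᵥ ≡ 0ℤ
ip-0ᵥ []      = refl
ip-0ᵥ (a ∷ z) = cong₂ ℤ._+_ (ℤ.*-zeroʳ a) (ip-0ᵥ z)

ip-frame : ∀ {n} (z : Vec ℤ n) j → ip z (frame j) ≡ Vec.lookup z j ℤ.* + 3
ip-frame (a ∷ z) zero    = trans (cong (λ r → a ℤ.* + 3 ℤ.+ r) (ip-0ᵥ z)) (ℤ.+-identityʳ (a ℤ.* + 3))
ip-frame (a ∷ z) (suc j) = trans (cong₂ ℤ._+_ (ℤ.*-zeroʳ a) (ip-frame z j)) (ℤ.+-identityˡ _)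

lookup-frame : ∀ {n} (j : Fin n) → Vec.lookup (frame j) j ≡ + 3
lookup-frame j = Vec.lookup∘update j 0ᵥ (+ 3)

lookup-frame′ : ∀ {n} {i j : Fin n} → i ≢ j → Vec.lookup (frame j) i ≡ 0ℤ
lookup-frame′ {i = i} {j} i≢j = trans (Vec.lookup∘update′ i≢j 0ᵥ (+ 3)) (Vec.lookup-replicate i 0ℤ)

map-mod3-frame : ∀ {n} (j : Fin n) → Vec.map mod3 (frame j) ≡ 𝟎
map-mod3-frame {n} j = Vec-ext λ i → trans (Vec.lookup-map i mod3 (frame j)) (trans (at i (i Fin.≟ j)) (sym (lookup-𝟎 i)))
  where
  at : ∀ i → Dec (i ≡ j) → mod3 (Vec.lookup (frame j) i) ≡ 0F
  at i (yes refl) = cong mod3 (lookup-frame i)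
  at i (no i≢j)   = cong mod3 (lookup-frame′ i≢j)

/3-mono : ∀ {i j} → i ℤ.≤ j → i ℚ./ 3 ℚ.≤ j ℚ./ 3
/3-mono {i} {j} i≤j = ℚ.toℚᵘ-cancel-≤ (ℚᵘ.≤-respˡ-≃ (ℚᵘ.≃-sym (ℚ.toℚᵘ-fromℚᵘ (ℚᵘ.mkℚᵘ i 2)))
  (ℚᵘ.≤-respʳ-≃ (ℚᵘ.≃-sym (ℚ.toℚᵘ-fromℚᵘ (ℚᵘ.mkℚᵘ j 2))) (ℚᵘ.*≤* (ℤ.*-monoʳ-≤-nonNeg (+ 3) i≤j))))

/3-cancel : ∀ {i j} → i ℚ./ 3 ℚ.≤ j ℚ./ 3 → i ℤ.≤ j
/3-cancel {i} {j} i≤j = ℤ.*-cancelʳ-≤-pos i j (+ 3) (ℚᵘ.drop-*≤* (ℚᵘ.≤-respˡ-≃ (ℚ.toℚᵘ-fromℚᵘ (ℚᵘ.mkℚᵘ i 2))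
  (ℚᵘ.≤-respʳ-≃ (ℚ.toℚᵘ-fromℚᵘ (ℚᵘ.mkℚᵘ j 2)) (ℚ.toℚᵘ-mono-≤ i≤j))))

/3≡/1 : ∀ {i j} → i ℚ./ 3 ≡ j ℚ./ 1 → i ≡ j ℤ.* + 3
/3≡/1 {i} {j} e = trans (sym (ℤ.*-identityʳ i)) (ℚᵘ.drop-*≡* (ℚᵘ.≃-trans (ℚᵘ.≃-sym (ℚ.toℚᵘ-fromℚᵘ (ℚᵘ.mkℚᵘ i 2)))
  (ℚᵘ.≃-trans (ℚᵘ.≃-reflexive (cong ℚ.toℚᵘ e)) (ℚ.toℚᵘ-fromℚᵘ (ℚᵘ.mkℚᵘ j 0)))))

/3≡/1′ : ∀ {i j} → i ≡ j ℤ.* + 3 → i ℚ./ 3 ≡ j ℚ./ 1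
/3≡/1′ {i} {j} e = ℚ.fromℚᵘ-cong {ℚᵘ.mkℚᵘ i 2} {ℚᵘ.mkℚᵘ j 0} (ℚᵘ.*≡* (trans (ℤ.*-identityʳ i) e))

-- The hypotheses say 9 ≤ 18 + 6r and 9 ≤ 18 - 6r, that is, 2|r| ≤ 3.
bounded : ∀ r → + 9 ℤ.≤ + 18 ℤ.+ + 2 ℤ.* (r ℤ.* + 3) → + 9 ℤ.≤ + 18 ℤ.+ + 2 ℤ.* (ℤ.- (r ℤ.* + 3)) →
        r ≡ 0ℤ ⊎ r ≡ 1ℤ ⊎ r ≡ -1ℤ
bounded (+ 0) _ _ = inj₁ refl
bounded (+ 1) _ _ = inj₂ (inj₁ refl)
bounded (+ suc (suc n)) _ u = contradiction (bound (ℤ.≤-trans u (ℤ.≤-reflexive (flip (+ n))))) (ℤ.<⇒≱ (ℤ.+<+ (ℕ.≤ᵇ⇒≤ 7 9 _)))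
  where
  flip : ∀ n → + 18 ℤ.+ + 2 ℤ.* (ℤ.- ((+ 2 ℤ.+ n) ℤ.* + 3)) ≡ + 6 ℤ.- n ℤ.* + 6
  flip = ℤ-Solver.solve-∀
  bound : + 9 ℤ.≤ + 6 ℤ.- + n ℤ.* + 6 → + 9 ℤ.≤ + 6
  bound le = ℤ.≤-trans le (ℤ.i-j≤i (+ 6) (+ n ℤ.* + 6) {{ℤ.nonNegative (ℤ.*-monoʳ-≤-nonNeg (+ 6) (ℤ.+≤+ {n = n} z≤n))}})
bounded -[1+ 0 ] _ _ = inj₂ (inj₂ refl)
bounded -[1+ suc n ] l _ = contradiction (bound (ℤ.≤-trans l (ℤ.≤-reflexive (flip (+ n))))) (ℤ.<⇒≱ (ℤ.+<+ (ℕ.≤ᵇ⇒≤ 7 9 _)))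
  where
  flip : ∀ n → + 18 ℤ.+ + 2 ℤ.* ((ℤ.- (+ 2 ℤ.+ n)) ℤ.* + 3) ≡ + 6 ℤ.- n ℤ.* + 6
  flip = ℤ-Solver.solve-∀
  bound : + 9 ℤ.≤ + 6 ℤ.- + n ℤ.* + 6 → + 9 ℤ.≤ + 6
  bound le = ℤ.≤-trans le (ℤ.i-j≤i (+ 6) (+ n ℤ.* + 6) {{ℤ.nonNegative (ℤ.*-monoʳ-≤-nonNeg (+ 6) (ℤ.+≤+ {n = n} z≤n))}})

-- The lattice L_m and its minimal vectors

-- Inner products are kept as integers, three times the true ones; minimal norm 3 appears as 9.
module Lattice (setup : Setup) (m : ℕ) (m≥1 : m ≥ 1) where
  open LongCode setup m
  open Construction setup using (C[_])

  N : ℕ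
  N = m ℕ.* 24

  Lm : Vec ℤ N → Set
  Lm z = C[ m ] (Vec.map mod3 z)

  Lm-+ : ∀ x y → Lm x → Lm y → Lm (x +ᵥ y)
  Lm-+ x y x∈ y∈ = subst C[ m ] (sym (map-mod3-+ x y)) (C[m]-⊕ {Vec.map mod3 x} {Vec.map mod3 y} x∈ y∈)

  Lm-neg : ∀ x → Lm x → Lm (negᵥ x)
  Lm-neg x x∈ = subst C[ m ] (sym (map-mod3-neg x)) (C[m]-⊙ 2F {Vec.map mod3 x} x∈)

  Lm-frame : ∀ j → Lm (frame j)
  Lm-frame j = subst C[ m ] (sym (map-mod3-frame j)) C[m]-𝟎

  Lm? : ∀ z → Dec (Lm z)
  Lm? z = C[m]? (Vec.map mod3 z)

  coordinate₀ : Fin N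
  coordinate₀ = Fin.fromℕ< {0} (ℕ.*-mono-< {0} {m} {0} {24} m≥1 (s≤s z≤n))

  -- If the reduction modulo 3 is nonzero, it has at least 9 nonzero entries, each of which
  -- contributes at least 1. Otherwise all entries are multiples of 3, and a single nonzero one
  -- contributes 9.
  ip-minimum : ∀ z → Lm z → z ≢ 0ᵥ → + 9 ℤ.≤ ip z z
  ip-minimum z z∈ z≢0 with Vec.map mod3 z ≟ᵥ 𝟎
  ... | no ≢𝟎 = ℤ.≤-trans (ℤ.+≤+ (C[m]-distance z∈ ≢𝟎)) (wt-≤-ip z)
  ... | yes e with Fin.any? (λ i → ¬? (Vec.lookup z i ℤ.≟ 0ℤ))
  ...   | no none = contradiction (Vec-ext λ i → trans (zero-at i) (sym (Vec.lookup-replicate i 0ℤ))) z≢0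
    where
    zero-at : ∀ i → Vec.lookup z i ≡ 0ℤ
    zero-at i with Vec.lookup z i ℤ.≟ 0ℤ
    ... | yes e  = e
    ... | no ≢0 = contradiction (i , ≢0) none
  ...   | yes (i , zᵢ≢0) with mod3≡0 (Vec.lookup z i) (trans (sym (Vec.lookup-map i mod3 z)) (trans (cong (λ v → Vec.lookup v i) e) (lookup-𝟎 i)))
  ...     | r , zᵢ≡3r = ℤ.≤-trans (subst (+ 9 ℤ.≤_) (sym (trans (cong (λ t → t ℤ.* t) zᵢ≡3r) (nine r)))
      (ℤ.*-monoˡ-≤-nonNeg (+ 9) (square-positive r λ where refl → zᵢ≢0 zᵢ≡3r)))
      (ip-≥-square z i)
    where
    nine : ∀ r → r ℤ.* + 3 ℤ.* (r ℤ.* + 3) ≡ + 9 ℤ.* (r ℤ.* r)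
    nine = ℤ-Solver.solve-∀

  ip-frame-frame : ∀ (j : Fin N) → ip (frame j) (frame j) ≡ + 9
  ip-frame-frame j = trans (ip-frame (frame j) j) (cong (ℤ._* + 3) (lookup-frame j))

  ip≢0 : ∀ {z : Vec ℤ N} {r} → ip z z ≡ + suc r → z ≢ 0ᵥ
  ip≢0 e refl = contradiction (trans (sym (ip-0ᵥ {N} 0ᵥ)) e) λ ()

  to-Min : ∀ z → Lm z → ip z z ≡ + 9 → Min (L setup m) z
  to-Min z z∈ e = z∈ , ip≢0 e , λ z′ z′∈ z′≢0 →
    /3-mono (ℤ.≤-trans (ℤ.≤-reflexive e) (ip-minimum z′ z′∈ z′≢0))

  Min-ip : ∀ z → Min (L setup m) z → ip z z ≡ + 9
  Min-ip z (z∈ , z≢0 , minimal) = ℤ.≤-antisym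
    (ℤ.≤-trans (/3-cancel (minimal (frame coordinate₀) (Lm-frame coordinate₀) (ip≢0 (ip-frame-frame coordinate₀))))
      (ℤ.≤-reflexive (ip-frame-frame coordinate₀)))
    (ip-minimum z z∈ z≢0)

  frame-Min : ∀ j → Min (L setup m) (frame j)
  frame-Min j = to-Min (frame j) (Lm-frame j) (ip-frame-frame j)

  lift-Min : ∀ c → C[ m ] c → wt c ≡ 9 → Min (L setup m) (Vec.map lift c)
  lift-Min c c∈ wt≡9 = to-Min (Vec.map lift c) (subst C[ m ] (sym (map-mod3-lift c)) c∈) (trans (ip-lift c) (cong +_ wt≡9))

  -- Divisibility by 3 is integrality of the true inner product. The lifts of words of weight 9 are
  -- minimal and already test membership of the reduction in C_m, so every integer vector in the
  -- dual belongs to the lattice.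
  minimal-vectors-generate : ∀ s → (∀ z → Min (L setup m) z → ∃[ r ] ip z s ≡ r ℤ.* + 3) → Lm s
  minimal-vectors-generate s h = minimum-words-generate (Vec.map mod3 s) λ c c∈ wt≡9 →
    let r , e = h (Vec.map lift c) (lift-Min c c∈ wt≡9) in begin
    c · Vec.map mod3 s                              ≡⟨ cong (_· Vec.map mod3 s) (map-mod3-lift c) ⟨
    Vec.map mod3 (Vec.map lift c) · Vec.map mod3 s  ≡⟨ ip-mod3 (Vec.map lift c) s ⟨
    mod3 (ip (Vec.map lift c) s)                    ≡⟨ mod3-unique _ 0F r (trans e (sym (ℤ.+-identityˡ (r ℤ.* + 3)))) ⟩
    0F                                              ∎
    where open ≡-Reasoning

  negᵥ-involutive : ∀ (x : Vec ℤ N) → negᵥ (negᵥ x) ≡ x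
  negᵥ-involutive x = Vec-ext λ i → trans (Vec.lookup-map i (λ a → ℤ.- a) (negᵥ x))
    (trans (cong (λ t → ℤ.- t) (Vec.lookup-map i (λ a → ℤ.- a) x)) (ℤ.neg-involutive (Vec.lookup x i)))

  sum≢0 : ∀ {x y : Vec ℤ N} → x ≢ negᵥ y → x +ᵥ y ≢ 0ᵥ
  sum≢0 {x} {y} x≢-y e = x≢-y (Vec-ext λ i → begin
    Vec.lookup x i                                         ≡⟨ cancel (Vec.lookup x i) (Vec.lookup y i) ⟩
    (Vec.lookup x i ℤ.+ Vec.lookup y i) ℤ.- Vec.lookup y i ≡⟨ cong (ℤ._- Vec.lookup y i) (trans (sym (Vec.lookup-zipWith ℤ._+_ i x y))
      (trans (cong (λ v → Vec.lookup v i) e) (Vec.lookup-replicate i 0ℤ))) ⟩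
    0ℤ ℤ.- Vec.lookup y i                                  ≡⟨ trans (ℤ.+-identityˡ _) (sym (Vec.lookup-map i (λ a → ℤ.- a) y)) ⟩
    Vec.lookup (negᵥ y) i                                  ∎)
    where
    open ≡-Reasoning
    cancel : ∀ a b → a ≡ (a ℤ.+ b) ℤ.- b
    cancel = ℤ-Solver.solve-∀

  -- |x ± y|² ≥ 9 bounds the inner product of independent minimal vectors.
  Min-ip-small : ∀ x y → Min (L setup m) x → Min (L setup m) y → x ≢ y → x ≢ negᵥ y →
                 ∃[ r ] ip x y ≡ r ℤ.* + 3 × (r ≡ 0ℤ ⊎ r ≡ 1ℤ ⊎ r ≡ -1ℤ)
  Min-ip-small x y x∈ y∈ x≢y x≢-y = r , e , bounded r lower upper
    where
    divisible : ∃[ r ] ip x y ≡ r ℤ.* + 3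
    divisible = mod3≡0 (ip x y) (trans (ip-mod3 x y) (C[m]-orthogonal {Vec.map mod3 x} {Vec.map mod3 y} (proj₁ x∈) (proj₁ y∈)))
    r : ℤ
    r = proj₁ divisible
    e : ip x y ≡ r ℤ.* + 3
    e = proj₂ divisible
    open ℤ.≤-Reasoning
    lower : + 9 ℤ.≤ + 18 ℤ.+ + 2 ℤ.* (r ℤ.* + 3)
    lower = begin
      + 9                                        ≤⟨ ip-minimum (x +ᵥ y) (Lm-+ x y (proj₁ x∈) (proj₁ y∈)) (sum≢0 x≢-y) ⟩
      ip (x +ᵥ y) (x +ᵥ y)                       ≡⟨ ip-square x y ⟩
      ip x x ℤ.+ ip y y ℤ.+ + 2 ℤ.* ip x y       ≡⟨ cong₂ (λ a b → a ℤ.+ + 2 ℤ.* b) (cong₂ ℤ._+_ (Min-ip x x∈) (Min-ip y y∈)) e ⟩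
      + 18 ℤ.+ + 2 ℤ.* (r ℤ.* + 3)               ∎
    -y∈ : Lm (negᵥ y)
    -y∈ = Lm-neg y (proj₁ y∈)
    upper : + 9 ℤ.≤ + 18 ℤ.+ + 2 ℤ.* (ℤ.- (r ℤ.* + 3))
    upper = begin
      + 9
        ≤⟨ ip-minimum (x +ᵥ negᵥ y) (Lm-+ x (negᵥ y) (proj₁ x∈) -y∈) (sum≢0 λ x≡ → x≢y (trans x≡ (negᵥ-involutive y))) ⟩
      ip (x +ᵥ negᵥ y) (x +ᵥ negᵥ y)
        ≡⟨ ip-square x (negᵥ y) ⟩
      ip x x ℤ.+ ip (negᵥ y) (negᵥ y) ℤ.+ + 2 ℤ.* ip x (negᵥ y)
        ≡⟨ cong₂ (λ a b → a ℤ.+ + 2 ℤ.* b) (cong₂ ℤ._+_ (Min-ip x x∈) (trans (trans (ip-neg y (negᵥ y))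
             (cong (λ t → ℤ.- t) (trans (ip-comm y (negᵥ y)) (ip-neg y y)))) (trans (ℤ.neg-involutive (ip y y)) (Min-ip y y∈))))
             (trans (ip-comm x (negᵥ y)) (trans (ip-neg y x) (cong (λ t → ℤ.- t) (trans (ip-comm y x) e)))) ⟩
      + 18 ℤ.+ + 2 ℤ.* (ℤ.- (r ℤ.* + 3)) ∎

-- Rational vectors and the number of orthogonal ones

ℚ-ring : AlmostCommutativeRing 0ℓ 0ℓ
ℚ-ring = fromCommutativeRing ℚ.+-*-commutativeRing λ p → dec⇒maybe (0ℚ ℚ.≟ p)

module Σℚ = Sums ℚ.+-0-commutativeMonoid id

sum-scale : ∀ {n} c (f : Fin n → ℚ) → c ℚ.* Σℚ.sum f ≡ Σℚ.sum (λ i → c ℚ.* f i)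
sum-scale {zero}  c f = ℚ.*-zeroʳ c
sum-scale {suc n} c f = trans (ℚ.*-distribˡ-+ c (f zero) (Σℚ.sum (f ∘ suc))) (cong (c ℚ.* f zero ℚ.+_) (sum-scale c (f ∘ suc)))

sum-mono : ∀ {n} {f h : Fin n → ℚ} → (∀ i → f i ℚ.≤ h i) → Σℚ.sum f ℚ.≤ Σℚ.sum h
sum-mono {zero}  f≤h = ℚ.≤-refl
sum-mono {suc n} f≤h = ℚ.+-mono-≤ (f≤h zero) (sum-mono (f≤h ∘ suc))

sum-nonneg : ∀ {n} {f : Fin n → ℚ} → (∀ i → 0ℚ ℚ.≤ f i) → 0ℚ ℚ.≤ Σℚ.sum f
sum-nonneg {n} {f} 0≤f = subst (ℚ._≤ Σℚ.sum f) (Σℚ.sum-ε {n} {λ _ → 0ℚ} (λ _ → refl)) (sum-mono 0≤f)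

sum-≥-term : ∀ {n} {f : Fin n → ℚ} → (∀ i → 0ℚ ℚ.≤ f i) → ∀ i → f i ℚ.≤ Σℚ.sum f
sum-≥-term {f = f} 0≤f zero    = subst (ℚ._≤ Σℚ.sum f) (ℚ.+-identityʳ (f zero)) (ℚ.+-monoʳ-≤ (f zero) (sum-nonneg (0≤f ∘ suc)))
sum-≥-term {f = f} 0≤f (suc i) = ℚ.≤-trans (sum-≥-term (0≤f ∘ suc) i)
  (subst (ℚ._≤ Σℚ.sum f) (ℚ.+-identityˡ (Σℚ.sum (f ∘ suc))) (ℚ.+-monoˡ-≤ (Σℚ.sum (f ∘ suc)) (0≤f zero)))

ℚ-square-nonneg : ∀ q → 0ℚ ℚ.≤ q ℚ.* q
ℚ-square-nonneg q with ℚ.≤-total 0ℚ q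
... | inj₁ 0≤q = subst (ℚ._≤ q ℚ.* q) (ℚ.*-zeroˡ q) (ℚ.*-monoʳ-≤-nonNeg q {{ℚ.nonNegative 0≤q}} 0≤q)
... | inj₂ q≤0 = subst (ℚ._≤ q ℚ.* q) (ℚ.*-zeroˡ q) (ℚ.*-monoʳ-≤-nonPos q {{ℚ.nonPositive q≤0}} q≤0)

ℚ-square≡0 : ∀ q → q ℚ.* q ≡ 0ℚ → q ≡ 0ℚ
ℚ-square≡0 q e with q ℚ.≟ 0ℚ
... | yes q≡0 = q≡0
... | no q≢0  = begin
  q                          ≡⟨ ℚ.*-identityˡ q ⟨
  1ℚ ℚ.* q                   ≡⟨ cong (ℚ._* q) (ℚ.*-inverseˡ q) ⟨
  (ℚ.1/ q) ℚ.* q ℚ.* q       ≡⟨ ℚ.*-assoc (ℚ.1/ q) q q ⟩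
  (ℚ.1/ q) ℚ.* (q ℚ.* q)     ≡⟨ cong (ℚ.1/ q ℚ.*_) e ⟩
  (ℚ.1/ q) ℚ.* 0ℚ            ≡⟨ ℚ.*-zeroʳ (ℚ.1/ q) ⟩
  0ℚ                         ∎
  where
  open ≡-Reasoning
  instance q-nonZero = ℚ.≢-nonZero q≢0

-- inv 0 = 0.
inv : ℚ → ℚ
inv q with q ℚ.≟ 0ℚ
... | yes _  = 0ℚ
... | no q≢0 = ℚ.1/_ q {{ℚ.≢-nonZero q≢0}}

inv-inverse : ∀ q → q ≢ 0ℚ → inv q ℚ.* q ≡ 1ℚ
inv-inverse q q≢0 with q ℚ.≟ 0ℚ
... | yes q≡0 = contradiction q≡0 q≢0
... | no q≢0′ = ℚ.*-inverseˡ q {{ℚ.≢-nonZero q≢0′}}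

inv-positive : ∀ q → 0ℚ ℚ.< q → 0ℚ ℚ.< inv q
inv-positive q 0<q with q ℚ.≟ 0ℚ
... | yes q≡0 = contradiction 0<q (ℚ.<-irrefl (sym q≡0))
... | no q≢0  = ℚ.positive⁻¹ _ {{ℚ.1/pos⇒pos q {{ℚ.positive 0<q}}}}

inv-nonneg : ∀ q → 0ℚ ℚ.≤ q → 0ℚ ℚ.≤ inv q
inv-nonneg q 0≤q with ℚ.<-cmp 0ℚ q
... | tri< 0<q _ _    = ℚ.<⇒≤ (inv-positive q 0<q)
... | tri≈ _ refl _   = ℚ.≤-refl
... | tri> _ _ q<0    = contradiction (ℚ.<-≤-trans q<0 0≤q) (ℚ.<-irrefl refl)

Vecℚ : ℕ → Set
Vecℚ n = Fin n → ℚ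

dot : ∀ {n} → Vecℚ n → Vecℚ n → ℚ
dot u v = Σℚ.sum λ i → u i ℚ.* v i

module _ {n : ℕ} where

  dot-comm : ∀ (u v : Vecℚ n) → dot u v ≡ dot v u
  dot-comm u v = Σℚ.sum-cong-≗ λ i → ℚ.*-comm (u i) (v i)

  dot-congˡ : ∀ {u u′ : Vecℚ n} v → (∀ i → u i ≡ u′ i) → dot u v ≡ dot u′ v
  dot-congˡ v e = Σℚ.sum-cong-≗ λ i → cong (ℚ._* v i) (e i)

  dot-+ˡ : ∀ (u w v : Vecℚ n) → dot (λ i → u i ℚ.+ w i) v ≡ dot u v ℚ.+ dot w v
  dot-+ˡ u w v = trans (Σℚ.sum-cong-≗ λ i → ℚ.*-distribʳ-+ (v i) (u i) (w i))
    (Σℚ.sum-distrib (λ i → u i ℚ.* v i) (λ i → w i ℚ.* v i))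

  dot-*ˡ : ∀ c (u v : Vecℚ n) → dot (λ i → c ℚ.* u i) v ≡ c ℚ.* dot u v
  dot-*ˡ c u v = trans (Σℚ.sum-cong-≗ λ i → ℚ.*-assoc c (u i) (v i)) (sym (sum-scale c λ i → u i ℚ.* v i))

  dot-zeroˡ : ∀ {u : Vecℚ n} v → (∀ i → u i ≡ 0ℚ) → dot u v ≡ 0ℚ
  dot-zeroˡ v u≡0 = Σℚ.sum-ε λ i → trans (cong (ℚ._* v i) (u≡0 i)) (ℚ.*-zeroˡ (v i))

  dot-nonneg : ∀ (u : Vecℚ n) → 0ℚ ℚ.≤ dot u u
  dot-nonneg u = sum-nonneg λ i → ℚ-square-nonneg (u i)

  dot≡0 : ∀ (u : Vecℚ n) → dot u u ≡ 0ℚ → ∀ i → u i ≡ 0ℚ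
  dot≡0 u e i = ℚ-square≡0 (u i) (ℚ.≤-antisym
    (ℚ.≤-trans (sum-≥-term (λ i → ℚ-square-nonneg (u i)) i) (ℚ.≤-reflexive e)) (ℚ-square-nonneg (u i)))

  dot-sum : ∀ {m} (c : Fin m → ℚ) (f : Fin m → Vecℚ n) v →
            dot (λ i → Σℚ.sum λ k → c k ℚ.* f k i) v ≡ Σℚ.sum λ k → c k ℚ.* dot (f k) v
  dot-sum c f v = begin
    Σℚ.sum (λ i → Σℚ.sum (λ k → c k ℚ.* f k i) ℚ.* v i)
      ≡⟨ Σℚ.sum-cong-≗ (λ i → trans (ℚ.*-comm (Σℚ.sum λ k → c k ℚ.* f k i) (v i)) (sum-scale (v i) (λ k → c k ℚ.* f k i))) ⟩
    Σℚ.sum (λ i → Σℚ.sum (λ k → v i ℚ.* (c k ℚ.* f k i)))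
      ≡⟨ Σℚ.sum-swap (λ i k → v i ℚ.* (c k ℚ.* f k i)) ⟩
    Σℚ.sum (λ k → Σℚ.sum (λ i → v i ℚ.* (c k ℚ.* f k i)))
      ≡⟨ Σℚ.sum-cong-≗ (λ k → trans (Σℚ.sum-cong-≗ λ i → lemma (v i) (c k) (f k i)) (sym (sum-scale (c k) λ i → f k i ℚ.* v i))) ⟩
    Σℚ.sum (λ k → c k ℚ.* dot (f k) v) ∎
    where
    open ≡-Reasoning
    lemma : ∀ v c f → v ℚ.* (c ℚ.* f) ≡ c ℚ.* (f ℚ.* v)
    lemma = RingSolver.solve-∀ ℚ-ring

  unit : Fin n → Vecℚ n
  unit j i = if does (i Fin.≟ j) then 1ℚ else 0ℚ

  unit-other : ∀ j i → i ≢ j → unit j i ≡ 0ℚ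
  unit-other j i i≢j with i Fin.≟ j
  ... | yes i≡j = contradiction i≡j i≢j
  ... | no _    = refl

  dot-unit : ∀ j v → dot (unit j) v ≡ v j
  dot-unit j v = trans (Σℚ.sum-single j (λ i → unit j i ℚ.* v i) λ i i≢j →
    trans (cong (ℚ._* v i) (unit-other j i i≢j)) (ℚ.*-zeroˡ (v i))) at-j
    where
    at-j : unit j j ℚ.* v j ≡ v j
    at-j with j Fin.≟ j
    ... | yes _  = ℚ.*-identityˡ (v j)
    ... | no j≢j = contradiction refl j≢j

fromInt : ℤ → ℚ
fromInt z = z ℚ./ 1

fromInt-+ : ∀ i j → fromInt (i ℤ.+ j) ≡ fromInt i ℚ.+ fromInt j
fromInt-+ i j = ℚ.toℚᵘ-injective (ℚᵘ.≃-trans (ℚ.toℚᵘ-fromℚᵘ (ℚᵘ.mkℚᵘ (i ℤ.+ j) 0))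
  (ℚᵘ.≃-trans (ℚᵘ.*≡* (lemma i j)) (ℚᵘ.≃-sym (ℚᵘ.≃-trans (ℚ.toℚᵘ-homo-+ (fromInt i) (fromInt j))
    (ℚᵘ.+-cong (ℚ.toℚᵘ-fromℚᵘ (ℚᵘ.mkℚᵘ i 0)) (ℚ.toℚᵘ-fromℚᵘ (ℚᵘ.mkℚᵘ j 0)))))))
  where
  lemma : ∀ i j → (i ℤ.+ j) ℤ.* 1ℤ ≡ (i ℤ.* 1ℤ ℤ.+ j ℤ.* 1ℤ) ℤ.* 1ℤ
  lemma = ℤ-Solver.solve-∀

fromInt-* : ∀ i j → fromInt (i ℤ.* j) ≡ fromInt i ℚ.* fromInt j
fromInt-* i j = ℚ.toℚᵘ-injective (ℚᵘ.≃-trans (ℚ.toℚᵘ-fromℚᵘ (ℚᵘ.mkℚᵘ (i ℤ.* j) 0))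
  (ℚᵘ.≃-sym (ℚᵘ.≃-trans (ℚ.toℚᵘ-homo-* (fromInt i) (fromInt j))
    (ℚᵘ.*-cong (ℚ.toℚᵘ-fromℚᵘ (ℚᵘ.mkℚᵘ i 0)) (ℚ.toℚᵘ-fromℚᵘ (ℚᵘ.mkℚᵘ j 0))))))

fromInt-mono : ∀ {i j} → i ℤ.≤ j → fromInt i ℚ.≤ fromInt j
fromInt-mono {i} {j} i≤j = ℚ.toℚᵘ-cancel-≤ (ℚᵘ.≤-respˡ-≃ (ℚᵘ.≃-sym (ℚ.toℚᵘ-fromℚᵘ (ℚᵘ.mkℚᵘ i 0)))
  (ℚᵘ.≤-respʳ-≃ (ℚᵘ.≃-sym (ℚ.toℚᵘ-fromℚᵘ (ℚᵘ.mkℚᵘ j 0))) (ℚᵘ.*≤* (ℤ.*-monoʳ-≤-nonNeg (+ 1) i≤j))))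

fromInt-cancel : ∀ {i j} → fromInt i ℚ.≤ fromInt j → i ℤ.≤ j
fromInt-cancel {i} {j} i≤j = ℤ.*-cancelʳ-≤-pos i j (+ 1) (ℚᵘ.drop-*≤* (ℚᵘ.≤-respˡ-≃ (ℚ.toℚᵘ-fromℚᵘ (ℚᵘ.mkℚᵘ i 0))
  (ℚᵘ.≤-respʳ-≃ (ℚ.toℚᵘ-fromℚᵘ (ℚᵘ.mkℚᵘ j 0)) (ℚ.toℚᵘ-mono-≤ i≤j))))

fromInt-injective : ∀ {i j} → fromInt i ≡ fromInt j → i ≡ j
fromInt-injective e = ℤ.≤-antisym (fromInt-cancel (ℚ.≤-reflexive e)) (fromInt-cancel (ℚ.≤-reflexive (sym e)))

fromInt-sum : ∀ {n} (f : Fin n → ℤ) → fromInt (Σℤ.sum f) ≡ Σℚ.sum (fromInt ∘ f)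
fromInt-sum {zero}  f = refl
fromInt-sum {suc n} f = trans (fromInt-+ (f zero) (Σℤ.sum (f ∘ suc))) (cong (fromInt (f zero) ℚ.+_) (fromInt-sum (f ∘ suc)))

sum-1 : ∀ m → Σℚ.sum {m} (λ _ → 1ℚ) ≡ fromInt (+ m)
sum-1 zero    = refl
sum-1 (suc m) = trans (cong (1ℚ ℚ.+_) (sum-1 m)) (sym (fromInt-+ 1ℤ (+ m)))

-- Bessel's inequality, summed over the standard unit vectors.
orthogonal-count : ∀ {m n} (f : Fin m → Vecℚ n) → (∀ k l → k ≢ l → dot (f k) (f l) ≡ 0ℚ) →
                   (∀ k → dot (f k) (f k) ≢ 0ℚ) → m ℕ.≤ n
orthogonal-count {m} {n} f orth nonzero-norm = ℤ.drop‿+≤+ (fromInt-cancel (begin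
  fromInt (+ m)
    ≡⟨ sum-1 m ⟨
  Σℚ.sum {m} (λ _ → 1ℚ)
    ≡⟨ Σℚ.sum-cong-≗ (λ k → trans (sym (sum-scale (inv (norm² k)) λ j → f k j ℚ.* f k j)) (inv-inverse (norm² k) (nonzero-norm k))) ⟨
  Σℚ.sum (λ k → Σℚ.sum (λ j → inv (norm² k) ℚ.* (f k j ℚ.* f k j)))
    ≡⟨ Σℚ.sum-swap (λ k j → inv (norm² k) ℚ.* (f k j ℚ.* f k j)) ⟩
  Σℚ.sum (λ j → Σℚ.sum (λ k → inv (norm² k) ℚ.* (f k j ℚ.* f k j)))
    ≤⟨ sum-mono bessel ⟩
  Σℚ.sum {n} (λ _ → 1ℚ)
    ≡⟨ sum-1 n ⟩
  fromInt (+ n) ∎))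
  where
  open ℚ.≤-Reasoning
  norm² : Fin m → ℚ
  norm² k = dot (f k) (f k)
  bessel : ∀ j → Σℚ.sum (λ k → inv (norm² k) ℚ.* (f k j ℚ.* f k j)) ℚ.≤ 1ℚ
  bessel j = subst₂ ℚ._≤_ (ℚ.+-identityʳ S) (cancel S) (ℚ.+-monoʳ-≤ S (subst (0ℚ ℚ.≤_) residual (dot-nonneg r)))
    where
    S : ℚ
    S = Σℚ.sum λ k → inv (norm² k) ℚ.* (f k j ℚ.* f k j)
    cancel : ∀ s → s ℚ.+ (1ℚ ℚ.+ (ℚ.- 1ℚ) ℚ.* s) ≡ 1ℚ
    cancel = RingSolver.solve-∀ ℚ-ring
    c : Fin m → ℚ
    c k = inv (norm² k) ℚ.* f k j
    -- `P` is the projection of the unit vector at `j` to the span of the `f k`, and `r` is the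
    -- remainder. Both |P|² and the entry of `P` at `j` equal `S`, so |r|² = 1 - S.
    P r : Vecℚ n
    P i = Σℚ.sum λ k → c k ℚ.* f k i
    r i = unit j i ℚ.+ (ℚ.- 1ℚ) ℚ.* P i
    Pⱼ≡S : P j ≡ S
    Pⱼ≡S = Σℚ.sum-cong-≗ λ k → ℚ.*-assoc (inv (norm² k)) (f k j) (f k j)
    f·P : ∀ k → dot (f k) P ≡ f k j
    f·P k = begin-equality
      dot (f k) P                                 ≡⟨ dot-comm (f k) P ⟩
      dot P (f k)                                 ≡⟨ dot-sum c f (f k) ⟩
      Σℚ.sum (λ l → c l ℚ.* dot (f l) (f k))      ≡⟨ Σℚ.sum-single k _ (λ l l≢k → trans (cong (c l ℚ.*_) (orth l k l≢k)) (ℚ.*-zeroʳ (c l))) ⟩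
      c k ℚ.* norm² k                             ≡⟨ swap (inv (norm² k)) (f k j) (norm² k) ⟩
      inv (norm² k) ℚ.* norm² k ℚ.* f k j         ≡⟨ cong (ℚ._* f k j) (inv-inverse (norm² k) (nonzero-norm k)) ⟩
      1ℚ ℚ.* f k j                                ≡⟨ ℚ.*-identityˡ (f k j) ⟩
      f k j                                       ∎
      where
      swap : ∀ a b c → a ℚ.* b ℚ.* c ≡ a ℚ.* c ℚ.* b
      swap = RingSolver.solve-∀ ℚ-ring
    P·P : dot P P ≡ S
    P·P = trans (dot-sum c f P) (Σℚ.sum-cong-≗ λ k → trans (cong (c k ℚ.*_) (f·P k)) (ℚ.*-assoc (inv (norm² k)) (f k j) (f k j)))
    split : ∀ v → dot r v ≡ dot (unit j) v ℚ.+ (ℚ.- 1ℚ) ℚ.* dot P v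
    split v = trans (dot-+ˡ (unit j) (λ i → (ℚ.- 1ℚ) ℚ.* P i) v) (cong (dot (unit j) v ℚ.+_) (dot-*ˡ (ℚ.- 1ℚ) P v))
    residual : dot r r ≡ 1ℚ ℚ.+ (ℚ.- 1ℚ) ℚ.* S
    residual = begin-equality
      dot r r
        ≡⟨ split r ⟩
      dot (unit j) r ℚ.+ (ℚ.- 1ℚ) ℚ.* dot P r
        ≡⟨ cong₂ (λ a b → a ℚ.+ (ℚ.- 1ℚ) ℚ.* b) (trans (dot-comm (unit j) r) (split (unit j))) (trans (dot-comm P r) (split P)) ⟩
      dot (unit j) (unit j) ℚ.+ (ℚ.- 1ℚ) ℚ.* dot P (unit j) ℚ.+ (ℚ.- 1ℚ) ℚ.* (dot (unit j) P ℚ.+ (ℚ.- 1ℚ) ℚ.* dot P P)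
        ≡⟨ cong₂ (λ a b → a ℚ.+ (ℚ.- 1ℚ) ℚ.* b ℚ.+ (ℚ.- 1ℚ) ℚ.* (dot (unit j) P ℚ.+ (ℚ.- 1ℚ) ℚ.* dot P P))
             (trans (dot-unit j (unit j)) unit-same) (trans (dot-comm P (unit j)) (trans (dot-unit j P) Pⱼ≡S)) ⟩
      1ℚ ℚ.+ (ℚ.- 1ℚ) ℚ.* S ℚ.+ (ℚ.- 1ℚ) ℚ.* (dot (unit j) P ℚ.+ (ℚ.- 1ℚ) ℚ.* dot P P)
        ≡⟨ cong₂ (λ a b → 1ℚ ℚ.+ (ℚ.- 1ℚ) ℚ.* S ℚ.+ (ℚ.- 1ℚ) ℚ.* (a ℚ.+ (ℚ.- 1ℚ) ℚ.* b)) (trans (dot-unit j P) Pⱼ≡S) P·P ⟩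
      1ℚ ℚ.+ (ℚ.- 1ℚ) ℚ.* S ℚ.+ (ℚ.- 1ℚ) ℚ.* (S ℚ.+ (ℚ.- 1ℚ) ℚ.* S)
        ≡⟨ simplify S ⟩
      1ℚ ℚ.+ (ℚ.- 1ℚ) ℚ.* S ∎
      where
      unit-same : unit j j ≡ 1ℚ
      unit-same with j Fin.≟ j
      ... | yes _  = refl
      ... | no j≢j = contradiction refl j≢j
      simplify : ∀ s → 1ℚ ℚ.+ (ℚ.- 1ℚ) ℚ.* s ℚ.+ (ℚ.- 1ℚ) ℚ.* (s ℚ.+ (ℚ.- 1ℚ) ℚ.* s) ≡ 1ℚ ℚ.+ (ℚ.- 1ℚ) ℚ.* s
      simplify = RingSolver.solve-∀ ℚ-ring

-- Tridiagonalisation of a symmetric rational matrix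

mul : ∀ {n} → (Fin n → Vecℚ n) → Vecℚ n → Vecℚ n
mul B v x = dot (B x) v

mul-symmetric : ∀ {n} (B : Fin n → Vecℚ n) → (∀ x y → B x y ≡ B y x) → ∀ u v → dot (mul B u) v ≡ dot u (mul B v)
mul-symmetric B B-sym u v = begin
  Σℚ.sum (λ x → Σℚ.sum (λ y → B x y ℚ.* u y) ℚ.* v x)
    ≡⟨ Σℚ.sum-cong-≗ (λ x → trans (ℚ.*-comm (Σℚ.sum λ y → B x y ℚ.* u y) (v x)) (sum-scale (v x) λ y → B x y ℚ.* u y)) ⟩
  Σℚ.sum (λ x → Σℚ.sum (λ y → v x ℚ.* (B x y ℚ.* u y)))
    ≡⟨ Σℚ.sum-swap (λ x y → v x ℚ.* (B x y ℚ.* u y)) ⟩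
  Σℚ.sum (λ y → Σℚ.sum (λ x → v x ℚ.* (B x y ℚ.* u y)))
    ≡⟨ Σℚ.sum-cong-≗ (λ y → trans (Σℚ.sum-cong-≗ λ x → trans (cong (λ b → v x ℚ.* (b ℚ.* u y)) (B-sym x y)) (lemma (v x) (B y x) (u y)))
         (sym (sum-scale (u y) λ x → B y x ℚ.* v x))) ⟩
  Σℚ.sum (λ y → u y ℚ.* Σℚ.sum (λ x → B y x ℚ.* v x)) ∎
  where
  open ≡-Reasoning
  lemma : ∀ v b u → v ℚ.* (b ℚ.* u) ≡ u ℚ.* (b ℚ.* v)
  lemma = RingSolver.solve-∀ ℚ-ring

module Recurrence (a b : ℕ → ℚ) where

  -- The index is shifted by one: `φ t (suc k)` is the characteristic polynomial of the leading
  -- block of size `k`, and the value 0 at index 0 absorbs the boundary term.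
  φ : ℚ → ℕ → ℚ
  φ t 0             = 0ℚ
  φ t 1             = 1ℚ
  φ t (suc (suc k)) = (t ℚ.+ (ℚ.- a (suc k))) ℚ.* φ t (suc k) ℚ.+ (ℚ.- b (suc k)) ℚ.* φ t k

-- The Lanczos process: W 1, W 2, … are orthogonal, span the Krylov space of u
-- and turn B into a tridiagonal matrix with the characteristic polynomials φ.
module Lanczos {n} (B : Fin n → Vecℚ n) (B-sym : ∀ x y → B x y ≡ B y x) (u : Vecℚ n) where

  α : Vecℚ n → ℚ
  α w = dot (mul B w) w ℚ.* inv (dot w w)

  ratio : Vecℚ n → Vecℚ n → ℚ
  ratio w w′ = dot w w ℚ.* inv (dot w′ w′)

  W : ℕ → Vecℚ n
  -- The zero vector makes the recurrence uniform from index 1 on: since `inv 0ℚ` is 0, the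
  -- coefficient `b 1` is 0.
  W 0             = λ _ → 0ℚ
  W 1             = u
  W (suc (suc k)) = λ x → (mul B (W (suc k)) x ℚ.+ (ℚ.- α (W (suc k))) ℚ.* W (suc k) x)
                          ℚ.+ (ℚ.- ratio (W (suc k)) (W k)) ℚ.* W k x

  a b norm² : ℕ → ℚ
  a k     = α (W k)
  b 0     = 0ℚ
  b (suc k) = ratio (W (suc k)) (W k)
  norm² k = dot (W k) (W k)

  recurrence : ∀ k x → mul B (W (suc k)) x ≡ W (suc (suc k)) x ℚ.+ a (suc k) ℚ.* W (suc k) x ℚ.+ b (suc k) ℚ.* W k x
  recurrence k x = lemma (mul B (W (suc k)) x) (a (suc k)) (W (suc k) x) (b (suc k)) (W k x)
    where
    lemma : ∀ m a w b w′ → m ≡ ((m ℚ.+ (ℚ.- a) ℚ.* w) ℚ.+ (ℚ.- b) ℚ.* w′) ℚ.+ a ℚ.* w ℚ.+ b ℚ.* w′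
    lemma = RingSolver.solve-∀ ℚ-ring

  dot-W : ∀ k v → dot (W (suc (suc k))) v ≡
    dot (mul B (W (suc k))) v ℚ.+ (ℚ.- a (suc k)) ℚ.* dot (W (suc k)) v ℚ.+ (ℚ.- b (suc k)) ℚ.* dot (W k) v
  dot-W k v = trans (dot-+ˡ (λ x → mul B (W (suc k)) x ℚ.+ (ℚ.- a (suc k)) ℚ.* W (suc k) x) (λ x → (ℚ.- b (suc k)) ℚ.* W k x) v)
    (cong₂ ℚ._+_ (trans (dot-+ˡ (mul B (W (suc k))) (λ x → (ℚ.- a (suc k)) ℚ.* W (suc k) x) v)
      (cong (dot (mul B (W (suc k))) v ℚ.+_) (dot-*ˡ (ℚ.- a (suc k)) (W (suc k)) v))) (dot-*ˡ (ℚ.- b (suc k)) (W k) v))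

  dot-mul : ∀ v k → dot (mul B v) (W (suc k)) ≡
    dot (W (suc (suc k))) v ℚ.+ a (suc k) ℚ.* dot (W (suc k)) v ℚ.+ b (suc k) ℚ.* dot (W k) v
  dot-mul v k = begin
    dot (mul B v) (W (suc k))
      ≡⟨ trans (mul-symmetric B B-sym v (W (suc k))) (dot-comm v (mul B (W (suc k)))) ⟩
    dot (mul B (W (suc k))) v
      ≡⟨ dot-congˡ v (recurrence k) ⟩
    dot (λ x → W (suc (suc k)) x ℚ.+ a (suc k) ℚ.* W (suc k) x ℚ.+ b (suc k) ℚ.* W k x) v
      ≡⟨ trans (dot-+ˡ (λ x → W (suc (suc k)) x ℚ.+ a (suc k) ℚ.* W (suc k) x) (λ x → b (suc k) ℚ.* W k x) v)
           (cong₂ ℚ._+_ (trans (dot-+ˡ (W (suc (suc k))) (λ x → a (suc k) ℚ.* W (suc k) x) v)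
             (cong (dot (W (suc (suc k))) v ℚ.+_) (dot-*ˡ (a (suc k)) (W (suc k)) v))) (dot-*ˡ (b (suc k)) (W k) v)) ⟩
    dot (W (suc (suc k))) v ℚ.+ a (suc k) ℚ.* dot (W (suc k)) v ℚ.+ b (suc k) ℚ.* dot (W k) v ∎
    where open ≡-Reasoning

  -- The quotient `c / |w|²` is formed by the total function `inv`; when `w` is 0 the numerator
  -- vanishes as well, so no case distinction is needed in the recurrence itself.
  normalised : ∀ c (w : Vecℚ n) → (dot w w ≡ 0ℚ → c ≡ 0ℚ) → c ℚ.* inv (dot w w) ℚ.* dot w w ≡ c
  normalised c w degenerate = split (dot w w ℚ.≟ 0ℚ)
    where
    split : Dec (dot w w ≡ 0ℚ) → c ℚ.* inv (dot w w) ℚ.* dot w w ≡ c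
    split (yes e) = trans (cong (c ℚ.* inv (dot w w) ℚ.*_) e) (trans (ℚ.*-zeroʳ (c ℚ.* inv (dot w w))) (sym (degenerate e)))
    split (no ≢0) = trans (ℚ.*-assoc c (inv (dot w w)) (dot w w))
      (trans (cong (c ℚ.*_) (inv-inverse (dot w w) ≢0)) (ℚ.*-identityʳ c))

  kill : ∀ c {x} → x ≡ 0ℚ → c ℚ.* x ≡ 0ℚ
  kill c e = trans (cong (c ℚ.*_) e) (ℚ.*-zeroʳ c)

  cancelˡ : ∀ {x y} → x ≡ y → x ℚ.+ (ℚ.- y) ≡ 0ℚ
  cancelˡ {y = y} refl = ℚ.+-inverseʳ y

  -- The bound `k` makes all smaller pairs available to the induction. Moving `B` across the product
  -- expands it by the recurrence at the smaller index; what remains is cancelled by `a` for equal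
  -- neighbours, by `b` for indices one apart, and vanishes by induction further away.
  orthogonal-W : ∀ k i j → i ℕ.< j → j ℕ.≤ k → dot (W j) (W i) ≡ 0ℚ
  orthogonal-W k zero j _ _ = trans (dot-comm (W j) (W 0)) (dot-zeroˡ (W j) λ _ → refl)
  orthogonal-W k (suc i) (suc zero) (s≤s ()) _
  orthogonal-W (suc k) (suc i) (suc (suc j)) (s≤s i<j) (s≤s j≤k) = trans (dot-W j (W (suc i))) (split (ℕ.m≤n⇒m<n∨m≡n i<j))
    where
    IH : ∀ i j → i ℕ.< j → j ℕ.≤ k → dot (W j) (W i) ≡ 0ℚ
    IH = orthogonal-W k
    0+0 : ∀ {x y} → x ≡ 0ℚ → y ≡ 0ℚ → x ℚ.+ y ≡ 0ℚ
    0+0 refl refl = refl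
    v = W (suc j)
    three : ℚ
    three = dot (mul B v) (W (suc i)) ℚ.+ (ℚ.- a (suc j)) ℚ.* dot v (W (suc i)) ℚ.+ (ℚ.- b (suc j)) ℚ.* dot (W j) (W (suc i))
    split : suc i ℕ.< suc j ⊎ suc i ≡ suc j → three ≡ 0ℚ
    split (inj₂ refl) = 0+0 (trans (cong (dot (mul B v) v ℚ.+_) (sym (ℚ.neg-distribˡ-* (a (suc j)) (dot v v))))
        (cancelˡ (sym (normalised (dot (mul B v) v) v λ e → trans (dot-comm (mul B v) v) (dot-zeroˡ (mul B v) (dot≡0 v e))))))
      (kill (ℚ.- b (suc j)) (trans (dot-comm (W j) v) (IH j (suc j) ℕ.≤-refl j≤k)))
    split (inj₁ (s≤s i<j)) with ℕ.m≤n⇒m<n∨m≡n i<j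
    ... | inj₂ refl = trans
      (cong₂ ℚ._+_ (trans (cong₂ ℚ._+_ expand (kill (ℚ.- a (suc j)) (IH (suc i) (suc j) ℕ.≤-refl j≤k))) (ℚ.+-identityʳ (dot v v)))
        (sym (ℚ.neg-distribˡ-* (b (suc j)) (dot (W j) (W j)))))
      (cancelˡ (sym (normalised (dot v v) (W j) degenerate)))
      where
      expand : dot (mul B v) (W (suc i)) ≡ dot v v
      expand = trans (dot-mul v i) (trans (cong₂ ℚ._+_ (trans (cong (dot v v ℚ.+_)
          (kill (a (suc i)) (trans (dot-comm (W (suc i)) v) (IH (suc i) (suc j) ℕ.≤-refl j≤k)))) (ℚ.+-identityʳ (dot v v)))
          (kill (b (suc i)) (trans (dot-comm (W i) v) (IH i (suc j) (ℕ.m≤n⇒m≤1+n ℕ.≤-refl) j≤k))))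
        (ℚ.+-identityʳ (dot v v)))
      degenerate : dot (W j) (W j) ≡ 0ℚ → dot v v ≡ 0ℚ
      degenerate e = trans (sym expand) (trans (dot-comm (mul B v) (W j)) (dot-zeroˡ (mul B v) (dot≡0 (W j) e)))
    ... | inj₁ i+1<j = 0+0 (0+0 (trans (dot-mul v i) (0+0 (0+0
        (trans (dot-comm (W (suc (suc i))) v) (IH (suc (suc i)) (suc j) (s≤s i+1<j) j≤k))
        (kill (a (suc i)) (trans (dot-comm (W (suc i)) v) (IH (suc i) (suc j) (s≤s i<j) j≤k))))
        (kill (b (suc i)) (trans (dot-comm (W i) v) (IH i (suc j) (ℕ.m≤n⇒m≤1+n i<j) j≤k)))))
      (kill (ℚ.- a (suc j)) (IH (suc i) (suc j) (s≤s i<j) j≤k)))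
      (kill (ℚ.- b (suc j)) (IH (suc i) j i+1<j (ℕ.≤-trans (ℕ.n≤1+n j) j≤k)))

  Regular : ℕ → Set
  Regular d = ∀ k → k ℕ.< d → norm² (suc k) ≢ 0ℚ

  first-zero : ∀ t → Regular t ⊎ ∃[ d ] Regular d × norm² (suc d) ≡ 0ℚ
  first-zero zero = inj₁ λ _ ()
  first-zero (suc t) with first-zero t
  ... | inj₂ found = inj₂ found
  ... | inj₁ regular with norm² (suc t) ℚ.≟ 0ℚ
  ...   | yes e = inj₂ (t , regular , e)
  ...   | no ≢0 = inj₁ λ k k<1+t → case ℕ.m≤n⇒m<n∨m≡n (ℕ.≤-pred k<1+t) of λ where
    (inj₁ k<t)  → regular k k<t
    (inj₂ refl) → ≢0

  -- Otherwise `n + 1` nonzero orthogonal vectors would exist in dimension `n`.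
  terminates : ∃[ d ] Regular d × norm² (suc d) ≡ 0ℚ
  terminates with first-zero (suc n)
  ... | inj₂ found   = found
  ... | inj₁ regular = contradiction
    (orthogonal-count {suc n} (λ i → W (suc (toℕ i))) orth (λ i → regular (toℕ i) (Fin.toℕ<n i))) (ℕ.<⇒≱ (ℕ.n<1+n n))
    where
    orth : ∀ (i j : Fin (suc n)) → i ≢ j → dot (W (suc (toℕ i))) (W (suc (toℕ j))) ≡ 0ℚ
    orth i j i≢j with ℕ.<-cmp (toℕ i) (toℕ j)
    ... | tri< i<j _ _ = trans (dot-comm (W (suc (toℕ i))) (W (suc (toℕ j)))) (orthogonal-W _ (suc (toℕ i)) (suc (toℕ j)) (s≤s i<j) ℕ.≤-refl)
    ... | tri≈ _ e _   = contradiction (Fin.toℕ-injective e) i≢j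
    ... | tri> _ _ j<i = orthogonal-W _ (suc (toℕ j)) (suc (toℕ i)) (s≤s j<i) ℕ.≤-refl

  open Recurrence a b using (φ) public

  -- The sum of `φ t k` times `W k / |W k|²` for `k` up to `d`: the eigenvector that the tridiagonal
  -- matrix has at a root `t`, written as a polynomial in `t`, so that it can be evaluated along
  -- approximations of the root.
  E : ℚ → ℕ → Vecℚ n
  E t 0       x = 0ℚ
  E t (suc d) x = E t d x ℚ.+ φ t (suc d) ℚ.* (inv (norm² (suc d)) ℚ.* W (suc d) x)

  mul-E : ∀ t d x → mul B (E t (suc d)) x ≡ mul B (E t d) x ℚ.+ φ t (suc d) ℚ.* (inv (norm² (suc d)) ℚ.* mul B (W (suc d)) x)
  mul-E t d x = begin
    dot (B x) (E t (suc d))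
      ≡⟨ dot-comm (B x) (E t (suc d)) ⟩
    dot (E t (suc d)) (B x)
      ≡⟨ dot-+ˡ (E t d) (λ x → φ t (suc d) ℚ.* (inv (norm² (suc d)) ℚ.* W (suc d) x)) (B x) ⟩
    dot (E t d) (B x) ℚ.+ dot (λ x → φ t (suc d) ℚ.* (inv (norm² (suc d)) ℚ.* W (suc d) x)) (B x)
      ≡⟨ cong₂ ℚ._+_ (dot-comm (E t d) (B x)) (trans (dot-*ˡ (φ t (suc d)) (λ x → inv (norm² (suc d)) ℚ.* W (suc d) x) (B x))
           (cong (φ t (suc d) ℚ.*_) (trans (dot-*ˡ (inv (norm² (suc d))) (W (suc d)) (B x))
             (cong (inv (norm² (suc d)) ℚ.*_) (dot-comm (W (suc d)) (B x)))))) ⟩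
    mul B (E t d) x ℚ.+ φ t (suc d) ℚ.* (inv (norm² (suc d)) ℚ.* mul B (W (suc d)) x) ∎
    where open ≡-Reasoning

  -- As in the Christoffel-Darboux formula, the recurrences of `φ` and `W` cancel except for two
  -- boundary terms. One disappears when `W (suc d)` is 0, the other tends to 0 at a root of `φ` at
  -- `suc d`.
  eigen-residual : ∀ t d → Regular d → ∀ x → mul B (E t d) x ≡
    t ℚ.* E t d x ℚ.+ φ t d ℚ.* inv (norm² d) ℚ.* W (suc d) x ℚ.+ (ℚ.- (φ t (suc d) ℚ.* inv (norm² d) ℚ.* W d x))
  eigen-residual t zero _ x = trans (trans (dot-comm (B x) (E t 0)) (dot-zeroˡ (B x) λ _ → refl))
    (sym (lemma t (inv (norm² 0)) (W 1 x)))
    where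
    lemma : ∀ t i w → t ℚ.* 0ℚ ℚ.+ 0ℚ ℚ.* i ℚ.* w ℚ.+ (ℚ.- (1ℚ ℚ.* i ℚ.* 0ℚ)) ≡ 0ℚ
    lemma = RingSolver.solve-∀ ℚ-ring
  eigen-residual t (suc d) regular x = begin
    mul B (E t (suc d)) x
      ≡⟨ mul-E t d x ⟩
    mul B (E t d) x ℚ.+ φ′ ℚ.* (ι′ ℚ.* mul B (W (suc d)) x)
      ≡⟨ cong₂ (λ p q → p ℚ.+ φ′ ℚ.* (ι′ ℚ.* q)) (eigen-residual t d (λ k k<d → regular k (ℕ.m≤n⇒m≤1+n k<d)) x) (recurrence d x) ⟩
    t ℚ.* e ℚ.+ φ t d ℚ.* ι ℚ.* w′ ℚ.+ (ℚ.- (φ′ ℚ.* ι ℚ.* w)) ℚ.+ φ′ ℚ.* (ι′ ℚ.* (w″ ℚ.+ a′ ℚ.* w′ ℚ.+ b′ ℚ.* w))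
      ≡⟨ cong (λ ι → t ℚ.* e ℚ.+ φ t d ℚ.* ι ℚ.* w′ ℚ.+ (ℚ.- (φ′ ℚ.* ι ℚ.* w)) ℚ.+ φ′ ℚ.* (ι′ ℚ.* (w″ ℚ.+ a′ ℚ.* w′ ℚ.+ b′ ℚ.* w))) ι≡ ⟩
    t ℚ.* e ℚ.+ φ t d ℚ.* (ι′ ℚ.* b′) ℚ.* w′ ℚ.+ (ℚ.- (φ′ ℚ.* (ι′ ℚ.* b′) ℚ.* w)) ℚ.+ φ′ ℚ.* (ι′ ℚ.* (w″ ℚ.+ a′ ℚ.* w′ ℚ.+ b′ ℚ.* w))
      ≡⟨ lemma t e (φ t d) φ′ ι′ a′ b′ w w′ w″ ⟩
    t ℚ.* (e ℚ.+ φ′ ℚ.* (ι′ ℚ.* w′)) ℚ.+ φ′ ℚ.* ι′ ℚ.* w″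
      ℚ.+ (ℚ.- (((t ℚ.+ (ℚ.- a′)) ℚ.* φ′ ℚ.+ (ℚ.- b′) ℚ.* φ t d) ℚ.* ι′ ℚ.* w′)) ∎
    where
    open ≡-Reasoning
    φ′ = φ t (suc d)
    ι  = inv (norm² d)
    ι′ = inv (norm² (suc d))
    a′ = a (suc d)
    b′ = b (suc d)
    e  = E t d x
    w  = W d x
    w′ = W (suc d) x
    w″ = W (suc (suc d)) x
    ι≡ : ι ≡ ι′ ℚ.* b′
    ι≡ = sym (trans (sym (ℚ.*-assoc ι′ (norm² (suc d)) ι))
      (trans (cong (ℚ._* ι) (inv-inverse (norm² (suc d)) (regular d ℕ.≤-refl))) (ℚ.*-identityˡ ι)))
    lemma : ∀ t e f φ ι a b w w′ w″ →
      t ℚ.* e ℚ.+ f ℚ.* (ι ℚ.* b) ℚ.* w′ ℚ.+ (ℚ.- (φ ℚ.* (ι ℚ.* b) ℚ.* w)) ℚ.+ φ ℚ.* (ι ℚ.* (w″ ℚ.+ a ℚ.* w′ ℚ.+ b ℚ.* w))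
      ≡ t ℚ.* (e ℚ.+ φ ℚ.* (ι ℚ.* w′)) ℚ.+ φ ℚ.* ι ℚ.* w″ ℚ.+ (ℚ.- (((t ℚ.+ (ℚ.- a)) ℚ.* φ ℚ.+ (ℚ.- b) ℚ.* f) ℚ.* ι ℚ.* w′))
    lemma = RingSolver.solve-∀ ℚ-ring

  -- By orthogonality only the summand of `W 1 = u` counts. The product is 1 for every `t`, which
  -- keeps the limit of the vectors from being 0.
  dot-E-u : ∀ t d → norm² 1 ≢ 0ℚ → dot (E t (suc d)) u ≡ 1ℚ
  dot-E-u t d N≢0 = trans (dot-+ˡ (E t d) (λ x → φ t (suc d) ℚ.* (inv (norm² (suc d)) ℚ.* W (suc d) x)) u)
    (trans (cong (dot (E t d) u ℚ.+_) (trans (dot-*ˡ (φ t (suc d)) (λ x → inv (norm² (suc d)) ℚ.* W (suc d) x) u)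
      (cong (φ t (suc d) ℚ.*_) (dot-*ˡ (inv (norm² (suc d))) (W (suc d)) u)))) (split d))
    where
    split : ∀ d → dot (E t d) u ℚ.+ φ t (suc d) ℚ.* (inv (norm² (suc d)) ℚ.* dot (W (suc d)) u) ≡ 1ℚ
    split zero    = trans (cong₂ (λ p q → p ℚ.+ 1ℚ ℚ.* q) (dot-zeroˡ u λ _ → refl) (inv-inverse (norm² 1) N≢0)) refl
    split (suc d) = trans (cong₂ (λ p q → p ℚ.+ φ t (suc (suc d)) ℚ.* q) (dot-E-u t d N≢0)
      (kill (inv (norm² (suc (suc d)))) (orthogonal-W _ 1 (suc (suc d)) (s≤s (s≤s z≤n)) ℕ.≤-refl)))
      (trans (cong (1ℚ ℚ.+_) (ℚ.*-zeroʳ (φ t (suc (suc d))))) refl)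

  b-nonneg : ∀ k → 0ℚ ℚ.≤ b (suc k)
  b-nonneg k = subst (ℚ._≤ b (suc k)) (ℚ.*-zeroʳ (norm² (suc k)))
    (ℚ.*-monoˡ-≤-nonNeg (norm² (suc k)) {{ℚ.nonNegative (dot-nonneg (W (suc k)))}} (inv-nonneg (norm² k) (dot-nonneg (W k))))

-- Null sequences and bisection

abs-< : ∀ {q ε} → q ℚ.< ε → ℚ.- q ℚ.< ε → ℚ.∣ q ∣ ℚ.< ε
abs-< {q} {ε} q<ε -q<ε with ℚ.∣p∣≡p∨∣p∣≡-p q
... | inj₁ e = subst (ℚ._< ε) (sym e) q<ε
... | inj₂ e = subst (ℚ._< ε) (sym e) -q<ε

≤-abs : ∀ q → q ℚ.≤ ℚ.∣ q ∣
≤-abs q with ℚ.≤-total 0ℚ q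
... | inj₁ 0≤q = ℚ.≤-reflexive (sym (ℚ.0≤p⇒∣p∣≡p 0≤q))
... | inj₂ q≤0 = ℚ.≤-trans q≤0 (ℚ.0≤∣p∣ q)

half : ∀ {ε} → 0ℚ ℚ.< ε → 0ℚ ℚ.< ε ℚ.* ½
half {ε} 0<ε = subst (ℚ._< ε ℚ.* ½) (ℚ.*-zeroˡ ½) (ℚ.*-monoˡ-<-pos ½ 0<ε)

half+half : ∀ ε → ε ℚ.* ½ ℚ.+ ε ℚ.* ½ ≡ ε
half+half ε = trans (sym (ℚ.*-distribˡ-+ ε ½ ½)) (ℚ.*-identityʳ ε)

-- `x ≃ᵣ y` unfolds to `Null` of the difference of the sequences, so equations between reals become
-- statements about rational sequences.
Null : (ℕ → ℚ) → Set
Null s = ∀ ε → 0ℚ ℚ.< ε → ∃[ N ] (∀ i → N ℕ.≤ i → ℚ.∣ s i ∣ ℚ.< ε)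

Null-cong : ∀ {s s′} → (∀ i → s i ≡ s′ i) → Null s → Null s′
Null-cong e null ε 0<ε with null ε 0<ε
... | N , h = N , λ i N≤i → subst (λ t → ℚ.∣ t ∣ ℚ.< ε) (e i) (h i N≤i)

Null-0 : Null (λ _ → 0ℚ)
Null-0 ε 0<ε = 0 , λ _ _ → 0<ε

Null-+ : ∀ {s s′} → Null s → Null s′ → Null (λ i → s i ℚ.+ s′ i)
Null-+ {s} {s′} null null′ ε 0<ε with null (ε ℚ.* ½) (half 0<ε) | null′ (ε ℚ.* ½) (half 0<ε)
... | M , h | N , h′ = M ℕ.⊔ N , λ i M⊔N≤i → ℚ.≤-<-trans (ℚ.∣p+q∣≤∣p∣+∣q∣ (s i) (s′ i))
  (subst (ℚ.∣ s i ∣ ℚ.+ ℚ.∣ s′ i ∣ ℚ.<_) (half+half ε)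
    (ℚ.+-mono-< (h i (ℕ.m⊔n≤o⇒m≤o M N M⊔N≤i)) (h′ i (ℕ.m⊔n≤o⇒n≤o M N M⊔N≤i))))

Null-scale : ∀ {s} c → Null s → Null (λ i → s i ℚ.* c)
Null-scale {s} c null ε 0<ε with null (ε ℚ.* inv C) (subst (ℚ._< ε ℚ.* inv C) (ℚ.*-zeroˡ (inv C))
    (ℚ.*-monoˡ-<-pos (inv C) {{ℚ.positive (inv-positive C 0<C)}} 0<ε))
  where
  C = 1ℚ ℚ.+ ℚ.∣ c ∣
  0<C : 0ℚ ℚ.< C
  0<C = ℚ.+-mono-<-≤ (ℚ.positive⁻¹ 1ℚ) (ℚ.0≤∣p∣ c)
... | N , h = N , λ i N≤i → begin-strict
  ℚ.∣ s i ℚ.* c ∣              ≡⟨ ℚ.∣p*q∣≡∣p∣*∣q∣ (s i) c ⟩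
  ℚ.∣ s i ∣ ℚ.* ℚ.∣ c ∣        ≤⟨ ℚ.*-monoˡ-≤-nonNeg ℚ.∣ s i ∣ {{ℚ.∣-∣-nonNeg (s i)}} ∣c∣≤C ⟩
  ℚ.∣ s i ∣ ℚ.* C              <⟨ ℚ.*-monoˡ-<-pos C {{ℚ.positive 0<C}} (h i N≤i) ⟩
  ε ℚ.* inv C ℚ.* C            ≡⟨ ℚ.*-assoc ε (inv C) C ⟩
  ε ℚ.* (inv C ℚ.* C)          ≡⟨ cong (ε ℚ.*_) (inv-inverse C λ C≡0 → ℚ.<-irrefl (sym C≡0) 0<C) ⟩
  ε ℚ.* 1ℚ                     ≡⟨ ℚ.*-identityʳ ε ⟩
  ε                            ∎
  where
  open ℚ.≤-Reasoning
  C = 1ℚ ℚ.+ ℚ.∣ c ∣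
  0<C : 0ℚ ℚ.< C
  0<C = ℚ.+-mono-<-≤ (ℚ.positive⁻¹ 1ℚ) (ℚ.0≤∣p∣ c)
  ∣c∣≤C : ℚ.∣ c ∣ ℚ.≤ C
  ∣c∣≤C = subst (ℚ._≤ C) (ℚ.+-identityˡ ℚ.∣ c ∣) (ℚ.+-monoˡ-≤ ℚ.∣ c ∣ (ℚ.nonNegative⁻¹ 1ℚ))

Null-sum : ∀ {n} (f : ℕ → Fin n → ℚ) → (∀ x → Null (λ i → f i x)) → Null (λ i → Σℚ.sum (f i))
Null-sum {zero}  f null = Null-0
Null-sum {suc n} f null = Null-+ (null zero) (Null-sum (λ i → f i ∘ suc) (null ∘ suc))

archimedean : ∀ q → ∃[ N ] q ℚ.< fromInt (+ N)
archimedean q@record{} = suc ℤ.∣ ℚ.↥ q ∣ , ℚ.toℚᵘ-cancel-< (ℚᵘ.<-respʳ-≃ (ℚᵘ.≃-sym (ℚ.toℚᵘ-fromℚᵘ (ℚᵘ.mkℚᵘ (+ suc ℤ.∣ ℚ.↥ q ∣) 0)))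
  (ℚᵘ.*<* (subst (ℤ._< + suc ℤ.∣ ℚ.↥ q ∣ ℤ.* ℚᵘ.↧ (ℚ.toℚᵘ q)) (sym (ℤ.*-identityʳ (ℚᵘ.↥ (ℚ.toℚᵘ q)))) (below (ℚᵘ.↥ (ℚ.toℚᵘ q)) (ℚ.denominator-1 q)))))
  where
  below : ∀ n d → n ℤ.< + suc ℤ.∣ n ∣ ℤ.* + suc d
  below (+ n)    d = subst (+ n ℤ.<_) (ℤ.pos-* (suc n) (suc d)) (ℤ.+<+ (ℕ.m≤m*n (suc n) (suc d)))
  below -[1+ n ] d = subst (-[1+ n ] ℤ.<_) (ℤ.pos-* (suc (suc n)) (suc d)) ℤ.-<+

alternate : ℕ → Bool
alternate zero    = false
alternate (suc i) = not (alternate i)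

alternate-even : ∀ s → alternate (s ℕ.+ s) ≡ false
alternate-even zero    = refl
alternate-even (suc s) = trans (cong (not ∘ alternate) (ℕ.+-suc s s))
  (trans (cong (not ∘ not) (alternate-even s)) refl)

module Bisection (Pos : ℚ → Set) (Pos? : ∀ t → Dec (Pos t)) where

  record Bracket : Set where
    field
      l r   : ℚ
      l≤r   : l ℚ.≤ r
      ¬Pos-l : ¬ Pos l
      Pos-r : Pos r

  open Bracket public

  private
    mid : Bracket → ℚ
    mid b = (l b ℚ.+ r b) ℚ.* ½

    double : ∀ x → x ≡ (x ℚ.+ x) ℚ.* ½
    double x = sym (trans (ℚ.*-distribʳ-+ ½ x x) (half+half x))

    l≤mid : ∀ b → l b ℚ.≤ mid b
    l≤mid b = subst (ℚ._≤ mid b) (sym (double (l b))) (ℚ.*-monoʳ-≤-nonNeg ½ (ℚ.+-monoʳ-≤ (l b) (l≤r b)))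

    mid≤r : ∀ b → mid b ℚ.≤ r b
    mid≤r b = subst (mid b ℚ.≤_) (sym (double (r b))) (ℚ.*-monoʳ-≤-nonNeg ½ (ℚ.+-monoˡ-≤ (r b) (l≤r b)))

  refine : Bracket → Bracket
  refine b with Pos? (mid b)
  ... | yes pos = record { l = l b ; r = mid b ; l≤r = l≤mid b ; ¬Pos-l = ¬Pos-l b ; Pos-r = pos }
  ... | no ¬pos = record { l = mid b ; r = r b ; l≤r = mid≤r b ; ¬Pos-l = ¬pos ; Pos-r = Pos-r b }

  width : Bracket → ℚ
  width b = r b ℚ.+ (ℚ.- l b)

  refine-l : ∀ b → l b ℚ.≤ l (refine b)
  refine-l b with Pos? (mid b)
  ... | yes _ = ℚ.≤-refl
  ... | no _  = l≤mid b

  refine-r : ∀ b → r (refine b) ℚ.≤ r b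
  refine-r b with Pos? (mid b)
  ... | yes _ = mid≤r b
  ... | no _  = ℚ.≤-refl

  refine-width : ∀ b → width (refine b) ℚ.+ width (refine b) ≡ width b
  refine-width b with Pos? (mid b)
  ... | yes _ = trans (lower (l b) (r b) ½) (simplify (l b) (r b))
    where
    lower : ∀ l r h → ((l ℚ.+ r) ℚ.* h ℚ.+ (ℚ.- l)) ℚ.+ ((l ℚ.+ r) ℚ.* h ℚ.+ (ℚ.- l)) ≡ (l ℚ.+ r) ℚ.* (h ℚ.+ h) ℚ.+ (ℚ.- (l ℚ.+ l))
    lower = RingSolver.solve-∀ ℚ-ring
    simplify : ∀ l r → (l ℚ.+ r) ℚ.* 1ℚ ℚ.+ (ℚ.- (l ℚ.+ l)) ≡ r ℚ.+ (ℚ.- l)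
    simplify = RingSolver.solve-∀ ℚ-ring
  ... | no _  = trans (upper (l b) (r b) ½) (simplify (l b) (r b))
    where
    upper : ∀ l r h → (r ℚ.+ (ℚ.- ((l ℚ.+ r) ℚ.* h))) ℚ.+ (r ℚ.+ (ℚ.- ((l ℚ.+ r) ℚ.* h))) ≡ (r ℚ.+ r) ℚ.+ (ℚ.- ((l ℚ.+ r) ℚ.* (h ℚ.+ h)))
    upper = RingSolver.solve-∀ ℚ-ring
    simplify : ∀ l r → (r ℚ.+ r) ℚ.+ (ℚ.- ((l ℚ.+ r) ℚ.* 1ℚ)) ≡ r ℚ.+ (ℚ.- l)
    simplify = RingSolver.solve-∀ ℚ-ring

  module _ (b₀ : Bracket) where

    bracket : ℕ → Bracket
    bracket zero    = b₀
    bracket (suc i) = refine (bracket i)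

    width-nonneg : ∀ i → 0ℚ ℚ.≤ width (bracket i)
    width-nonneg i = subst (ℚ._≤ width (bracket i)) (ℚ.+-inverseʳ (l (bracket i))) (ℚ.+-monoˡ-≤ (ℚ.- l (bracket i)) (l≤r (bracket i)))

    -- Halving gives an exponential decrease; the linear bound, proved from i + 2 ≤ 2(i + 1),
    -- suffices for the Archimedean argument and needs no powers.
    width-bound : ∀ i → fromInt (+ suc i) ℚ.* width (bracket i) ℚ.≤ width b₀
    width-bound zero    = ℚ.≤-reflexive (ℚ.*-identityˡ (width b₀))
    width-bound (suc i) = begin
      fromInt (+ suc (suc i)) ℚ.* w′
        ≤⟨ ℚ.*-monoʳ-≤-nonNeg w′ {{ℚ.nonNegative (width-nonneg (suc i))}} (fromInt-mono (ℤ.+≤+ (s≤s (ℕ.m≤n+m (suc i) i)))) ⟩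
      fromInt (+ suc i ℤ.+ + suc i) ℚ.* w′
        ≡⟨ cong (ℚ._* w′) (fromInt-+ (+ suc i) (+ suc i)) ⟩
      (fromInt (+ suc i) ℚ.+ fromInt (+ suc i)) ℚ.* w′
        ≡⟨ swap (fromInt (+ suc i)) w′ ⟩
      fromInt (+ suc i) ℚ.* (w′ ℚ.+ w′)
        ≡⟨ cong (fromInt (+ suc i) ℚ.*_) (refine-width (bracket i)) ⟩
      fromInt (+ suc i) ℚ.* width (bracket i)
        ≤⟨ width-bound i ⟩
      width b₀ ∎
      where
      open ℚ.≤-Reasoning
      w′ = width (bracket (suc i))
      swap : ∀ k w → (k ℚ.+ k) ℚ.* w ≡ k ℚ.* (w ℚ.+ w)
      swap = RingSolver.solve-∀ ℚ-ring

    width-small : ∀ ε → 0ℚ ℚ.< ε → ∃[ N ] width (bracket N) ℚ.< ε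
    width-small ε 0<ε with archimedean (width b₀ ℚ.* inv ε)
    ... | N , w/ε<N = N , ℚ.≰⇒> λ ε≤w → ℚ.<-irrefl refl (begin-strict
      width b₀
        ≡⟨ trans (ℚ.*-assoc (width b₀) (inv ε) ε) (trans (cong (width b₀ ℚ.*_) (inv-inverse ε λ ε≡0 → ℚ.<-irrefl (sym ε≡0) 0<ε)) (ℚ.*-identityʳ (width b₀))) ⟨
      width b₀ ℚ.* inv ε ℚ.* ε
        <⟨ ℚ.*-monoˡ-<-pos ε {{ℚ.positive 0<ε}} w/ε<N ⟩
      fromInt (+ N) ℚ.* ε
        ≤⟨ ℚ.*-monoʳ-≤-nonNeg ε {{ℚ.nonNegative (ℚ.<⇒≤ 0<ε)}} (fromInt-mono (ℤ.+≤+ (ℕ.n≤1+n N))) ⟩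
      fromInt (+ suc N) ℚ.* ε
        ≤⟨ ℚ.*-monoˡ-≤-nonNeg (fromInt (+ suc N)) {{ℚ.nonNegative (fromInt-mono {0ℤ} {+ suc N} (ℤ.+≤+ z≤n))}} ε≤w ⟩
      fromInt (+ suc N) ℚ.* width (bracket N)
        ≤⟨ width-bound N ⟩
      width b₀ ∎)
      where open ℚ.≤-Reasoning

    -- The sequence alternates between the two ends of the brackets, so that a
    -- function continuous along it takes close values at both ends.
    approximation : ℕ → ℚ
    approximation i = if alternate i then r (bracket i) else l (bracket i)

    within : ∀ N i → N ℕ.≤ i → l (bracket N) ℚ.≤ approximation i × approximation i ℚ.≤ r (bracket N)
    within N i N≤i = ends (alternate i)
      where
      nested : ∀ N i → N ℕ.≤′ i → l (bracket N) ℚ.≤ l (bracket i) × r (bracket i) ℚ.≤ r (bracket N)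
      nested N .N (ℕ.≤′-reflexive refl) = ℚ.≤-refl , ℚ.≤-refl
      nested N (suc i) (ℕ.≤′-step N≤i) with nested N i N≤i
      ... | h , h′ = ℚ.≤-trans h (refine-l (bracket i)) , ℚ.≤-trans (refine-r (bracket i)) h′
      ends : ∀ t → l (bracket N) ℚ.≤ (if t then r (bracket i) else l (bracket i)) ×
                   (if t then r (bracket i) else l (bracket i)) ℚ.≤ r (bracket N)
      ends t with nested N i (ℕ.≤⇒≤′ N≤i) | t
      ... | h , h′ | true  = ℚ.≤-trans h (l≤r (bracket i)) , h′
      ... | h , h′ | false = h , ℚ.≤-trans (l≤r (bracket i)) h′

    limit : ℝ
    limit = mkℝ approximation λ ε 0<ε → close ε (width-small ε 0<ε)
      where
      flip : ∀ x y → ℚ.- (x ℚ.+ (ℚ.- y)) ≡ y ℚ.+ (ℚ.- x)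
      flip = RingSolver.solve-∀ ℚ-ring
      close : ∀ ε → ∃[ N ] width (bracket N) ℚ.< ε →
        ∃[ N ] (∀ i j → N ℕ.≤ i → N ℕ.≤ j → ℚ.∣ approximation i ℚ.- approximation j ∣ ℚ.< ε)
      close ε (N , w<ε) = N , λ i j N≤i N≤j → abs-<
        (ℚ.≤-<-trans (ℚ.+-mono-≤ (proj₂ (within N i N≤i)) (ℚ.neg-antimono-≤ (proj₁ (within N j N≤j)))) w<ε)
        (subst (ℚ._< ε) (sym (flip (approximation i) (approximation j)))
          (ℚ.≤-<-trans (ℚ.+-mono-≤ (proj₂ (within N j N≤j)) (ℚ.neg-antimono-≤ (proj₁ (within N i N≤i)))) w<ε))

    ¬Pos-even : ∀ s → ¬ Pos (approximation (s ℕ.+ s))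
    ¬Pos-even s rewrite alternate-even s = ¬Pos-l (bracket (s ℕ.+ s))

    Pos-odd : ∀ s → Pos (approximation (suc (s ℕ.+ s)))
    Pos-odd s rewrite alternate-even s = Pos-r (bracket (suc (s ℕ.+ s)))

seq-∑ᵣ : ∀ {n} (f : Fin n → ℝ) i → seq (∑ᵣ f) i ≡ Σℚ.sum (λ x → seq (f x) i)
seq-∑ᵣ {zero}  f i = refl
seq-∑ᵣ {suc n} f i = cong (seq (f zero) i ℚ.+_) (seq-∑ᵣ (f ∘ suc) i)

positive-bound : ∀ q → ∃[ ρ ] 0ℚ ℚ.< ρ × q ℚ.≤ ρ
positive-bound q = 1ℚ ℚ.+ ℚ.∣ q ∣ , ℚ.+-mono-<-≤ (ℚ.positive⁻¹ 1ℚ) (ℚ.0≤∣p∣ q) ,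
  ℚ.≤-trans (≤-abs q) (subst (ℚ._≤ 1ℚ ℚ.+ ℚ.∣ q ∣) (ℚ.+-identityˡ ℚ.∣ q ∣) (ℚ.+-monoˡ-≤ ℚ.∣ q ∣ (ℚ.nonNegative⁻¹ 1ℚ)))

scaled-positive : ∀ ε ρ → 0ℚ ℚ.< ε → 0ℚ ℚ.< ρ → 0ℚ ℚ.< ε ℚ.* inv ρ
scaled-positive ε ρ 0<ε 0<ρ = subst (ℚ._< ε ℚ.* inv ρ) (ℚ.*-zeroˡ (inv ρ)) (ℚ.*-monoˡ-<-pos (inv ρ) {{ℚ.positive (inv-positive ρ 0<ρ)}} 0<ε)

below-close : ∀ {ε} x y → y ℚ.≤ 0ℚ → ℚ.∣ x ℚ.- y ∣ ℚ.< ε → x ℚ.< ε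
below-close {ε} x y y≤0 close = begin-strict
  x                    ≡⟨ ℚ.+-identityʳ x ⟨
  x ℚ.+ 0ℚ             ≤⟨ ℚ.+-monoʳ-≤ x (ℚ.neg-antimono-≤ y≤0) ⟩
  x ℚ.- y              ≤⟨ ≤-abs (x ℚ.- y) ⟩
  ℚ.∣ x ℚ.- y ∣        <⟨ close ⟩
  ε                    ∎
  where open ℚ.≤-Reasoning

recurrence-small : ∀ t a b f′ f ρ ε → t ℚ.+ (ℚ.- a) ℚ.≤ ρ → 0ℚ ℚ.< ρ → 0ℚ ℚ.≤ f′ → 0ℚ ℚ.≤ f → 0ℚ ℚ.≤ b →
  f′ ℚ.< ε ℚ.* inv ρ → (t ℚ.+ (ℚ.- a)) ℚ.* f′ ℚ.+ (ℚ.- b) ℚ.* f ℚ.< ε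
recurrence-small t a b f′ f ρ ε t-a≤ρ 0<ρ 0≤f′ 0≤f 0≤b f′<δ = begin-strict
  (t ℚ.+ (ℚ.- a)) ℚ.* f′ ℚ.+ (ℚ.- b) ℚ.* f
    ≤⟨ ℚ.+-mono-≤ (ℚ.*-monoʳ-≤-nonNeg f′ {{ℚ.nonNegative 0≤f′}} t-a≤ρ)
                  (ℚ.*-monoˡ-≤-nonPos (ℚ.- b) {{ℚ.nonPositive (ℚ.neg-antimono-≤ 0≤b)}} 0≤f) ⟩
  ρ ℚ.* f′ ℚ.+ (ℚ.- b) ℚ.* 0ℚ
    ≡⟨ trans (cong (ρ ℚ.* f′ ℚ.+_) (ℚ.*-zeroʳ (ℚ.- b))) (ℚ.+-identityʳ (ρ ℚ.* f′)) ⟩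
  ρ ℚ.* f′
    <⟨ ℚ.*-monoʳ-<-pos ρ {{ℚ.positive 0<ρ}} f′<δ ⟩
  ρ ℚ.* (ε ℚ.* inv ρ)
    ≡⟨ swap ρ ε (inv ρ) ⟩
  ε ℚ.* (inv ρ ℚ.* ρ)
    ≡⟨ trans (cong (ε ℚ.*_) (inv-inverse ρ λ ρ≡0 → ℚ.<-irrefl (sym ρ≡0) 0<ρ)) (ℚ.*-identityʳ ε) ⟩
  ε ∎
  where
  open ℚ.≤-Reasoning
  swap : ∀ r e i → r ℚ.* (e ℚ.* i) ≡ e ℚ.* (i ℚ.* r)
  swap = RingSolver.solve-∀ ℚ-ring

-- A real root above the Rayleigh quotient and its eigenvector

module Root (a b : ℕ → ℚ) (b-nonneg : ∀ k → 0ℚ ℚ.≤ b (suc k)) (d : ℕ) (d≥1 : 1 ℕ.≤ d) where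
  open Recurrence a b

  -- Running the recurrence on Cauchy reals makes the values of `φ` along `seq ν` a Cauchy sequence;
  -- this takes the place of continuity.
  φᵣ : ℝ → ℕ → ℝ
  φᵣ t 0             = 0ᵣ
  φᵣ t 1             = fromℚ 1ℚ
  φᵣ t (suc (suc k)) = ((t +ᵣ fromℚ (ℚ.- a (suc k))) *ᵣ φᵣ t (suc k)) +ᵣ (fromℚ (ℚ.- b (suc k)) *ᵣ φᵣ t k)

  seq-φ : ∀ t k i → seq (φᵣ t k) i ≡ φ (seq t i) k
  seq-φ t 0             i = refl
  seq-φ t 1             i = refl
  seq-φ t (suc (suc k)) i = cong₂ (λ p q → (seq t i ℚ.+ (ℚ.- a (suc k))) ℚ.* p ℚ.+ (ℚ.- b (suc k)) ℚ.* q)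
    (seq-φ t (suc k) i) (seq-φ t k i)

  private
    -- Positivity of the whole Sturm sequence, which for nonnegative `b` means that `t` exceeds the
    -- largest root. The sign of the last polynomial alone is not known at the left end `a 1`,
    -- whereas the sequence cannot be positive there because its second polynomial vanishes.
    Pos : ℚ → Set
    Pos t = ∀ {j} → j ℕ.< suc d → 0ℚ ℚ.< φ t (suc j)

    Pos? : ∀ t → Dec (Pos t)
    Pos? t = ℕ.allUpTo? (λ j → 0ℚ ℚ.<? φ t (suc j)) (suc d)

    ¬Pos-a₁ : ¬ Pos (a 1)
    ¬Pos-a₁ pos = ℚ.<-irrefl (sym (root (a 1) (b 1))) (pos (s≤s d≥1))
      where
      root : ∀ a b → (a ℚ.+ (ℚ.- a)) ℚ.* 1ℚ ℚ.+ (ℚ.- b) ℚ.* 0ℚ ≡ 0ℚ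
      root = RingSolver.solve-∀ ℚ-ring

    -- The right end of the first bracket. Once `t` is at least `a + b + 1` in every row, each value
    -- of `φ` is at least its predecessor, and the sequence stays positive from its initial value 1
    -- on.
    bound : ℕ → ℚ
    bound zero    = 0ℚ
    bound (suc k) = bound k ℚ.⊔ (a (suc k) ℚ.+ b (suc k) ℚ.+ 1ℚ)

    bound-≥ : ∀ k j → j ℕ.< k → a (suc j) ℚ.+ b (suc j) ℚ.+ 1ℚ ℚ.≤ bound k
    bound-≥ (suc k) j (s≤s j≤k) with ℕ.m≤n⇒m<n∨m≡n j≤k
    ... | inj₁ j<k  = ℚ.≤-trans (bound-≥ k j j<k) (ℚ.p≤p⊔q (bound k) _)
    ... | inj₂ refl = ℚ.p≤q⊔p (bound k) _

    R : ℚ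
    R = bound d

    growing : ∀ k → k ℕ.≤ d → φ R k ℚ.≤ φ R (suc k) × 0ℚ ℚ.< φ R (suc k)
    growing zero    _   = ℚ.nonNegative⁻¹ 1ℚ , ℚ.positive⁻¹ 1ℚ
    growing (suc k) k<d with growing k (ℕ.≤-trans (ℕ.n≤1+n k) k<d)
    ... | φ≤φ′ , 0<φ′ = φ′≤φ″ , ℚ.<-≤-trans 0<φ′ φ′≤φ″
      where
      open ℚ.≤-Reasoning
      φ′ = φ R (suc k)
      a′ = a (suc k)
      b′ = b (suc k)
      expand : ∀ f a b → f ≡ ((a ℚ.+ b ℚ.+ 1ℚ) ℚ.+ (ℚ.- a)) ℚ.* f ℚ.+ (ℚ.- b) ℚ.* f
      expand = RingSolver.solve-∀ ℚ-ring
      φ′≤φ″ : φ′ ℚ.≤ φ R (suc (suc k))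
      φ′≤φ″ = begin
        φ′
          ≡⟨ expand φ′ a′ b′ ⟩
        ((a′ ℚ.+ b′ ℚ.+ 1ℚ) ℚ.+ (ℚ.- a′)) ℚ.* φ′ ℚ.+ (ℚ.- b′) ℚ.* φ′
          ≤⟨ ℚ.+-mono-≤
               (ℚ.*-monoʳ-≤-nonNeg φ′ {{ℚ.nonNegative (ℚ.<⇒≤ 0<φ′)}} (ℚ.+-monoˡ-≤ (ℚ.- a′) (bound-≥ d k k<d)))
               (ℚ.*-monoˡ-≤-nonPos (ℚ.- b′) {{ℚ.nonPositive (ℚ.neg-antimono-≤ (b-nonneg k))}} φ≤φ′) ⟩
        φ R (suc (suc k)) ∎

    a₁≤R : a 1 ℚ.≤ R
    a₁≤R = ℚ.≤-trans (subst (ℚ._≤ a 1 ℚ.+ b 1 ℚ.+ 1ℚ) (trans (ℚ.+-identityʳ _) (ℚ.+-identityʳ (a 1)))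
      (ℚ.+-mono-≤ (ℚ.+-monoʳ-≤ (a 1) (b-nonneg 0)) (ℚ.nonNegative⁻¹ 1ℚ))) (bound-≥ d 0 d≥1)

    open Bisection Pos Pos?

    b₀ : Bracket
    b₀ = record { l = a 1 ; r = R ; l≤r = a₁≤R ; ¬Pos-l = ¬Pos-a₁ ; Pos-r = λ { {j} (s≤s j≤d) → proj₂ (growing j j≤d) } }

    module At (ν : ℝ) (ν≤R : ∀ i → seq ν i ℚ.≤ R)
      (¬pos-even : ∀ s → ¬ Pos (seq ν (s ℕ.+ s))) (pos-odd : ∀ s → Pos (seq ν (suc (s ℕ.+ s)))) where

      τ : ℕ → ℚ
      τ = seq ν

      φ-cauchy : ∀ k ε → 0ℚ ℚ.< ε → ∃[ N ] (∀ i j → N ℕ.≤ i → N ℕ.≤ j → ℚ.∣ φ (τ i) k ℚ.- φ (τ j) k ∣ ℚ.< ε)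
      φ-cauchy k ε 0<ε = proj₁ c , λ i j N≤i N≤j → subst₂ (λ p q → ℚ.∣ p ℚ.- q ∣ ℚ.< ε)
        (seq-φ ν k i) (seq-φ ν k j) (proj₂ c i j N≤i N≤j)
        where
        c = cauchy (φᵣ ν k) ε 0<ε

      even odd : ℕ → ℕ
      even s = s ℕ.+ s
      odd s  = suc (s ℕ.+ s)

      -- At the left ends some φ j is not positive; at the right ends all are,
      -- and by continuity and the recurrence smallness propagates up to φ (1 + d).
      Small : ℕ → ℚ → ℕ → Set
      Small k ε N = ∀ s → N ℕ.≤ s →
        (∀ j → j ℕ.≤ k → 0ℚ ℚ.< φ (τ (even s)) (suc j)) ⊎ φ (τ (odd s)) (suc k) ℚ.< ε

      small : ∀ k → k ℕ.≤ d → ∀ ε → 0ℚ ℚ.< ε → ∃ (Small k ε)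
      small zero    _   ε 0<ε = 0 , λ s _ → inj₁ λ where zero z≤n → ℚ.positive⁻¹ 1ℚ
      small (suc k) k<d ε 0<ε = choose (positive-bound (R ℚ.+ (ℚ.- a (suc k))))
        where
        choose : ∃[ ρ ] 0ℚ ℚ.< ρ × R ℚ.+ (ℚ.- a (suc k)) ℚ.≤ ρ → ∃ (Small (suc k) ε)
        choose (ρ , 0<ρ , R-a≤ρ) = combine (small k (ℕ.≤-trans (ℕ.n≤1+n k) k<d) (ε ℚ.* inv ρ) (scaled-positive ε ρ 0<ε 0<ρ))
                                           (φ-cauchy (suc (suc k)) ε 0<ε)
          where
          combine : ∃ (Small k (ε ℚ.* inv ρ)) →
            ∃[ N ] (∀ i j → N ℕ.≤ i → N ℕ.≤ j → ℚ.∣ φ (τ i) (suc (suc k)) ℚ.- φ (τ j) (suc (suc k)) ∣ ℚ.< ε) →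
            ∃ (Small (suc k) ε)
          combine (M , h) (N , close) = M ℕ.⊔ N , λ s M⊔N≤s →
            step s (ℕ.m⊔n≤o⇒n≤o M N M⊔N≤s) (h s (ℕ.m⊔n≤o⇒m≤o M N M⊔N≤s))
            where
            step : ∀ s → N ℕ.≤ s →
              (∀ j → j ℕ.≤ k → 0ℚ ℚ.< φ (τ (even s)) (suc j)) ⊎ φ (τ (odd s)) (suc k) ℚ.< ε ℚ.* inv ρ →
              (∀ j → j ℕ.≤ suc k → 0ℚ ℚ.< φ (τ (even s)) (suc j)) ⊎ φ (τ (odd s)) (suc (suc k)) ℚ.< ε
            step s N≤s (inj₁ pos) = split (0ℚ ℚ.<? φ (τ (even s)) (suc (suc k)))
              where
              split : Dec (0ℚ ℚ.< φ (τ (even s)) (suc (suc k))) →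
                (∀ j → j ℕ.≤ suc k → 0ℚ ℚ.< φ (τ (even s)) (suc j)) ⊎ φ (τ (odd s)) (suc (suc k)) ℚ.< ε
              split (yes 0<φ) = inj₁ λ j j≤1+k → case ℕ.m≤n⇒m<n∨m≡n j≤1+k of λ where
                (inj₁ (s≤s j≤k)) → pos j j≤k
                (inj₂ refl)      → 0<φ
              split (no 0≮φ) = inj₂ (below-close (φ (τ (odd s)) (suc (suc k))) (φ (τ (even s)) (suc (suc k))) (ℚ.≮⇒≥ 0≮φ)
                (close (odd s) (even s) (ℕ.≤-trans N≤s (ℕ.m≤n⇒m≤1+n (ℕ.m≤m+n s s))) (ℕ.≤-trans N≤s (ℕ.m≤m+n s s))))
            step s N≤s (inj₂ φ<δ) = inj₂ (recurrence-small (τ (odd s)) (a (suc k)) (b (suc k)) (φ (τ (odd s)) (suc k)) (φ (τ (odd s)) k) ρ ε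
              (ℚ.≤-trans (ℚ.+-monoˡ-≤ (ℚ.- a (suc k)) (ν≤R (odd s))) R-a≤ρ) 0<ρ (ℚ.<⇒≤ (φ>0 k k<d)) (φ≥0 k k<d) (b-nonneg k) φ<δ)
              where
              φ>0 : ∀ k → k ℕ.< d → 0ℚ ℚ.< φ (τ (odd s)) (suc k)
              φ>0 k k<d = pos-odd s (ℕ.m≤n⇒m≤1+n k<d)
              φ≥0 : ∀ k → k ℕ.< d → 0ℚ ℚ.≤ φ (τ (odd s)) k
              φ≥0 zero    _   = ℚ.≤-refl
              φ≥0 (suc k) k<d = ℚ.<⇒≤ (φ>0 k (ℕ.≤-trans (ℕ.n≤1+n (suc k)) k<d))

      -- Full positivity is excluded at the left ends, so at level `d` only smallness at the right
      -- ends remains; the Cauchy property carries it over to all indices.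
      φ-null : Null (λ i → φ (τ i) (suc d))
      φ-null ε 0<ε with small d ℕ.≤-refl (ε ℚ.* ½) (half 0<ε) | φ-cauchy (suc d) (ε ℚ.* ½) (half 0<ε)
      ... | M , h | N , close = N , λ i N≤i → begin-strict
        ℚ.∣ φ (τ i) (suc d) ∣
          ≡⟨ cong ℚ.∣_∣ (split (φ (τ i) (suc d)) (φ (τ (odd s)) (suc d))) ⟩
        ℚ.∣ (φ (τ i) (suc d) ℚ.- φ (τ (odd s)) (suc d)) ℚ.+ φ (τ (odd s)) (suc d) ∣
          ≤⟨ ℚ.∣p+q∣≤∣p∣+∣q∣ (φ (τ i) (suc d) ℚ.- φ (τ (odd s)) (suc d)) (φ (τ (odd s)) (suc d)) ⟩
        ℚ.∣ φ (τ i) (suc d) ℚ.- φ (τ (odd s)) (suc d) ∣ ℚ.+ ℚ.∣ φ (τ (odd s)) (suc d) ∣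
          <⟨ ℚ.+-mono-< (close i (odd s) N≤i (ℕ.≤-trans (ℕ.m≤n⊔m M N) (ℕ.m≤n⇒m≤1+n (ℕ.m≤m+n s s)))) end-small ⟩
        ε ℚ.* ½ ℚ.+ ε ℚ.* ½
          ≡⟨ half+half ε ⟩
        ε ∎
        where
        open ℚ.≤-Reasoning
        s = M ℕ.⊔ N
        split : ∀ x y → x ≡ (x ℚ.+ (ℚ.- y)) ℚ.+ y
        split = RingSolver.solve-∀ ℚ-ring
        end-small : ℚ.∣ φ (τ (odd s)) (suc d) ∣ ℚ.< ε ℚ.* ½
        end-small with h s (ℕ.m≤m⊔n M N)
        ... | inj₁ pos = contradiction (λ { {j} (s≤s j≤d) → pos j j≤d }) (¬pos-even s)
        ... | inj₂ φ<  = subst (ℚ._< ε ℚ.* ½) (sym (ℚ.0≤p⇒∣p∣≡p (ℚ.<⇒≤ (pos-odd s ℕ.≤-refl)))) φ<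

  root : ∃[ ν ] (∀ i → a 1 ℚ.≤ seq ν i) × Null (λ i → φ (seq ν i) (suc d))
  root = limit b₀ , (λ i → proj₁ (within b₀ 0 i z≤n)) ,
    At.φ-null (limit b₀) (λ i → proj₂ (within b₀ 0 i z≤n)) (¬Pos-even b₀) (Pos-odd b₀)

module Eigenpair {n} (B : Fin n → Vecℚ n) (B-sym : ∀ x y → B x y ≡ B y x) (u : Vecℚ n) (u≢0 : dot u u ≢ 0ℚ)
  (d : ℕ) (regular : Lanczos.Regular B B-sym u d) (last≡0 : Lanczos.norm² B B-sym u (suc d) ≡ 0ℚ) where
  open Lanczos B B-sym u

  private
    W-last : ∀ x → W (suc d) x ≡ 0ℚ
    W-last = dot≡0 (W (suc d)) last≡0

    d≥1 : 1 ℕ.≤ d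
    d≥1 = positive d last≡0
      where
      positive : ∀ d → norm² (suc d) ≡ 0ℚ → 1 ℕ.≤ d
      positive zero    e = contradiction e u≢0
      positive (suc _) _ = s≤s z≤n

  open Root a b b-nonneg d d≥1

  module _ (ν : ℝ) (φ-null : Null (λ i → φ (seq ν i) (suc d))) where

    Eᵣ : ℝ → ℕ → Fin n → ℝ
    Eᵣ t 0       x = 0ᵣ
    Eᵣ t (suc k) x = Eᵣ t k x +ᵣ (φᵣ t (suc k) *ᵣ fromℚ (inv (norm² (suc k)) ℚ.* W (suc k) x))

    seq-E : ∀ t k x i → seq (Eᵣ t k x) i ≡ E (seq t i) k x
    seq-E t 0       x i = refl
    seq-E t (suc k) x i = cong₂ (λ p q → p ℚ.+ q ℚ.* (inv (norm² (suc k)) ℚ.* W (suc k) x)) (seq-E t k x i) (seq-φ t (suc k) i)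

    eigenvector : Fin n → ℝ
    eigenvector = Eᵣ ν d

    eigenvector-equation : ∀ x → Null λ i →
      mul B (λ y → seq (eigenvector y) i) x ℚ.+ (ℚ.- (seq ν i ℚ.* seq (eigenvector x) i))
    eigenvector-equation x = Null-cong (λ i → sym (begin
      mul B (λ y → seq (eigenvector y) i) x ℚ.+ (ℚ.- (seq ν i ℚ.* seq (eigenvector x) i))
        ≡⟨ cong₂ (λ p q → p ℚ.+ (ℚ.- (seq ν i ℚ.* q))) (Σℚ.sum-cong-≗ λ y → cong (B x y ℚ.*_) (seq-E ν d y i)) (seq-E ν d x i) ⟩
      mul B (E (seq ν i) d) x ℚ.+ (ℚ.- (seq ν i ℚ.* E (seq ν i) d x))
        ≡⟨ cong (ℚ._+ (ℚ.- (seq ν i ℚ.* E (seq ν i) d x))) (eigen-residual (seq ν i) d regular x) ⟩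
      seq ν i ℚ.* E (seq ν i) d x ℚ.+ φ (seq ν i) d ℚ.* inv (norm² d) ℚ.* W (suc d) x ℚ.+ (ℚ.- (φ (seq ν i) (suc d) ℚ.* inv (norm² d) ℚ.* W d x))
        ℚ.+ (ℚ.- (seq ν i ℚ.* E (seq ν i) d x))
        ≡⟨ cong (λ w → seq ν i ℚ.* E (seq ν i) d x ℚ.+ φ (seq ν i) d ℚ.* inv (norm² d) ℚ.* w ℚ.+ (ℚ.- (φ (seq ν i) (suc d) ℚ.* inv (norm² d) ℚ.* W d x))
             ℚ.+ (ℚ.- (seq ν i ℚ.* E (seq ν i) d x))) (W-last x) ⟩
      seq ν i ℚ.* E (seq ν i) d x ℚ.+ φ (seq ν i) d ℚ.* inv (norm² d) ℚ.* 0ℚ ℚ.+ (ℚ.- (φ (seq ν i) (suc d) ℚ.* inv (norm² d) ℚ.* W d x))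
        ℚ.+ (ℚ.- (seq ν i ℚ.* E (seq ν i) d x))
        ≡⟨ simplify (seq ν i ℚ.* E (seq ν i) d x) (φ (seq ν i) d ℚ.* inv (norm² d)) (φ (seq ν i) (suc d)) (inv (norm² d)) (W d x) ⟩
      φ (seq ν i) (suc d) ℚ.* (ℚ.- (inv (norm² d) ℚ.* W d x)) ∎))
      (Null-scale (ℚ.- (inv (norm² d) ℚ.* W d x)) φ-null)
      where
      open ≡-Reasoning
      simplify : ∀ e f g i w → e ℚ.+ f ℚ.* 0ℚ ℚ.+ (ℚ.- (g ℚ.* i ℚ.* w)) ℚ.+ (ℚ.- e) ≡ g ℚ.* (ℚ.- (i ℚ.* w))
      simplify = RingSolver.solve-∀ ℚ-ring

    eigenvector-≄0 : ¬ (∀ x → Null (seq (eigenvector x)))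
    eigenvector-≄0 null with Null-sum (λ i x → seq (eigenvector x) i ℚ.* u x) (λ x → Null-scale (u x) (null x)) 1ℚ (ℚ.positive⁻¹ 1ℚ)
    ... | N , h = contradiction (subst (λ t → ℚ.∣ t ∣ ℚ.< 1ℚ) (begin
      dot (λ x → seq (eigenvector x) N) u   ≡⟨ dot-congˡ u (λ x → seq-E ν d x N) ⟩
      dot (E (seq ν N) d) u                     ≡⟨ normalised-E d d≥1 ⟩
      1ℚ                                    ∎) (h N ℕ.≤-refl)) (ℚ.<-irrefl refl)
      where
      open ≡-Reasoning
      normalised-E : ∀ d → 1 ℕ.≤ d → dot (E (seq ν N) d) u ≡ 1ℚ
      normalised-E (suc d) _ = dot-E-u (seq ν N) d u≢0

  eigenpair : ∃[ ν ] ∃ λ (v : Fin n → ℝ) → (∀ i → α u ℚ.≤ seq ν i) ×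
    (∀ x → Null λ i → mul B (λ y → seq (v y) i) x ℚ.+ (ℚ.- (seq ν i ℚ.* seq (v x) i))) ×
    ¬ (∀ x → Null (seq (v x)))
  eigenpair = from root
    where
    from : ∃[ ν ] (∀ i → a 1 ℚ.≤ seq ν i) × Null (λ i → φ (seq ν i) (suc d)) → _
    from (ν , α≤ν , φ-null) = ν , eigenvector ν φ-null , α≤ν , eigenvector-equation ν φ-null , eigenvector-≄0 ν φ-null

-- Eigenvalue bounds and semidefiniteness

quadratic : ∀ {n} → Matrix n → Vecℚ n → ℚ
quadratic A v = dot (mul (λ x y → fromInt (A x y)) v) v

-- If the form is negative at `v`, the process is started for `-A` at `v`. Its first coefficient is
-- the Rayleigh quotient, which exceeds 3, and the root found lies at or above it; its negative is
-- an eigenvalue of `A` below -3.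
eigenvalues⇒form : ∀ {n} (A : Matrix n) → (∀ x y → A x y ≡ A y x) →
  (∀ ν → IsEigenvalue A ν → -3ᵣ ≤ᵣ ν) → ∀ v → 0ℚ ℚ.≤ quadratic A v ℚ.+ fromInt (+ 3) ℚ.* dot v v
eigenvalues⇒form {n} A A-sym eigen≥ v = ℚ.≮⇒≥ λ form<0 →
  let d , regular , last≡0 = Lanczos.terminates B B-sym v
      ν , w , α≤ν , equation , w≄0 = Eigenpair.eigenpair B B-sym v (v≢0 form<0) d regular last≡0
  in absurd form<0 ν w α≤ν equation w≄0
  where
  3ℚ : ℚ
  3ℚ = fromInt (+ 3)
  Aℚ B : Fin n → Vecℚ n
  Aℚ x y = fromInt (A x y)
  B x y = ℚ.- Aℚ x y
  B-sym : ∀ x y → B x y ≡ B y x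
  B-sym x y = cong (λ t → ℚ.- fromInt t) (A-sym x y)
  minus : ∀ q → ℚ.- q ≡ (ℚ.- 1ℚ) ℚ.* q
  minus = RingSolver.solve-∀ ℚ-ring
  mulB : ∀ w x → mul B w x ≡ (ℚ.- 1ℚ) ℚ.* mul Aℚ w x
  mulB w x = trans (Σℚ.sum-cong-≗ λ y → trans (sym (ℚ.neg-distribˡ-* (Aℚ x y) (w y))) (minus (Aℚ x y ℚ.* w y)))
    (sym (sum-scale (ℚ.- 1ℚ) λ y → Aℚ x y ℚ.* w y))
  α : ℚ
  α = Lanczos.α B B-sym v v

  module _ (form<0 : quadratic A v ℚ.+ 3ℚ ℚ.* dot v v ℚ.< 0ℚ) where

    v≢0 : dot v v ≢ 0ℚ
    v≢0 e = ℚ.<-irrefl (trans (cong₂ (λ p q → p ℚ.+ 3ℚ ℚ.* q)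
      (trans (dot-comm (mul Aℚ v) v) (dot-zeroˡ (mul Aℚ v) (dot≡0 v e))) e) refl) form<0

    α>3 : 3ℚ ℚ.< α
    α>3 = begin-strict
      3ℚ
        ≡⟨ trans (ℚ.*-assoc 3ℚ (dot v v) (inv (dot v v))) (trans (cong (3ℚ ℚ.*_)
             (trans (ℚ.*-comm (dot v v) (inv (dot v v))) (inv-inverse (dot v v) v≢0))) (ℚ.*-identityʳ 3ℚ)) ⟨
      3ℚ ℚ.* dot v v ℚ.* inv (dot v v)
        <⟨ ℚ.*-monoˡ-<-pos (inv (dot v v)) {{ℚ.positive (inv-positive (dot v v) 0<v)}} 3v<Bv ⟩
      dot (mul B v) v ℚ.* inv (dot v v) ∎
      where
      open ℚ.≤-Reasoning
      0<v : 0ℚ ℚ.< dot v v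
      0<v = ℚ.≰⇒> λ v≤0 → v≢0 (ℚ.≤-antisym v≤0 (dot-nonneg v))
      Bv≡ : dot (mul B v) v ≡ (ℚ.- 1ℚ) ℚ.* quadratic A v
      Bv≡ = trans (dot-congˡ v (mulB v)) (dot-*ˡ (ℚ.- 1ℚ) (mul Aℚ v) v)
      left : ∀ q t → (ℚ.- 1ℚ) ℚ.* q ℚ.+ (q ℚ.+ t) ≡ t
      left = RingSolver.solve-∀ ℚ-ring
      3v<Bv : 3ℚ ℚ.* dot v v ℚ.< dot (mul B v) v
      3v<Bv = subst₂ ℚ._<_ (left (quadratic A v) (3ℚ ℚ.* dot v v)) (trans (ℚ.+-identityʳ ((ℚ.- 1ℚ) ℚ.* quadratic A v)) (sym Bv≡))
        (ℚ.+-monoʳ-< ((ℚ.- 1ℚ) ℚ.* quadratic A v) form<0)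

    module _ (ν : ℝ) (w : Fin n → ℝ) (α≤ν : ∀ i → α ℚ.≤ seq ν i)
      (equation : ∀ x → Null λ i → mul B (λ y → seq (w y) i) x ℚ.+ (ℚ.- (seq ν i ℚ.* seq (w x) i)))
      (w≄0 : ¬ (∀ x → Null (seq (w x)))) where

      μ : ℝ
      μ = fromℚ (ℚ.- 1ℚ) *ᵣ ν

      isEigenvalue : IsEigenvalue A μ
      isEigenvalue = w ,
        (λ zero → w≄0 λ x → Null-cong (λ i → ℚ.+-identityʳ (seq (w x) i)) (zero x)) ,
        λ x → Null-cong (λ i → sym (begin
          seq (∑ᵣ (λ y → fromℤ (A x y) *ᵣ w y)) i ℚ.+ (ℚ.- ((ℚ.- 1ℚ) ℚ.* seq ν i ℚ.* seq (w x) i))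
            ≡⟨ cong (ℚ._+ (ℚ.- ((ℚ.- 1ℚ) ℚ.* seq ν i ℚ.* seq (w x) i))) (seq-∑ᵣ (λ y → fromℤ (A x y) *ᵣ w y) i) ⟩
          mul Aℚ (λ y → seq (w y) i) x ℚ.+ (ℚ.- ((ℚ.- 1ℚ) ℚ.* seq ν i ℚ.* seq (w x) i))
            ≡⟨ flip (mul Aℚ (λ y → seq (w y) i) x) (seq ν i) (seq (w x) i) ⟩
          ((ℚ.- 1ℚ) ℚ.* mul Aℚ (λ y → seq (w y) i) x ℚ.+ (ℚ.- (seq ν i ℚ.* seq (w x) i))) ℚ.* (ℚ.- 1ℚ)
            ≡⟨ cong (λ t → (t ℚ.+ (ℚ.- (seq ν i ℚ.* seq (w x) i))) ℚ.* (ℚ.- 1ℚ)) (mulB (λ y → seq (w y) i) x) ⟨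
          (mul B (λ y → seq (w y) i) x ℚ.+ (ℚ.- (seq ν i ℚ.* seq (w x) i))) ℚ.* (ℚ.- 1ℚ) ∎))
          (Null-scale (ℚ.- 1ℚ) (equation x))
        where
        open ≡-Reasoning
        flip : ∀ m t e → m ℚ.+ (ℚ.- ((ℚ.- 1ℚ) ℚ.* t ℚ.* e)) ≡ ((ℚ.- 1ℚ) ℚ.* m ℚ.+ (ℚ.- (t ℚ.* e))) ℚ.* (ℚ.- 1ℚ)
        flip = RingSolver.solve-∀ ℚ-ring

      absurd : ⊥
      absurd = ℚ.<-irrefl refl (ℚ.<-≤-trans (proj₂ far (proj₁ far) ℕ.≤-refl) (begin
        (ℚ.- 1ℚ) ℚ.* seq ν N ℚ.+ (α ℚ.+ (ℚ.- 3ℚ))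
          ≤⟨ ℚ.+-monoˡ-≤ (α ℚ.+ (ℚ.- 3ℚ)) (ℚ.*-monoˡ-≤-nonPos (ℚ.- 1ℚ) (α≤ν N)) ⟩
        (ℚ.- 1ℚ) ℚ.* α ℚ.+ (α ℚ.+ (ℚ.- 3ℚ))
          ≡⟨ cancel α (ℚ.- 3ℚ) ⟩
        ℚ.- 3ℚ ∎))
        where
        open ℚ.≤-Reasoning
        -- With tolerance α - 3 the assumed bound says that the terms of `μ` eventually exceed -α,
        -- while all of them are at most -α.
        far = eigen≥ μ isEigenvalue (α ℚ.+ (ℚ.- 3ℚ)) (subst (ℚ._< α ℚ.+ (ℚ.- 3ℚ)) (ℚ.+-inverseʳ 3ℚ) (ℚ.+-monoˡ-< (ℚ.- 3ℚ) α>3))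
        N = proj₁ far
        cancel : ∀ a c → (ℚ.- 1ℚ) ℚ.* a ℚ.+ (a ℚ.+ c) ≡ c
        cancel = RingSolver.solve-∀ ℚ-ring

Null-dominated : ∀ {s t} N₀ → (∀ i → N₀ ℕ.≤ i → ℚ.∣ s i ∣ ℚ.≤ t i) → Null t → Null s
Null-dominated {s} {t} N₀ dominated null ε 0<ε = from (null ε 0<ε)
  where
  from : ∃[ N ] (∀ i → N ℕ.≤ i → ℚ.∣ t i ∣ ℚ.< ε) → ∃[ N ] (∀ i → N ℕ.≤ i → ℚ.∣ s i ∣ ℚ.< ε)
  from (N , h) = N₀ ℕ.⊔ N , λ i le → ℚ.≤-<-trans (dominated i (ℕ.m⊔n≤o⇒m≤o N₀ N le))
    (ℚ.≤-<-trans (≤-abs (t i)) (h i (ℕ.m⊔n≤o⇒n≤o N₀ N le)))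

Null-abs : ∀ {s} → Null s → Null (λ i → ℚ.∣ s i ∣)
Null-abs {s} null ε 0<ε = proj₁ (null ε 0<ε) , λ i le → subst (ℚ._< ε) (sym (ℚ.∣∣p∣∣≡∣p∣ (s i))) (proj₂ (null ε 0<ε) i le)

square-cancel : ∀ x s → 0ℚ ℚ.≤ s → x ℚ.* x ℚ.≤ s ℚ.* s → x ℚ.≤ s
square-cancel x s 0≤s x²≤s² = ℚ.≮⇒≥ λ s<x → ℚ.<-irrefl refl (begin-strict
  s ℚ.* s        ≤⟨ ℚ.*-monoˡ-≤-nonNeg s {{ℚ.nonNegative 0≤s}} (ℚ.<⇒≤ s<x) ⟩
  s ℚ.* x        <⟨ ℚ.*-monoˡ-<-pos x {{ℚ.positive (ℚ.≤-<-trans 0≤s s<x)}} s<x ⟩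
  x ℚ.* x        ≤⟨ x²≤s² ⟩
  s ℚ.* s        ∎)
  where open ℚ.≤-Reasoning

abs-square : ∀ q → ℚ.∣ q ∣ ℚ.* ℚ.∣ q ∣ ≡ q ℚ.* q
abs-square q with ℚ.∣p∣≡p∨∣p∣≡-p q
... | inj₁ e = cong₂ ℚ._*_ e e
... | inj₂ e = trans (cong₂ ℚ._*_ e e) (lemma q)
  where
  lemma : ∀ q → (ℚ.- q) ℚ.* (ℚ.- q) ≡ q ℚ.* q
  lemma = RingSolver.solve-∀ ℚ-ring

sum-squares-≤ : ∀ {n} (r : Vecℚ n) → dot r r ℚ.≤ Σℚ.sum (λ x → ℚ.∣ r x ∣) ℚ.* Σℚ.sum (λ x → ℚ.∣ r x ∣)
sum-squares-≤ {zero}  r = ℚ.≤-refl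
sum-squares-≤ {suc n} r = begin
  r zero ℚ.* r zero ℚ.+ dot (r ∘ suc) (r ∘ suc)
    ≤⟨ ℚ.+-mono-≤ (ℚ.≤-reflexive (sym (abs-square (r zero)))) (sum-squares-≤ (r ∘ suc)) ⟩
  x ℚ.* x ℚ.+ S ℚ.* S
    ≡⟨ ℚ.+-identityʳ (x ℚ.* x ℚ.+ S ℚ.* S) ⟨
  x ℚ.* x ℚ.+ S ℚ.* S ℚ.+ 0ℚ
    ≤⟨ ℚ.+-monoʳ-≤ (x ℚ.* x ℚ.+ S ℚ.* S) (ℚ.+-mono-≤ 0≤xS 0≤xS) ⟩
  x ℚ.* x ℚ.+ S ℚ.* S ℚ.+ (x ℚ.* S ℚ.+ x ℚ.* S)
    ≡⟨ expand x S ⟩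
  (x ℚ.+ S) ℚ.* (x ℚ.+ S) ∎
  where
  open ℚ.≤-Reasoning
  x = ℚ.∣ r zero ∣
  S = Σℚ.sum (λ y → ℚ.∣ r (suc y) ∣)
  0≤xS : 0ℚ ℚ.≤ x ℚ.* S
  0≤xS = subst (ℚ._≤ x ℚ.* S) (ℚ.*-zeroʳ x) (ℚ.*-monoˡ-≤-nonNeg x {{ℚ.∣-∣-nonNeg (r zero)}} (sum-nonneg λ y → ℚ.0≤∣p∣ (r (suc y))))
  expand : ∀ x s → x ℚ.* x ℚ.+ s ℚ.* s ℚ.+ (x ℚ.* s ℚ.+ x ℚ.* s) ≡ (x ℚ.+ s) ℚ.* (x ℚ.+ s)
  expand = RingSolver.solve-∀ ℚ-ring

-- If ⟨r, w⟩ ≥ δ|w|² then δ|w| ≤ |r|, because |δw − r|² ≥ 0.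
residual-bound : ∀ {n} (r w : Vecℚ n) δ → 0ℚ ℚ.< δ → δ ℚ.* dot w w ℚ.≤ dot r w → ∀ x →
                 ℚ.∣ w x ∣ ℚ.≤ Σℚ.sum (λ y → ℚ.∣ r y ∣) ℚ.* inv δ
residual-bound {n} r w δ 0<δ h x = begin
  ℚ.∣ w x ∣
    ≡⟨ trans (swap δ ℚ.∣ w x ∣ (inv δ)) (trans (cong (ℚ._* ℚ.∣ w x ∣) (inv-inverse δ λ δ≡0 → ℚ.<-irrefl (sym δ≡0) 0<δ)) (ℚ.*-identityˡ ℚ.∣ w x ∣)) ⟨
  δ ℚ.* ℚ.∣ w x ∣ ℚ.* inv δ
    ≤⟨ ℚ.*-monoʳ-≤-nonNeg (inv δ) {{ℚ.nonNegative (ℚ.<⇒≤ (inv-positive δ 0<δ))}} (square-cancel (δ ℚ.* ℚ.∣ w x ∣) S (sum-nonneg λ y → ℚ.0≤∣p∣ (r y)) squares) ⟩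
  S ℚ.* inv δ ∎
  where
  open ℚ.≤-Reasoning
  S = Σℚ.sum (λ y → ℚ.∣ r y ∣)
  swap : ∀ d w i → d ℚ.* w ℚ.* i ≡ i ℚ.* d ℚ.* w
  swap = RingSolver.solve-∀ ℚ-ring
  u : Vecℚ n
  u y = δ ℚ.* w y ℚ.+ (ℚ.- 1ℚ) ℚ.* r y
  dot-u : ∀ v → dot u v ≡ δ ℚ.* dot w v ℚ.+ (ℚ.- 1ℚ) ℚ.* dot r v
  dot-u v = trans (dot-+ˡ (λ y → δ ℚ.* w y) (λ y → (ℚ.- 1ℚ) ℚ.* r y) v) (cong₂ ℚ._+_ (dot-*ˡ δ w v) (dot-*ˡ (ℚ.- 1ℚ) r v))
  dot-uu : dot u u ≡ δ ℚ.* (δ ℚ.* dot w w) ℚ.+ (ℚ.- 1ℚ) ℚ.* (δ ℚ.* dot r w) ℚ.+ ((ℚ.- 1ℚ) ℚ.* (δ ℚ.* dot r w) ℚ.+ dot r r)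
  dot-uu = trans (dot-u u) (trans (cong₂ (λ p q → δ ℚ.* p ℚ.+ (ℚ.- 1ℚ) ℚ.* q)
    (trans (dot-comm w u) (dot-u w)) (trans (dot-comm r u) (dot-u r)))
    (trans (cong (λ t → δ ℚ.* (δ ℚ.* dot w w ℚ.+ (ℚ.- 1ℚ) ℚ.* dot r w) ℚ.+ (ℚ.- 1ℚ) ℚ.* (δ ℚ.* t ℚ.+ (ℚ.- 1ℚ) ℚ.* dot r r)) (dot-comm w r))
      (expand δ (dot w w) (dot r w) (dot r r))))
    where
    expand : ∀ d ww rw rr → d ℚ.* (d ℚ.* ww ℚ.+ (ℚ.- 1ℚ) ℚ.* rw) ℚ.+ (ℚ.- 1ℚ) ℚ.* (d ℚ.* rw ℚ.+ (ℚ.- 1ℚ) ℚ.* rr)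
      ≡ d ℚ.* (d ℚ.* ww) ℚ.+ (ℚ.- 1ℚ) ℚ.* (d ℚ.* rw) ℚ.+ ((ℚ.- 1ℚ) ℚ.* (d ℚ.* rw) ℚ.+ rr)
    expand = RingSolver.solve-∀ ℚ-ring
  δ²ww≤δrw : δ ℚ.* (δ ℚ.* dot w w) ℚ.≤ δ ℚ.* dot r w
  δ²ww≤δrw = ℚ.*-monoˡ-≤-nonNeg δ {{ℚ.nonNegative (ℚ.<⇒≤ 0<δ)}} h
  δ²ww≤rr : δ ℚ.* (δ ℚ.* dot w w) ℚ.≤ dot r r
  δ²ww≤rr = begin
    P
      ≤⟨ δ²ww≤δrw ⟩
    Q
      ≡⟨ ℚ.+-identityʳ Q ⟨
    Q ℚ.+ 0ℚ
      ≤⟨ ℚ.+-monoʳ-≤ Q (ℚ.≤-trans (dot-nonneg u) (ℚ.≤-reflexive dot-uu)) ⟩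
    Q ℚ.+ (P ℚ.+ (ℚ.- 1ℚ) ℚ.* Q ℚ.+ ((ℚ.- 1ℚ) ℚ.* Q ℚ.+ dot r r))
      ≡⟨ regroup P Q (dot r r) ⟩
    P ℚ.+ ((ℚ.- 1ℚ) ℚ.* Q ℚ.+ dot r r)
      ≤⟨ ℚ.+-monoˡ-≤ ((ℚ.- 1ℚ) ℚ.* Q ℚ.+ dot r r) δ²ww≤δrw ⟩
    Q ℚ.+ ((ℚ.- 1ℚ) ℚ.* Q ℚ.+ dot r r)
      ≡⟨ cancel Q (dot r r) ⟩
    dot r r ∎
    where
    P = δ ℚ.* (δ ℚ.* dot w w)
    Q = δ ℚ.* dot r w
    regroup : ∀ p q r → q ℚ.+ (p ℚ.+ (ℚ.- 1ℚ) ℚ.* q ℚ.+ ((ℚ.- 1ℚ) ℚ.* q ℚ.+ r)) ≡ p ℚ.+ ((ℚ.- 1ℚ) ℚ.* q ℚ.+ r)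
    regroup = RingSolver.solve-∀ ℚ-ring
    cancel : ∀ q r → q ℚ.+ ((ℚ.- 1ℚ) ℚ.* q ℚ.+ r) ≡ r
    cancel = RingSolver.solve-∀ ℚ-ring
  squares : (δ ℚ.* ℚ.∣ w x ∣) ℚ.* (δ ℚ.* ℚ.∣ w x ∣) ℚ.≤ S ℚ.* S
  squares = begin
    (δ ℚ.* ℚ.∣ w x ∣) ℚ.* (δ ℚ.* ℚ.∣ w x ∣)   ≡⟨ rearrange δ ℚ.∣ w x ∣ ⟩
    δ ℚ.* (δ ℚ.* (ℚ.∣ w x ∣ ℚ.* ℚ.∣ w x ∣))   ≤⟨ ℚ.*-monoˡ-≤-nonNeg δ {{0≤δ}} (ℚ.*-monoˡ-≤-nonNeg δ {{0≤δ}}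
      (ℚ.≤-trans (ℚ.≤-reflexive (abs-square (w x))) (sum-≥-term (λ y → ℚ-square-nonneg (w y)) x))) ⟩
    δ ℚ.* (δ ℚ.* dot w w)                     ≤⟨ δ²ww≤rr ⟩
    dot r r                                   ≤⟨ sum-squares-≤ r ⟩
    S ℚ.* S                                   ∎
    where
    0≤δ = ℚ.nonNegative (ℚ.<⇒≤ 0<δ)
    rearrange : ∀ d w → (d ℚ.* w) ℚ.* (d ℚ.* w) ≡ d ℚ.* (d ℚ.* (w ℚ.* w))
    rearrange = RingSolver.solve-∀ ℚ-ring

-- If `ν` stayed below -3 by a margin δ, semidefiniteness at the rational approximants of the
-- eigenvector would give ⟨Av - νv, v⟩ ≥ δ|v|². The residual tends to 0, hence so would `v`.
form⇒eigenvalues : ∀ {n} (A : Matrix n) → (∀ v → 0ℚ ℚ.≤ quadratic A v ℚ.+ fromInt (+ 3) ℚ.* dot v v) →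
                   ∀ ν → IsEigenvalue A ν → -3ᵣ ≤ᵣ ν
form⇒eigenvalues {n} A form≥0 ν (v , v≄0 , equation) ε 0<ε = from (cauchy ν δ 0<δ)
  where
  3ℚ δ : ℚ
  3ℚ = fromInt (+ 3)
  -- The rational test at index `N` uses two quarters of ε: if it fails, one pays for the
  -- oscillation of `ν` and the other is left as the margin.
  δ = ε ℚ.* ½ ℚ.* ½
  0<δ : 0ℚ ℚ.< δ
  0<δ = half (half 0<ε)
  4δ : (δ ℚ.+ δ) ℚ.+ (δ ℚ.+ δ) ≡ ε
  4δ = trans (cong₂ ℚ._+_ (half+half (ε ℚ.* ½)) (half+half (ε ℚ.* ½))) (half+half ε)
  Aℚ : Fin n → Vecℚ n
  Aℚ x y = fromInt (A x y)

  from : ∃[ N ] (∀ i j → N ℕ.≤ i → N ℕ.≤ j → ℚ.∣ seq ν i ℚ.- seq ν j ∣ ℚ.< δ) →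
         ∃[ N ] (∀ i → N ℕ.≤ i → ℚ.- 3ℚ ℚ.< seq ν i ℚ.+ ε)
  from (N , close) = split (ℚ.- 3ℚ ℚ.<? seq ν N ℚ.+ (δ ℚ.+ δ))
    where
    open ℚ.≤-Reasoning
    cancel : ∀ a b → b ℚ.+ (a ℚ.+ (ℚ.- b)) ≡ a
    cancel = RingSolver.solve-∀ ℚ-ring
    near : ∀ i j → N ℕ.≤ i → N ℕ.≤ j → seq ν i ℚ.< seq ν j ℚ.+ δ
    near i j N≤i N≤j = begin-strict
      seq ν i                                   ≡⟨ cancel (seq ν i) (seq ν j) ⟨
      seq ν j ℚ.+ (seq ν i ℚ.- seq ν j)         <⟨ ℚ.+-monoʳ-< (seq ν j) (ℚ.≤-<-trans (≤-abs (seq ν i ℚ.- seq ν j)) (close i j N≤i N≤j)) ⟩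
      seq ν j ℚ.+ δ                             ∎
    split : Dec (ℚ.- 3ℚ ℚ.< seq ν N ℚ.+ (δ ℚ.+ δ)) → ∃[ N ] (∀ i → N ℕ.≤ i → ℚ.- 3ℚ ℚ.< seq ν i ℚ.+ ε)
    split (yes above) = N , λ i N≤i → begin-strict
      ℚ.- 3ℚ                                        <⟨ above ⟩
      seq ν N ℚ.+ (δ ℚ.+ δ)                         <⟨ ℚ.+-monoˡ-< (δ ℚ.+ δ) (near N i ℕ.≤-refl N≤i) ⟩
      seq ν i ℚ.+ δ ℚ.+ (δ ℚ.+ δ)                   ≡⟨ ℚ.+-assoc (seq ν i) δ (δ ℚ.+ δ) ⟩
      seq ν i ℚ.+ (δ ℚ.+ (δ ℚ.+ δ))                 ≤⟨ ℚ.+-monoʳ-≤ (seq ν i) (ℚ.+-monoˡ-≤ (δ ℚ.+ δ) (subst (ℚ._≤ δ ℚ.+ δ) (ℚ.+-identityʳ δ) (ℚ.+-monoʳ-≤ δ (ℚ.<⇒≤ 0<δ)))) ⟩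
      seq ν i ℚ.+ ((δ ℚ.+ δ) ℚ.+ (δ ℚ.+ δ))         ≡⟨ cong (seq ν i ℚ.+_) 4δ ⟩
      seq ν i ℚ.+ ε                                 ∎
    split (no ¬above) = contradiction (λ x → Null-cong (λ i → sym (ℚ.+-identityʳ (seq (v x) i))) (null x)) v≄0
      where
      low : ∀ i → N ℕ.≤ i → seq ν i ℚ.+ δ ℚ.≤ ℚ.- 3ℚ
      low i N≤i = begin
        seq ν i ℚ.+ δ             ≤⟨ ℚ.+-monoˡ-≤ δ (ℚ.<⇒≤ (near i N N≤i ℕ.≤-refl)) ⟩
        seq ν N ℚ.+ δ ℚ.+ δ       ≡⟨ ℚ.+-assoc (seq ν N) δ δ ⟩
        seq ν N ℚ.+ (δ ℚ.+ δ)     ≤⟨ ℚ.≮⇒≥ ¬above ⟩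
        ℚ.- 3ℚ                    ∎
      r : ℕ → Vecℚ n
      r i x = mul Aℚ (λ y → seq (v y) i) x ℚ.+ (ℚ.- (seq ν i ℚ.* seq (v x) i))
      r-null : ∀ x → Null (λ i → r i x)
      r-null x = Null-cong (λ i → cong (ℚ._+ (ℚ.- (seq ν i ℚ.* seq (v x) i))) (seq-∑ᵣ (λ y → fromℤ (A x y) *ᵣ v y) i)) (equation x)
      large : ∀ i → N ℕ.≤ i → δ ℚ.* dot (λ y → seq (v y) i) (λ y → seq (v y) i) ℚ.≤ dot (r i) (λ y → seq (v y) i)
      large i N≤i = begin
        δ ℚ.* ww
          ≡⟨ ℚ.+-identityʳ (δ ℚ.* ww) ⟨
        δ ℚ.* ww ℚ.+ 0ℚ
          ≤⟨ ℚ.+-monoʳ-≤ (δ ℚ.* ww) (form≥0 w) ⟩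
        δ ℚ.* ww ℚ.+ (quadratic A w ℚ.+ 3ℚ ℚ.* ww)
          ≡⟨ regroup δ ww (quadratic A w) 3ℚ (seq ν i) ⟩
        (seq ν i ℚ.+ δ) ℚ.* ww ℚ.+ (3ℚ ℚ.* ww ℚ.+ (quadratic A w ℚ.+ (ℚ.- seq ν i) ℚ.* ww))
          ≤⟨ ℚ.+-monoˡ-≤ (3ℚ ℚ.* ww ℚ.+ (quadratic A w ℚ.+ (ℚ.- seq ν i) ℚ.* ww)) (ℚ.*-monoʳ-≤-nonNeg ww {{ℚ.nonNegative (dot-nonneg w)}} (low i N≤i)) ⟩
        (ℚ.- 3ℚ) ℚ.* ww ℚ.+ (3ℚ ℚ.* ww ℚ.+ (quadratic A w ℚ.+ (ℚ.- seq ν i) ℚ.* ww))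
          ≡⟨ drop 3ℚ ww (quadratic A w ℚ.+ (ℚ.- seq ν i) ℚ.* ww) ⟩
        quadratic A w ℚ.+ (ℚ.- seq ν i) ℚ.* ww
          ≡⟨ dot-r ⟨
        dot (r i) w ∎
        where
        w : Vecℚ n
        w y = seq (v y) i
        ww = dot w w
        regroup : ∀ d ww q t n → d ℚ.* ww ℚ.+ (q ℚ.+ t ℚ.* ww) ≡ (n ℚ.+ d) ℚ.* ww ℚ.+ (t ℚ.* ww ℚ.+ (q ℚ.+ (ℚ.- n) ℚ.* ww))
        regroup = RingSolver.solve-∀ ℚ-ring
        drop : ∀ t ww q → (ℚ.- t) ℚ.* ww ℚ.+ (t ℚ.* ww ℚ.+ q) ≡ q
        drop = RingSolver.solve-∀ ℚ-ring
        dot-r : dot (r i) w ≡ quadratic A w ℚ.+ (ℚ.- seq ν i) ℚ.* ww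
        dot-r = trans (dot-congˡ w λ x → cong (mul Aℚ w x ℚ.+_) (ℚ.neg-distribˡ-* (seq ν i) (w x)))
          (trans (dot-+ˡ (mul Aℚ w) (λ x → (ℚ.- seq ν i) ℚ.* w x) w) (cong (quadratic A w ℚ.+_) (dot-*ˡ (ℚ.- seq ν i) w w)))
      null : ∀ x → Null (seq (v x))
      null x = Null-dominated N (λ i N≤i → residual-bound (r i) (λ y → seq (v y) i) δ 0<δ (large i N≤i) x)
        (Null-scale (inv δ) (Null-sum (λ i y → ℚ.∣ r i y ∣) (λ y → Null-abs (r-null y))))

-- Integer combinations and Gram matrices

ℤ-sum-scale : ∀ {n} c (f : Fin n → ℤ) → c ℤ.* Σℤ.sum f ≡ Σℤ.sum (λ i → c ℤ.* f i)
ℤ-sum-scale c f = SemiringSum.*-distribˡ-sum ℤ.+-*-semiring c f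

δ : ∀ {n} → Fin n → Fin n → ℤ
δ x y = if does (x Fin.≟ y) then 1ℤ else 0ℤ

δ-same : ∀ {n} (x : Fin n) → δ x x ≡ 1ℤ
δ-same x with x Fin.≟ x
... | yes _  = refl
... | no x≢x = contradiction refl x≢x

δ-other : ∀ {n} {x y : Fin n} → x ≢ y → δ x y ≡ 0ℤ
δ-other {x = x} {y} x≢y with x Fin.≟ y
... | yes x≡y = contradiction x≡y x≢y
... | no _    = refl

δ-sum : ∀ {n} a (h : Fin n → ℤ) → Σℤ.sum (λ x → δ x a ℤ.* h x) ≡ h a
δ-sum a h = trans (Σℤ.sum-single a (λ x → δ x a ℤ.* h x) λ x x≢a →
  trans (cong (ℤ._* h x) (δ-other x≢a)) (ℤ.*-zeroˡ (h x)))
  (trans (cong (ℤ._* h a) (δ-same a)) (ℤ.*-identityˡ (h a)))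

combine : ∀ {n} → (Fin n → ℤ) → (Fin n → ℤ) → ℤ
combine κ σ = Σℤ.sum λ x → κ x ℤ.* σ x

combine-swap : ∀ {m n} (κ : Fin m → ℤ) (f : Fin m → Fin n → ℤ) (h : Fin n → ℤ) →
  combine (λ k → combine κ (λ x → f x k)) h ≡ combine κ (λ x → combine (f x) h)
combine-swap κ f h = begin
  Σℤ.sum (λ k → combine κ (λ x → f x k) ℤ.* h k)
    ≡⟨ Σℤ.sum-cong-≗ (λ k → trans (ℤ.*-comm (combine κ (λ x → f x k)) (h k)) (ℤ-sum-scale (h k) λ x → κ x ℤ.* f x k)) ⟩
  Σℤ.sum (λ k → Σℤ.sum (λ x → h k ℤ.* (κ x ℤ.* f x k)))
    ≡⟨ Σℤ.sum-swap (λ k x → h k ℤ.* (κ x ℤ.* f x k)) ⟩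
  Σℤ.sum (λ x → Σℤ.sum (λ k → h k ℤ.* (κ x ℤ.* f x k)))
    ≡⟨ Σℤ.sum-cong-≗ (λ x → trans (Σℤ.sum-cong-≗ λ k → lemma (h k) (κ x) (f x k)) (sym (ℤ-sum-scale (κ x) λ k → f x k ℤ.* h k))) ⟩
  Σℤ.sum (λ x → κ x ℤ.* combine (f x) h) ∎
  where
  open ≡-Reasoning
  lemma : ∀ h κ f → h ℤ.* (κ ℤ.* f) ≡ κ ℤ.* (f ℤ.* h)
  lemma = ℤ-Solver.solve-∀

combine-comm : ∀ {n} (f h : Fin n → ℤ) → combine f h ≡ combine h f
combine-comm f h = Σℤ.sum-cong-≗ λ x → ℤ.*-comm (f x) (h x)

-- In the integer scaling the Gram matrix is 3(A + 3), hence the factors 3 and 9.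
module Gram {n K} (A : Matrix n) (Z : Fin n → Fin K → ℤ)
  (gram : ∀ x y → combine (Z x) (Z y) ≡ A x y ℤ.* + 3 ℤ.+ δ y x ℤ.* + 9) where

  form-nonneg : ∀ v → 0ℚ ℚ.≤ quadratic A v ℚ.+ fromInt (+ 3) ℚ.* dot v v
  form-nonneg v = ℚ.*-cancelˡ-≤-pos (fromInt (+ 3)) (ℚ.≤-trans (ℚ.≤-reflexive (ℚ.*-zeroʳ (fromInt (+ 3))))
    (ℚ.≤-trans (dot-nonneg S) (ℚ.≤-reflexive S·S)))
    where
    open ≡-Reasoning
    3ℚ 9ℚ : ℚ
    3ℚ = fromInt (+ 3)
    9ℚ = fromInt (+ 9)
    Zℚ : Fin n → Vecℚ K
    Zℚ x k = fromInt (Z x k)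
    Aℚ : Fin n → Vecℚ n
    Aℚ x y = fromInt (A x y)
    S : Vecℚ K
    S k = Σℚ.sum λ x → v x ℚ.* Zℚ x k
    gramℚ : ∀ x y → dot (Zℚ x) (Zℚ y) ≡ Aℚ x y ℚ.* 3ℚ ℚ.+ fromInt (δ y x) ℚ.* 9ℚ
    gramℚ x y = begin
      dot (Zℚ x) (Zℚ y)                                ≡⟨ Σℚ.sum-cong-≗ (λ k → fromInt-* (Z x k) (Z y k)) ⟨
      Σℚ.sum (λ k → fromInt (Z x k ℤ.* Z y k))         ≡⟨ fromInt-sum (λ k → Z x k ℤ.* Z y k) ⟨
      fromInt (combine (Z x) (Z y))                    ≡⟨ cong fromInt (gram x y) ⟩
      fromInt (A x y ℤ.* + 3 ℤ.+ δ y x ℤ.* + 9)        ≡⟨ fromInt-+ (A x y ℤ.* + 3) (δ y x ℤ.* + 9) ⟩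
      fromInt (A x y ℤ.* + 3) ℚ.+ fromInt (δ y x ℤ.* + 9) ≡⟨ cong₂ ℚ._+_ (fromInt-* (A x y) (+ 3)) (fromInt-* (δ y x) (+ 9)) ⟩
      Aℚ x y ℚ.* 3ℚ ℚ.+ fromInt (δ y x) ℚ.* 9ℚ         ∎
    δℚ-sum : ∀ x → Σℚ.sum (λ y → fromInt (δ y x) ℚ.* v y) ≡ v x
    δℚ-sum x = trans (Σℚ.sum-single x (λ y → fromInt (δ y x) ℚ.* v y) λ y y≢x →
      trans (cong (λ t → fromInt t ℚ.* v y) (δ-other y≢x)) (ℚ.*-zeroˡ (v y)))
      (trans (cong (λ t → fromInt t ℚ.* v x) (δ-same x)) (ℚ.*-identityˡ (v x)))
    Z·S : ∀ x → dot (Zℚ x) S ≡ 3ℚ ℚ.* mul Aℚ v x ℚ.+ 9ℚ ℚ.* v x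
    Z·S x = begin
      dot (Zℚ x) S
        ≡⟨ trans (dot-comm (Zℚ x) S) (dot-sum v Zℚ (Zℚ x)) ⟩
      Σℚ.sum (λ y → v y ℚ.* dot (Zℚ y) (Zℚ x))
        ≡⟨ Σℚ.sum-cong-≗ (λ y → trans (cong (v y ℚ.*_) (trans (dot-comm (Zℚ y) (Zℚ x)) (gramℚ x y)))
             (expand (v y) (Aℚ x y) 3ℚ (fromInt (δ y x)) 9ℚ)) ⟩
      Σℚ.sum (λ y → 3ℚ ℚ.* (Aℚ x y ℚ.* v y) ℚ.+ 9ℚ ℚ.* (fromInt (δ y x) ℚ.* v y))
        ≡⟨ Σℚ.sum-distrib (λ y → 3ℚ ℚ.* (Aℚ x y ℚ.* v y)) (λ y → 9ℚ ℚ.* (fromInt (δ y x) ℚ.* v y)) ⟩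
      Σℚ.sum (λ y → 3ℚ ℚ.* (Aℚ x y ℚ.* v y)) ℚ.+ Σℚ.sum (λ y → 9ℚ ℚ.* (fromInt (δ y x) ℚ.* v y))
        ≡⟨ cong₂ ℚ._+_ (sum-scale 3ℚ λ y → Aℚ x y ℚ.* v y) (sum-scale 9ℚ λ y → fromInt (δ y x) ℚ.* v y) ⟨
      3ℚ ℚ.* mul Aℚ v x ℚ.+ 9ℚ ℚ.* Σℚ.sum (λ y → fromInt (δ y x) ℚ.* v y)
        ≡⟨ cong (λ t → 3ℚ ℚ.* mul Aℚ v x ℚ.+ 9ℚ ℚ.* t) (δℚ-sum x) ⟩
      3ℚ ℚ.* mul Aℚ v x ℚ.+ 9ℚ ℚ.* v x ∎
      where
      expand : ∀ v a t d n → v ℚ.* (a ℚ.* t ℚ.+ d ℚ.* n) ≡ t ℚ.* (a ℚ.* v) ℚ.+ n ℚ.* (d ℚ.* v)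
      expand = RingSolver.solve-∀ ℚ-ring
    S·S : dot S S ≡ 3ℚ ℚ.* (quadratic A v ℚ.+ 3ℚ ℚ.* dot v v)
    S·S = begin
      dot S S
        ≡⟨ dot-sum v Zℚ S ⟩
      Σℚ.sum (λ x → v x ℚ.* dot (Zℚ x) S)
        ≡⟨ Σℚ.sum-cong-≗ (λ x → trans (cong (v x ℚ.*_) (Z·S x)) (expand (v x) 3ℚ (mul Aℚ v x) 9ℚ)) ⟩
      Σℚ.sum (λ x → 3ℚ ℚ.* (mul Aℚ v x ℚ.* v x) ℚ.+ 9ℚ ℚ.* (v x ℚ.* v x))
        ≡⟨ Σℚ.sum-distrib (λ x → 3ℚ ℚ.* (mul Aℚ v x ℚ.* v x)) (λ x → 9ℚ ℚ.* (v x ℚ.* v x)) ⟩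
      Σℚ.sum (λ x → 3ℚ ℚ.* (mul Aℚ v x ℚ.* v x)) ℚ.+ Σℚ.sum (λ x → 9ℚ ℚ.* (v x ℚ.* v x))
        ≡⟨ cong₂ ℚ._+_ (sum-scale 3ℚ λ x → mul Aℚ v x ℚ.* v x) (sum-scale 9ℚ λ x → v x ℚ.* v x) ⟨
      3ℚ ℚ.* quadratic A v ℚ.+ 9ℚ ℚ.* dot v v
        ≡⟨ trans (cong (λ t → 3ℚ ℚ.* quadratic A v ℚ.+ t ℚ.* dot v v) (fromInt-* (+ 3) (+ 3))) (collect 3ℚ (quadratic A v) (dot v v)) ⟩
      3ℚ ℚ.* (quadratic A v ℚ.+ 3ℚ ℚ.* dot v v) ∎
      where
      expand : ∀ v t m n → v ℚ.* (t ℚ.* m ℚ.+ n ℚ.* v) ≡ t ℚ.* (m ℚ.* v) ℚ.+ n ℚ.* (v ℚ.* v)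
      expand = RingSolver.solve-∀ ℚ-ring
      collect : ∀ t q d → t ℚ.* q ℚ.+ t ℚ.* t ℚ.* d ≡ t ℚ.* (q ℚ.+ t ℚ.* d)
      collect = RingSolver.solve-∀ ℚ-ring

  gram-combination : ∀ κ x → combine (λ k → combine κ (λ y → Z y k)) (Z x) ≡ + 3 ℤ.* combine (A x) κ ℤ.+ + 9 ℤ.* κ x
  gram-combination κ x = begin
    combine (λ k → combine κ (λ y → Z y k)) (Z x)
      ≡⟨ combine-swap κ Z (Z x) ⟩
    combine κ (λ y → combine (Z y) (Z x))
      ≡⟨ Σℤ.sum-cong-≗ (λ y → trans (cong (κ y ℤ.*_) (trans (combine-comm (Z y) (Z x)) (gram x y))) (expand (κ y) (A x y) (δ y x))) ⟩
    Σℤ.sum (λ y → + 3 ℤ.* (A x y ℤ.* κ y) ℤ.+ + 9 ℤ.* (δ y x ℤ.* κ y))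
      ≡⟨ Σℤ.sum-distrib (λ y → + 3 ℤ.* (A x y ℤ.* κ y)) (λ y → + 9 ℤ.* (δ y x ℤ.* κ y)) ⟩
    Σℤ.sum (λ y → + 3 ℤ.* (A x y ℤ.* κ y)) ℤ.+ Σℤ.sum (λ y → + 9 ℤ.* (δ y x ℤ.* κ y))
      ≡⟨ cong₂ ℤ._+_ (ℤ-sum-scale (+ 3) λ y → A x y ℤ.* κ y) (ℤ-sum-scale (+ 9) λ y → δ y x ℤ.* κ y) ⟨
    + 3 ℤ.* combine (A x) κ ℤ.+ + 9 ℤ.* Σℤ.sum (λ y → δ y x ℤ.* κ y)
      ≡⟨ cong (λ t → + 3 ℤ.* combine (A x) κ ℤ.+ + 9 ℤ.* t) (δ-sum x κ) ⟩
    + 3 ℤ.* combine (A x) κ ℤ.+ + 9 ℤ.* κ x ∎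
    where
    open ≡-Reasoning
    expand : ∀ k a d → k ℤ.* (a ℤ.* + 3 ℤ.+ d ℤ.* + 9) ≡ + 3 ℤ.* (a ℤ.* k) ℤ.+ + 9 ℤ.* (d ℤ.* k)
    expand = ℤ-Solver.solve-∀

  dependency⇒eigenvalue : ∀ κ → (∀ k → combine κ (λ y → Z y k) ≡ 0ℤ) → ∀ x₀ → κ x₀ ≢ 0ℤ → IsEigenvalue A -3ᵣ
  dependency⇒eigenvalue κ dependency x₀ κ≢0 = (λ x → fromℤ (κ x)) , nonzero-vector , λ x →
    Null-cong {λ _ → 0ℚ} (λ i → sym (trans (cong (ℚ._- (fromInt (ℤ.- (+ 3)) ℚ.* fromInt (κ x))) (seq-∑ᵣ (λ y → fromℤ (A x y) *ᵣ fromℤ (κ y)) i))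
      (trans (cong (ℚ._- (fromInt (ℤ.- (+ 3)) ℚ.* fromInt (κ x))) (row x)) (ℚ.+-inverseʳ (fromInt (ℤ.- (+ 3)) ℚ.* fromInt (κ x)))))) Null-0
    where
    open ≡-Reasoning
    nonzero-vector : ¬ (∀ x → fromℤ (κ x) ≃ᵣ 0ᵣ)
    nonzero-vector zeros = κ≢0 (fromInt-injective {j = 0ℤ} (decide (fromInt (κ x₀) ℚ.≟ 0ℚ)))
      where
      decide : Dec (fromInt (κ x₀) ≡ 0ℚ) → fromInt (κ x₀) ≡ 0ℚ
      decide (yes e) = e
      decide (no ≢0) = contradiction (proj₂ far (proj₁ far) ℕ.≤-refl) (ℚ.<-irrefl (cong ℚ.∣_∣ (ℚ.+-identityʳ (fromInt (κ x₀)))))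
        where
        far = zeros x₀ ℚ.∣ fromInt (κ x₀) ∣ (abs-positive (fromInt (κ x₀)) ≢0)
          where
          abs-positive : ∀ q → q ≢ 0ℚ → 0ℚ ℚ.< ℚ.∣ q ∣
          abs-positive q q≢0 = ℚ.≰⇒> λ ∣q∣≤0 → q≢0 (ℚ.∣p∣≡0⇒p≡0 q (ℚ.≤-antisym ∣q∣≤0 (ℚ.0≤∣p∣ q)))
    integer-row : ∀ x → combine (A x) κ ≡ ℤ.- (+ 3) ℤ.* κ x
    integer-row x = ℤ.*-cancelˡ-≡ (+ 3) (combine (A x) κ) (ℤ.- (+ 3) ℤ.* κ x) (begin
      + 3 ℤ.* combine (A x) κ
        ≡⟨ isolate (+ 3 ℤ.* combine (A x) κ) (κ x) ⟩
      (+ 3 ℤ.* combine (A x) κ ℤ.+ + 9 ℤ.* κ x) ℤ.+ + 3 ℤ.* (ℤ.- (+ 3) ℤ.* κ x)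
        ≡⟨ cong (ℤ._+ + 3 ℤ.* (ℤ.- (+ 3) ℤ.* κ x)) (trans (sym (gram-combination κ x))
             (Σℤ.sum-ε λ k → trans (cong (ℤ._* Z x k) (dependency k)) (ℤ.*-zeroˡ (Z x k)))) ⟩
      0ℤ ℤ.+ + 3 ℤ.* (ℤ.- (+ 3) ℤ.* κ x)
        ≡⟨ ℤ.+-identityˡ (+ 3 ℤ.* (ℤ.- (+ 3) ℤ.* κ x)) ⟩
      + 3 ℤ.* (ℤ.- (+ 3) ℤ.* κ x) ∎)
      where
      isolate : ∀ a k → a ≡ (a ℤ.+ + 9 ℤ.* k) ℤ.+ + 3 ℤ.* (ℤ.- (+ 3) ℤ.* k)
      isolate = ℤ-Solver.solve-∀
    row : ∀ x → Σℚ.sum (λ y → fromInt (A x y) ℚ.* fromInt (κ y)) ≡ fromInt (ℤ.- (+ 3)) ℚ.* fromInt (κ x)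
    row x = begin
      Σℚ.sum (λ y → fromInt (A x y) ℚ.* fromInt (κ y))   ≡⟨ Σℚ.sum-cong-≗ (λ y → fromInt-* (A x y) (κ y)) ⟨
      Σℚ.sum (λ y → fromInt (A x y ℤ.* κ y))             ≡⟨ fromInt-sum (λ y → A x y ℤ.* κ y) ⟨
      fromInt (combine (A x) κ)                          ≡⟨ cong fromInt (integer-row x) ⟩
      fromInt (ℤ.- (+ 3) ℤ.* κ x)                        ≡⟨ fromInt-* (ℤ.- (+ 3)) (κ x) ⟩
      fromInt (ℤ.- (+ 3)) ℚ.* fromInt (κ x)              ∎

  module Extension {N} (A⁺ : Matrix N) (A⁺-sym : ∀ v w → A⁺ v w ≡ A⁺ w v)
    (eigenvalues : ∀ ν → IsEigenvalue A⁺ ν → -3ᵣ ≤ᵣ ν)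
    (f : Fin n → Fin N) (f-injective : ∀ {x y} → f x ≡ f y → x ≡ y) (f-edges : ∀ x y → A⁺ (f x) (f y) ≡ A x y)
    (w : Fin N) (w∉f : ∀ x → f x ≢ w) (w-loop : A⁺ w w ≡ 0ℤ) where

    integer-form : ∀ u → 0ℤ ℤ.≤ combine u (λ v → combine (A⁺ v) u ℤ.+ + 3 ℤ.* u v)
    integer-form u = fromInt-cancel (ℚ.≤-trans (eigenvalues⇒form A⁺ A⁺-sym eigenvalues (fromInt ∘ u)) (ℚ.≤-reflexive (sym (begin
      fromInt (combine u (λ v → combine (A⁺ v) u ℤ.+ + 3 ℤ.* u v))
        ≡⟨ fromInt-sum (λ v → u v ℤ.* (combine (A⁺ v) u ℤ.+ + 3 ℤ.* u v)) ⟩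
      Σℚ.sum (λ v → fromInt (u v ℤ.* (combine (A⁺ v) u ℤ.+ + 3 ℤ.* u v)))
        ≡⟨ Σℚ.sum-cong-≗ (λ v → trans (fromInt-* (u v) (combine (A⁺ v) u ℤ.+ + 3 ℤ.* u v))
             (trans (cong (fromInt (u v) ℚ.*_) (trans (fromInt-+ (combine (A⁺ v) u) (+ 3 ℤ.* u v))
               (cong₂ ℚ._+_ (row v) (fromInt-* (+ 3) (u v))))) (expand (fromInt (u v)) (mul A⁺ℚ (fromInt ∘ u) v) (fromInt (+ 3))))) ⟩
      Σℚ.sum (λ v → mul A⁺ℚ (fromInt ∘ u) v ℚ.* fromInt (u v) ℚ.+ fromInt (+ 3) ℚ.* (fromInt (u v) ℚ.* fromInt (u v)))
        ≡⟨ Σℚ.sum-distrib (λ v → mul A⁺ℚ (fromInt ∘ u) v ℚ.* fromInt (u v)) (λ v → fromInt (+ 3) ℚ.* (fromInt (u v) ℚ.* fromInt (u v))) ⟩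
      quadratic A⁺ (fromInt ∘ u) ℚ.+ Σℚ.sum (λ v → fromInt (+ 3) ℚ.* (fromInt (u v) ℚ.* fromInt (u v)))
        ≡⟨ cong (quadratic A⁺ (fromInt ∘ u) ℚ.+_) (sum-scale (fromInt (+ 3)) λ v → fromInt (u v) ℚ.* fromInt (u v)) ⟨
      quadratic A⁺ (fromInt ∘ u) ℚ.+ fromInt (+ 3) ℚ.* dot (fromInt ∘ u) (fromInt ∘ u) ∎))))
      where
      open ≡-Reasoning
      A⁺ℚ : Fin N → Vecℚ N
      A⁺ℚ v y = fromInt (A⁺ v y)
      expand : ∀ u m t → u ℚ.* (m ℚ.+ t ℚ.* u) ≡ m ℚ.* u ℚ.+ t ℚ.* (u ℚ.* u)
      expand = RingSolver.solve-∀ ℚ-ring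
      row : ∀ v → fromInt (combine (A⁺ v) u) ≡ mul A⁺ℚ (fromInt ∘ u) v
      row v = trans (fromInt-sum λ y → A⁺ v y ℤ.* u y) (Σℚ.sum-cong-≗ λ y → fromInt-* (A⁺ v y) (u y))

    b : Fin n → ℤ
    b x = A⁺ w (f x)

    -- Three times the form of `A⁺ + 3` at the vector with entry `l` at the new vertex and `κ` on
    -- the image of `f`. The part on the image is the square of an actual combination of the vectors
    -- `Z`, so only the row `b` of the new vertex remains abstract.
    extended-form : ∀ l κ → 0ℤ ℤ.≤ + 9 ℤ.* (l ℤ.* l) ℤ.+ + 6 ℤ.* (l ℤ.* combine κ b)
      ℤ.+ combine (λ k → combine κ (λ x → Z x k)) (λ k → combine κ (λ x → Z x k))
    extended-form l κ = ℤ.≤-trans (ℤ.*-monoˡ-≤-nonNeg (+ 3) (integer-form u)) (ℤ.≤-reflexive (begin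
      + 3 ℤ.* combine u (λ v → combine (A⁺ v) u ℤ.+ + 3 ℤ.* u v)
        ≡⟨ cong (+ 3 ℤ.*_) (push (λ v → combine (A⁺ v) u ℤ.+ + 3 ℤ.* u v)) ⟩
      + 3 ℤ.* (l ℤ.* (combine (A⁺ w) u ℤ.+ + 3 ℤ.* u w) ℤ.+ combine κ (λ x → combine (A⁺ (f x)) u ℤ.+ + 3 ℤ.* u (f x)))
        ≡⟨ cong₂ (λ p q → + 3 ℤ.* (l ℤ.* p ℤ.+ q)) (cong₂ (λ p q → p ℤ.+ + 3 ℤ.* q) row-w u-w)
             (trans (Σℤ.sum-cong-≗ λ x → cong (κ x ℤ.*_) (cong₂ (λ p q → p ℤ.+ + 3 ℤ.* q) (row-f x) (u-f x)))
               (trans (Σℤ.sum-cong-≗ λ x → spread (κ x) l (b x) (combine (A x) κ))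
                 (trans (Σℤ.sum-distrib (λ x → l ℤ.* (κ x ℤ.* b x)) (λ x → κ x ℤ.* (combine (A x) κ ℤ.+ + 3 ℤ.* κ x)))
                   (cong (ℤ._+ Q) (sym (ℤ-sum-scale l λ x → κ x ℤ.* b x)))))) ⟩
      + 3 ℤ.* (l ℤ.* (combine κ b ℤ.+ + 3 ℤ.* l) ℤ.+ (l ℤ.* combine κ b ℤ.+ Q))
        ≡⟨ collect l (combine κ b) Q ⟩
      + 9 ℤ.* (l ℤ.* l) ℤ.+ + 6 ℤ.* (l ℤ.* combine κ b) ℤ.+ + 3 ℤ.* Q
        ≡⟨ cong (λ t → + 9 ℤ.* (l ℤ.* l) ℤ.+ + 6 ℤ.* (l ℤ.* combine κ b) ℤ.+ t) 3Q ⟩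
      + 9 ℤ.* (l ℤ.* l) ℤ.+ + 6 ℤ.* (l ℤ.* combine κ b) ℤ.+ combine S S ∎))
      where
      open ≡-Reasoning
      S : Fin K → ℤ
      S k = combine κ (λ x → Z x k)
      Q : ℤ
      Q = combine κ (λ x → combine (A x) κ ℤ.+ + 3 ℤ.* κ x)
      u : Fin N → ℤ
      u v = l ℤ.* δ v w ℤ.+ combine κ (λ x → δ v (f x))
      push : ∀ h → combine u h ≡ l ℤ.* h w ℤ.+ combine κ (h ∘ f)
      push h = begin
        Σℤ.sum (λ v → (l ℤ.* δ v w ℤ.+ combine κ (λ x → δ v (f x))) ℤ.* h v)
          ≡⟨ Σℤ.sum-cong-≗ (λ v → distrib l (δ v w) (combine κ (λ x → δ v (f x))) (h v)) ⟩
        Σℤ.sum (λ v → l ℤ.* (δ v w ℤ.* h v) ℤ.+ combine κ (λ x → δ v (f x)) ℤ.* h v)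
          ≡⟨ Σℤ.sum-distrib (λ v → l ℤ.* (δ v w ℤ.* h v)) (λ v → combine κ (λ x → δ v (f x)) ℤ.* h v) ⟩
        Σℤ.sum (λ v → l ℤ.* (δ v w ℤ.* h v)) ℤ.+ combine (λ v → combine κ (λ x → δ v (f x))) h
          ≡⟨ cong₂ ℤ._+_ (trans (sym (ℤ-sum-scale l λ v → δ v w ℤ.* h v)) (cong (l ℤ.*_) (δ-sum w h)))
               (trans (combine-swap κ (λ x v → δ v (f x)) h) (Σℤ.sum-cong-≗ λ x → cong (κ x ℤ.*_) (δ-sum (f x) h))) ⟩
        l ℤ.* h w ℤ.+ combine κ (h ∘ f) ∎
        where
        distrib : ∀ l d c h → (l ℤ.* d ℤ.+ c) ℤ.* h ≡ l ℤ.* (d ℤ.* h) ℤ.+ c ℤ.* h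
        distrib = ℤ-Solver.solve-∀
      u-w : u w ≡ l
      u-w = trans (cong₂ ℤ._+_ (trans (cong (l ℤ.*_) (δ-same w)) (ℤ.*-identityʳ l))
        (Σℤ.sum-ε λ x → trans (cong (κ x ℤ.*_) (δ-other (w∉f x ∘ sym))) (ℤ.*-zeroʳ (κ x)))) (ℤ.+-identityʳ l)
      u-f : ∀ x → u (f x) ≡ κ x
      u-f x = trans (cong₂ ℤ._+_ (trans (cong (l ℤ.*_) (δ-other (w∉f x))) (ℤ.*-zeroʳ l))
        (trans (Σℤ.sum-single x (λ y → κ y ℤ.* δ (f x) (f y)) λ y y≢x →
            trans (cong (κ y ℤ.*_) (δ-other (λ e → y≢x (sym (f-injective e))))) (ℤ.*-zeroʳ (κ y)))
          (trans (cong (κ x ℤ.*_) (δ-same (f x))) (ℤ.*-identityʳ (κ x))))) (ℤ.+-identityˡ (κ x))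
      row-w : combine (A⁺ w) u ≡ combine κ b
      row-w = trans (combine-comm (A⁺ w) u) (trans (push (A⁺ w))
        (trans (cong (ℤ._+ combine κ b) (trans (cong (l ℤ.*_) w-loop) (ℤ.*-zeroʳ l))) (ℤ.+-identityˡ (combine κ b))))
      row-f : ∀ x → combine (A⁺ (f x)) u ≡ l ℤ.* b x ℤ.+ combine (A x) κ
      row-f x = trans (combine-comm (A⁺ (f x)) u) (trans (push (A⁺ (f x))) (cong₂ ℤ._+_ (cong (l ℤ.*_) (A⁺-sym (f x) w))
        (trans (combine-comm κ (A⁺ (f x) ∘ f)) (Σℤ.sum-cong-≗ λ y → cong (ℤ._* κ y) (f-edges x y)))))
      spread : ∀ k l b a → k ℤ.* ((l ℤ.* b ℤ.+ a) ℤ.+ + 3 ℤ.* k) ≡ l ℤ.* (k ℤ.* b) ℤ.+ k ℤ.* (a ℤ.+ + 3 ℤ.* k)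
      spread = ℤ-Solver.solve-∀
      collect : ∀ l c q → + 3 ℤ.* (l ℤ.* (c ℤ.+ + 3 ℤ.* l) ℤ.+ (l ℤ.* c ℤ.+ q)) ≡ + 9 ℤ.* (l ℤ.* l) ℤ.+ + 6 ℤ.* (l ℤ.* c) ℤ.+ + 3 ℤ.* q
      collect = ℤ-Solver.solve-∀
      3Q : + 3 ℤ.* Q ≡ combine S S
      3Q = trans (ℤ-sum-scale (+ 3) λ x → κ x ℤ.* (combine (A x) κ ℤ.+ + 3 ℤ.* κ x))
        (trans (Σℤ.sum-cong-≗ λ x → trans (triple (κ x) (combine (A x) κ)) (cong (κ x ℤ.*_) (trans (sym (gram-combination κ x)) (combine-comm S (Z x)))))
          (sym (combine-swap κ Z S)))
        where
        triple : ∀ k a → + 3 ℤ.* (k ℤ.* (a ℤ.+ + 3 ℤ.* k)) ≡ k ℤ.* (+ 3 ℤ.* a ℤ.+ + 9 ℤ.* k)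
        triple = ℤ-Solver.solve-∀

-- Reachability and adjacency matrices

lift≢0 : ∀ a → a ≢ 0F → lift a ≢ 0ℤ
lift≢0 0F a≢0 = contradiction refl a≢0
lift≢0 1F _   ()
lift≢0 2F _   ()

lift≢±3 : ∀ a → lift a ≢ + 3 × lift a ≢ -[1+ 2 ]
lift≢±3 0F = (λ ()) , (λ ())
lift≢±3 1F = (λ ()) , (λ ())
lift≢±3 2F = (λ ()) , (λ ())

add-member : ∀ {n} (T : Subset n) z → Vec.lookup T z ≡ false → ∣ T [ z ]≔ true ∣ ≡ suc ∣ T ∣
add-member (false ∷ T) zero    refl = refl
add-member (true  ∷ T) (suc z) e    = cong suc (add-member T z e)
add-member (false ∷ T) (suc z) e    = add-member T z e

module Reachability {n} (R : Fin n → Fin n → Set) (R? : ∀ x y → Dec (R x y)) (x₀ : Fin n) where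

  Closed : Subset n → Set
  Closed T = ∀ y z → Vec.lookup T y ≡ true → R y z → Vec.lookup T z ≡ true

  -- Each round adds a vertex, so fuel plus size never drops below `n`; running out of fuel would
  -- leave a subset with more than `n` elements.
  grow : ∀ fuel (T : Subset n) → n ℕ.≤ fuel ℕ.+ ∣ T ∣ → Vec.lookup T x₀ ≡ true →
    (∀ y → Vec.lookup T y ≡ true → Star R x₀ y) →
    ∃[ T ] Vec.lookup T x₀ ≡ true × (∀ y → Vec.lookup T y ≡ true → Star R x₀ y) × Closed T
  grow fuel T enough x₀∈T reached
    with Fin.any? (λ y → Fin.any? λ z → (Vec.lookup T y Bool.≟ true) ×-dec (R? y z ×-dec (Vec.lookup T z Bool.≟ false)))
  ... | no none = T , x₀∈T , reached , closed
    where
    closed : Closed T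
    closed y z y∈T Ryz with Vec.lookup T z in e
    ... | true  = refl
    ... | false = contradiction (y , z , y∈T , Ryz , e) none
  ... | yes (y , z , y∈T , Ryz , z∉T) = extend fuel enough
    where
    T′ : Subset n
    T′ = T [ z ]≔ true
    size : ∣ T′ ∣ ≡ suc ∣ T ∣
    size = add-member T z z∉T
    x₀∈T′ : Vec.lookup T′ x₀ ≡ true
    x₀∈T′ with x₀ Fin.≟ z
    ... | yes refl = Vec.lookup∘update z T true
    ... | no x₀≢z  = trans (Vec.lookup∘update′ x₀≢z T true) x₀∈T
    reached′ : ∀ v → Vec.lookup T′ v ≡ true → Star R x₀ v
    reached′ v v∈T′ with v Fin.≟ z
    ... | yes refl = reached y y∈T ◅◅ (Ryz ◅ Star-refl)
    ... | no v≢z   = reached v (trans (sym (Vec.lookup∘update′ v≢z T true)) v∈T′)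
    extend : ∀ fuel → n ℕ.≤ fuel ℕ.+ ∣ T ∣ →
      ∃[ T ] Vec.lookup T x₀ ≡ true × (∀ y → Vec.lookup T y ≡ true → Star R x₀ y) × Closed T
    extend zero       n≤∣T∣ = contradiction (ℕ.≤-trans (ℕ.≤-reflexive (sym size)) (∣p∣≤n T′)) (ℕ.≤⇒≯ n≤∣T∣)
    extend (suc fuel) n≤   = grow fuel T′ (subst (n ℕ.≤_) (trans (sym (ℕ.+-suc fuel ∣ T ∣)) (cong (fuel ℕ.+_) (sym size))) n≤) x₀∈T′ reached′

  component : ∃[ T ] Vec.lookup T x₀ ≡ true × (∀ y → Vec.lookup T y ≡ true → Star R x₀ y) × Closed T
  component = grow n start (ℕ.m≤m+n n _) (Vec.lookup∘update x₀ (Vec.replicate n false) true) start-reached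
    where
    start : Subset n
    start = Vec.replicate n false [ x₀ ]≔ true
    start-reached : ∀ y → Vec.lookup start y ≡ true → Star R x₀ y
    start-reached y y∈ with y Fin.≟ x₀
    ... | yes refl = Star-refl
    ... | no y≢x₀  = contradiction (trans (sym y∈) (trans (Vec.lookup∘update′ y≢x₀ (Vec.replicate n false) true) (Vec.lookup-replicate y false))) λ ()

-- The property climbs from `i` to the last index, wraps to 0 and climbs again from there.
cyclic : ∀ {m} (R : Fin m → Set) → (∀ i → R i → R (next i)) → ∀ i → R i → ∀ k → R k
cyclic {suc n} R step i Ri = <-weakInduction R
  (subst R (next-fromℕ n) (step (fromℕ n) (<-weakInduction-startingFrom R Ri up {fromℕ n}
    (subst (toℕ i ℕ.≤_) (sym (Fin.toℕ-fromℕ n)) (ℕ.≤-pred (Fin.toℕ<n i)))))) up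
  where
  up : ∀ j → R (inject₁ j) → R (suc j)
  up j Rj = subst R (next-inject₁ j) (step (inject₁ j) Rj)

module AdjacencyMatrix (G : SignedGraph) where

  adjacency-sym : ∀ x y → adjacency G x y ≡ adjacency G y x
  adjacency-sym x y = cong (maybe′ (_◃ 1) 0ℤ) (edge-sym G x y)

  adjacency-loop : ∀ x → adjacency G x x ≡ 0ℤ
  adjacency-loop x = cong (maybe′ (_◃ 1) 0ℤ) (edge-irrefl G x)

  Adjacent? : ∀ x y → Dec (Adjacent G x y)
  Adjacent? x y with edge G x y
  ... | just s  = yes (s , refl)
  ... | nothing = no λ ()

  adjacency≢0 : ∀ x y → adjacency G x y ≢ 0ℤ → Adjacent G x y
  adjacency≢0 x y ≢0 with edge G x y
  ... | just s  = s , refl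
  ... | nothing = contradiction refl ≢0

  Adjacent⇒≢0 : ∀ x y → Adjacent G x y → adjacency G x y ≢ 0ℤ
  Adjacent⇒≢0 x y (s , e) ≡0 = sign≢0 s (trans (sym (cong (maybe′ (_◃ 1) 0ℤ) e)) ≡0)
    where
    sign≢0 : ∀ s → s ◃ 1 ≢ 0ℤ
    sign≢0 Sign.+ ()
    sign≢0 Sign.- ()

  adjacency≢±3 : ∀ x y → adjacency G x y ≢ + 3 × adjacency G x y ≢ -[1+ 2 ]
  adjacency≢±3 x y with edge G x y
  ... | just Sign.+ = (λ ()) , (λ ())
  ... | just Sign.- = (λ ()) , (λ ())
  ... | nothing     = (λ ()) , (λ ())

-- The signed graph of the minimal vectors

module Γ-graph (setup : Setup) (m : ℕ) (m≥1 : m ≥ 1) (G : SignedGraph) (isΓ : IsΓ setup m G) where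
  open Lattice setup m m≥1
  open LongCode setup m
  open SetupCode setup
  open Blocks m 24
  open IsΓ isΓ
  open AdjacencyMatrix G

  Z : Vertex G → Fin N → ℤ
  Z x k = Vec.lookup (vector x) k

  ip-Z : ∀ x y → combine (Z x) (Z y) ≡ ip (vector x) (vector y)
  ip-Z x y = sym (ip-sum (vector x) (vector y))

  gram : ∀ x y → combine (Z x) (Z y) ≡ adjacency G x y ℤ.* + 3 ℤ.+ δ y x ℤ.* + 9
  gram x y = trans (ip-Z x y) (split (y Fin.≟ x))
    where
    split : Dec (y ≡ x) → ip (vector x) (vector y) ≡ adjacency G x y ℤ.* + 3 ℤ.+ δ y x ℤ.* + 9
    split (yes refl) = trans (Min-ip (vector x) (vector-Min x))
      (sym (cong₂ (λ a d → a ℤ.* + 3 ℤ.+ d ℤ.* + 9) (adjacency-loop x) (δ-same x)))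
    split (no y≢x) = trans (/3≡/1 {ip (vector x) (vector y)} {adjacency G x y} (edge-sign x y (y≢x ∘ sym)))
      (sym (trans (cong (λ d → adjacency G x y ℤ.* + 3 ℤ.+ d ℤ.* + 9) (δ-other y≢x)) (ℤ.+-identityʳ (adjacency G x y ℤ.* + 3))))

  open Gram (adjacency G) Z gram

  -- Only one of `z` and `-z` is a vertex. Keeping the sign as an integer lets linear relations
  -- between minimal vectors be rewritten as relations between vertices.
  record Representative (z : Vec ℤ N) : Set where
    field
      vertex   : Vertex G
      ±        : ℤ
      ±²≡1     : ± ℤ.* ± ≡ 1ℤ
      lookup-± : ∀ k → ± ℤ.* Z vertex k ≡ Vec.lookup z k
      is-±     : vector vertex ≡ z ⊎ vector vertex ≡ negᵥ z

  representative : ∀ z → Min (L setup m) z → Representative z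
  representative z z∈ = from (proj₁ (transversal z z∈)) (proj₁ (proj₂ (transversal z z∈)))
    where
    from : ∀ x → vector x ≡ z ⊎ vector x ≡ neg z → Representative z
    from x (inj₁ e) = record { vertex = x ; ± = 1ℤ ; ±²≡1 = refl ; is-± = inj₁ e
      ; lookup-± = λ k → trans (ℤ.*-identityˡ (Z x k)) (cong (λ v → Vec.lookup v k) e) }
    from x (inj₂ e) = record { vertex = x ; ± = -1ℤ ; ±²≡1 = refl ; is-± = inj₂ e
      ; lookup-± = λ k → trans (cong (-1ℤ ℤ.*_) (trans (cong (λ v → Vec.lookup v k) e) (Vec.lookup-map k (λ a → ℤ.- a) z)))
          (minus (Vec.lookup z k)) }
      where
      minus : ∀ a → -1ℤ ℤ.* (ℤ.- a) ≡ a
      minus = ℤ-Solver.solve-∀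

  frame-vertex : Fin N → Vertex G
  frame-vertex j = Representative.vertex (representative (frame j) (frame-Min j))

  frame-sign : Fin N → ℤ
  frame-sign j = Representative.± (representative (frame j) (frame-Min j))

  frame-sign² : ∀ j → frame-sign j ℤ.* frame-sign j ≡ 1ℤ
  frame-sign² j = Representative.±²≡1 (representative (frame j) (frame-Min j))

  frame-lookup : ∀ j k → frame-sign j ℤ.* Z (frame-vertex j) k ≡ Vec.lookup (frame j) k
  frame-lookup j = Representative.lookup-± (representative (frame j) (frame-Min j))

  -- The value at frame j of the odd extension of h from vertices to minimal vectors.
  at-frame : (Vertex G → ℤ) → Fin N → ℤ
  at-frame h j = frame-sign j ℤ.* h (frame-vertex j)

  -- Vertex coefficients of the combination of frame vectors with coefficients `s`. That combination
  -- is the integer vector `3s`.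
  frames : (Fin N → ℤ) → Vertex G → ℤ
  frames s y = combine s (λ j → frame-sign j ℤ.* δ y (frame-vertex j))

  combine-frames : ∀ s h → combine (frames s) h ≡ combine s (at-frame h)
  combine-frames s h = trans (combine-swap s (λ j y → frame-sign j ℤ.* δ y (frame-vertex j)) h)
    (Σℤ.sum-cong-≗ λ j → cong (s j ℤ.*_) (trans (Σℤ.sum-cong-≗ λ y → ℤ.*-assoc (frame-sign j) (δ y (frame-vertex j)) (h y))
      (trans (sym (ℤ-sum-scale (frame-sign j) λ y → δ y (frame-vertex j) ℤ.* h y)) (cong (frame-sign j ℤ.*_) (δ-sum (frame-vertex j) h)))))

  combine-frames-Z : ∀ s k → combine (frames s) (λ y → Z y k) ≡ s k ℤ.* + 3
  combine-frames-Z s k = trans (combine-frames s (λ y → Z y k)) (trans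
    (Σℤ.sum-single k (λ j → s j ℤ.* at-frame (λ y → Z y k) j) λ j j≢k →
      trans (cong (s j ℤ.*_) (trans (frame-lookup j k) (lookup-frame′ (j≢k ∘ sym)))) (ℤ.*-zeroʳ (s j)))
    (cong (s k ℤ.*_) (trans (frame-lookup k k) (lookup-frame k))))

  -- The relation that writes 3 times the vector of `x` through the frame vectors with the
  -- coordinates as coefficients. It supplies the eigenvector for -3 and later forces the row of a
  -- new vertex to be linear in the vectors.
  dependency : Vertex G → Vertex G → ℤ
  dependency x y = + 3 ℤ.* δ y x ℤ.- frames (Z x) y

  combine-dependency : ∀ x h → combine (dependency x) h ≡ + 3 ℤ.* h x ℤ.- combine (Z x) (at-frame h)
  combine-dependency x h = begin
    Σℤ.sum (λ y → (+ 3 ℤ.* δ y x ℤ.- frames (Z x) y) ℤ.* h y)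
      ≡⟨ Σℤ.sum-cong-≗ (λ y → distrib (δ y x) (frames (Z x) y) (h y)) ⟩
    Σℤ.sum (λ y → + 3 ℤ.* (δ y x ℤ.* h y) ℤ.+ -1ℤ ℤ.* (frames (Z x) y ℤ.* h y))
      ≡⟨ Σℤ.sum-distrib (λ y → + 3 ℤ.* (δ y x ℤ.* h y)) (λ y → -1ℤ ℤ.* (frames (Z x) y ℤ.* h y)) ⟩
    Σℤ.sum (λ y → + 3 ℤ.* (δ y x ℤ.* h y)) ℤ.+ Σℤ.sum (λ y → -1ℤ ℤ.* (frames (Z x) y ℤ.* h y))
      ≡⟨ cong₂ ℤ._+_ (trans (sym (ℤ-sum-scale (+ 3) λ y → δ y x ℤ.* h y)) (cong (+ 3 ℤ.*_) (δ-sum x h)))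
           (trans (sym (ℤ-sum-scale -1ℤ λ y → frames (Z x) y ℤ.* h y)) (trans (cong (-1ℤ ℤ.*_) (combine-frames (Z x) h)) (ℤ.-1*i≡-i (combine (Z x) (at-frame h))))) ⟩
    + 3 ℤ.* h x ℤ.- combine (Z x) (at-frame h) ∎
    where
    open ≡-Reasoning
    distrib : ∀ d f h → (+ 3 ℤ.* d ℤ.- f) ℤ.* h ≡ + 3 ℤ.* (d ℤ.* h) ℤ.+ -1ℤ ℤ.* (f ℤ.* h)
    distrib = ℤ-Solver.solve-∀

  dependency-Z : ∀ x k → combine (dependency x) (λ y → Z y k) ≡ 0ℤ
  dependency-Z x k = trans (combine-dependency x (λ y → Z y k))
    (trans (cong (λ t → + 3 ℤ.* Z x k ℤ.- t) (trans (sym (combine-frames (Z x) (λ y → Z y k))) (combine-frames-Z (Z x) k))) (cancel (Z x k)))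
    where
    cancel : ∀ z → + 3 ℤ.* z ℤ.- z ℤ.* + 3 ≡ 0ℤ
    cancel = ℤ-Solver.solve-∀

  block₀ : Fin m
  block₀ = Fin.fromℕ< {0} m≥1

  cross : Fin m → Vec ℤ N
  cross i = Vec.map lift x[ i ]

  cross-Min : ∀ i → Min (L setup m) (cross i)
  cross-Min i = lift-Min x[ i ] (x∈C[m] i) (wt-x i)

  -- The relation must be nontrivial, so a vertex outside the frame is needed. The lift of a word
  -- `x[ i ]` provides it: its entries are 0 and ±1, never ±3, and its own coefficient in the
  -- relation stays 3.
  hasSmallestEigenvalue : HasSmallestEigenvalue G -3ᵣ
  hasSmallestEigenvalue = dependency⇒eigenvalue (dependency x) (dependency-Z x) x (λ e → contradiction (trans (sym value) e) λ ()) ,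
    form⇒eigenvalues (adjacency G) form-nonneg
    where
    w : Vec ℤ N
    w = cross block₀
    open Representative (representative w (cross-Min block₀)) renaming (vertex to x)
    entry : ∀ j → Vec.lookup w j ≢ + 3 × Vec.lookup w j ≢ -[1+ 2 ]
    entry j = subst (λ t → t ≢ + 3 × t ≢ -[1+ 2 ]) (sym (Vec.lookup-map j lift x[ block₀ ])) (lift≢±3 (Vec.lookup x[ block₀ ] j))
    x≢frame : ∀ j → x ≢ frame-vertex j
    x≢frame j e = split (± ℤ.* frame-sign j) (square (trans (swap ± (frame-sign j)) (cong₂ ℤ._*_ ±²≡1 (frame-sign² j)))) (begin
      Vec.lookup w j                                       ≡⟨ lookup-± j ⟨
      ± ℤ.* Z x j                                          ≡⟨ cong (λ t → ± ℤ.* Z t j) e ⟩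
      ± ℤ.* Z (frame-vertex j) j                           ≡⟨ insert ± (frame-sign j) (Z (frame-vertex j) j) (frame-sign² j) ⟩
      ± ℤ.* frame-sign j ℤ.* (frame-sign j ℤ.* Z (frame-vertex j) j) ≡⟨ cong (± ℤ.* frame-sign j ℤ.*_) (trans (frame-lookup j j) (lookup-frame j)) ⟩
      ± ℤ.* frame-sign j ℤ.* + 3                           ∎)
      where
      open ≡-Reasoning
      swap : ∀ a b → (a ℤ.* b) ℤ.* (a ℤ.* b) ≡ (a ℤ.* a) ℤ.* (b ℤ.* b)
      swap = ℤ-Solver.solve-∀
      insert : ∀ a b z → b ℤ.* b ≡ 1ℤ → a ℤ.* z ≡ a ℤ.* b ℤ.* (b ℤ.* z)
      insert a b z e = sym (trans (regroup a b z) (trans (cong (ℤ._* (a ℤ.* z)) e) (ℤ.*-identityˡ (a ℤ.* z))))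
        where
        regroup : ∀ a b z → a ℤ.* b ℤ.* (b ℤ.* z) ≡ b ℤ.* b ℤ.* (a ℤ.* z)
        regroup = ℤ-Solver.solve-∀
      square : ∀ {s} → s ℤ.* s ≡ 1ℤ → s ≡ 1ℤ ⊎ s ≡ -1ℤ
      square {+ 0}           ()
      square {+ 1}           _ = inj₁ refl
      square {+ suc (suc n)} ()
      square { -[1+ 0 ]}     _ = inj₂ refl
      square { -[1+ suc n ]} ()
      split : ∀ s → s ≡ 1ℤ ⊎ s ≡ -1ℤ → Vec.lookup w j ≡ s ℤ.* + 3 → ⊥
      split s (inj₁ refl) = proj₁ (entry j)
      split s (inj₂ refl) = proj₂ (entry j)
    value : dependency x x ≡ + 3
    value = trans (cong₂ (λ d f → + 3 ℤ.* d ℤ.- f) (δ-same x)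
      (Σℤ.sum-ε λ j → trans (cong (λ d → Z x j ℤ.* (frame-sign j ℤ.* d)) (δ-other (x≢frame j)))
        (trans (cong (Z x j ℤ.*_) (ℤ.*-zeroʳ (frame-sign j))) (ℤ.*-zeroʳ (Z x j))))) refl

  module Nonextendable (H : SignedGraph) (eigenvalues : SmallestEigenvalueAtLeast H -3ᵣ)
    (f : Vertex G → Vertex H) (f-injective : ∀ {x y} → f x ≡ f y → x ≡ y)
    (f-edges : ∀ x y → edge H (f x) (f y) ≡ edge G x y)
    (w : Vertex H) (w∉f : ∀ x → f x ≢ w) (x₀ : Vertex G) (adjacent : Adjacent H w (f x₀)) where

    private module H = AdjacencyMatrix H

    open Extension (adjacency H) H.adjacency-sym eigenvalues f f-injective
      (λ x y → cong (maybe′ (_◃ 1) 0ℤ) (f-edges x y)) w w∉f (H.adjacency-loop w)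

    -- The projection of the new vertex to the span of the lattice is s / √3.
    s : Fin N → ℤ
    s = at-frame b

    sᵥ : Vec ℤ N
    sᵥ = Vec.tabulate s

    -- With `l = -3` and the combination `3s` of old vectors, the extended form is 81 - 18|s|² +
    -- 9|s|², nine times the squared distance from the new vector to its projection.
    norm≤9 : combine s s ℤ.≤ + 9
    norm≤9 = ℤ.*-cancelˡ-≤-pos (combine s s) (+ 9) (+ 9) (ℤ.0≤i-j⇒j≤i (ℤ.≤-trans (extended-form -[1+ 2 ] (frames s)) (ℤ.≤-reflexive (begin
      + 81 ℤ.+ + 6 ℤ.* (-[1+ 2 ] ℤ.* combine (frames s) b) ℤ.+ combine Y Y
        ≡⟨ cong₂ (λ p q → + 81 ℤ.+ + 6 ℤ.* (-[1+ 2 ] ℤ.* p) ℤ.+ q) (combine-frames s b) Y·Y ⟩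
      + 81 ℤ.+ + 6 ℤ.* (-[1+ 2 ] ℤ.* combine s s) ℤ.+ + 9 ℤ.* combine s s
        ≡⟨ collect (combine s s) ⟩
      + 81 ℤ.- + 9 ℤ.* combine s s ∎))))
      where
      open ≡-Reasoning
      Y : Fin N → ℤ
      Y k = combine (frames s) (λ y → Z y k)
      Y·Y : combine Y Y ≡ + 9 ℤ.* combine s s
      Y·Y = trans (Σℤ.sum-cong-≗ λ k → trans (cong (λ t → t ℤ.* t) (combine-frames-Z s k)) (nine (s k)))
        (sym (ℤ-sum-scale (+ 9) λ k → s k ℤ.* s k))
        where
        nine : ∀ a → a ℤ.* + 3 ℤ.* (a ℤ.* + 3) ≡ + 9 ℤ.* (a ℤ.* a)
        nine = ℤ-Solver.solve-∀
      collect : ∀ w → + 81 ℤ.+ + 6 ℤ.* (-[1+ 2 ] ℤ.* w) ℤ.+ + 9 ℤ.* w ≡ + 81 ℤ.- + 9 ℤ.* w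
      collect = ℤ-Solver.solve-∀

    -- A combination that vanishes among the old vectors must be orthogonal to the new one by
    -- semidefiniteness: with `t` the product in question, `l = -t` and twice the relation give 9t²
    -- - 12t² ≥ 0.
    dependency-b : ∀ x → combine (dependency x) b ≡ 0ℤ
    dependency-b x = nonpositive-square t (ℤ.≤-trans (extended-form (ℤ.- t) κ) (ℤ.≤-reflexive (begin
      + 9 ℤ.* (ℤ.- t ℤ.* ℤ.- t) ℤ.+ + 6 ℤ.* (ℤ.- t ℤ.* combine κ b) ℤ.+ combine Y Y
        ≡⟨ cong₂ (λ p q → + 9 ℤ.* (ℤ.- t ℤ.* ℤ.- t) ℤ.+ + 6 ℤ.* (ℤ.- t ℤ.* p) ℤ.+ q) (double b)
             (Σℤ.sum-ε λ k → trans (cong (ℤ._* Y k) (trans (double (λ y → Z y k)) (cong (+ 2 ℤ.*_) (dependency-Z x k)))) (ℤ.*-zeroˡ (Y k))) ⟩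
      + 9 ℤ.* (ℤ.- t ℤ.* ℤ.- t) ℤ.+ + 6 ℤ.* (ℤ.- t ℤ.* (+ 2 ℤ.* t)) ℤ.+ 0ℤ
        ≡⟨ collect t ⟩
      ℤ.- (+ 3 ℤ.* (t ℤ.* t)) ∎)))
      where
      open ≡-Reasoning
      t : ℤ
      t = combine (dependency x) b
      κ : Vertex G → ℤ
      κ y = + 2 ℤ.* dependency x y
      Y : Fin N → ℤ
      Y k = combine κ (λ y → Z y k)
      double : ∀ h → combine κ h ≡ + 2 ℤ.* combine (dependency x) h
      double h = trans (Σℤ.sum-cong-≗ λ y → ℤ.*-assoc (+ 2) (dependency x y) (h y)) (sym (ℤ-sum-scale (+ 2) λ y → dependency x y ℤ.* h y))
      collect : ∀ t → + 9 ℤ.* (ℤ.- t ℤ.* ℤ.- t) ℤ.+ + 6 ℤ.* (ℤ.- t ℤ.* (+ 2 ℤ.* t)) ℤ.+ 0ℤ ≡ ℤ.- (+ 3 ℤ.* (t ℤ.* t))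
      collect = ℤ-Solver.solve-∀
      nonpositive-square : ∀ t → 0ℤ ℤ.≤ ℤ.- (+ 3 ℤ.* (t ℤ.* t)) → t ≡ 0ℤ
      nonpositive-square (+ 0)      _ = refl
      nonpositive-square (+ suc _)  ()
      nonpositive-square -[1+ _ ]   ()

    ip-s : ∀ x → ip (vector x) sᵥ ≡ b x ℤ.* + 3
    ip-s x = begin
      ip (vector x) sᵥ
        ≡⟨ ip-sum (vector x) sᵥ ⟩
      Σℤ.sum (λ k → Z x k ℤ.* Vec.lookup sᵥ k)
        ≡⟨ Σℤ.sum-cong-≗ (λ k → cong (Z x k ℤ.*_) (Vec.lookup∘tabulate s k)) ⟩
      combine (Z x) s
        ≡⟨ solve (b x) (combine (Z x) s) (trans (sym (combine-dependency x b)) (dependency-b x)) ⟩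
      b x ℤ.* + 3 ∎
      where
      open ≡-Reasoning
      solve : ∀ b c → + 3 ℤ.* b ℤ.- c ≡ 0ℤ → c ≡ b ℤ.* + 3
      solve b c e = trans (sym (ℤ.i-j≡0⇒i≡j (+ 3 ℤ.* b) c e)) (ℤ.*-comm (+ 3) b)

    s∈L : Lm sᵥ
    s∈L = minimal-vectors-generate sᵥ λ z z∈ → from z (representative z z∈)
      where
      from : ∀ z → Representative z → ∃[ r ] ip z sᵥ ≡ r ℤ.* + 3
      from z r = ± ℤ.* b vertex , trans (ip-sum z sᵥ) (trans
        (Σℤ.sum-cong-≗ λ k → trans (cong (ℤ._* Vec.lookup sᵥ k) (sym (lookup-± k))) (ℤ.*-assoc ± (Z vertex k) (Vec.lookup sᵥ k)))
        (trans (sym (ℤ-sum-scale ± λ k → Z vertex k ℤ.* Vec.lookup sᵥ k)) (trans (cong (± ℤ.*_) (trans (sym (ip-sum (vector vertex) sᵥ)) (ip-s vertex)))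
          (sym (ℤ.*-assoc ± (b vertex) (+ 3))))))
        where open Representative r

    s≢0 : sᵥ ≢ 0ᵥ
    s≢0 s≡0 = H.Adjacent⇒≢0 w (f x₀) adjacent (ℤ.*-cancelʳ-≡ (b x₀) 0ℤ (+ 3)
      (trans (sym (ip-s x₀)) (trans (cong (ip (vector x₀)) s≡0) (ip-0ᵥ (vector x₀)))))

    ip-ss : ip sᵥ sᵥ ≡ + 9
    ip-ss = ℤ.≤-antisym (ℤ.≤-trans (ℤ.≤-reflexive (trans (ip-sum sᵥ sᵥ)
      (Σℤ.sum-cong-≗ λ k → cong₂ ℤ._*_ (Vec.lookup∘tabulate s k) (Vec.lookup∘tabulate s k)))) norm≤9) (ip-minimum sᵥ s∈L s≢0)

    -- The projection would be plus or minus the vector of an old vertex, and the edge between that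
    -- vertex and the new one would have value ±3, which no adjacency entry has.
    impossible : ⊥
    impossible = split (Representative.is-± r)
      where
      r : Representative sᵥ
      r = representative sᵥ (to-Min sᵥ s∈L ip-ss)
      x : Vertex G
      x = Representative.vertex r
      split : vector x ≡ sᵥ ⊎ vector x ≡ negᵥ sᵥ → ⊥
      split (inj₁ e) = proj₁ (H.adjacency≢±3 w (f x)) (ℤ.*-cancelʳ-≡ (b x) (+ 3) (+ 3)
        (trans (sym (ip-s x)) (trans (cong (λ v → ip v sᵥ) e) ip-ss)))
      split (inj₂ e) = proj₂ (H.adjacency≢±3 w (f x)) (ℤ.*-cancelʳ-≡ (b x) -[1+ 2 ] (+ 3)
        (trans (sym (ip-s x)) (trans (cong (λ v → ip v sᵥ) e) (trans (ip-neg sᵥ sᵥ) (cong (λ t → ℤ.- t) ip-ss)))))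

  -- A missed vertex need not be adjacent to the image of `f`. The edge by which a walk first enters
  -- the image provides one that is.
  boundary : ∀ (H : SignedGraph) (f : Vertex G → Vertex H) {v u} → Star (Adjacent H) v u → (∀ x → f x ≢ v) → ∀ y → f y ≡ u →
             ∃[ w ] ∃[ x ] (∀ y → f y ≢ w) × Adjacent H w (f x)
  boundary H f Star-refl v∉f y e = contradiction e (v∉f y)
  boundary H f (_◅_ {i} {j} adj path) v∉f y e = split (Fin.any? (λ x → f x Fin.≟ j))
    where
    split : Dec (∃[ x ] f x ≡ j) → ∃[ w ] ∃[ x ] (∀ y → f y ≢ w) × Adjacent H w (f x)
    split (yes (x , refl)) = i , x , v∉f , adj
    split (no none)        = boundary H f path (λ x e → none (x , e)) y e

  nonExtendable : NonExtendable G
  nonExtendable H connected eigenvalues (f , f-injective , f-edges , z , z∉f) =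
    from (boundary H f (connected z (f y₀)) z∉f y₀ refl)
    where
    y₀ : Vertex G
    y₀ = frame-vertex coordinate₀
    from : ∃[ w ] ∃[ x ] (∀ y → f y ≢ w) × Adjacent H w (f x) → ⊥
    from (w , x , w∉f , adj) = Nonextendable.impossible H eigenvalues f f-injective f-edges w w∉f x adj

  -- The product with a frame vector is three times a coordinate. Every vertex is thus equal or
  -- adjacent to the frame vertices of its support, which turns connectedness into a question about
  -- coordinates.
  frame-adjacent : ∀ x j → Z x j ≢ 0ℤ → x ≢ frame-vertex j → adjacency G x (frame-vertex j) ≢ 0ℤ
  frame-adjacent x j Z≢0 x≢ A≡0 = Z≢0 (ℤ.*-cancelʳ-≡ (Z x j) 0ℤ (+ 3) (begin
    Z x j ℤ.* + 3
      ≡⟨ ip-frame (vector x) j ⟨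
    ip (vector x) (frame j)
      ≡⟨ trans (ip-sum (vector x) (frame j)) (Σℤ.sum-cong-≗ λ k → trans (cong (Z x k ℤ.*_) (sym (frame-lookup j k))) (swap (Z x k) (frame-sign j) (Z (frame-vertex j) k))) ⟩
    Σℤ.sum (λ k → frame-sign j ℤ.* (Z x k ℤ.* Z (frame-vertex j) k))
      ≡⟨ ℤ-sum-scale (frame-sign j) (λ k → Z x k ℤ.* Z (frame-vertex j) k) ⟨
    frame-sign j ℤ.* combine (Z x) (Z (frame-vertex j))
      ≡⟨ cong (frame-sign j ℤ.*_) (trans (gram x (frame-vertex j)) (cong₂ (λ a d → a ℤ.* + 3 ℤ.+ d ℤ.* + 9) A≡0 (δ-other (x≢ ∘ sym)))) ⟩
    frame-sign j ℤ.* 0ℤ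
      ≡⟨ ℤ.*-zeroʳ (frame-sign j) ⟩
    0ℤ ∎))
    where
    open ≡-Reasoning
    swap : ∀ a b c → a ℤ.* (b ℤ.* c) ≡ b ℤ.* (a ℤ.* c)
    swap = ℤ-Solver.solve-∀

  nonzero-coordinate : ∀ x → ∃[ j ] Z x j ≢ 0ℤ
  nonzero-coordinate x = split (Fin.any? (λ j → ¬? (Z x j ℤ.≟ 0ℤ)))
    where
    split : Dec (∃[ j ] Z x j ≢ 0ℤ) → ∃[ j ] Z x j ≢ 0ℤ
    split (yes found) = found
    split (no none)   = contradiction (trans (sym (Min-ip (vector x) (vector-Min x))) (trans (sym (ip-Z x x)) (Σℤ.sum-ε λ j → zero-term j (Z x j ℤ.≟ 0ℤ)))) λ ()
      where
      zero-term : ∀ j → Dec (Z x j ≡ 0ℤ) → Z x j ℤ.* Z x j ≡ 0ℤ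
      zero-term j (yes e) = cong (λ t → t ℤ.* t) e
      zero-term j (no ≢0) = contradiction (j , ≢0) none

  module Connectedness (x₀ : Vertex G) (T : Subset (order G)) (x₀∈T : Vec.lookup T x₀ ≡ true)
    (reached : ∀ y → Vec.lookup T y ≡ true → Star (Adjacent G) x₀ y)
    (closed : ∀ y z → Vec.lookup T y ≡ true → Adjacent G y z → Vec.lookup T z ≡ true) where

    reach : Fin N → Bool
    reach j = Vec.lookup T (frame-vertex j)

    same-side : ∀ x j → Z x j ≢ 0ℤ → Vec.lookup T x ≡ reach j
    same-side x j Z≢0 = split (x Fin.≟ frame-vertex j)
      where
      split : Dec (x ≡ frame-vertex j) → Vec.lookup T x ≡ reach j
      split (yes e) = cong (Vec.lookup T) e
      split (no x≢) = agree x≢ (Vec.lookup T x) (Vec.lookup T (frame-vertex j)) refl refl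
        where
        agree : x ≢ frame-vertex j → ∀ s t → Vec.lookup T x ≡ s → Vec.lookup T (frame-vertex j) ≡ t → Vec.lookup T x ≡ Vec.lookup T (frame-vertex j)
        agree x≢ true  _     e e′ = trans e (sym (closed x (frame-vertex j) e forth))
          where
          forth : Adjacent G x (frame-vertex j)
          forth = adjacency≢0 x (frame-vertex j) (frame-adjacent x j Z≢0 x≢)
        agree x≢ false true  e e′ = contradiction (trans (sym (closed (frame-vertex j) x e′ back)) e) λ ()
          where
          back : Adjacent G (frame-vertex j) x
          back = adjacency≢0 (frame-vertex j) x (λ e → frame-adjacent x j Z≢0 x≢ (trans (adjacency-sym x (frame-vertex j)) e))
        agree x≢ false false e e′ = trans e (sym e′)

    -- The lift of the word is represented by a vertex that ties together all frame vertices over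
    -- its support.
    word-side : ∀ c → C[ m ] c → wt c ≡ 9 → ∃[ t ] ∀ l → Vec.lookup c l ≢ 0F → reach l ≡ t
    word-side c c∈ wt≡9 = Vec.lookup T vertex , λ l c≢0 → sym (same-side vertex l λ Z≡0 →
      lift≢0 (Vec.lookup c l) c≢0 (trans (sym (Vec.lookup-map l lift c)) (trans (sym (lookup-± l)) (trans (cong (± ℤ.*_) Z≡0) (ℤ.*-zeroʳ ±)))))
      where open Representative (representative (Vec.map lift c) (lift-Min c c∈ wt≡9))

    abstract
      side : Fin m → Subset 24
      side i = Vec.tabulate λ j → reach (Fin.combine i j)

      lookup-side : ∀ i l → Vec.lookup (side i) l ≡ reach (Fin.combine i l)
      lookup-side i l = Vec.lookup∘tabulate (λ j → reach (Fin.combine i j)) l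

    side-splits : ∀ i → Splits (side i)
    side-splits i c c∈C wt≡9 c·p≡0 = from (word-side (block i c) (block∈C[m] i (c∈C , c·p≡0)) (trans (wt-block i c) wt≡9))
      where
      in-block : ∀ l → Vec.lookup c l ≢ 0F → Vec.lookup (block i c) (Fin.combine i l) ≢ 0F
      in-block l c≢0 e = c≢0 (trans (sym (cong (λ v → Vec.lookup v l) (trans (blockOf-block i c i) (at-same i c))))
        (trans (lookup-blockOf (block i c) i l) e))
      from : ∃[ t ] (∀ l → Vec.lookup (block i c) l ≢ 0F → reach l ≡ t) →
        (∀ l → Vec.lookup c l ≢ 0F → Vec.lookup (side i) l ≡ true) ⊎ (∀ l → Vec.lookup c l ≢ 0F → Vec.lookup (side i) l ≡ false)
      from (true  , h) = inj₁ λ l c≢0 → trans (lookup-side i l) (h (Fin.combine i l) (in-block l c≢0))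
      from (false , h) = inj₂ λ l c≢0 → trans (lookup-side i l) (h (Fin.combine i l) (in-block l c≢0))

    Reached : Fin m → Set
    Reached i = ∀ j → reach (Fin.combine i j) ≡ true

    spread : ∀ i j → reach (Fin.combine i j) ≡ true → Reached i
    spread i j r k = trans (sym (lookup-side i k)) (D-support-connected (side i) (side-splits i) j k
      (trans (lookup-side i j) r))

    -- The support of `x[ i ]` meets `P` in block `i` and `Q` in the next block, so it carries
    -- reachability across.
    reached-next : ∀ i → Reached i → Reached (next i)
    reached-next i all = from (word-side x[ i ] (x∈C[m] i) (wt-x i)) (∣∣-member P ∣P∣≡4) (∣∣-member Q ∣Q∣≡5)
      where
      two≢0 : ∀ {c : F₃} → c ≡ 2F → c ≢ 0F
      two≢0 refl ()
      from : ∃[ t ] (∀ l → Vec.lookup x[ i ] l ≢ 0F → reach l ≡ t) → ∃[ a ] Vec.lookup P a ≡ true → ∃[ b ] Vec.lookup Q b ≡ true → Reached (next i)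
      from (t , h) (a , a∈P) (b , b∈Q) = spread (next i) b (trans (h (Fin.combine (next i) b) (two≢0 (x-on-Q i b b∈Q)))
        (trans (sym (h (Fin.combine i a) (two≢0 (x-on-P i a a∈P)))) (all a)))

    everything : ∀ y → Star (Adjacent G) x₀ y
    everything y = reached y (trans (same-side y l Z≢0) (all-reached l))
      where
      l : Fin N
      l = proj₁ (nonzero-coordinate y)
      Z≢0 : Z y l ≢ 0ℤ
      Z≢0 = proj₂ (nonzero-coordinate y)
      all-reached : ∀ l → reach l ≡ true
      all-reached l = from (Fin.combine-surjective {m} {24} l) (Fin.combine-surjective {m} {24} (proj₁ (nonzero-coordinate x₀)))
        where
        from : ∃[ k ] ∃[ j ] Fin.combine {m} {24} k j ≡ l → ∃[ k ] ∃[ j ] Fin.combine {m} {24} k j ≡ proj₁ (nonzero-coordinate x₀) → reach l ≡ true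
        from (k , j , refl) (k₀ , j₀ , e) = cyclic Reached reached-next k₀
          (spread k₀ j₀ (trans (cong reach e) (trans (sym (same-side x₀ _ (proj₂ (nonzero-coordinate x₀)))) x₀∈T))) k j

  connected : Connected G
  connected x y = from (Reachability.component (Adjacent G) Adjacent? x)
    where
    from : ∃[ T ] Vec.lookup T x ≡ true × (∀ y → Vec.lookup T y ≡ true → Star (Adjacent G) x y) ×
      Reachability.Closed (Adjacent G) Adjacent? x T → Star (Adjacent G) x y
    from (T , x∈T , reached , closed) = Connectedness.everything x T x∈T reached closed y

-- Choosing one vector from each antipodal pair

module Transversal {A : Set} (_≈_ : A → A → Set) (_≈?_ : ∀ x y → Dec (x ≈ y)) (≈-sym : ∀ {x y} → x ≈ y → y ≈ x)
  (≈-refl : ∀ {x} → x ≈ x) (P : A → Set) (P? : ∀ x → Dec (P x)) where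

  record Choice (zs : List A) : Set where
    field
      size     : ℕ
      chosen   : Fin size → A
      good     : ∀ i → P (chosen i)
      distinct : ∀ i j → chosen i ≈ chosen j → i ≡ j
      covers   : ∀ z → z List.∈ zs → P z → ∃[ i ] chosen i ≈ z

  choose : ∀ zs → Choice zs
  choose []       = record { size = 0 ; chosen = λ () ; good = λ () ; distinct = λ () ; covers = λ _ () }
  choose (z ∷ zs) = extend (P? z) (Fin.any? λ i → chosen i ≈? z)
    where
    open Choice (choose zs)
    extend : Dec (P z) → Dec (∃[ i ] chosen i ≈ z) → Choice (z ∷ zs)
    extend (no ¬Pz) _ = record { size = size ; chosen = chosen ; good = good ; distinct = distinct ; covers = λ where
      _ (here refl) Pz → contradiction Pz ¬Pz
      y (there y∈)  Py → covers y y∈ Py }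
    extend (yes _) (yes found) = record { size = size ; chosen = chosen ; good = good ; distinct = distinct ; covers = λ where
      _ (here refl) _  → found
      y (there y∈)  Py → covers y y∈ Py }
    extend (yes Pz) (no new) = record
      { size     = suc size
      ; chosen   = λ where zero → z ; (suc i) → chosen i
      ; good     = λ where zero → Pz ; (suc i) → good i
      ; distinct = λ where
          zero    zero    _ → refl
          zero    (suc j) e → contradiction (j , ≈-sym e) new
          (suc i) zero    e → contradiction (i , e) new
          (suc i) (suc j) e → cong suc (distinct i j e)
      ; covers   = λ where
          _ (here refl) _  → zero , ≈-refl
          y (there y∈)  Py → let i , e = covers y y∈ Py in suc i , e }

-- The possible entries of an integer vector of squared length 9; they confine the minimal vectors
-- to a finite list.
digits : List ℤ
digits = -[1+ 2 ] ∷ -[1+ 1 ] ∷ -[1+ 0 ] ∷ + 0 ∷ + 1 ∷ + 2 ∷ + 3 ∷ []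

digit∈ : ∀ a → a ℤ.* a ℤ.≤ + 9 → a List.∈ digits
digit∈ -[1+ 2 ] _ = here refl
digit∈ -[1+ 1 ] _ = there (here refl)
digit∈ -[1+ 0 ] _ = there (there (here refl))
digit∈ (+ 0)    _ = there (there (there (here refl)))
digit∈ (+ 1)    _ = there (there (there (there (here refl))))
digit∈ (+ 2)    _ = there (there (there (there (there (here refl)))))
digit∈ (+ 3)    _ = there (there (there (there (there (there (here refl))))))
digit∈ (+ suc (suc (suc (suc n)))) le = contradiction (ℕ.≤-trans (ℕ.*-mono-≤ (ℕ.m≤m+n 4 n) (ℕ.m≤m+n 4 n)) (ℤ.drop‿+≤+ le)) (ℕ.<⇒≱ (ℕ.≤ᵇ⇒≤ 10 16 _))
digit∈ -[1+ suc (suc (suc n)) ]    le = contradiction (ℕ.≤-trans (ℕ.*-mono-≤ (ℕ.m≤m+n 4 n) (ℕ.m≤m+n 4 n)) (ℤ.drop‿+≤+ le)) (ℕ.<⇒≱ (ℕ.≤ᵇ⇒≤ 10 16 _))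

small-vectors : ∀ n → List (Vec ℤ n)
small-vectors zero    = [] ∷ []
small-vectors (suc n) = List.cartesianProductWith _∷_ digits (small-vectors n)

small-vector∈ : ∀ {n} (z : Vec ℤ n) → (∀ i → Vec.lookup z i ℤ.* Vec.lookup z i ℤ.≤ + 9) → z List.∈ small-vectors n
small-vector∈ []      _ = here refl
small-vector∈ (a ∷ z) h = List.∈-cartesianProductWith⁺ _∷_ (digit∈ a (h zero)) (small-vector∈ z (h ∘ suc))

sign-of : ℤ → Maybe Sign
sign-of (+ 0)     = nothing
sign-of (+ suc _) = just Sign.+
sign-of -[1+ _ ]  = just Sign.-

module Existence (setup : Setup) (m : ℕ) (m≥1 : m ≥ 1) where
  open Lattice setup m m≥1

  Antipodal : Vec ℤ N → Vec ℤ N → Set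
  Antipodal y z = y ≡ z ⊎ y ≡ negᵥ z

  _≟ℤᵥ_ : (y z : Vec ℤ N) → Dec (y ≡ z)
  _≟ℤᵥ_ = Vec.≡-dec ℤ._≟_

  antipodal? : ∀ y z → Dec (Antipodal y z)
  antipodal? y z = (y ≟ℤᵥ z) ⊎-dec (y ≟ℤᵥ negᵥ z)

  antipodal-sym : ∀ {y z} → Antipodal y z → Antipodal z y
  antipodal-sym         (inj₁ e) = inj₁ (sym e)
  antipodal-sym {z = z} (inj₂ e) = inj₂ (trans (sym (negᵥ-involutive z)) (cong negᵥ (sym e)))

  antipodal-trans : ∀ {x y z} → Antipodal x z → Antipodal y z → Antipodal x y
  antipodal-trans         (inj₁ refl) h           = antipodal-sym h
  antipodal-trans         (inj₂ e)    (inj₁ refl) = inj₂ e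
  antipodal-trans         (inj₂ refl) (inj₂ e)    = inj₁ (sym e)

  -- A decidable substitute for `Min`, whose definition quantifies over the whole lattice.
  Minimal : Vec ℤ N → Set
  Minimal z = Lm z × ip z z ≡ + 9

  open Transversal Antipodal antipodal? antipodal-sym (inj₁ refl) Minimal (λ z → Lm? z ×-dec (ip z z ℤ.≟ + 9))

  module FromChoice (choice : Choice (small-vectors N)) where
    open Choice choice

    edge′ : Fin size → Fin size → Maybe Sign
    edge′ x y = if does (x Fin.≟ y) then nothing else sign-of (ip (chosen x) (chosen y))

    edge′-irrefl : ∀ x → edge′ x x ≡ nothing
    edge′-irrefl x with x Fin.≟ x
    ... | yes _  = refl
    ... | no x≢x = contradiction refl x≢x

    edge′-other : ∀ x y → x ≢ y → edge′ x y ≡ sign-of (ip (chosen x) (chosen y))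
    edge′-other x y x≢y with x Fin.≟ y
    ... | yes e = contradiction e x≢y
    ... | no _  = refl

    edge′-sym : ∀ x y → edge′ x y ≡ edge′ y x
    edge′-sym x y = split (x Fin.≟ y)
      where
      split : Dec (x ≡ y) → edge′ x y ≡ edge′ y x
      split (yes refl) = refl
      split (no x≢y)   = trans (edge′-other x y x≢y)
        (trans (cong sign-of (ip-comm (chosen x) (chosen y))) (sym (edge′-other y x (x≢y ∘ sym))))

    Γ : SignedGraph
    Γ = record { order = size ; edge = edge′ ; edge-sym = edge′-sym ; edge-irrefl = edge′-irrefl }

    chosen-Min : ∀ x → Min (L setup m) (chosen x)
    chosen-Min x = to-Min (chosen x) (proj₁ (good x)) (proj₂ (good x))

    edge′-sign : ∀ x y → x ≢ y → ip (chosen x) (chosen y) ≡ maybe′ (_◃ 1) 0ℤ (edge′ x y) ℤ.* + 3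
    edge′-sign x y x≢y = trans (sign-value (Min-ip-small (chosen x) (chosen y) (chosen-Min x) (chosen-Min y)
        (λ e → x≢y (distinct x y (inj₁ e))) (λ e → x≢y (distinct x y (inj₂ e)))))
      (cong (λ e → maybe′ (_◃ 1) 0ℤ e ℤ.* + 3) (sym (edge′-other x y x≢y)))
      where
      sign-value : ∀ {i} → ∃[ r ] i ≡ r ℤ.* + 3 × (r ≡ 0ℤ ⊎ r ≡ 1ℤ ⊎ r ≡ -1ℤ) → i ≡ maybe′ (_◃ 1) 0ℤ (sign-of i) ℤ.* + 3
      sign-value (_ , refl , inj₁ refl)        = refl
      sign-value (_ , refl , inj₂ (inj₁ refl)) = refl
      sign-value (_ , refl , inj₂ (inj₂ refl)) = refl

    Γ-isΓ : IsΓ setup m Γ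
    Γ-isΓ = record
      { vector      = chosen
      ; vector-Min  = chosen-Min
      ; transversal = λ z z∈ → unique z (covers z (small-vector∈ z λ i → ℤ.≤-trans (ip-≥-square z i) (ℤ.≤-reflexive (Min-ip z z∈)))
                                (proj₁ z∈ , Min-ip z z∈))
      ; edge-sign   = λ x y x≢y → /3≡/1′ {ip (chosen x) (chosen y)} {maybe′ (_◃ 1) 0ℤ (edge′ x y)} (edge′-sign x y x≢y)
      }
      where
      unique : ∀ z → ∃[ i ] Antipodal (chosen i) z → ∃! _≡_ (λ i → Antipodal (chosen i) z)
      unique z (i , h) = i , h , λ {j} h′ → distinct i j (antipodal-trans h h′)

  exists : ∃[ G ] IsΓ setup m G
  exists = FromChoice.Γ choice , FromChoice.Γ-isΓ choice
    where choice = choose (small-vectors N)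

-- The dimension as a switching invariant

-- A map preserving non-adjacency sends the frame of the first lattice to
-- nonzero pairwise orthogonal vectors of the second.
module Dimension (setup : Setup) (m m′ : ℕ) (m≥1 : m ≥ 1) (m′≥1 : m′ ≥ 1) (G G′ : SignedGraph)
  (isΓ : IsΓ setup m G) (isΓ′ : IsΓ setup m′ G′) (σ : Vertex G → Vertex G′) (σ-injective : ∀ {x y} → σ x ≡ σ y → x ≡ y)
  (σ-nonadjacent : ∀ x y → adjacency G x y ≡ 0ℤ → adjacency G′ (σ x) (σ y) ≡ 0ℤ) where

  private
    module Γ = Γ-graph setup m m≥1 G isΓ
    module Γ′ = Γ-graph setup m′ m′≥1 G′ isΓ′

  frame-distinct : ∀ {i j} → i ≢ j → Γ.frame-vertex i ≢ Γ.frame-vertex j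
  frame-distinct {i} {j} i≢j e = contradiction (begin
    + 3                                                    ≡⟨ lookup-frame i ⟨
    Vec.lookup (frame i) i                                 ≡⟨ Γ.frame-lookup i i ⟨
    Γ.frame-sign i ℤ.* Γ.Z (Γ.frame-vertex i) i            ≡⟨ cong (λ t → Γ.frame-sign i ℤ.* Γ.Z t i) e ⟩
    Γ.frame-sign i ℤ.* Γ.Z (Γ.frame-vertex j) i            ≡⟨ insert (Γ.frame-sign i) (Γ.frame-sign j) (Γ.Z (Γ.frame-vertex j) i) (Γ.frame-sign² j) ⟩
    Γ.frame-sign i ℤ.* Γ.frame-sign j ℤ.* (Γ.frame-sign j ℤ.* Γ.Z (Γ.frame-vertex j) i)
      ≡⟨ cong (Γ.frame-sign i ℤ.* Γ.frame-sign j ℤ.*_) (trans (Γ.frame-lookup j i) (lookup-frame′ i≢j)) ⟩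
    Γ.frame-sign i ℤ.* Γ.frame-sign j ℤ.* 0ℤ               ≡⟨ ℤ.*-zeroʳ (Γ.frame-sign i ℤ.* Γ.frame-sign j) ⟩
    0ℤ                                                     ∎) λ ()
    where
    open ≡-Reasoning
    insert : ∀ a b z → b ℤ.* b ≡ 1ℤ → a ℤ.* z ≡ a ℤ.* b ℤ.* (b ℤ.* z)
    insert a b z e = sym (trans (regroup a b z) (trans (cong (ℤ._* (a ℤ.* z)) e) (ℤ.*-identityˡ (a ℤ.* z))))
      where
      regroup : ∀ a b z → a ℤ.* b ℤ.* (b ℤ.* z) ≡ b ℤ.* b ℤ.* (a ℤ.* z)
      regroup = ℤ-Solver.solve-∀

  frame-nonadjacent : ∀ {i j} → i ≢ j → adjacency G (Γ.frame-vertex i) (Γ.frame-vertex j) ≡ 0ℤ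
  frame-nonadjacent {i} {j} i≢j = decide (adjacency G (Γ.frame-vertex i) (Γ.frame-vertex j) ℤ.≟ 0ℤ)
    where
    open ≡-Reasoning
    Z≡0 : Γ.Z (Γ.frame-vertex i) j ≡ 0ℤ
    Z≡0 = trans (sym (ℤ.*-identityˡ (Γ.Z (Γ.frame-vertex i) j))) (trans (cong (ℤ._* Γ.Z (Γ.frame-vertex i) j) (sym (Γ.frame-sign² i)))
      (trans (ℤ.*-assoc (Γ.frame-sign i) (Γ.frame-sign i) (Γ.Z (Γ.frame-vertex i) j))
        (trans (cong (Γ.frame-sign i ℤ.*_) (trans (Γ.frame-lookup i j) (lookup-frame′ (i≢j ∘ sym)))) (ℤ.*-zeroʳ (Γ.frame-sign i)))))
    decide : Dec (adjacency G (Γ.frame-vertex i) (Γ.frame-vertex j) ≡ 0ℤ) → adjacency G (Γ.frame-vertex i) (Γ.frame-vertex j) ≡ 0ℤ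
    decide (yes e) = e
    decide (no ≢0) = contradiction (ℤ.*-cancelʳ-≡ (adjacency G (Γ.frame-vertex i) (Γ.frame-vertex j)) 0ℤ (+ 3) (begin
      adjacency G (Γ.frame-vertex i) (Γ.frame-vertex j) ℤ.* + 3
        ≡⟨ ℤ.+-identityʳ (adjacency G (Γ.frame-vertex i) (Γ.frame-vertex j) ℤ.* + 3) ⟨
      adjacency G (Γ.frame-vertex i) (Γ.frame-vertex j) ℤ.* + 3 ℤ.+ 0ℤ
        ≡⟨ cong (λ d → adjacency G (Γ.frame-vertex i) (Γ.frame-vertex j) ℤ.* + 3 ℤ.+ d ℤ.* + 9) (δ-other (frame-distinct (i≢j ∘ sym))) ⟨
      adjacency G (Γ.frame-vertex i) (Γ.frame-vertex j) ℤ.* + 3 ℤ.+ δ (Γ.frame-vertex j) (Γ.frame-vertex i) ℤ.* + 9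
        ≡⟨ Γ.gram (Γ.frame-vertex i) (Γ.frame-vertex j) ⟨
      combine (Γ.Z (Γ.frame-vertex i)) (Γ.Z (Γ.frame-vertex j))
        ≡⟨ Σℤ.sum-ε term≡0 ⟩
      0ℤ ∎)) ≢0
      where
      Zⱼ≡0 : ∀ k → k ≢ j → Γ.Z (Γ.frame-vertex j) k ≡ 0ℤ
      Zⱼ≡0 k k≢j = trans (sym (ℤ.*-identityˡ (Γ.Z (Γ.frame-vertex j) k))) (trans (cong (ℤ._* Γ.Z (Γ.frame-vertex j) k) (sym (Γ.frame-sign² j)))
        (trans (ℤ.*-assoc (Γ.frame-sign j) (Γ.frame-sign j) (Γ.Z (Γ.frame-vertex j) k))
          (trans (cong (Γ.frame-sign j ℤ.*_) (trans (Γ.frame-lookup j k) (lookup-frame′ k≢j))) (ℤ.*-zeroʳ (Γ.frame-sign j)))))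
      term≡0 : ∀ k → Γ.Z (Γ.frame-vertex i) k ℤ.* Γ.Z (Γ.frame-vertex j) k ≡ 0ℤ
      term≡0 k = at (k Fin.≟ j)
        where
        at : Dec (k ≡ j) → Γ.Z (Γ.frame-vertex i) k ℤ.* Γ.Z (Γ.frame-vertex j) k ≡ 0ℤ
        at (yes refl) = trans (cong (ℤ._* Γ.Z (Γ.frame-vertex k) k) Z≡0) (ℤ.*-zeroˡ (Γ.Z (Γ.frame-vertex k) k))
        at (no k≢j)   = trans (cong (Γ.Z (Γ.frame-vertex i) k ℤ.*_) (Zⱼ≡0 k k≢j)) (ℤ.*-zeroʳ (Γ.Z (Γ.frame-vertex i) k))

  image : Fin (m ℕ.* 24) → Vecℚ (m′ ℕ.* 24)
  image j k = fromInt (Γ′.Z (σ (Γ.frame-vertex j)) k)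

  dot-image : ∀ i j → dot (image i) (image j) ≡ fromInt (combine (Γ′.Z (σ (Γ.frame-vertex i))) (Γ′.Z (σ (Γ.frame-vertex j))))
  dot-image i j = sym (trans (fromInt-sum λ k → Γ′.Z (σ (Γ.frame-vertex i)) k ℤ.* Γ′.Z (σ (Γ.frame-vertex j)) k)
    (Σℚ.sum-cong-≗ λ k → fromInt-* (Γ′.Z (σ (Γ.frame-vertex i)) k) (Γ′.Z (σ (Γ.frame-vertex j)) k)))

  dimension-≤ : m ℕ.≤ m′
  dimension-≤ = ℕ.*-cancelʳ-≤ m m′ 24 (orthogonal-count image
    (λ i j i≢j → trans (dot-image i j) (cong fromInt (trans (Γ′.gram (σ (Γ.frame-vertex i)) (σ (Γ.frame-vertex j)))
      (cong₂ (λ a d → a ℤ.* + 3 ℤ.+ d ℤ.* + 9) (σ-nonadjacent (Γ.frame-vertex i) (Γ.frame-vertex j) (frame-nonadjacent i≢j))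
        (δ-other (λ e → frame-distinct i≢j (sym (σ-injective e))))))))
    (λ j e → contradiction (trans (sym (image-norm j)) (fromInt-injective {j = 0ℤ} (trans (sym (dot-image j j)) e))) λ ()))
    where
    image-norm : ∀ j → combine (Γ′.Z (σ (Γ.frame-vertex j))) (Γ′.Z (σ (Γ.frame-vertex j))) ≡ + 9
    image-norm j = trans (Γ′.gram (σ (Γ.frame-vertex j)) (σ (Γ.frame-vertex j)))
      (cong₂ (λ a d → a ℤ.* + 3 ℤ.+ d ℤ.* + 9) (AdjacencyMatrix.adjacency-loop G′ (σ (Γ.frame-vertex j))) (δ-same (σ (Γ.frame-vertex j))))

-- Signs and relabelling leave the zero pattern of the adjacency matrix intact, so the comparison of
-- dimensions applies to the relabelling and to its inverse.
switching-dimension : (setup : Setup) → ∀ m m′ → m ≥ 1 → m′ ≥ 1 → ∀ G G′ → IsΓ setup m G → IsΓ setup m′ G′ →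
                      SwitchingEquivalent G G′ → m ≡ m′
switching-dimension setup m m′ m≥1 m′≥1 G G′ isΓ isΓ′ (π , t , switch) = ℕ.≤-antisym
  (Dimension.dimension-≤ setup m m′ m≥1 m′≥1 G G′ isΓ isΓ′ (π ⟨$⟩ʳ_)
    (λ {x} {y} e → trans (sym (inverseˡ π)) (trans (cong (π ⟨$⟩ˡ_) e) (inverseˡ π)))
    λ x y A≡0 → trans (switch x y) (trans (cong (λ a → (t x ◃ 1) ℤ.* a ℤ.* (t y ◃ 1)) A≡0) (cong (ℤ._* (t y ◃ 1)) (ℤ.*-zeroʳ (t x ◃ 1)))))
  (Dimension.dimension-≤ setup m′ m m′≥1 m≥1 G′ G isΓ′ isΓ (π ⟨$⟩ˡ_)
    (λ {x} {y} e → trans (sym (inverseʳ π)) (trans (cong (π ⟨$⟩ʳ_) e) (inverseʳ π)))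
    λ x y A≡0 → unsign (t (π ⟨$⟩ˡ x)) (t (π ⟨$⟩ˡ y)) (adjacency G (π ⟨$⟩ˡ x) (π ⟨$⟩ˡ y))
      (trans (sym (switch (π ⟨$⟩ˡ x) (π ⟨$⟩ˡ y))) (trans (cong₂ (adjacency G′) (inverseʳ π) (inverseʳ π)) A≡0)))
  where
  unit-sign : ∀ s → (s ◃ 1) ≢ 0ℤ
  unit-sign Sign.+ ()
  unit-sign Sign.- ()
  unsign : ∀ s t a → (s ◃ 1) ℤ.* a ℤ.* (t ◃ 1) ≡ 0ℤ → a ≡ 0ℤ
  unsign s t a e with ℤ.i*j≡0⇒i≡0∨j≡0 ((s ◃ 1) ℤ.* a) e
  ... | inj₂ t≡0 = contradiction t≡0 (unit-sign t)
  ... | inj₁ sa≡0 with ℤ.i*j≡0⇒i≡0∨j≡0 (s ◃ 1) sa≡0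
  ...   | inj₁ s≡0 = contradiction s≡0 (unit-sign s)
  ...   | inj₂ a≡0 = a≡0

corollary1p2 : (setup : Setup) →
    (∀ m → m ≥ 1 →
    (∃[ G ] IsΓ setup m G) ×
    (∀ G → IsΓ setup m G →
    Connected G × HasSmallestEigenvalue G -3ᵣ × NonExtendable G)) ×
    (∀ m m′ → m ≥ 1 → m′ ≥ 1 → m ≢ m′ →
    ∀ G G′ → IsΓ setup m G → IsΓ setup m′ G′ →
    ¬ SwitchingEquivalent G G′)
corollary1p2 setup =
  (λ m m≥1 → Existence.exists setup m m≥1 , λ G isΓ →
    Γ-graph.connected setup m m≥1 G isΓ ,
    Γ-graph.hasSmallestEigenvalue setup m m≥1 G isΓ ,
    Γ-graph.nonExtendable setup m m≥1 G isΓ) ,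
  λ m m′ m≥1 m′≥1 m≢m′ G G′ isΓ isΓ′ equivalent →
    m≢m′ (switching-dimension setup m m′ m≥1 m′≥1 G G′ isΓ isΓ′ equivalent)
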